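{- Let $w\in B_n$ avoid the patterns $3412$ and $4231$, let $Q=Q(w)$ be its type-$\mathsf{BC}$ unit interval order, and fix a bipartition $(\lambda,\mu)\vdash n$. Then $$(\psi\psi)^{\lambda,\mu}(C'_w(1))=\#\{(U,V)\in\mathrm{Tab}(Q,\lambda,\mu): U,V \text{ cyclically row-semistrict}\}.$$
   Context: Notation: $[\bar n,n]=\{ -n,\dots,-1,1,\dots,n\}$, $\bar a=-a$, $[n]=\{1,\dots,n\}$; for $h\le l$, $[h,l]=\{h,\dots,l\}\setminus\{0\}$. $B_n$ is the group of permutations $w$ of $[\bar n,n]$ with $w(\bar i)=\overline{w(i)}$ (Coxeter group of type $B_n=C_n$, Bruhat order $\le_{B_n}$); $w_i=w(i)$. $w$ avoids $3412$ and $4231$ means $w_{\bar n}\cdots w_{\bar1}w_1\cdots w_n$ has no subsequence order-isomorphic to $3412$ or $4231$. For such $w$, $C'_w(1)$ is the Kazhdan–Lusztig basis element $C'_w(q)$ of the Hecke algebra of $B_n$ at $q=1$; it equals $\sum_{v\le_{B_n}w}v$. Traces are extended linearly. Traces: for $u\in B_m$, $\ell_t(u)=\#\{i\in[m]:u_i<0\}$ and $\varphi(u)\in S_m$ is $i\mapsto|u_i|$. For $\lambda\vdash m$, $\psi^\lambda$ is the class function on $S_m$ with $\psi^\lambda(u)=z_\lambda$ if $u$ has cycle type $\lambda$ and $0$ otherwise, where $z_\lambda=\prod_k k^{a_k}a_k!$, $a_k$ the multiplicity of $k$ in $\lambda$. For $(\lambda,\mu)\vdash n$ with $|\lambda|=k$,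 $(\psi\psi)^{\lambda,\mu}$ is the induction from $B_k\times B_{n-k}$ to $B_n$ of $u\mapsto\psi^\lambda(\varphi(u))$ tensored with $u\mapsto(-1)^{\ell_t(u)}\psi^\mu(\varphi(u))$, where $B_k\times B_{n-k}$ is the subgroup of $w\in B_n$ with $\{|w_1|,\dots,|w_k|\}=[k]$ (second factor on $[k+1,n]$ identified with $[1,n-k]$). Networks: a type-A planar network on an interval $[h,l]$ is a directed planar acyclic multigraph in a disc with boundary vertices labelled clockwise source $h,\dots,$ source $l$, sink $l,\dots,$ sink $h$, edges possibly with positive integer multiplicities, sources of indegree 0 and outdegree 1, sinks of indegree 1 and outdegree 0. For $[a,b]\subseteq[h,l]$, $F_{[a,b]}$ has an edge source $i\to$ sink $i$ for $i\notin[a,b]$ and one interior vertex $z$ with edges source $i\to z\to$ sink $i$ for $i\in[a,b]$ (no interior vertex if $a=b$). $E\circ F$ merges the edge into sink $i$ of $E$ with the edge out of source $i$ of $F$; $E\bullet F$ further replaces each set of $m>1$ parallel edges by one edge of multiplicity $m$. Intervals $[c_1,d_1],\dots,[c_t,d_t]$ satisfy the zig-zag conditions if distinct, pairwise non-nesting, and for $i<j<k$ with $[c_i,d_i]\cap[c_j,d_j]\ne\emptyset\ne[c_j,d_j]\cap[c_k,d_k]$ one has $c_i<c_j<c_k$ or $c_i>c_j>c_k$; a type-A zig-zag network is $F_{[c_1,d_1]}\bullet\cdots\bullet F_{[c_t,d_t]}$ with such intervals (or trivial). A path family of type $u$ is $(\pi_h,\dots,\pi_l)$ with $\pi_i$ from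 source $i$ to sink $u(i)$; it covers the network if every edge lies on some path. For a zig-zag network $F$ the covering types have a unique element $w(F)$ of maximal length, and $F\mapsto w(F)$ is a bijection onto permutations avoiding $3412,4231$; $F_w$ is the inverse. $F_w$ has a unique covering family $\pi$ of type $e$; $P(w)$ is the order with $i<_{P(w)}j$ iff $i<j$ and $\pi_i,\pi_j$ share no vertex. For $w\in B_n$ avoiding $3412,4231$, $i\in[n]$ is grounded if $\pi_i,\pi_{\bar i}$ share a vertex; $Q(w)$ is the subposet of $P(w)$ on $[n]$ with grounded elements distinguished. Bitableaux: $\mathrm{Tab}(Q,\lambda,\mu)$ is the set of pairs $(U,V)$ of fillings of Young diagrams of shapes $\lambda,\mu$ (French convention; $U_{i,j}$ the $j$-th entry of row $i$) using each element of $Q$ exactly once in total, all grounded elements in $U$, each grounded element starred or not. A filling is row-semistrict if $U_{i,j}\not>_QU_{i,j+1}$ whenever defined, and cyclically row-semistrict if moreover the last entry of each row $i$ (of length $\lambda_i$) satisfies $U_{i,\lambda_i}\not>_QU_{i,1}$. -}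

module Defs where

open import Data.Bool using (Bool; true; false; _∧_; _∨_; not; if_then_else_; T)
open import Data.Nat as N using (ℕ; zero; suc; _∸_; _!; _^_; _≡ᵇ_; _<ᵇ_; _≤ᵇ_; NonZero)
open import Data.Nat.Properties using (m*n≢0; m^n≢0; _!*_!≢0)
open import Data.Integer as ℤ using (ℤ; +_; -[1+_]; -_; ∣_∣)
import Data.Integer.Properties as ℤP
open import Data.Rational as ℚ using (ℚ)
open import Data.List using (List; []; _∷_; _++_; map; length; concatMap; upTo; take; drop; reverse; foldr; zip)
open import Data.Bool.ListAction using (all; any)
open import Data.Nat.ListAction using (sum)
import Data.List.Properties as LP
open import Data.Fin using (Fin; toℕ)
open import Data.List using (lookup)
open import Data.Product using (Σ; ∃; ∃₂; _×_; _,_; proj₁; proj₂)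
open import Data.Sum using (_⊎_)
open import Relation.Nullary using (¬_; Dec; yes; no)
open import Relation.Nullary.Decidable using (⌊_⌋)
open import Relation.Binary.PropositionalEquality using (_≡_; _≢_; refl; cong)

filt : {A : Set} → (A → Bool) → List A → List A
filt p []       = []
filt p (x ∷ xs) = if p x then x ∷ filt p xs else filt p xs

countP : {A : Set} → (A → Bool) → List A → ℕ
countP p xs = length (filt p xs)

range : ℕ → List ℕ
range n = map suc (upTo n)

words : {A : Set} → ℕ → List A → List (List A)
words zero    S = [] ∷ []
words (suc k) S = concatMap (λ x → map (x ∷_) (words k S)) S

-- 1-based lookup with default
at : {A : Set} → A → List A → ℕ → A
at d []       _             = d
at d (x ∷ xs) zero          = d
at d (x ∷ xs) (suc zero)    = x
at d (x ∷ xs) (suc (suc i)) = at d xs (suc i)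

pairsLt : ℕ → List (ℕ × ℕ)
pairsLt n = concatMap (λ i → map (i ,_) (filt (i <ᵇ_) (range n))) (range n)

infix 4 _==ℤ_ _<ℤ_ _==L_

_==ℤ_ : ℤ → ℤ → Bool
a ==ℤ b = ⌊ a ℤ.≟ b ⌋

_<ℤ_ : ℤ → ℤ → Bool
a <ℤ b = ⌊ a ℤ.<? b ⌋

_==L_ : List ℤ → List ℤ → Bool
u ==L v = ⌊ LP.≡-dec ℤ._≟_ u v ⌋

-- The hyperoctahedral group B_n.
-- An element w ∈ B_n is given by its one-line notation  w₁ … wₙ  (a list of
-- integers); it acts on [n̄,n] by  w(i) = w_i,  w(ī) = - w_i.

labels : ℕ → List ℤ
labels n = reverse (map (λ i → - (+ i)) (range n)) ++ map +_ (range n)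

Label : ℕ → ℤ → Set
Label n x = (1 N.≤ ∣ x ∣) × (∣ x ∣ N.≤ n)

isBn : ℕ → List ℤ → Bool
isBn n w = (length w ≡ᵇ n)
         ∧ all (λ x → (1 ≤ᵇ ∣ x ∣) ∧ (∣ x ∣ ≤ᵇ n)) w
         ∧ all (λ j → any (λ x → ∣ x ∣ ≡ᵇ j) w) (range n)

IsBn : ℕ → List ℤ → Set
IsBn n w = T (isBn n w)

allBn : ℕ → List (List ℤ)
allBn n = filt (isBn n) (words n (labels n))

app : List ℤ → ℤ → ℤ
app w (+ zero)    = + zero
app w (+ suc k)   = at (+ 0) w (suc k)
app w -[1+ k ]    = - at (+ 0) w (suc k)

mul : List ℤ → List ℤ → List ℤ
mul u v = map (app u) v

inverse : ℕ → List ℤ → List ℤ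
inverse n w = map (λ j → findL (filt (λ x → app w x ==ℤ (+ j)) (labels n))) (range n)
  where
  findL : List ℤ → ℤ
  findL []      = + 0
  findL (x ∷ _) = x

-- Coxeter length in B_n:  ℓ(w) = inv(w) + nsp(w) + neg(w)
-- (Björner–Brenti, Prop. 8.1.1)
lenB : List ℤ → ℕ
lenB w = countP (λ { (i , j) → at (+ 0) w j <ℤ at (+ 0) w i }) (pairsLt (length w))
       N.+ countP (λ { (i , j) → (at (+ 0) w i ℤ.+ at (+ 0) w j) <ℤ + 0 }) (pairsLt (length w))
       N.+ countP (λ x → x <ℤ + 0) w

-- the reflections of B_n, in one-line notation:
--   (i j)(ī j̄),  (i j̄)(j ī)  for 1 ≤ i < j ≤ n,   and  (i ī)  for i ∈ [n]
reflections : ℕ → List (List ℤ)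
reflections n =
     map (λ { (i , j) → map (λ k → if k ≡ᵇ i then + j else if k ≡ᵇ j then + i else + k) (range n) }) (pairsLt n)
  ++ map (λ { (i , j) → map (λ k → if k ≡ᵇ i then - + j else if k ≡ᵇ j then - + i else + k) (range n) }) (pairsLt n)
  ++ map (λ i → map (λ k → if k ≡ᵇ i then - + i else + k) (range n)) (range n)

-- Bruhat order of the Coxeter group B_n: the reflexive–transitive closure of
-- u → u t  (t a reflection, ℓ(u) < ℓ(u t)).  Going down from w, every step
-- decreases the length, so ℓ(w) steps suffice; 'leqFuel' unfolds the closure.
leqFuel : ℕ → ℕ → List ℤ → List ℤ → Bool
leqFuel n zero    v w = v ==L w
leqFuel n (suc k) v w =
  (v ==L w) ∨ any (λ t → (lenB (mul w t) <ᵇ lenB w) ∧ leqFuel n k v (mul w t)) (reflections n)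

bruhatLeq : ℕ → List ℤ → List ℤ → Bool
bruhatLeq n v w = leqFuel n (lenB w) v w

fullWord : List ℤ → List ℤ
fullWord w = reverse (map -_ w) ++ w

Occurs3412 : List ℤ → Set
Occurs3412 xs = Σ ℕ λ a → Σ ℕ λ b → Σ ℕ λ c → Σ ℕ λ d →
  (1 N.≤ a) × (a N.< b) × (b N.< c) × (c N.< d) × (d N.≤ length xs) ×
  (at (+ 0) xs c ℤ.< at (+ 0) xs d) × (at (+ 0) xs d ℤ.< at (+ 0) xs a) × (at (+ 0) xs a ℤ.< at (+ 0) xs b)

Occurs4231 : List ℤ → Set
Occurs4231 xs = Σ ℕ λ a → Σ ℕ λ b → Σ ℕ λ c → Σ ℕ λ d →
  (1 N.≤ a) × (a N.< b) × (b N.< c) × (c N.< d) × (d N.≤ length xs) ×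
  (at (+ 0) xs d ℤ.< at (+ 0) xs b) × (at (+ 0) xs b ℤ.< at (+ 0) xs c) × (at (+ 0) xs c ℤ.< at (+ 0) xs a)

Avoids3412-4231 : List ℤ → Set
Avoids3412-4231 w = ¬ Occurs3412 (fullWord w) × ¬ Occurs4231 (fullWord w)

Decreasing : List ℕ → Set
Decreasing []             = Data.Unit.⊤
  where import Data.Unit
Decreasing (x ∷ [])       = 1 N.≤ x
Decreasing (x ∷ y ∷ xs)   = (y N.≤ x) × Decreasing (y ∷ xs)

IsPartition : List ℕ → Set
IsPartition = Decreasing

IsBipartition : ℕ → List ℕ → List ℕ → Set
IsBipartition n λ′ μ = IsPartition λ′ × IsPartition μ × (sum λ′ N.+ sum μ ≡ n)

-- Cycle types and the class functions ψ^λ on S_m.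
-- A permutation p ∈ S_m is given in one-line notation as a list of naturals.

iterP : List ℕ → ℕ → ℕ → ℕ
iterP p zero    i = i
iterP p (suc c) i = at 0 p (iterP p c i)

cycLen : List ℕ → ℕ → ℕ
cycLen p i = first (filt (λ c → iterP p c i ≡ᵇ i) (range (length p)))
  where
  first : List ℕ → ℕ
  first []      = 0
  first (c ∷ _) = c

isCycleMin : List ℕ → ℕ → Bool
isCycleMin p i = all (λ c → i ≤ᵇ iterP p c i) (range (length p))

cycleType : List ℕ → List ℕ
cycleType p = map (cycLen p) (filt (isCycleMin p) (range (length p)))

multiplicity : ℕ → List ℕ → ℕ
multiplicity k xs = countP (_≡ᵇ k) xs

hasCycleType : List ℕ → List ℕ → Bool
hasCycleType p λ′ = all (λ k → multiplicity k (cycleType p) ≡ᵇ multiplicity k λ′)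
                        (range (length p N.+ sum λ′))

zee : List ℕ → ℕ
zee λ′ = foldr N._*_ 1 (map (λ k → (k ^ multiplicity k λ′) N.* (multiplicity k λ′) !) (range (sum λ′)))

ψ : List ℕ → List ℕ → ℤ
ψ λ′ p = if hasCycleType p λ′ then + zee λ′ else + 0

φ : List ℤ → List ℕ
φ u = map ∣_∣ u

ℓt : List ℤ → ℕ
ℓt u = countP (λ x → x <ℤ + 0) u

signPow : ℕ → ℤ
signPow zero    = + 1
signPow (suc k) = - signPow k

-- u ∈ B_k × B_{n-k} ⊆ B_n, i.e. {|u₁|,…,|u_k|} = [k]
inH : ℕ → List ℤ → Bool
inH k u = all (λ j → any (λ x → ∣ x ∣ ≡ᵇ j) (take k u)) (range k)

-- the second factor, on [k+1,n] identified with [1,n-k]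
shiftDown : ℕ → ℤ → ℤ
shiftDown k (+ m)    = + (m ∸ k)
shiftDown k -[1+ m ] = - (+ (suc m ∸ k))

fH : List ℕ → List ℕ → List ℤ → ℤ
fH λ′ μ u = ψ λ′ (φ u₁) ℤ.* (signPow (ℓt u₂) ℤ.* ψ μ (φ u₂))
  where
  k  = sum λ′
  u₁ = take k u
  u₂ = map (shiftDown k) (drop k u)

-- |B_k × B_{n-k}| = 2^n k! (n-k)!
orderH : ℕ → ℕ → ℕ
orderH n k = 2 ^ n N.* (k ! N.* (n ∸ k) !)

instance
  orderH-nonZero : ∀ {n k} → NonZero (orderH n k)
  orderH-nonZero {n} {k} = m*n≢0 (2 ^ n) (k ! N.* (n ∸ k) !) {{m^n≢0 2 n}} {{k !* (n ∸ k) !≢0}}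

sumℤ : List ℤ → ℤ
sumℤ = foldr ℤ._+_ (+ 0)

-- Induction from H = B_k × B_{n-k} to B_n:
--   Ind f (g) = (1/|H|) Σ_{x ∈ B_n, x⁻¹ g x ∈ H} f(x⁻¹ g x)
indChar : ℕ → List ℕ → List ℕ → List ℤ → ℚ
indChar n λ′ μ g = ℚ._/_ total (orderH n (sum λ′)) {{orderH-nonZero {n} {sum λ′}}}
  where
  total : ℤ
  total = sumℤ (map (λ x → let c = mul (inverse n x) (mul g x) in
                           if inH (sum λ′) c then fH λ′ μ c else + 0) (allBn n))

sumℚ : List ℚ → ℚ
sumℚ = foldr ℚ._+_ ℚ.0ℚ

-- (ψψ)^{λ,μ}(C'_w(1)) where C'_w(1) = Σ_{v ≤ w} v  (w avoiding 3412, 4231)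
traceC : ℕ → List ℕ → List ℕ → List ℤ → ℚ
traceC n λ′ μ w = sumℚ (map (indChar n λ′ μ) (filt (λ v → bruhatLeq n v w) (allBn n)))

-- an interval [c,d] ⊆ [n̄,n] is given by its endpoints (c , d)
Interval : Set
Interval = ℤ × ℤ

_∈I_ : ℤ → Interval → Set
x ∈I (c , d) = (c ℤ.≤ x) × (x ℤ.≤ d) × (x ≢ + 0)

inIᵇ : ℤ → Interval → Bool
inIᵇ x (c , d) = ⌊ c ℤ.≤? x ⌋ ∧ ⌊ x ℤ.≤? d ⌋ ∧ not (x ==ℤ + 0)

-- [c,d] has more than one element (so F_[c,d] has an interior vertex)
nontrivialᵇ : Interval → Bool
nontrivialᵇ (c , d) = c <ℤ d

-- Vertices of F_{I₁} • ⋯ • F_{I_t}: boundary sources and sinks, and the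
-- interior vertex  mid j  of the factor F_{I_j} (0-based j, only if |I_j| > 1).
data Vertex : Set where
  src : ℤ → Vertex
  snk : ℤ → Vertex
  mid : ℕ → Vertex

_≟V_ : (a b : Vertex) → Dec (a ≡ b)
src x ≟V src y with x ℤ.≟ y
... | yes refl = yes refl
... | no ne    = no λ { refl → ne refl }
src x ≟V snk y = no λ ()
src x ≟V mid y = no λ ()
snk x ≟V src y = no λ ()
snk x ≟V snk y with x ℤ.≟ y
... | yes refl = yes refl
... | no ne    = no λ { refl → ne refl }
snk x ≟V mid y = no λ ()
mid x ≟V src y = no λ ()
mid x ≟V snk y = no λ ()
mid x ≟V mid y with x N.≟ y
... | yes refl = yes refl
... | no ne    = no λ { refl → ne refl }

-- In F_{I₁} ∘ ⋯ ∘ F_{I_t}, the edge leaving source i runs through the interior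
-- vertices of those factors F_{I_j} with i ∈ I_j (in order j = 1,…,t) and ends
-- at sink i; its successive vertices are:
strand : List Interval → ℤ → List Vertex
strand I i = src i ∷ map (λ p → mid (proj₁ p))
                         (filt (λ p → inIᵇ i (proj₂ p) ∧ nontrivialᵇ (proj₂ p)) (zip (upTo (length I)) I))
             ++ (snk i ∷ [])

Adjacent : Vertex → Vertex → List Vertex → Set
Adjacent a b xs = ∃₂ λ ys zs → xs ≡ ys ++ a ∷ b ∷ zs

-- edges of F_{I₁} • ⋯ • F_{I_t} (parallel edges merged into one edge)
Edge : ℕ → List Interval → Vertex → Vertex → Set
Edge n I a b = ∃ λ i → Label n i × Adjacent a b (strand I i)

data Path (n : ℕ) (I : List Interval) : Vertex → Vertex → List Vertex → Set where
  here : ∀ {v} → Path n I v v (v ∷ [])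
  step : ∀ {a b v p} → Edge n I a b → Path n I b v p → Path n I a v (a ∷ p)

IsPermOn : ℕ → (ℤ → ℤ) → Set
IsPermOn n u = (∀ i → Label n i → Label n (u i))
             × (∀ i j → Label n i → Label n j → u i ≡ u j → i ≡ j)

PathFamily : ℕ → List Interval → (ℤ → ℤ) → (ℤ → List Vertex) → Set
PathFamily n I u π = ∀ i → Label n i → Path n I (src i) (snk (u i)) (π i)

Covers : ℕ → List Interval → (ℤ → List Vertex) → Set
Covers n I π = ∀ a b → Edge n I a b → ∃ λ i → Label n i × Adjacent a b (π i)

CoveringFamily : ℕ → List Interval → (ℤ → ℤ) → (ℤ → List Vertex) → Set
CoveringFamily n I u π = PathFamily n I u π × Covers n I π

invA : ℕ → (ℤ → ℤ) → ℕ
invA n u = countP (λ { (i , j) → u (at (+ 0) (labels n) j) <ℤ u (at (+ 0) (labels n) i) })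
                  (pairsLt (2 N.* n))

IsCoveringType : ℕ → List Interval → (ℤ → ℤ) → Set
IsCoveringType n I u = ∃ λ π → CoveringFamily n I u π

-- w is the (unique) covering type of maximal length, i.e. w = w(F_I)
IsMaxCoveringType : ℕ → List Interval → (ℤ → ℤ) → Set
IsMaxCoveringType n I w = IsCoveringType n I w
  × (∀ u → IsPermOn n u → IsCoveringType n I u → invA n u N.≤ invA n w)

ZigZag : ℕ → List Interval → Set
ZigZag n I =
    (∀ j → Label n (proj₁ (lookup I j)) × Label n (proj₂ (lookup I j))
           × (proj₁ (lookup I j) ℤ.≤ proj₂ (lookup I j)))
  × (∀ j k → j ≢ k → lookup I j ≢ lookup I k)
  × (∀ j k → j ≢ k → ¬ (∀ x → x ∈I lookup I j → x ∈I lookup I k))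
  × (∀ i j k → toℕ i N.< toℕ j → toℕ j N.< toℕ k
       → (∃ λ x → x ∈I lookup I i × x ∈I lookup I j)
       → (∃ λ x → x ∈I lookup I j × x ∈I lookup I k)
       → ((proj₁ (lookup I i) ℤ.< proj₁ (lookup I j)) × (proj₁ (lookup I j) ℤ.< proj₁ (lookup I k)))
         ⊎ ((proj₁ (lookup I i) ℤ.> proj₁ (lookup I j)) × (proj₁ (lookup I j) ℤ.> proj₁ (lookup I k))))

-- The poset Q(w) read off from the type-e covering family π of F_w

shareVertex : List Vertex → List Vertex → Bool
shareVertex p q = any (λ a → any (λ b → ⌊ a ≟V b ⌋) q) p

ltQ : (ℤ → List Vertex) → ℕ → ℕ → Bool
ltQ π i j = (i <ᵇ j) ∧ not (shareVertex (π (+ i)) (π (+ j)))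

grounded : (ℤ → List Vertex) → ℕ → Bool
grounded π i = shareVertex (π (+ i)) (π (- + i))

-- a filling: list of rows; an entry is an element of [n] with a star flag
Filling : Set
Filling = List (List (ℕ × Bool))

chop : {A : Set} → List ℕ → List A → List (List A)
chop []       xs = []
chop (r ∷ rs) xs = take r xs ∷ chop rs (drop r xs)

distinct : List ℕ → Bool
distinct []       = true
distinct (x ∷ xs) = not (any (_≡ᵇ x) xs) ∧ distinct xs

-- Tab(Q,λ,μ): all pairs (U,V) of fillings of shapes λ, μ using each element of
-- [n] exactly once in total, all grounded elements in U, and only grounded
-- elements possibly starred.  (Enumerated via the reading word σ (a
-- permutation of [n]) and the star flags s; this map is injective.)
Tab : ℕ → (ℤ → List Vertex) → List ℕ → List ℕ → List (Filling × Filling)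
Tab n π λ′ μ =
  map (λ e → chop λ′ (take (sum λ′) e) , chop μ (drop (sum λ′) e))
      (filt valid (concatMap (λ σ → map (zip σ) (words n (true ∷ false ∷ [])))
                             (filt distinct (words n (range n)))))
  where
  valid : List (ℕ × Bool) → Bool
  valid e = all (λ { (x , b) → not b ∨ grounded π x }) e
          ∧ all (λ { (x , b) → not (grounded π x) ∨ any (λ y → proj₁ y ≡ᵇ x) (take (sum λ′) e) }) e

gtQ : (ℤ → List Vertex) → ℕ → ℕ → Bool
gtQ π x y = ltQ π y x

lastOr : {A : Set} → A → List A → A
lastOr d []       = d
lastOr d (x ∷ xs) = lastOr x xs

rowSemistrict : (ℤ → List Vertex) → List (ℕ × Bool) → Bool
rowSemistrict π (x ∷ y ∷ r) = not (gtQ π (proj₁ x) (proj₁ y)) ∧ rowSemistrict π (y ∷ r)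
rowSemistrict π _           = true

cycRow : (ℤ → List Vertex) → List (ℕ × Bool) → Bool
cycRow π []      = true
cycRow π (x ∷ r) = rowSemistrict π (x ∷ r) ∧ not (gtQ π (proj₁ (lastOr x r)) (proj₁ x))

cyclicallyRowSemistrict : (ℤ → List Vertex) → Filling → Bool
cyclicallyRowSemistrict π U = all (cycRow π) U

countCyc : ℕ → (ℤ → List Vertex) → List ℕ → List ℕ → ℕ
countCyc n π λ′ μ =
  countP (λ { (U , V) → cyclicallyRowSemistrict π U ∧ cyclicallyRowSemistrict π V }) (Tab n π λ′ μ)

{-# OPTIONS --safe #-}
module Submission where

-- Write A i j if the network has a path from source i to sink j, and call two labels neighbours
-- if some interval contains both.  Peel off the largest label m: one of the row and the column
-- of m in A is supported on the neighbours k < m of m, and the other one agrees with that of any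
-- such k.  This rule has two consequences.
--
-- * Among the permutations v with A i (v i) for all i, exactly one admits no exchange of two values
--   that adds an inversion, and it must be w.  As A is recovered from w, it is invariant under
--   i ↦ -i, so every such v ∈ B_n is joined to w by reflections increasing the length: these v
--   are the elements below w.
--
-- * Since ψ^λ counts the ways to write the cycles of a permutation into the rows of λ, the trace is
--   a sum over fillings of products, over cyclically consecutive entries (a , b) of the rows, of
--   A a b + A a (-b) in U and A a b - A a (-b) in V.  For a matrix obeying the peeling rule, the
--   sum over the cyclic arrangements of a set of letters is determined by the diagonal and the
--   neighbours: the largest letter m can be cut out and contributes M m m times the number of its
--   neighbours present.  The matrices [a is not above b in Q], with rows of grounded a
--   multiplied by 2 in U and by 0 in V, obey the same rule with the same data.

open import Defs
open import Data.Bool using (Bool; true; false; _∧_; _∨_; not; if_then_else_; T)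
import Data.Bool.Properties as BP
open import Data.Bool.ListAction using (all; any)
open import Data.Nat as N using (ℕ; zero; suc; _≡ᵇ_; _<ᵇ_; _≤ᵇ_; z≤n; s≤s; _∸_; _!; _^_; pred; NonZero)
import Data.Nat.Properties as NP
open import Data.Nat.ListAction using (sum)
import Data.Nat.ListAction.Properties as SumP
open import Data.Integer as ℤ using (ℤ; +_; -[1+_]; -_; ∣_∣; 0ℤ; 1ℤ; -1ℤ; _≤_; _<_)
import Data.Integer.Properties as ℤP
open import Data.Integer.Tactic.RingSolver using (solve-∀)
open import Data.Rational as ℚ using (_/_)
import Data.Rational.Properties as ℚP
open import Data.Rational.Unnormalised using (mkℚᵘ; *≡*)
import Data.Rational.Unnormalised.Properties as ℚᵘP
open import Data.List using (List; []; _∷_; _++_; map; length; concatMap; upTo; applyUpTo; take; drop; reverse; foldr; zip; lookup; initLast; _∷ʳ′_)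
import Data.List.Properties as LP
open import Data.List.Membership.Propositional using (_∈_; _∉_; lose; find)
open import Data.List.Membership.Propositional.Properties using (∈-map⁺; ∈-map⁻; ∈-++⁺ˡ; ∈-++⁺ʳ; ∈-++⁻; ∈-∃++; ∈-upTo⁺; ∈-upTo⁻)
open import Data.List.Relation.Unary.Any as Any using (here; there)
open import Data.List.Relation.Unary.All as All using ([]; _∷_)
open import Data.List.Relation.Unary.AllPairs using (AllPairs; []; _∷_)
import Data.List.Relation.Unary.AllPairs.Properties as APP
open import Data.List.Relation.Unary.Unique.Propositional using (Unique)
open import Data.List.Relation.Unary.Unique.Propositional.Properties using (upTo⁺)
open import Data.List.Relation.Binary.Pointwise as Pw using (Pointwise; []; _∷_)
open import Data.List.Relation.Binary.Permutation.Propositional using (_↭_; prep; swap; ↭-refl; ↭-sym; ↭-trans; ↭-reflexive)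
import Data.List.Relation.Binary.Permutation.Propositional as Perm
open import Data.List.Relation.Binary.Permutation.Propositional.Properties using (shift; ↭-length; ∈-resp-↭; ∷↭∷ʳ; ↭-reverse; ++⁺; map⁺)
open import Data.Fin as Fin using (Fin; toℕ; fromℕ<)
import Data.Fin.Properties as FP
open import Data.Product using (∃; ∃₂; _×_; _,_; proj₁; proj₂)
open import Data.Sum using (_⊎_; inj₁; inj₂)
open import Data.Empty using (⊥; ⊥-elim)
open import Data.Unit using (tt)
open import Function using (_∘_; id)
open import Relation.Nullary using (¬_; Dec; yes; no)
open import Relation.Nullary.Decidable using (⌊_⌋; toWitness; fromWitness; map′; _×-dec_; ¬?)
open import Relation.Binary.PropositionalEquality
open import Relation.Binary.Definitions using (tri<; tri≈; tri>)

-- Cutting the largest letter m out of a cyclic word leaves a condition on a single letter, the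
-- successor or the predecessor of m, according to whether the row or the column of m is the sparse
-- one. Two matrices may differ in this, so single words have different weights; only after
-- averaging over the rotations of the remaining word does the condition become the number of
-- neighbours of m among the remaining letters, a symmetric function. Hence the induction runs over
-- sums with an arbitrary symmetric weight, which also stores the other rows of a filling.
--
-- Row or column is decided by two overlapping intervals at the left end of the neighbourhood of m:
-- their order as factors of the network lets paths pass between them in one direction only.
--
-- If m is grounded, all labels from -m to m are neighbours of each other, so that A a b + A a (-b)
-- is 2 and A a b - A a (-b) is 0 for all letters up to m; this is the origin of the stars and of
-- the exclusion of grounded elements from V. If m is not grounded, its neighbourhood contains no -b
-- with b < m, and the peeling rule passes from A to both combinations.

private variable
  El El′ : Set

-- Booleans and duplicate-free lists

⟦_⟧ : Bool → ℤ
⟦ true ⟧ = 1ℤ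
⟦ false ⟧ = 0ℤ

T⇒≡ : ∀ {b} → T b → b ≡ true
T⇒≡ {true} _ = refl

≡⇒T : ∀ {b} → b ≡ true → T b
≡⇒T refl = tt

¬T⇒≡ : ∀ {b} → ¬ T b → b ≡ false
¬T⇒≡ {true} h = ⊥-elim (h tt)
¬T⇒≡ {false} _ = refl

bool-ext : ∀ {a b} → (T a → T b) → (T b → T a) → a ≡ b
bool-ext {true} {true} f g = refl
bool-ext {true} {false} f g = ⊥-elim (f tt)
bool-ext {false} {true} f g = ⊥-elim (g tt)
bool-ext {false} {false} f g = refl

∧-T : ∀ {a b} → T (a ∧ b) → T a × T b
∧-T {true} {true} _ = tt , tt

T-∧ : ∀ {a b} → T a → T b → T (a ∧ b)
T-∧ {true} {true} _ _ = tt

T-not : ∀ {b} → ¬ T b → T (not b)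
T-not {true} h = h tt
T-not {false} h = tt

not-T : ∀ {b} → T (not b) → ¬ T b
not-T {false} _ ()

T-∨ˡ : ∀ {a b} → T a → T (a ∨ b)
T-∨ˡ {true} _ = tt

T-∨ʳ : ∀ {a b} → T b → T (a ∨ b)
T-∨ʳ {true} _ = tt
T-∨ʳ {false} h = h

∨-T : ∀ {a b} → T (a ∨ b) → T a ⊎ T b
∨-T {true} h = inj₁ tt
∨-T {false} h = inj₂ h

⟦∧⟧ : ∀ a b → ⟦ a ∧ b ⟧ ≡ ⟦ a ⟧ ℤ.* ⟦ b ⟧
⟦∧⟧ true b = sym (ℤP.*-identityˡ ⟦ b ⟧)
⟦∧⟧ false b = sym (ℤP.*-zeroˡ ⟦ b ⟧)

all-T : (p : El → Bool) (xs : List El) → T (all p xs) → ∀ {x} → x ∈ xs → T (p x)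
all-T p (x ∷ xs) h (here refl) = proj₁ (∧-T h)
all-T p (x ∷ xs) h (there i) = all-T p xs (proj₂ (∧-T {p x} h)) i

T-all : (p : El → Bool) (xs : List El) → (∀ {x} → x ∈ xs → T (p x)) → T (all p xs)
T-all p [] h = tt
T-all p (x ∷ xs) h = T-∧ (h (here refl)) (T-all p xs (h ∘ there))

any-T : (p : El → Bool) (xs : List El) → T (any p xs) → ∃ λ x → x ∈ xs × T (p x)
any-T p (x ∷ xs) h with ∨-T {p x} h
... | inj₁ t = x , here refl , t
... | inj₂ t = let y , i , q = any-T p xs t in y , there i , q

T-any : (p : El → Bool) (xs : List El) → ∀ {x} → x ∈ xs → T (p x) → T (any p xs)
T-any p (x ∷ xs) (here refl) t = T-∨ˡ t
T-any p (x ∷ xs) (there i) t = T-∨ʳ {p x} (T-any p xs i t)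

filt-∈⁻ : (p : El → Bool) (xs : List El) → ∀ {x} → x ∈ filt p xs → x ∈ xs × T (p x)
filt-∈⁻ p (y ∷ xs) i with p y in eq
filt-∈⁻ p (y ∷ xs) (here refl) | true = here refl , ≡⇒T eq
filt-∈⁻ p (y ∷ xs) (there i)   | true = let j , t = filt-∈⁻ p xs i in there j , t
filt-∈⁻ p (y ∷ xs) i           | false = let j , t = filt-∈⁻ p xs i in there j , t

filt-∈⁺ : (p : El → Bool) (xs : List El) → ∀ {x} → x ∈ xs → T (p x) → x ∈ filt p xs
filt-∈⁺ p (y ∷ xs) (here refl) t rewrite T⇒≡ t = here refl
filt-∈⁺ p (y ∷ xs) (there i) t with p y
... | true = there (filt-∈⁺ p xs i t)
... | false = filt-∈⁺ p xs i t

filt-cong : {p q : El → Bool} (xs : List El) → (∀ {x} → x ∈ xs → p x ≡ q x) → filt p xs ≡ filt q xs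
filt-cong [] h = refl
filt-cong {p = p} {q} (x ∷ xs) h rewrite h (here refl) with q x
... | true = cong (x ∷_) (filt-cong xs (h ∘ there))
... | false = filt-cong xs (h ∘ there)

filt-filt : (p q : El → Bool) (xs : List El) → filt p (filt q xs) ≡ filt (λ x → q x ∧ p x) xs
filt-filt p q [] = refl
filt-filt p q (x ∷ xs) with q x
... | false = filt-filt p q xs
... | true with p x
...   | true = cong (x ∷_) (filt-filt p q xs)
...   | false = filt-filt p q xs

unique-∷ : {x : El} {xs : List El} → x ∉ xs → Unique xs → Unique (x ∷ xs)
unique-∷ n u = All.tabulate (λ i e → n (subst (_∈ _) (sym e) i)) ∷ u

unique-head : {x : El} {xs : List El} → Unique (x ∷ xs) → x ∉ xs
unique-head (a ∷ _) i = All.lookup a i refl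

unique-tail : {x : El} {xs : List El} → Unique (x ∷ xs) → Unique xs
unique-tail (_ ∷ u) = u

unique-filt : (p : El → Bool) {xs : List El} → Unique xs → Unique (filt p xs)
unique-filt p {[]} u = []
unique-filt p {x ∷ xs} u with p x
... | true = unique-∷ (unique-head u ∘ proj₁ ∘ filt-∈⁻ p xs) (unique-filt p (unique-tail u))
... | false = unique-filt p (unique-tail u)

unique-++ : {xs ys : List El} → Unique xs → Unique ys → (∀ {x} → x ∈ xs → x ∈ ys → ⊥) → Unique (xs ++ ys)
unique-++ {xs = []} u v d = v
unique-++ {xs = x ∷ xs} {ys} u v d =
  unique-∷ (λ i → h (∈-++⁻ xs i)) (unique-++ (unique-tail u) v (λ i j → d (there i) j))
  where
  h : x ∈ xs ⊎ x ∈ ys → ⊥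
  h (inj₁ i) = unique-head u i
  h (inj₂ j) = d (here refl) j

unique-map : (f : El → El′) {xs : List El} → (∀ {x y} → x ∈ xs → y ∈ xs → f x ≡ f y → x ≡ y)
           → Unique xs → Unique (map f xs)
unique-map f {[]} inj u = []
unique-map f {x ∷ xs} inj u =
  unique-∷ (λ i → let y , j , e = ∈-map⁻ f i in
              unique-head u (subst (_∈ xs) (sym (inj (here refl) (there j) e)) j))
           (unique-map f (λ i j → inj (there i) (there j)) (unique-tail u))

unique-↭ : {xs ys : List El} → xs ↭ ys → Unique xs → Unique ys
unique-↭ Perm.refl u = u
unique-↭ (prep x p) u = unique-∷ (unique-head u ∘ ∈-resp-↭ (↭-sym p)) (unique-↭ p (unique-tail u))
unique-↭ (swap x y p) u =
  unique-∷ (λ { (here e) → unique-head u (here (sym e))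
              ; (there i) → unique-head (unique-tail u) (∈-resp-↭ (↭-sym p) i) })
    (unique-∷ (λ i → unique-head u (there (∈-resp-↭ (↭-sym p) i))) (unique-↭ p (unique-tail (unique-tail u))))
unique-↭ (Perm.trans p q) u = unique-↭ q (unique-↭ p u)

subset-length : {xs ys : List El} → Unique xs → (∀ {x} → x ∈ xs → x ∈ ys) → length xs N.≤ length ys
subset-length {xs = []} u s = z≤n
subset-length {xs = x ∷ xs} {ys} u s with ∈-∃++ (s (here refl))
... | as , bs , refl = subst (suc (length xs) N.≤_) (sym (↭-length (shift x as bs)))
        (s≤s (subset-length (unique-tail u) λ {z} i → h z i (∈-++⁻ as (s (there i)))))
  where
  h : ∀ z → z ∈ xs → z ∈ as ⊎ z ∈ (x ∷ bs) → z ∈ as ++ bs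
  h z i (inj₁ j) = ∈-++⁺ˡ j
  h z i (inj₂ (here refl)) = ⊥-elim (unique-head u i)
  h z i (inj₂ (there j)) = ∈-++⁺ʳ as j

same-elements-↭ : {xs ys : List El} → Unique xs → Unique ys
  → (∀ {x} → x ∈ xs → x ∈ ys) → (∀ {x} → x ∈ ys → x ∈ xs) → xs ↭ ys
same-elements-↭ {xs = []} {[]} u v s t = ↭-refl
same-elements-↭ {xs = []} {y ∷ ys} u v s t with t (here refl)
... | ()
same-elements-↭ {xs = x ∷ xs} {ys} u v s t with ∈-∃++ (s (here refl))
... | as , bs , refl = ↭-trans (prep x (same-elements-↭ (unique-tail u) (unique-tail v′) s′ t′)) (↭-sym (shift x as bs))
  where
  v′ : Unique (x ∷ as ++ bs)
  v′ = unique-↭ (shift x as bs) v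
  s′ : ∀ {z} → z ∈ xs → z ∈ as ++ bs
  s′ i with ∈-++⁻ as (s (there i))
  ... | inj₁ j = ∈-++⁺ˡ j
  ... | inj₂ (here refl) = ⊥-elim (unique-head u i)
  ... | inj₂ (there j) = ∈-++⁺ʳ as j
  t″ : ∀ {z} → z ∈ as ++ bs → z ∈ as ++ x ∷ bs
  t″ i with ∈-++⁻ as i
  ... | inj₁ j = ∈-++⁺ˡ j
  ... | inj₂ j = ∈-++⁺ʳ as (there j)
  t′ : ∀ {z} → z ∈ as ++ bs → z ∈ xs
  t′ i with t (t″ i)
  ... | here refl = ⊥-elim (unique-head v′ i)
  ... | there j = j

subset-full : (_≟_ : (x y : El) → Dec (x ≡ y)) {xs ys : List El} → Unique xs → (∀ {x} → x ∈ xs → x ∈ ys)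
  → length ys N.≤ length xs → ∀ {y} → y ∈ ys → y ∈ xs
subset-full _≟_ {xs} {ys} u s le {y} i with Any.any? (y ≟_) xs
... | yes j = j
... | no n = ⊥-elim (NP.<-irrefl refl (NP.≤-trans
      (subset-length (unique-∷ n u) (λ { (here refl) → i ; (there j) → s j })) le))

-- A repeated head of `ys` could be dropped, and the shorter tail would still contain all of `xs`,
-- against the lengths.
unique-of-surjective : (_≟_ : (x y : El) → Dec (x ≡ y)) {xs ys : List El} → Unique xs → (∀ {x} → x ∈ xs → x ∈ ys)
  → length ys N.≤ length xs → Unique ys
unique-of-surjective _≟_ {xs} {[]} u s le = []
unique-of-surjective _≟_ {xs} {y ∷ ys} u s le with Any.any? (y ≟_) ys
... | yes j = ⊥-elim (NP.<-irrefl refl (NP.≤-trans le (subset-length u s′)))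
  where
  s′ : ∀ {z} → z ∈ xs → z ∈ ys
  s′ i with s i
  ... | here refl = j
  ... | there k = k
... | no n with ∈-∃++ (subset-full _≟_ u s le (here refl))
...   | as , bs , refl = unique-∷ n (unique-of-surjective _≟_ (unique-tail v) s′ le′)
  where
  v : Unique (y ∷ as ++ bs)
  v = unique-↭ (shift y as bs) u
  s′ : ∀ {z} → z ∈ as ++ bs → z ∈ ys
  s′ {z} i with s (∈-resp-↭ (↭-sym (shift y as bs)) (there i))
  ... | here refl = ⊥-elim (unique-head v i)
  ... | there k = k
  le′ : length ys N.≤ length (as ++ bs)
  le′ = N.s≤s⁻¹ (subst (suc (length ys) N.≤_) (↭-length (shift y as bs)) le)

-- Finite sums and products

∑ : List El → (El → ℤ) → ℤ
∑ [] f = 0ℤ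
∑ (x ∷ xs) f = f x ℤ.+ ∑ xs f

∏ : List El → (El → ℤ) → ℤ
∏ [] f = 1ℤ
∏ (x ∷ xs) f = f x ℤ.* ∏ xs f

∑-cong∈ : (xs : List El) {f g : El → ℤ} → (∀ {x} → x ∈ xs → f x ≡ g x) → ∑ xs f ≡ ∑ xs g
∑-cong∈ [] h = refl
∑-cong∈ (x ∷ xs) h = cong₂ ℤ._+_ (h (here refl)) (∑-cong∈ xs (h ∘ there))

∑-cong : (xs : List El) {f g : El → ℤ} → (∀ x → f x ≡ g x) → ∑ xs f ≡ ∑ xs g
∑-cong xs h = ∑-cong∈ xs (λ {x} _ → h x)

∑-++ : (xs ys : List El) (f : El → ℤ) → ∑ (xs ++ ys) f ≡ ∑ xs f ℤ.+ ∑ ys f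
∑-++ [] ys f = sym (ℤP.+-identityˡ _)
∑-++ (x ∷ xs) ys f = trans (cong (ℤ._+_ (f x)) (∑-++ xs ys f)) (sym (ℤP.+-assoc (f x) (∑ xs f) (∑ ys f)))

∑-map : (g : El → El′) (xs : List El) (f : El′ → ℤ) → ∑ (map g xs) f ≡ ∑ xs (f ∘ g)
∑-map g [] f = refl
∑-map g (x ∷ xs) f = cong (ℤ._+_ (f (g x))) (∑-map g xs f)

∑-concatMap : (g : El → List El′) (xs : List El) (f : El′ → ℤ) → ∑ (concatMap g xs) f ≡ ∑ xs (λ x → ∑ (g x) f)
∑-concatMap g [] f = refl
∑-concatMap g (x ∷ xs) f = trans (∑-++ (g x) (concatMap g xs) f) (cong (ℤ._+_ (∑ (g x) f)) (∑-concatMap g xs f))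

∑-0 : (xs : List El) → ∑ xs (λ _ → 0ℤ) ≡ 0ℤ
∑-0 [] = refl
∑-0 (x ∷ xs) = trans (ℤP.+-identityˡ _) (∑-0 xs)

∑-zero∈ : (xs : List El) {f : El → ℤ} → (∀ {x} → x ∈ xs → f x ≡ 0ℤ) → ∑ xs f ≡ 0ℤ
∑-zero∈ xs h = trans (∑-cong∈ xs h) (∑-0 xs)

private
  interchange : ∀ a b c d → (a ℤ.+ b) ℤ.+ (c ℤ.+ d) ≡ (a ℤ.+ c) ℤ.+ (b ℤ.+ d)
  interchange = solve-∀

∑-+ : (xs : List El) (f g : El → ℤ) → ∑ xs (λ x → f x ℤ.+ g x) ≡ ∑ xs f ℤ.+ ∑ xs g
∑-+ [] f g = refl
∑-+ (x ∷ xs) f g = trans (cong (ℤ._+_ (f x ℤ.+ g x)) (∑-+ xs f g)) (interchange (f x) (g x) (∑ xs f) (∑ xs g))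

∑-*ˡ : (c : ℤ) (xs : List El) (f : El → ℤ) → ∑ xs (λ x → c ℤ.* f x) ≡ c ℤ.* ∑ xs f
∑-*ˡ c [] f = sym (ℤP.*-zeroʳ c)
∑-*ˡ c (x ∷ xs) f = trans (cong (ℤ._+_ (c ℤ.* f x)) (∑-*ˡ c xs f)) (sym (ℤP.*-distribˡ-+ c (f x) (∑ xs f)))

∑-*ʳ : (c : ℤ) (xs : List El) (f : El → ℤ) → ∑ xs (λ x → f x ℤ.* c) ≡ ∑ xs f ℤ.* c
∑-*ʳ c xs f = trans (∑-cong xs (λ x → ℤP.*-comm (f x) c)) (trans (∑-*ˡ c xs f) (ℤP.*-comm c (∑ xs f)))

∑-swap : (xs : List El) (ys : List El′) (f : El → El′ → ℤ) → ∑ xs (λ x → ∑ ys (f x)) ≡ ∑ ys (λ y → ∑ xs (λ x → f x y))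
∑-swap [] ys f = sym (∑-0 ys)
∑-swap (x ∷ xs) ys f = trans (cong (ℤ._+_ (∑ ys (f x))) (∑-swap xs ys f)) (sym (∑-+ ys (f x) (λ y → ∑ xs (λ x → f x y))))

∑-filt : (p : El → Bool) (xs : List El) (f : El → ℤ) → ∑ (filt p xs) f ≡ ∑ xs (λ x → ⟦ p x ⟧ ℤ.* f x)
∑-filt p [] f = refl
∑-filt p (x ∷ xs) f with p x
... | true = cong₂ ℤ._+_ (sym (ℤP.*-identityˡ (f x))) (∑-filt p xs f)
... | false = trans (∑-filt p xs f) (sym (trans (cong (ℤ._+ ∑ xs (λ x → ⟦ p x ⟧ ℤ.* f x)) (ℤP.*-zeroˡ (f x))) (ℤP.+-identityˡ _)))

∑-↭ : {xs ys : List El} (f : El → ℤ) → xs ↭ ys → ∑ xs f ≡ ∑ ys f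
∑-↭ f Perm.refl = refl
∑-↭ f (prep x p) = cong (ℤ._+_ (f x)) (∑-↭ f p)
∑-↭ {ys = _ ∷ _ ∷ ys} f (swap x y p) = trans (cong (λ z → f x ℤ.+ (f y ℤ.+ z)) (∑-↭ f p)) (l (f x) (f y) (∑ ys f))
  where
  l : ∀ a b c → a ℤ.+ (b ℤ.+ c) ≡ b ℤ.+ (a ℤ.+ c)
  l = solve-∀
∑-↭ f (Perm.trans p q) = trans (∑-↭ f p) (∑-↭ f q)

∑-length : (xs : List El) → ∑ xs (λ _ → 1ℤ) ≡ + length xs
∑-length [] = refl
∑-length (x ∷ xs) = cong (ℤ._+_ 1ℤ) (∑-length xs)

∑-const : (c : ℤ) (xs : List El) → ∑ xs (λ _ → c) ≡ + length xs ℤ.* c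
∑-const c xs = trans (trans (∑-cong xs (λ _ → sym (ℤP.*-identityʳ c))) (∑-*ˡ c xs (λ _ → 1ℤ)))
  (trans (cong (c ℤ.*_) (∑-length xs)) (ℤP.*-comm c (+ length xs)))

countP-∑ : (p : El → Bool) (xs : List El) → + countP p xs ≡ ∑ xs (λ x → ⟦ p x ⟧)
countP-∑ p xs = trans (sym (∑-length (filt p xs))) (trans (∑-filt p xs (λ _ → 1ℤ)) (∑-cong xs (λ x → ℤP.*-identityʳ ⟦ p x ⟧)))

∑-bij : (xs : List El) (ys : List El′) (b : El → El′) (f : El → ℤ) (g : El′ → ℤ) → Unique xs → Unique ys
  → (∀ {x} → x ∈ xs → b x ∈ ys)
  → (∀ {x y} → x ∈ xs → y ∈ xs → b x ≡ b y → x ≡ y)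
  → (∀ {y} → y ∈ ys → ∃ λ x → x ∈ xs × b x ≡ y)
  → (∀ {x} → x ∈ xs → f x ≡ g (b x))
  → ∑ xs f ≡ ∑ ys g
∑-bij xs ys b f g u v into inj surj h = trans (∑-cong∈ xs h) (trans (sym (∑-map b xs g))
  (∑-↭ g (same-elements-↭ (unique-map b inj u) v
     (λ i → let x , j , e = ∈-map⁻ b i in subst (_∈ ys) (sym e) (into j))
     (λ i → let x , j , e = surj i in subst (_∈ map b xs) e (∈-map⁺ b j)))))

∏-cong∈ : (xs : List El) {f g : El → ℤ} → (∀ {x} → x ∈ xs → f x ≡ g x) → ∏ xs f ≡ ∏ xs g
∏-cong∈ [] h = refl
∏-cong∈ (x ∷ xs) h = cong₂ ℤ._*_ (h (here refl)) (∏-cong∈ xs (h ∘ there))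

∏-cong : (xs : List El) {f g : El → ℤ} → (∀ x → f x ≡ g x) → ∏ xs f ≡ ∏ xs g
∏-cong xs h = ∏-cong∈ xs (λ {x} _ → h x)

∏-++ : (xs ys : List El) (f : El → ℤ) → ∏ (xs ++ ys) f ≡ ∏ xs f ℤ.* ∏ ys f
∏-++ [] ys f = sym (ℤP.*-identityˡ _)
∏-++ (x ∷ xs) ys f = trans (cong (f x ℤ.*_) (∏-++ xs ys f)) (sym (ℤP.*-assoc (f x) (∏ xs f) (∏ ys f)))

∏-map : (g : El → El′) (xs : List El) (f : El′ → ℤ) → ∏ (map g xs) f ≡ ∏ xs (f ∘ g)
∏-map g [] f = refl
∏-map g (x ∷ xs) f = cong (f (g x) ℤ.*_) (∏-map g xs f)

∏-* : (xs : List El) (f g : El → ℤ) → ∏ xs (λ x → f x ℤ.* g x) ≡ ∏ xs f ℤ.* ∏ xs g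
∏-* [] f g = refl
∏-* (x ∷ xs) f g = trans (cong (f x ℤ.* g x ℤ.*_) (∏-* xs f g)) (l (f x) (g x) (∏ xs f) (∏ xs g))
  where
  l : ∀ a b c d → a ℤ.* b ℤ.* (c ℤ.* d) ≡ a ℤ.* c ℤ.* (b ℤ.* d)
  l = solve-∀

∏-↭ : {xs ys : List El} (f : El → ℤ) → xs ↭ ys → ∏ xs f ≡ ∏ ys f
∏-↭ f Perm.refl = refl
∏-↭ f (prep x p) = cong (f x ℤ.*_) (∏-↭ f p)
∏-↭ {ys = _ ∷ _ ∷ ys} f (swap x y p) = trans (cong (λ z → f x ℤ.* (f y ℤ.* z)) (∏-↭ f p)) (l (f x) (f y) (∏ ys f))
  where
  l : ∀ a b c → a ℤ.* (b ℤ.* c) ≡ b ℤ.* (a ℤ.* c)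
  l = solve-∀
∏-↭ f (Perm.trans p q) = trans (∏-↭ f p) (∏-↭ f q)

∏-1 : (xs : List El) → ∏ xs (λ _ → 1ℤ) ≡ 1ℤ
∏-1 [] = refl
∏-1 (x ∷ xs) = trans (ℤP.*-identityˡ (∏ xs (λ _ → 1ℤ))) (∏-1 xs)

∏-zero : (xs : List El) (f : El → ℤ) {x : El} → x ∈ xs → f x ≡ 0ℤ → ∏ xs f ≡ 0ℤ
∏-zero (x ∷ xs) f (here refl) e = trans (cong (ℤ._* ∏ xs f) e) (ℤP.*-zeroˡ (∏ xs f))
∏-zero (x ∷ xs) f (there i) e = trans (cong (f x ℤ.*_) (∏-zero xs f i e)) (ℤP.*-zeroʳ (f x))

⟦all⟧ : (p : El → Bool) (xs : List El) → ⟦ all p xs ⟧ ≡ ∏ xs (λ x → ⟦ p x ⟧)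
⟦all⟧ p [] = refl
⟦all⟧ p (x ∷ xs) = trans (⟦∧⟧ (p x) (all p xs)) (cong (⟦ p x ⟧ ℤ.*_) (⟦all⟧ p xs))

-- Sums over words with distinct letters

infixl 5 _−_ _∖_

_−_ : List ℕ → ℕ → List ℕ
S − x = filt (λ y → not (y ≡ᵇ x)) S

_∖_ : List ℕ → List ℕ → List ℕ
S ∖ [] = S
S ∖ (x ∷ s) = (S − x) ∖ s

-- Drawing without replacement: the letters already drawn are held by the summand, so a sum over
-- injective words never needs the list of these words, and recursion on the number of letters is at
-- hand.
draw : ℕ → List ℕ → (List ℕ → ℤ) → ℤ
draw zero S φ = φ []
draw (suc r) S φ = ∑ S (λ x → draw r (S − x) (φ ∘ (x ∷_)))

≡ᵇ-refl : ∀ x → T (x ≡ᵇ x)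
≡ᵇ-refl x = NP.≡⇒≡ᵇ x x refl

≡ᵇ-sym : ∀ x y → (x ≡ᵇ y) ≡ (y ≡ᵇ x)
≡ᵇ-sym x y = bool-ext (λ t → NP.≡⇒≡ᵇ y x (sym (NP.≡ᵇ⇒≡ x y t))) (λ t → NP.≡⇒≡ᵇ x y (sym (NP.≡ᵇ⇒≡ y x t)))

−-∈⁻ : ∀ S {x y} → y ∈ S − x → y ∈ S × y ≢ x
−-∈⁻ S {x} {y} i = let j , t = filt-∈⁻ _ S i in j , λ e → not-T t (NP.≡⇒≡ᵇ y x e)

−-∈⁺ : ∀ S {x y} → y ∈ S → y ≢ x → y ∈ S − x
−-∈⁺ S {x} {y} i n = filt-∈⁺ _ S i (T-not λ t → n (NP.≡ᵇ⇒≡ y x t))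

−-comm : ∀ S x y → S − x − y ≡ S − y − x
−-comm S x y = trans (filt-filt _ _ S) (trans (filt-cong S (λ {z} _ → BP.∧-comm (not (z ≡ᵇ x)) (not (z ≡ᵇ y)))) (sym (filt-filt _ _ S)))

∖-↭ : ∀ S {s t} → s ↭ t → S ∖ s ≡ S ∖ t
∖-↭ S Perm.refl = refl
∖-↭ S (prep x p) = ∖-↭ (S − x) p
∖-↭ S {t = _ ∷ _ ∷ t} (swap x y p) = trans (∖-↭ (S − x − y) p) (cong (_∖ t) (−-comm S x y))
∖-↭ S (Perm.trans p q) = trans (∖-↭ S p) (∖-↭ S q)

∖-∈⁻ : ∀ S s {x} → x ∈ S ∖ s → x ∈ S × x ∉ s
∖-∈⁻ S [] i = i , λ ()
∖-∈⁻ S (y ∷ s) i = let j , n = ∖-∈⁻ (S − y) s i ; k , m = −-∈⁻ S j in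
  k , λ { (here e) → m e ; (there l) → n l }

∖-unique : ∀ {S} s → Unique S → Unique (S ∖ s)
∖-unique [] u = u
∖-unique (x ∷ s) u = ∖-unique s (unique-filt _ u)

Drawn : ℕ → List ℕ → List ℕ → Set
Drawn r S s = length s ≡ r × Unique s × (∀ {x} → x ∈ s → x ∈ S)

drawn-∷ : ∀ {r S x s} → x ∈ S → Drawn r (S − x) s → Drawn (suc r) S (x ∷ s)
drawn-∷ {S = S} i (l , u , m) =
  cong suc l , unique-∷ (λ j → proj₂ (−-∈⁻ S (m j)) refl) u ,
  λ { (here refl) → i ; (there j) → proj₁ (−-∈⁻ S (m j)) }

draw-cong : ∀ r S {φ ψ} → (∀ {s} → Drawn r S s → φ s ≡ ψ s) → draw r S φ ≡ draw r S ψ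
draw-cong zero S h = h (refl , [] , λ ())
draw-cong (suc r) S h = ∑-cong∈ S (λ {x} i → draw-cong r (S − x) (λ d → h (drawn-∷ i d)))

draw-cong′ : ∀ r S {φ ψ} → (∀ s → φ s ≡ ψ s) → draw r S φ ≡ draw r S ψ
draw-cong′ r S h = draw-cong r S (λ {s} _ → h s)

draw-+ : ∀ r S φ ψ → draw r S (λ s → φ s ℤ.+ ψ s) ≡ draw r S φ ℤ.+ draw r S ψ
draw-+ zero S φ ψ = refl
draw-+ (suc r) S φ ψ = trans (∑-cong S (λ x → draw-+ r (S − x) _ _)) (∑-+ S _ _)

draw-*ˡ : ∀ c r S φ → draw r S (λ s → c ℤ.* φ s) ≡ c ℤ.* draw r S φ
draw-*ˡ c zero S φ = refl
draw-*ˡ c (suc r) S φ = trans (∑-cong S (λ x → draw-*ˡ c r (S − x) _)) (∑-*ˡ c S _)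

draw-0 : ∀ r S → draw r S (λ _ → 0ℤ) ≡ 0ℤ
draw-0 r S = trans (draw-*ˡ 0ℤ r S (λ _ → 0ℤ)) (ℤP.*-zeroˡ (draw r S (λ _ → 0ℤ)))

draw-split : ∀ r q S φ → draw (r N.+ q) S φ ≡ draw r S (λ s → draw q (S ∖ s) (λ t → φ (s ++ t)))
draw-split zero q S φ = refl
draw-split (suc r) q S φ = ∑-cong S (λ x → draw-split r q (S − x) (φ ∘ (x ∷_)))

swap₂ : List ℕ → List ℕ
swap₂ (x ∷ y ∷ s) = y ∷ x ∷ s
swap₂ s = s

-- In either order the first two letters run over the pairs of different letters, and the set that
-- remains does not depend on the order.
draw-swap : ∀ r S φ → draw (suc (suc r)) S φ ≡ draw (suc (suc r)) S (φ ∘ swap₂)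
draw-swap r S φ = trans (flat (λ x y → draw r (S − x − y) (λ s → φ (x ∷ y ∷ s))))
  (trans (∑-swap S S _) (trans (∑-cong S (λ y → ∑-cong S (λ x →
     cong₂ (λ b T′ → ⟦ not b ⟧ ℤ.* draw r T′ (λ s → φ (x ∷ y ∷ s))) (≡ᵇ-sym y x) (−-comm S x y))))
  (sym (flat (λ y x → draw r (S − y − x) (λ s → φ (x ∷ y ∷ s)))))))
  where
  flat : (F : ℕ → ℕ → ℤ) → ∑ S (λ x → ∑ (S − x) (F x)) ≡ ∑ S (λ x → ∑ S (λ y → ⟦ not (y ≡ᵇ x) ⟧ ℤ.* F x y))
  flat F = ∑-cong S (λ x → ∑-filt (λ y → not (y ≡ᵇ x)) S (F x))

rot : List ℕ → List ℕ
rot [] = []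
rot (x ∷ s) = s ++ x ∷ []

rot-↭ : ∀ s → rot s ↭ s
rot-↭ [] = ↭-refl
rot-↭ (x ∷ s) = ↭-sym (∷↭∷ʳ x s)

private
  under : (List ℕ → List ℕ) → List ℕ → List ℕ
  under f [] = []
  under f (x ∷ s) = x ∷ f s

-- Moving the first letter to the end means exchanging it with the second one and then rotating the
-- tail, which is `draw-swap` followed by the induction hypothesis.
draw-rot : ∀ r S φ → draw r S φ ≡ draw r S (φ ∘ rot)
draw-rot zero S φ = refl
draw-rot (suc zero) S φ = refl
draw-rot (suc (suc r)) S φ =
  trans (∑-cong S (λ y → draw-rot (suc r) (S − y) (φ ∘ (y ∷_))))
  (trans (draw-swap r S (φ ∘ under rot)) (draw-cong (suc (suc r)) S λ {s} d → cong φ (h s (proj₁ d))))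
  where
  h : ∀ s → length s ≡ suc (suc r) → under rot (swap₂ s) ≡ rot s
  h (x ∷ y ∷ s) e = refl

hd : (List ℕ → ℕ → ℤ) → List ℕ → ℤ
hd χ [] = 0ℤ
hd χ (x ∷ s) = χ (x ∷ s) x

-- All positions of a rotation-invariant sum look alike.
draw-head : ∀ r S (χ : List ℕ → ℕ → ℤ) (φ : List ℕ → ℤ)
  → (∀ s x → χ (rot s) x ≡ χ s x) → (∀ s → φ (rot s) ≡ φ s)
  → draw r S (λ s → ∑ s (χ s) ℤ.* φ s) ≡ + r ℤ.* draw r S (λ s → hd χ s ℤ.* φ s)
draw-head r S χ φ hχ hφ =
  trans (draw-cong r S λ {s} d → cong (ℤ._* φ s) (trans (sym (heads-all s)) (cong (λ l → heads l s) (proj₁ d)))) (go r)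
  where
  -- `heads i s` adds up χ at the heads of the first i rotations of `s`; for i the length of `s`
  -- every letter has been at the head once.
  heads : ℕ → List ℕ → ℤ
  heads zero s = 0ℤ
  heads (suc i) s = hd χ s ℤ.+ heads i (rot s)
  heads-++ : ∀ ys zs → heads (length ys) (ys ++ zs) ≡ ∑ ys (χ (ys ++ zs))
  heads-++ [] zs = refl
  heads-++ (y ∷ ys) zs = cong (ℤ._+_ (χ (y ∷ ys ++ zs) y))
    (trans (cong (heads (length ys)) (LP.++-assoc ys zs (y ∷ [])))
    (trans (heads-++ ys (zs ++ y ∷ []))
      (∑-cong ys (λ x → trans (cong (λ l → χ l x) (sym (LP.++-assoc ys zs (y ∷ [])))) (hχ (y ∷ ys ++ zs) x)))))
  heads-all : ∀ s → heads (length s) s ≡ ∑ s (χ s)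
  heads-all s = subst (λ t → heads (length s) t ≡ ∑ s (χ t)) (LP.++-identityʳ s) (heads-++ s [])
  suc-* : ∀ i (z : ℤ) → z ℤ.+ + i ℤ.* z ≡ + suc i ℤ.* z
  suc-* i z = sym (ℤP.suc-* (+ i) z)
  go : ∀ i → draw r S (λ s → heads i s ℤ.* φ s) ≡ + i ℤ.* draw r S (λ s → hd χ s ℤ.* φ s)
  go zero = trans (draw-cong′ r S (λ s → ℤP.*-zeroˡ (φ s))) (trans (draw-0 r S) (sym (ℤP.*-zeroˡ (draw r S (λ s → hd χ s ℤ.* φ s)))))
  go (suc i) = trans (draw-cong′ r S (λ s → trans (ℤP.*-distribʳ-+ (φ s) (hd χ s) (heads i (rot s)))
                        (cong (λ z → hd χ s ℤ.* φ s ℤ.+ heads i (rot s) ℤ.* z) (sym (hφ s)))))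
    (trans (draw-+ r S (λ s → hd χ s ℤ.* φ s) (λ s → heads i (rot s) ℤ.* φ (rot s)))
    (trans (cong (ℤ._+_ (draw r S (λ s → hd χ s ℤ.* φ s))) (trans (sym (draw-rot r S (λ s → heads i s ℤ.* φ s))) (go i)))
      (suc-* i _)))

words-avoid : ∀ r S x ψ → ∑ (words r (S − x)) ψ ≡ ∑ (words r S) (λ y → ⟦ not (any (_≡ᵇ x) y) ⟧ ℤ.* ψ y)
words-avoid zero S x ψ = cong (ℤ._+ 0ℤ) (sym (ℤP.*-identityˡ (ψ [])))
words-avoid (suc r) S x ψ =
  trans (∑-concatMap _ (S − x) ψ)
  (trans (∑-cong (S − x) (λ z → trans (∑-map (z ∷_) (words r (S − x)) ψ) (words-avoid r S x (ψ ∘ (z ∷_)))))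
  (trans (∑-filt (λ y → not (y ≡ᵇ x)) S _)
  (trans (∑-cong S (λ z → trans (sym (∑-*ˡ ⟦ not (z ≡ᵇ x) ⟧ (words r S) _)) (trans (∑-cong (words r S) (λ y → h (z ≡ᵇ x) (any (_≡ᵇ x) y) (ψ (z ∷ y))))
        (sym (∑-map (z ∷_) (words r S) _)))))
  (sym (∑-concatMap _ S _)))))
  where
  h : ∀ a b c → ⟦ not a ⟧ ℤ.* (⟦ not b ⟧ ℤ.* c) ≡ ⟦ not (a ∨ b) ⟧ ℤ.* c
  h true b c = trans (ℤP.*-zeroˡ (⟦ not b ⟧ ℤ.* c)) (sym (ℤP.*-zeroˡ c))
  h false b c = ℤP.*-identityˡ (⟦ not b ⟧ ℤ.* c)

∑-distinct-words : ∀ r S φ → ∑ (filt distinct (words r S)) φ ≡ draw r S φ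
∑-distinct-words zero S φ = ℤP.+-identityʳ (φ [])
∑-distinct-words (suc r) S φ =
  trans (∑-filt distinct (words (suc r) S) φ)
  (trans (∑-concatMap _ S _)
  (∑-cong S (λ x → trans (∑-map (x ∷_) (words r S) _)
    (trans (∑-cong (words r S) (λ y → trans (cong (ℤ._* φ (x ∷ y)) (⟦∧⟧ (not (any (_≡ᵇ x) y)) (distinct y))) (ℤP.*-assoc ⟦ not (any (_≡ᵇ x) y) ⟧ ⟦ distinct y ⟧ (φ (x ∷ y)))))
    (trans (sym (words-avoid r S x (λ y → ⟦ distinct y ⟧ ℤ.* φ (x ∷ y))))
    (trans (sym (∑-filt distinct (words r (S − x)) (φ ∘ (x ∷_))))
      (∑-distinct-words r (S − x) (φ ∘ (x ∷_)))))))))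

pick : ∀ {S : List ℕ} (F : ℕ → ℤ) {i} → Unique S → i ∈ S → ∑ S (λ j → ⟦ i ≡ᵇ j ⟧ ℤ.* F j) ≡ F i
pick {x ∷ S} F {i} u (here refl) = trans (cong₂ ℤ._+_ (trans (cong (λ b → ⟦ b ⟧ ℤ.* F x) (T⇒≡ (≡ᵇ-refl x))) (ℤP.*-identityˡ (F x)))
  (∑-zero∈ S (λ {y} m → trans (cong (λ b → ⟦ b ⟧ ℤ.* F y) (¬T⇒≡ (λ t → unique-head u (subst (_∈ S) (sym (NP.≡ᵇ⇒≡ x y t)) m)))) (ℤP.*-zeroˡ (F y))))) (ℤP.+-identityʳ (F x))
pick {x ∷ S} F {i} u (there m) = trans (cong₂ ℤ._+_ (trans (cong (λ b → ⟦ b ⟧ ℤ.* F x) (¬T⇒≡ (λ t → unique-head u (subst (_∈ S) (NP.≡ᵇ⇒≡ i x t) m)))) (ℤP.*-zeroˡ (F x)))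
  (pick F (unique-tail u) m)) (ℤP.+-identityˡ (F i))

-- Cyclic products along a row

Matrix : Set
Matrix = ℕ → ℕ → ℤ

chain : Matrix → ℕ → List ℕ → ℕ → ℤ
chain M a [] z = M a z
chain M a (b ∷ s) z = M a b ℤ.* chain M b s z

cyc : Matrix → List ℕ → ℤ
cyc M [] = 1ℤ
cyc M (x ∷ s) = chain M x s x

chain-∷ʳ : ∀ M a s x z → chain M a (s ++ x ∷ []) z ≡ chain M a s x ℤ.* M x z
chain-∷ʳ M a [] x z = refl
chain-∷ʳ M a (b ∷ s) x z = trans (cong (M a b ℤ.*_) (chain-∷ʳ M b s x z)) (sym (ℤP.*-assoc (M a b) _ _))

cyc-rot : ∀ M s → cyc M (rot s) ≡ cyc M s
cyc-rot M [] = refl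
cyc-rot M (x ∷ []) = refl
cyc-rot M (x ∷ y ∷ s) = trans (chain-∷ʳ M y s x y) (ℤP.*-comm (chain M y s x) (M x y))

maxL : List ℕ → ℕ
maxL = foldr N._⊔_ 0

maxL-∷ʳ : ∀ s x → maxL (s ++ x ∷ []) ≡ maxL (x ∷ s)
maxL-∷ʳ [] x = refl
maxL-∷ʳ (y ∷ s) x = trans (cong (y N.⊔_) (maxL-∷ʳ s x)) (trans (sym (NP.⊔-assoc y x (maxL s)))
  (trans (cong (N._⊔ maxL s) (NP.⊔-comm y x)) (NP.⊔-assoc x y (maxL s))))

maxL-rot : ∀ s → maxL (rot s) ≡ maxL s
maxL-rot [] = refl
maxL-rot (x ∷ s) = maxL-∷ʳ s x

maxL-↭ : ∀ {s t} → s ↭ t → maxL s ≡ maxL t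
maxL-↭ Perm.refl = refl
maxL-↭ (prep x p) = cong (x N.⊔_) (maxL-↭ p)
maxL-↭ (swap x y p) = trans (sym (NP.⊔-assoc x y _)) (trans (cong₂ N._⊔_ (NP.⊔-comm x y) (maxL-↭ p)) (NP.⊔-assoc y x _))
maxL-↭ (Perm.trans p q) = trans (maxL-↭ p) (maxL-↭ q)

maxL-≥ : ∀ s {x} → x ∈ s → x N.≤ maxL s
maxL-≥ (y ∷ s) (here refl) = NP.m≤m⊔n y (maxL s)
maxL-≥ (y ∷ s) (there i) = NP.≤-trans (maxL-≥ s i) (NP.m≤n⊔m y (maxL s))

maxL-∈ : ∀ x s → maxL (x ∷ s) ∈ x ∷ s
maxL-∈ x [] = here (NP.⊔-identityʳ x)
maxL-∈ x (y ∷ s) with NP.⊔-sel x (maxL (y ∷ s))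
... | inj₁ e = here e
... | inj₂ e = there (subst (_∈ y ∷ s) (sym e) (maxL-∈ y s))

∑-single : ∀ (s : List ℕ) m → Unique s → m ∈ s → ∑ s (λ x → ⟦ x ≡ᵇ m ⟧) ≡ 1ℤ
∑-single (x ∷ s) m u (here refl) = trans (cong₂ ℤ._+_ (cong ⟦_⟧ (T⇒≡ (≡ᵇ-refl x)))
  (∑-zero∈ s (λ {y} i → cong ⟦_⟧ (¬T⇒≡ (λ t → unique-head u (subst (_∈ s) (NP.≡ᵇ⇒≡ y x t) i)))))) refl
∑-single (x ∷ s) m u (there i) = trans (cong₂ ℤ._+_ (cong ⟦_⟧ (¬T⇒≡ (λ t → unique-head u (subst (_∈ s) (sym (NP.≡ᵇ⇒≡ x m t)) i))))
  (∑-single s m (unique-tail u) i)) refl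

-- `D` singles out the admissible letters, `ω` is the diagonal and `K m b` says that b < m is a
-- neighbour of m. The matrix is not a parameter: matrices sharing these data are to be compared.
module RowSums (D : ℕ → Set) (ω : ℕ → ℤ) (K : ℕ → ℕ → Bool) where

  -- The last row and column of M restricted to labels ≤ m: one of them is supported on the
  -- neighbourhood K m, the other one copies the row (column) of any k in K m.
  data Peel (M : Matrix) (m : ℕ) : Set where
    fwd : (∀ {b} → D b → b N.< m → M m b ≡ ω m ℤ.* ⟦ K m b ⟧)
        → (∀ {a k} → D a → D k → a N.< m → k N.< m → T (K m k) → M a m ≡ M a k) → Peel M m
    bwd : (∀ {b} → D b → b N.< m → M b m ≡ ω m ℤ.* ⟦ K m b ⟧)
        → (∀ {a k} → D a → D k → a N.< m → k N.< m → T (K m k) → M m a ≡ M k a) → Peel M m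

  record Peelable (M : Matrix) : Set where
    field
      diag : ∀ {m} → D m → M m m ≡ ω m
      peel : ∀ {m} → D m → Peel M m

  Symm : (List ℕ → ℤ) → Set
  Symm h = ∀ {s t} → s ↭ t → h s ≡ h t

  lastχ : ℕ → List ℕ → ℤ
  lastχ m [] = 0ℤ
  lastχ m (x ∷ []) = ⟦ K m x ⟧
  lastχ m (x ∷ y ∷ s) = lastχ m (y ∷ s)

  lastχ-∷ʳ : ∀ m s x → lastχ m (s ++ x ∷ []) ≡ ⟦ K m x ⟧
  lastχ-∷ʳ m [] x = refl
  lastχ-∷ʳ m (y ∷ []) x = refl
  lastχ-∷ʳ m (y ∷ z ∷ s) x = lastχ-∷ʳ m (z ∷ s) x

  headχ : ℕ → List ℕ → ℤ
  headχ m = hd (λ _ x → ⟦ K m x ⟧)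

  Below : ℕ → List ℕ → Set
  Below m t = ∀ {x} → x ∈ t → D x × x N.< m

  private
    re : ∀ a b c → a ℤ.* b ℤ.* c ≡ a ℤ.* (b ℤ.* c)
    re = solve-∀
    re₃ : ∀ a b c → b ℤ.* (a ℤ.* c) ≡ a ℤ.* (c ℤ.* b)
    re₃ = solve-∀

  module _ {M : Matrix} {m : ℕ} where

    chain-last : ∀ y t z z′ → (∀ {a} → a ∈ y ∷ t → M a z ≡ M a z′) → chain M y t z ≡ chain M y t z′
    chain-last y [] z z′ h = h (here refl)
    chain-last y (x ∷ t) z z′ h = cong (M y x ℤ.*_) (chain-last x t z z′ (h ∘ there))

    -- If y is a neighbour of m, the column of m copies that of y, so the word may close at y
    -- instead of m, and m drops out of the cycle with the factor `ω m`. If not, both sides vanish.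
    cyc-fwd : (∀ {b} → D b → b N.< m → M m b ≡ ω m ℤ.* ⟦ K m b ⟧)
      → (∀ {a k} → D a → D k → a N.< m → k N.< m → T (K m k) → M a m ≡ M a k)
      → ∀ y t → Below m (y ∷ t) → cyc M (m ∷ y ∷ t) ≡ ω m ℤ.* (headχ m (y ∷ t) ℤ.* cyc M (y ∷ t))
    cyc-fwd h₁ h₂ y t bl with K m y in eq
    ... | false = trans (cong (ℤ._* chain M y t m) (trans (h₁ (proj₁ (bl (here refl))) (proj₂ (bl (here refl)))) (cong (λ b → ω m ℤ.* ⟦ b ⟧) eq)))
                   (trans (re (ω m) 0ℤ _) (cong (ω m ℤ.*_) (trans (ℤP.*-zeroˡ (chain M y t m)) (sym (ℤP.*-zeroˡ (chain M y t y))))))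
    ... | true = trans (cong₂ ℤ._*_ (trans (h₁ (proj₁ (bl (here refl))) (proj₂ (bl (here refl)))) (cong (λ b → ω m ℤ.* ⟦ b ⟧) eq))
                         (chain-last y t m y (λ i → h₂ (proj₁ (bl i)) (proj₁ (bl (here refl))) (proj₂ (bl i)) (proj₂ (bl (here refl))) (≡⇒T eq))))
                   (re (ω m) 1ℤ (chain M y t y))

    chain-first : ∀ s z a a′ → (∀ {b} → b ∈ s ++ z ∷ [] → M a b ≡ M a′ b) → chain M a s z ≡ chain M a′ s z
    chain-first [] z a a′ h = h (here refl)
    chain-first (b ∷ s) z a a′ h = cong (ℤ._* chain M b s z) (h (here refl))

    cyc-bwd : (∀ {b} → D b → b N.< m → M b m ≡ ω m ℤ.* ⟦ K m b ⟧)
      → (∀ {a k} → D a → D k → a N.< m → k N.< m → T (K m k) → M m a ≡ M k a)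
      → ∀ t l → Below m (t ++ l ∷ []) → cyc M (m ∷ (t ++ l ∷ [])) ≡ ω m ℤ.* (lastχ m (t ++ l ∷ []) ℤ.* cyc M (t ++ l ∷ []))
    cyc-bwd h₁ h₂ t l bl = trans (chain-∷ʳ M m t l m)
      (trans (stp (K m l) refl) (cong₂ (λ x y → ω m ℤ.* (x ℤ.* y)) (sym (lastχ-∷ʳ m t l)) (sym (cyc-rot M (l ∷ t)))))
      where
      il : l ∈ t ++ l ∷ []
      il = ∈-++⁺ʳ t (here refl)
      stp : ∀ b → K m l ≡ b → chain M m t l ℤ.* M l m ≡ ω m ℤ.* (⟦ K m l ⟧ ℤ.* chain M l t l)
      stp false e = trans (cong (chain M m t l ℤ.*_) (trans (h₁ (proj₁ (bl il)) (proj₂ (bl il))) (cong (λ b → ω m ℤ.* ⟦ b ⟧) e)))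
         (trans (z (chain M m t l) (ω m) (chain M l t l)) (cong (λ b → ω m ℤ.* (⟦ b ⟧ ℤ.* chain M l t l)) (sym e)))
        where
        z : ∀ a b c → a ℤ.* (b ℤ.* 0ℤ) ≡ b ℤ.* (0ℤ ℤ.* c)
        z = solve-∀
      stp true e = trans (cong₂ ℤ._*_ (chain-first t l m l (λ i → h₂ (proj₁ (bl i)) (proj₁ (bl il)) (proj₂ (bl i)) (proj₂ (bl il)) (≡⇒T e)))
                               (h₁ (proj₁ (bl il)) (proj₂ (bl il))))
         (trans (re₃ (ω m) (chain M l t l) ⟦ K m l ⟧) refl)

  -- The largest letter m of a cyclic word, moved to the front, contributes ω m times
  -- the indicator that its successor (predecessor) lies in K m.
  draw-peel : ∀ {M m} → Peel M m → ∀ p S (g : List ℕ → ℤ) → Symm g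
    → (∀ {t} → Drawn (suc p) S t → Below m t ⊎ g t ≡ 0ℤ)
    → draw (suc p) S (λ t → cyc M (m ∷ t) ℤ.* g t)
      ≡ ω m ℤ.* draw (suc p) S (λ t → headχ m t ℤ.* (cyc M t ℤ.* g t))
  draw-peel {M} {m} (fwd h₁ h₂) p S g sg dich =
    trans (draw-cong (suc p) S (λ {t} d → go t d (dich d))) (draw-*ˡ (ω m) (suc p) S (λ t → headχ m t ℤ.* (cyc M t ℤ.* g t)))
    where
    go : ∀ t → Drawn (suc p) S t → Below m t ⊎ g t ≡ 0ℤ → cyc M (m ∷ t) ℤ.* g t ≡ ω m ℤ.* (headχ m t ℤ.* (cyc M t ℤ.* g t))
    go t d (inj₂ e) = trans (cong (cyc M (m ∷ t) ℤ.*_) e) (trans (z (cyc M (m ∷ t)) (ω m) (headχ m t) (cyc M t)) (cong (λ x → ω m ℤ.* (headχ m t ℤ.* (cyc M t ℤ.* x))) (sym e)))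
      where
      z : ∀ a b c d → a ℤ.* 0ℤ ≡ b ℤ.* (c ℤ.* (d ℤ.* 0ℤ))
      z = solve-∀
    go (y ∷ t) d (inj₁ bl) = trans (cong (ℤ._* g (y ∷ t)) (cyc-fwd {M} {m} h₁ h₂ y t bl)) (z (ω m) (headχ m (y ∷ t)) (cyc M (y ∷ t)) (g (y ∷ t)))
      where
      z : ∀ a b c d → a ℤ.* (b ℤ.* c) ℤ.* d ≡ a ℤ.* (b ℤ.* (c ℤ.* d))
      z = solve-∀
  -- Here the predecessor of m is tested, the last letter of t. A rotation of t, which changes
  -- neither the cyclic product nor the symmetric g, turns this into a test of the first letter.
  draw-peel {M} {m} (bwd h₁ h₂) p S g sg dich =
    trans (draw-cong (suc p) S (λ {t} d → go t d (dich d)))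
    (trans (draw-*ˡ (ω m) (suc p) S lastφ) (cong (ω m ℤ.*_)
      (trans (draw-rot (suc p) S lastφ) (draw-cong′ (suc p) S back))))
    where
    lastφ : List ℕ → ℤ
    lastφ t = lastχ m t ℤ.* (cyc M t ℤ.* g t)
    go : ∀ t → Drawn (suc p) S t → Below m t ⊎ g t ≡ 0ℤ → cyc M (m ∷ t) ℤ.* g t ≡ ω m ℤ.* (lastχ m t ℤ.* (cyc M t ℤ.* g t))
    go t d (inj₂ e) = trans (cong (cyc M (m ∷ t) ℤ.*_) e) (trans (z (cyc M (m ∷ t)) (ω m) (lastχ m t) (cyc M t)) (cong (λ x → ω m ℤ.* (lastχ m t ℤ.* (cyc M t ℤ.* x))) (sym e)))
      where
      z : ∀ a b c d → a ℤ.* 0ℤ ≡ b ℤ.* (c ℤ.* (d ℤ.* 0ℤ))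
      z = solve-∀
    go t d (inj₁ bl) with initLast t
    go .[] (() , _) (inj₁ bl) | []
    go .(t ++ l ∷ []) d (inj₁ bl) | t ∷ʳ′ l = trans (cong (ℤ._* g (t ++ l ∷ [])) (cyc-bwd {M} {m} h₁ h₂ t l bl))
        (z (ω m) (lastχ m (t ++ l ∷ [])) (cyc M (t ++ l ∷ [])) (g (t ++ l ∷ [])))
      where
      z : ∀ a b c d → a ℤ.* (b ℤ.* c) ℤ.* d ≡ a ℤ.* (b ℤ.* (c ℤ.* d))
      z = solve-∀
    back : ∀ t → lastχ m (rot t) ℤ.* (cyc M (rot t) ℤ.* g (rot t)) ≡ headχ m t ℤ.* (cyc M t ℤ.* g t)
    back [] = refl
    back (x ∷ t) = cong₂ ℤ._*_ (lastχ-∷ʳ m t x) (cong₂ ℤ._*_ (cyc-rot M (x ∷ t)) (sg (rot-↭ (x ∷ t))))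

  -- After a rotation the word starts with its maximum m, and `draw-peel` cuts m out. By `draw-head`
  -- the remaining test of the first letter amounts to counting the neighbours of m, up to the
  -- factor `suc p`. This count is symmetric and joins the weight `h`, so the induction hypothesis
  -- applies to words that are shorter by one.
  cyc-sum-unique : ∀ {M N′} → Peelable M → Peelable N′ → ∀ r S → (∀ {x} → x ∈ S → D x) → ∀ h → Symm h
    → draw r S (λ s → cyc M s ℤ.* h s) ≡ draw r S (λ s → cyc N′ s ℤ.* h s)
  cyc-sum-unique pM pN zero S dS h sh = refl
  cyc-sum-unique pM pN (suc zero) S dS h sh =
    ∑-cong∈ S (λ {x} i → cong (ℤ._* h (x ∷ [])) (trans (Peelable.diag pM (dS i)) (sym (Peelable.diag pN (dS i)))))
  cyc-sum-unique {M} {N′} pM pN (suc (suc p)) S dS h sh =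
    trans (to-max M) (trans (cong (+ suc (suc p) ℤ.*_) (∑-cong∈ S (same (cyc-sum-unique pM pN (suc p))))) (sym (to-max N′)))
    where
    -- The indicator of being the maximum has sum 1 over a duplicate-free word. Inserting this sum
    -- and applying `draw-head` moves the maximum to the front; `g` keeps the indicator, so that
    -- words exceeding m have weight 0.
    χ : List ℕ → ℕ → ℤ
    χ s x = ⟦ x ≡ᵇ maxL s ⟧
    g : ℕ → List ℕ → ℤ
    g m t = χ (m ∷ t) m ℤ.* h (m ∷ t)
    sg : ∀ m → Symm (g m)
    sg m q = cong₂ (λ a b → ⟦ m ≡ᵇ a ⟧ ℤ.* b) (maxL-↭ (prep m q)) (sh (prep m q))
    below : ∀ {m} → m ∈ S → ∀ {t} → Drawn (suc p) (S − m) t → Below m t ⊎ g m t ≡ 0ℤ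
    below {m} i {t} (_ , _ , sub) with m ≡ᵇ maxL (m ∷ t) in eq
    ... | false = inj₂ (ℤP.*-zeroˡ (h (m ∷ t)))
    ... | true = inj₁ (λ {x} j → dS (proj₁ (−-∈⁻ S (sub j))) ,
          NP.≤∧≢⇒< (subst (x N.≤_) (sym (NP.≡ᵇ⇒≡ m (maxL (m ∷ t)) (≡⇒T eq))) (maxL-≥ (m ∷ t) (there j))) (proj₂ (−-∈⁻ S (sub j))))
    to-max : ∀ L → draw (suc (suc p)) S (λ s → cyc L s ℤ.* h s)
       ≡ + suc (suc p) ℤ.* ∑ S (λ m → draw (suc p) (S − m) (λ t → cyc L (m ∷ t) ℤ.* g m t))
    to-max L = trans (draw-cong (suc (suc p)) S (λ {s} d → trans (sym (ℤP.*-identityˡ _)) (cong (ℤ._* (cyc L s ℤ.* h s)) (sym (one s d)))))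
      (trans (draw-head (suc (suc p)) S χ (λ s → cyc L s ℤ.* h s) (λ s x → cong (λ m → ⟦ x ≡ᵇ m ⟧) (maxL-rot s))
                (λ s → cong₂ ℤ._*_ (cyc-rot L s) (sh (rot-↭ s))))
       (cong (+ suc (suc p) ℤ.*_) (∑-cong S (λ m → draw-cong′ (suc p) (S − m) (λ t → z (χ (m ∷ t) m) (cyc L (m ∷ t)) (h (m ∷ t)))))))
      where
      z : ∀ a b c → a ℤ.* (b ℤ.* c) ≡ b ℤ.* (a ℤ.* c)
      z = solve-∀
      one : ∀ s → Drawn (suc (suc p)) S s → ∑ s (χ s) ≡ 1ℤ
      one (x ∷ s) (_ , u , _) = ∑-single (x ∷ s) (maxL (x ∷ s)) u (maxL-∈ x s)
    count : ∀ {L} → Peelable L → ∀ {m} → m ∈ S →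
      + suc p ℤ.* draw (suc p) (S − m) (λ t → cyc L (m ∷ t) ℤ.* g m t)
      ≡ ω m ℤ.* draw (suc p) (S − m) (λ t → cyc L t ℤ.* (∑ t (λ x → ⟦ K m x ⟧) ℤ.* g m t))
    count {L} pL {m} i = trans (cong (+ suc p ℤ.*_) (draw-peel (Peelable.peel pL (dS i)) p (S − m) (g m) (sg m) (below i)))
      (trans (z (+ suc p) (ω m) _) (cong (ω m ℤ.*_) (trans
        (sym (draw-head (suc p) (S − m) (λ _ x → ⟦ K m x ⟧) (λ t → cyc L t ℤ.* g m t) (λ _ _ → refl)
                (λ s → cong₂ ℤ._*_ (cyc-rot L s) (sg m (rot-↭ s)))))
        (draw-cong′ (suc p) (S − m) (λ t → z (∑ t (λ x → ⟦ K m x ⟧)) (cyc L t) (g m t))))))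
      where
      z : ∀ a b c → a ℤ.* (b ℤ.* c) ≡ b ℤ.* (a ℤ.* c)
      z = solve-∀
    IH : Set
    IH = ∀ S′ → (∀ {x} → x ∈ S′ → D x) → ∀ h′ → Symm h′
       → draw (suc p) S′ (λ s → cyc M s ℤ.* h′ s) ≡ draw (suc p) S′ (λ s → cyc N′ s ℤ.* h′ s)
    -- Only the multiple by the number of remaining letters is computed; as this number is not 0, it
    -- can be cancelled in the integers.
    same : IH → ∀ {m} → m ∈ S → draw (suc p) (S − m) (λ t → cyc M (m ∷ t) ℤ.* g m t) ≡ draw (suc p) (S − m) (λ t → cyc N′ (m ∷ t) ℤ.* g m t)
    same ih {m} i = ℤP.*-cancelˡ-≡ (+ suc p) _ _ (trans (count pM i) (trans (cong (ω m ℤ.*_)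
      (ih (S − m) (λ j → dS (proj₁ (−-∈⁻ S j))) (λ t → ∑ t (λ x → ⟦ K m x ⟧) ℤ.* g m t)
         (λ q → cong₂ ℤ._*_ (∑-↭ _ q) (sg m q)))) (sym (count pN i))))

-- Products over several rows

rowsProd : List (ℕ × Matrix) → List ℕ → ℤ
rowsProd [] s = 1ℤ
rowsProd ((r , M) ∷ rs) s = cyc M (take r s) ℤ.* rowsProd rs (drop r s)

size : List (ℕ × Matrix) → ℕ
size rs = sum (map proj₁ rs)

take-++-len : ∀ {A : Set} (s t : List A) {r} → length s ≡ r → take r (s ++ t) ≡ s
take-++-len [] t refl = refl
take-++-len (x ∷ s) t refl = cong (x ∷_) (take-++-len s t refl)

drop-++-len : ∀ {A : Set} (s t : List A) {r} → length s ≡ r → drop r (s ++ t) ≡ t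
drop-++-len [] t refl = refl
drop-++-len (x ∷ s) t refl = drop-++-len s t refl

draw-rows : ∀ r M rs S → draw (size ((r , M) ∷ rs)) S (rowsProd ((r , M) ∷ rs))
  ≡ draw r S (λ s → cyc M s ℤ.* draw (size rs) (S ∖ s) (rowsProd rs))
draw-rows r M rs S = trans (draw-split r (size rs) S _) (draw-cong r S (λ {s} d →
  trans (draw-cong′ (size rs) (S ∖ s) (λ t → cong₂ (λ a b → cyc M a ℤ.* rowsProd rs b) (take-++-len s t (proj₁ d)) (drop-++-len s t (proj₁ d))))
    (draw-*ˡ (cyc M s) (size rs) (S ∖ s) (rowsProd rs))))

SameRow : (ℕ → Set) → ℕ × Matrix → ℕ × Matrix → Set
SameRow D (r , M) (r′ , M′) = r ≡ r′ × ∃₂ λ ω K → RowSums.Peelable D ω K M × RowSums.Peelable D ω K M′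

-- The sum over the later rows depends only on the set of letters left for them, so it is a
-- symmetric weight for the first row; the matrices can be exchanged row by row.
rows-sum-unique : ∀ (D : ℕ → Set) {rs rs′} → Pointwise (SameRow D) rs rs′ → ∀ S → (∀ {x} → x ∈ S → D x)
  → draw (size rs) S (rowsProd rs) ≡ draw (size rs′) S (rowsProd rs′)
rows-sum-unique D [] S dS = refl
rows-sum-unique D {(r , M) ∷ rs} {(.r , M′) ∷ rs′} ((refl , ω , K , p , p′) ∷ q) S dS =
  trans (draw-rows r M rs S)
  (trans (RowSums.cyc-sum-unique D ω K p p′ r S dS (λ s → draw (size rs) (S ∖ s) (rowsProd rs)) (λ e → cong (λ X → draw (size rs) X (rowsProd rs)) (∖-↭ S e)))
  (trans (draw-cong′ r S (λ s → cong (cyc M′ s ℤ.*_) (rows-sum-unique D q (S ∖ s) (λ i → dS (proj₁ (∖-∈⁻ S s i))))))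
  (sym (draw-rows r M′ rs′ S))))

-- Networks

argmin : (f : ℕ → ℤ) {P : ℕ → Set} → (∀ k → Dec (P k)) → ∀ t
  → (∀ {k} → k N.< t → ¬ P k) ⊎ (∃ λ k → k N.< t × P k × (∀ {j} → j N.< t → P j → f k ≤ f j))
argmin f P? zero = inj₁ (λ ())
argmin f {P} P? (suc t) with P? t | argmin f P? t
... | no n | inj₁ h = inj₁ λ l → case l
  where
  case : ∀ {k} → k N.< suc t → ¬ P k
  case l with NP.m<1+n⇒m<n∨m≡n l
  ... | inj₁ q = h q
  ... | inj₂ refl = n
... | no n | inj₂ (k , k<t , pk , min) = inj₂ (k , NP.m<n⇒m<1+n k<t , pk , λ l → case l)
  where
  case : ∀ {j} → j N.< suc t → P j → f k ≤ f j
  case l pj with NP.m<1+n⇒m<n∨m≡n l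
  ... | inj₁ q = min q pj
  ... | inj₂ refl = ⊥-elim (n pj)
... | yes p | inj₁ h = inj₂ (t , NP.≤-refl , p , λ l → case l)
  where
  case : ∀ {j} → j N.< suc t → P j → f t ≤ f j
  case l pj with NP.m<1+n⇒m<n∨m≡n l
  ... | inj₁ q = ⊥-elim (h q pj)
  ... | inj₂ refl = ℤP.≤-refl
... | yes p | inj₂ (k , k<t , pk , min) with ℤP.≤-total (f k) (f t)
...   | inj₁ le = inj₂ (k , NP.m<n⇒m<1+n k<t , pk , λ l → case l)
  where
  case : ∀ {j} → j N.< suc t → P j → f k ≤ f j
  case l pj with NP.m<1+n⇒m<n∨m≡n l
  ... | inj₁ q = min q pj
  ... | inj₂ refl = le
...   | inj₂ le = inj₂ (t , NP.≤-refl , p , λ l → case l)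
  where
  case : ∀ {j} → j N.< suc t → P j → f t ≤ f j
  case l pj with NP.m<1+n⇒m<n∨m≡n l
  ... | inj₁ q = ℤP.≤-trans le (min q pj)
  ... | inj₂ refl = ℤP.≤-refl

argmax : (f : ℕ → ℤ) {P : ℕ → Set} → (∀ k → Dec (P k)) → ∀ t
  → (∀ {k} → k N.< t → ¬ P k) ⊎ (∃ λ k → k N.< t × P k × (∀ {j} → j N.< t → P j → f j ≤ f k))
argmax f P? t with argmin (λ k → - f k) P? t
... | inj₁ h = inj₁ h
... | inj₂ (k , k<t , p , h) = inj₂ (k , k<t , p , λ l q → ℤP.neg-cancel-≤ (h l q))

nth : List Interval → ℕ → Interval
nth [] _ = + 0 , + 0
nth (x ∷ xs) zero = x
nth (x ∷ xs) (suc k) = nth xs k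

nth-lookup : ∀ I k (l : k N.< length I) → lookup I (fromℕ< l) ≡ nth I k
nth-lookup (x ∷ I) zero l = refl
nth-lookup (x ∷ I) (suc k) l = nth-lookup I k (N.s<s⁻¹ l)

picked : ℤ → Interval → Bool
picked i v = inIᵇ i v ∧ nontrivialᵇ v

-- The numbering `f` is a parameter because the tail of the list is numbered by `f ∘ suc`.
sel : (ℕ → ℕ) → List Interval → ℤ → List ℕ
sel f I i = map proj₁ (filt (λ p → picked i (proj₂ p)) (zip (applyUpTo f (length I)) I))

sel-∈⁻ : ∀ f I i {x} → x ∈ sel f I i → ∃ λ k → k N.< length I × x ≡ f k × T (picked i (nth I k))
sel-∈⁻ f (v ∷ I) i x∈ with picked i v in eq
sel-∈⁻ f (v ∷ I) i (here refl) | true = 0 , s≤s z≤n , refl , ≡⇒T eq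
sel-∈⁻ f (v ∷ I) i (there m)   | true = let k , l , e , t = sel-∈⁻ (f ∘ suc) I i m in suc k , s≤s l , e , t
sel-∈⁻ f (v ∷ I) i m           | false = let k , l , e , t = sel-∈⁻ (f ∘ suc) I i m in suc k , s≤s l , e , t

sel-∈⁺ : ∀ f I i k → k N.< length I → T (picked i (nth I k)) → f k ∈ sel f I i
sel-∈⁺ f (v ∷ I) i zero l t rewrite T⇒≡ t = here refl
sel-∈⁺ f (v ∷ I) i (suc k) l t with picked i v
... | true = there (sel-∈⁺ (f ∘ suc) I i k (N.s<s⁻¹ l) t)
... | false = sel-∈⁺ (f ∘ suc) I i k (N.s<s⁻¹ l) t

sel-sorted : ∀ f I i → (∀ {a b} → a N.< b → f a N.< f b) → AllPairs N._<_ (sel f I i)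
sel-sorted f [] i mono = []
sel-sorted f (v ∷ I) i mono with picked i v
... | true = All.tabulate (λ m → let k , _ , e , _ = sel-∈⁻ (f ∘ suc) I i m in subst (f 0 N.<_) (sym e) (mono (s≤s z≤n)))
             ∷ sel-sorted (f ∘ suc) I i (mono ∘ s≤s)
... | false = sel-sorted (f ∘ suc) I i (mono ∘ s≤s)

strand-sel : ∀ I i → strand I i ≡ src i ∷ map mid (sel id I i) ++ snk i ∷ []
strand-sel I i = cong (λ l → src i ∷ l ++ snk i ∷ []) (LP.map-∘ (filt (λ p → picked i (proj₂ p)) (zip (upTo (length I)) I)))

data Adj (a b : Vertex) : List Vertex → Set where
  now   : ∀ {zs} → Adj a b (a ∷ b ∷ zs)
  later : ∀ {x xs} → Adj a b xs → Adj a b (x ∷ xs)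

adj⁺ : ∀ {a b xs} → Adjacent a b xs → Adj a b xs
adj⁺ ([] , zs , refl) = now
adj⁺ (y ∷ ys , zs , refl) = later (adj⁺ (ys , zs , refl))

adj⁻ : ∀ {a b xs} → Adj a b xs → Adjacent a b xs
adj⁻ (now {zs}) = [] , zs , refl
adj⁻ (later {x} h) = let ys , zs , e = adj⁻ h in x ∷ ys , zs , cong (x ∷_) e

adj-∈ : ∀ {a b xs} → Adj a b xs → a ∈ xs × b ∈ xs
adj-∈ now = here refl , there (here refl)
adj-∈ (later h) = there (proj₁ (adj-∈ h)) , there (proj₂ (adj-∈ h))

adj-++ˡ : ∀ {a b} ys {xs} → Adj a b xs → Adj a b (ys ++ xs)
adj-++ˡ [] h = h
adj-++ˡ (y ∷ ys) h = later (adj-++ˡ ys h)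

adj-++ʳ : ∀ {a b xs} ys → Adj a b xs → Adj a b (xs ++ ys)
adj-++ʳ ys now = now
adj-++ʳ ys (later h) = later (adj-++ʳ ys h)

swapV : Vertex → Vertex
swapV (src i) = snk i
swapV (snk i) = src i
swapV (mid k) = mid k

-- Edges described through the order ≺ in which a strand meets the intervals through its label:
-- reversing ≺ and exchanging sources with sinks reverses all edges.
data AEdge (_≺_ : ℕ → ℕ → Set) (In : ℤ → ℕ → Set) : Vertex → Vertex → Set where
  ss : ∀ {i} → i ≢ + 0 → (∀ {q} → ¬ In i q) → AEdge _≺_ In (src i) (snk i)
  sm : ∀ {i k} → In i k → (∀ {q} → In i q → ¬ (q ≺ k)) → AEdge _≺_ In (src i) (mid k)
  mm : ∀ {i k l} → In i k → In i l → k ≺ l → (∀ {q} → In i q → k ≺ q → ¬ (q ≺ l)) → AEdge _≺_ In (mid k) (mid l)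
  ms : ∀ {i k} → In i k → (∀ {q} → In i q → ¬ (k ≺ q)) → AEdge _≺_ In (mid k) (snk i)

aedge-flip : ∀ {In x y} → AEdge N._<_ In x y → AEdge N._>_ In (swapV y) (swapV x)
aedge-flip (ss z h) = ss z h
aedge-flip (sm i h) = ms i h
aedge-flip (mm i j l h) = mm j i l (λ q a b → h q b a)
aedge-flip (ms i h) = sm i h

module _ {i : ℤ} {In : ℤ → ℕ → Set} where

  private
    first-≤ : ∀ {k ks q} → AllPairs N._<_ (k ∷ ks) → q ∈ k ∷ ks → k N.≤ q
    first-≤ _ (here refl) = NP.≤-refl
    first-≤ (a ∷ _) (there m) = NP.<⇒≤ (All.lookup a m)

    data Inner (ks : List ℕ) : Vertex → Vertex → Set where
      mid-mid : ∀ {k l} → k ∈ ks → l ∈ ks → k N.< l → (∀ {q} → q ∈ ks → k N.< q → ¬ (q N.< l)) → Inner ks (mid k) (mid l)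
      mid-snk : ∀ {k} → k ∈ ks → (∀ {q} → q ∈ ks → ¬ (k N.< q)) → Inner ks (mid k) (snk i)

    inner : ∀ {x y} k ks → AllPairs N._<_ (k ∷ ks) → Adj x y (mid k ∷ map mid ks ++ snk i ∷ []) → Inner (k ∷ ks) x y
    inner k [] s now = mid-snk (here refl) λ { (here refl) → NP.<-irrefl refl }
    inner k [] s (later (later ()))
    inner k (l ∷ ks) s@(a ∷ s′) now = mid-mid (here refl) (there (here refl)) (All.lookup a (here refl))
      λ { (here refl) p _ → NP.<-irrefl refl p ; (there m) _ q → NP.<-irrefl refl (NP.<-≤-trans q (first-≤ s′ m)) }
    inner k (l ∷ ks) (a ∷ s′) (later h) with inner l ks s′ h
    ... | mid-mid m m′ lt nb = mid-mid (there m) (there m′) lt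
           λ { (here refl) p _ → NP.<-asym p (All.lookup a m) ; (there m″) → nb m″ }
    ... | mid-snk m la = mid-snk (there m) λ { (here refl) p → NP.<-asym p (All.lookup a m) ; (there m″) → la m″ }

  strand-adj : ∀ {x y} ks → i ≢ + 0 → AllPairs N._<_ ks → (∀ {q} → q ∈ ks → In i q) → (∀ {q} → In i q → q ∈ ks)
    → Adj x y (src i ∷ map mid ks ++ snk i ∷ []) → AEdge N._<_ In x y
  strand-adj [] z s f g now = ss z (λ q → case (g q))
    where
    case : ∀ {q} → q ∈ [] → ⊥
    case ()
  strand-adj [] z s f g (later (later ()))
  strand-adj (k ∷ ks) z s f g now = sm (f (here refl)) (λ q l → NP.<-irrefl refl (NP.<-≤-trans l (first-≤ s (g q))))
  strand-adj (k ∷ ks) z s f g (later h) with inner k ks s h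
  ... | mid-mid m m′ lt nb = mm (f m) (f m′) lt (λ q → nb (g q))
  ... | mid-snk m la = ms (f m) (λ q → la (g q))

InC : ℕ → (ℕ → ℤ) → (ℕ → ℤ) → ℤ → ℕ → Set
InC t c d i k = k N.< t × c k ≤ i × i ≤ d k × c k < d k × i ≢ + 0

-- The interior vertices of consecutive overlapping intervals p, s are joined by an edge that separates
-- Left from Right: it is the only edge from Left to Right and there is none back.

module Cut (t : ℕ) (c d : ℕ → ℤ) (_≺_ : ℕ → ℕ → Set)
  (≺-trans : ∀ {a b e} → a ≺ b → b ≺ e → a ≺ e) (≺-asym : ∀ {a b} → a ≺ b → ¬ (b ≺ a))
  (c-inj : ∀ {j k} → j N.< t → k N.< t → c j ≡ c k → j ≡ k)
  (d-mono : ∀ {j k} → j N.< t → k N.< t → c j < c k → d j < d k)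
  (zig₁ : ∀ {i a b e} → InC t c d i a → InC t c d i b → InC t c d i e → c a < c b → c b < c e → a ≺ b → b ≺ e)
  (zig₂ : ∀ {i a b e} → InC t c d i a → InC t c d i b → InC t c d i e → c a < c b → c b < c e → b ≺ e → a ≺ b)
  {p s : ℕ} (p<t : p N.< t) (s<t : s N.< t) (cp<cs : c p < c s) (cs≤dp : c s ≤ d p)
  (consec : ∀ {r} → r N.< t → c p < c r → ¬ (c r < c s)) (p≺s : p ≺ s)
  where

  private In = InC t c d

  Left Right : Vertex → Set
  Left (src i) = i ≤ d p
  Left (mid k) = c k ≤ c p
  Left (snk i) = i < c s
  Right (src i) = d p < i
  Right (mid k) = c s ≤ c k
  Right (snk i) = c s ≤ i

  d-mono≤ : ∀ {j k} → j N.< t → k N.< t → c j ≤ c k → d j ≤ d k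
  d-mono≤ {j} {k} a b l with ℤP.<-cmp (c j) (c k)
  ... | tri< x _ _ = ℤP.<⇒≤ (d-mono a b x)
  ... | tri≈ _ e _ = ℤP.≤-reflexive (cong d (c-inj a b e))
  ... | tri> _ _ x = ⊥-elim (ℤP.<-irrefl refl (ℤP.<-≤-trans x l))

  cp<dp : c p < d p
  cp<dp = ℤP.<-≤-trans cp<cs cs≤dp

  ds : d p < d s
  ds = d-mono p<t s<t cp<cs

  inP : ∀ {i} → i ≢ + 0 → c s ≤ i → i ≤ d p → In i p
  inP z a b = p<t , ℤP.≤-trans (ℤP.<⇒≤ cp<cs) a , b , cp<dp , z

  inS : ∀ {i} → i ≢ + 0 → c s ≤ i → i ≤ d p → In i s
  inS z a b = s<t , a , ℤP.≤-trans b (ℤP.<⇒≤ ds) , ℤP.≤-<-trans cs≤dp ds , z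

  nz : ∀ {i k} → In i k → i ≢ + 0
  nz (_ , _ , _ , _ , z) = z

  -- A label i in the overlap of p and s lies in k, p and s, so the zig-zag condition for these
  -- three carries the order p ≺ s over to k ≺ p. `right≽` is the same on the other side.
  left≼ : ∀ {i k} → c s ≤ i → i ≤ d p → In i k → c k ≤ c p → k ≡ p ⊎ k ≺ p
  left≼ {i} {k} a b m l with ℤP.<-cmp (c k) (c p)
  ... | tri< x _ _ = inj₂ (zig₂ m (inP (nz m) a b) (inS (nz m) a b) x cp<cs p≺s)
  ... | tri≈ _ e _ = inj₁ (c-inj (proj₁ m) p<t e)
  ... | tri> _ _ x = ⊥-elim (ℤP.<-irrefl refl (ℤP.<-≤-trans x l))

  right≽ : ∀ {i k} → c s ≤ i → i ≤ d p → In i k → c s ≤ c k → k ≡ s ⊎ s ≺ k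
  right≽ {i} {k} a b m l with ℤP.<-cmp (c s) (c k)
  ... | tri< x _ _ = inj₂ (zig₁ (inP (nz m) a b) (inS (nz m) a b) m cp<cs x p≺s)
  ... | tri≈ _ e _ = inj₁ (sym (c-inj s<t (proj₁ m) e))
  ... | tri> _ _ x = ⊥-elim (ℤP.<-irrefl refl (ℤP.<-≤-trans x l))

  ≺s : ∀ {k} → k ≡ p ⊎ k ≺ p → k ≺ s
  ≺s (inj₁ refl) = p≺s
  ≺s (inj₂ l) = ≺-trans l p≺s

  p≺ : ∀ {k} → k ≡ s ⊎ s ≺ k → p ≺ k
  p≺ (inj₁ refl) = p≺s
  p≺ (inj₂ l) = ≺-trans p≺s l

  -- For an edge between interior vertices the label of its strand lies in the overlap of p and s,
  -- where the intervals on the right come after those on the left, against the direction of the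
  -- edge. At sources and sinks the end points of the intervals already contradict each other.
  no-back : ∀ {x y} → AEdge _≺_ In x y → Right x → Left y → ⊥
  no-back (ss _ h) r l = ℤP.<-irrefl refl (ℤP.<-trans (ℤP.<-≤-trans l cs≤dp) r)
  no-back (sm (k<t , _ , i≤ , _) h) r l = ℤP.<-irrefl refl (ℤP.<-≤-trans r (ℤP.≤-trans i≤ (d-mono≤ k<t p<t l)))
  no-back (mm m@(_ , ck≤i , _) m′@(l<t , _ , i≤dl , _) k≺l h) r l =
    ≺-asym k≺l (lt (left≼ a b m′ l) (right≽ a b m r))
    where
    a = ℤP.≤-trans r ck≤i
    b = ℤP.≤-trans i≤dl (d-mono≤ l<t p<t l)
    lt : ∀ {k l} → k ≡ p ⊎ k ≺ p → l ≡ s ⊎ s ≺ l → k ≺ l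
    lt x (inj₁ refl) = ≺s x
    lt x (inj₂ y) = ≺-trans (≺s x) y
  no-back (ms (_ , ck≤i , _) h) r l = ℤP.<-irrefl refl (ℤP.<-≤-trans l (ℤP.≤-trans r ck≤i))

  -- The strand of such an edge belongs to a label in the overlap, so it passes p and s, which lie
  -- weakly between the two ends. Since an edge joins immediate successors on a strand, its ends
  -- must be p and s themselves.
  crossing : ∀ {x y} → AEdge _≺_ In x y → Left x → Right y → x ≡ mid p × y ≡ mid s
  crossing (ss z h) l r = ⊥-elim (h (inP z r l))
  crossing (sm m@(_ , ck≤i , _) h) l r = ⊥-elim (h (inP (nz m) a l) (p≺ (right≽ a l m r)))
    where a = ℤP.≤-trans r ck≤i
  crossing (mm {k = k} {l = l′} m@(k<t , _ , i≤dk , _) m′@(_ , cl≤i , _) k≺l h) l r = go (left≼ a b m l) (right≽ a b m′ r)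
    where
    a = ℤP.≤-trans r cl≤i
    b = ℤP.≤-trans i≤dk (d-mono≤ k<t p<t l)
    go : k ≡ p ⊎ k ≺ p → l′ ≡ s ⊎ s ≺ l′ → mid k ≡ mid p × mid l′ ≡ mid s
    go (inj₂ x) y = ⊥-elim (h (inP (nz m) a b) x (p≺ y))
    go x (inj₂ y) = ⊥-elim (h (inS (nz m) a b) (≺s x) y)
    go (inj₁ refl) (inj₁ refl) = refl , refl
  crossing (ms m@(k<t , _ , i≤dk , _) h) l r = ⊥-elim (h (inS (nz m) r b) (≺s (left≼ r b m l)))
    where b = ℤP.≤-trans i≤dk (d-mono≤ k<t p<t l)

  side : ∀ {x y} → AEdge _≺_ In x y → Left y ⊎ Right y
  side-k : ∀ {k} → k N.< t → c k ≤ c p ⊎ c s ≤ c k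
  side-k {k} k<t with c s ℤ.≤? c k
  ... | yes l = inj₂ l
  ... | no n = inj₁ (ℤP.≮⇒≥ (λ l → consec k<t l (ℤP.≰⇒> n)))
  side {y = src i} ()
  side {y = mid k} (sm m _) = side-k (proj₁ m)
  side {y = mid k} (mm _ m _ _) = side-k (proj₁ m)
  side {y = snk i} e with c s ℤ.≤? i
  ... | yes l = inj₂ l
  ... | no n = inj₁ (ℤP.≰⇒> n)

  side-src : ∀ {x y} → AEdge _≺_ In x y → Left x ⊎ Right x
  side-src {x = snk i} ()
  side-src {x = mid k} (ms m _) = side-k (proj₁ m)
  side-src {x = mid k} (mm m _ _ _) = side-k (proj₁ m)
  side-src {x = src i} e with i ℤ.≤? d p
  ... | yes l = inj₁ l
  ... | no n = inj₂ (ℤP.≰⇒> n)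

-- Paths, reachability and the peeling rule for networks

module Paths (n : ℕ) (I : List Interval) where

  private Pth = Path n I

  _⇝_ : Vertex → Vertex → Set
  x ⇝ y = ∃ λ l → Pth x y l

  path-++ : ∀ {x y z l} → Pth x y l → y ⇝ z → x ⇝ z
  path-++ here q = q
  path-++ (step e p) q = let l , r = path-++ p q in _ , step e r

  ⇝-trans : ∀ {x y z} → x ⇝ y → y ⇝ z → x ⇝ z
  ⇝-trans (_ , p) q = path-++ p q

  edge⇝ : ∀ {x y} → Edge n I x y → x ⇝ y
  edge⇝ e = _ , step e here

  path-∈ : ∀ {x y l v} → Pth x y l → v ∈ l → (x ⇝ v) × (v ⇝ y)
  path-∈ here (here refl) = (_ , here) , (_ , here)
  path-∈ (step e p) (here refl) = (_ , here) , (_ , step e p)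
  path-∈ (step e p) (there m) = let a , b = path-∈ p m in ⇝-trans (edge⇝ e) a , b

  path-head : ∀ {x y l} → Pth x y l → ∃ λ l′ → l ≡ x ∷ l′
  path-head here = _ , refl
  path-head (step e p) = _ , refl

  stay : (P : Vertex → Set) → (∀ {x y} → Edge n I x y → P x → P y) → ∀ {x y l} → Pth x y l → P x → P y
  stay P h here px = px
  stay P h (step e p) px = stay P h p (h e px)

  record Crosses (u v x y : Vertex) (l : List Vertex) : Set where
    field
      upto  : x ⇝ u
      over  : Edge n I u v
      after : v ⇝ y
      adj   : Adj u v l

  cross : (P : Vertex → Set) (u v : Vertex) → (∀ {x y} → Edge n I x y → P x → P y ⊎ (x ≡ u × y ≡ v))
    → ∀ {x y l} → Pth x y l → P x → ¬ P y → Crosses u v x y l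
  cross P u v h here px ny = ⊥-elim (ny px)
  cross P u v h (step e p) px ny with h e px
  ... | inj₁ py = let r = cross P u v h p py ny in record
        { upto = ⇝-trans (edge⇝ e) (Crosses.upto r) ; over = Crosses.over r ; after = Crosses.after r ; adj = later (Crosses.adj r) }
  ... | inj₂ (refl , refl) with path-head p
  ...   | l′ , refl = record { upto = _ , here ; over = e ; after = _ , p ; adj = now }

  walk : ∀ a xs b → (∀ {x y} → Adj x y (a ∷ xs ++ b ∷ []) → Edge n I x y) → a ⇝ b
  walk a [] b h = _ , step (h now) here
  walk a (x ∷ xs) b h = let l , p = walk x xs b (h ∘ later) in _ , step (h now) p

label≢0 : ∀ {n i} → Label n i → i ≢ + 0
label≢0 (() , _) refl

module Net (n : ℕ) (I : List Interval) (Z : ZigZag n I) where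
  open Paths n I public

  t : ℕ
  t = length I

  c d : ℕ → ℤ
  c k = proj₁ (nth I k)
  d k = proj₂ (nth I k)

  In : ℤ → ℕ → Set
  In = InC t c d

  In? : ∀ i k → Dec (In i k)
  In? i k = (k N.<? t) ×-dec (c k ℤ.≤? i) ×-dec (i ℤ.≤? d k) ×-dec (c k ℤ.<? d k) ×-dec ¬? (i ℤ.≟ + 0)

  interval-labels : ∀ {k} → k N.< t → Label n (c k) × Label n (d k) × c k ≤ d k
  interval-labels {k} l = subst (λ v → Label n (proj₁ v) × Label n (proj₂ v) × proj₁ v ≤ proj₂ v) (nth-lookup I k l) (proj₁ Z (fromℕ< l))

  fin≢ : ∀ {j k} (l : j N.< t) (m : k N.< t) → j ≢ k → fromℕ< l ≢ fromℕ< m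
  fin≢ l m ne e = ne (trans (sym (FP.toℕ-fromℕ< l)) (trans (cong toℕ e) (FP.toℕ-fromℕ< m)))

  non-nesting : ∀ {j k} → j N.< t → k N.< t → j ≢ k → ¬ (∀ x → x ∈I nth I j → x ∈I nth I k)
  non-nesting {j} {k} l m ne h = proj₁ (proj₂ (proj₂ Z)) (fromℕ< l) (fromℕ< m) (fin≢ l m ne)
    (subst₂ (λ u v → ∀ x → x ∈I u → x ∈I v) (sym (nth-lookup I j l)) (sym (nth-lookup I k m)) h)

  zigzag : ∀ {i j k x} → i N.< j → j N.< k → In x i → In x j → In x k → (c i < c j × c j < c k) ⊎ (c j < c i × c k < c j)
  zigzag {i} {j} {k} {x} i<j j<k (li , a , b , _ , z) (lj , a′ , b′ , _ , _) (lk , a″ , b″ , _ , _) =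
    subst₂ (λ u v → (c i < proj₁ u × proj₁ u < proj₁ v) ⊎ (proj₁ u < c i × proj₁ v < proj₁ u)) (nth-lookup I j lj) (nth-lookup I k lk)
    (subst (λ u → (proj₁ u < c′ × c′ < c″) ⊎ (c′ < proj₁ u × c″ < c′)) (nth-lookup I i li)
      (proj₂ (proj₂ (proj₂ Z)) (fromℕ< li) (fromℕ< lj) (fromℕ< lk)
        (subst₂ N._<_ (sym (FP.toℕ-fromℕ< li)) (sym (FP.toℕ-fromℕ< lj)) i<j)
        (subst₂ N._<_ (sym (FP.toℕ-fromℕ< lj)) (sym (FP.toℕ-fromℕ< lk)) j<k)
        (x , subst (x ∈I_) (sym (nth-lookup I i li)) (a , b , z) , subst (x ∈I_) (sym (nth-lookup I j lj)) (a′ , b′ , z))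
        (x , subst (x ∈I_) (sym (nth-lookup I j lj)) (a′ , b′ , z) , subst (x ∈I_) (sym (nth-lookup I k lk)) (a″ , b″ , z))))
    where
    c′ = proj₁ (lookup I (fromℕ< lj))
    c″ = proj₁ (lookup I (fromℕ< lk))

  c-inj : ∀ {j k} → j N.< t → k N.< t → c j ≡ c k → j ≡ k
  c-inj {j} {k} l m e with j N.≟ k
  ... | yes q = q
  ... | no ne with ℤP.≤-total (d j) (d k)
  ...   | inj₁ h = ⊥-elim (non-nesting l m ne (λ x (a , b , z) → ℤP.≤-trans (ℤP.≤-reflexive (sym e)) a , ℤP.≤-trans b h , z))
  ...   | inj₂ h = ⊥-elim (non-nesting m l (ne ∘ sym) (λ x (a , b , z) → ℤP.≤-trans (ℤP.≤-reflexive e) a , ℤP.≤-trans b h , z))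

  d-mono : ∀ {j k} → j N.< t → k N.< t → c j < c k → d j < d k
  d-mono {j} {k} l m lt with d j ℤ.<? d k
  ... | yes q = q
  ... | no nq = ⊥-elim (non-nesting m l (λ e → ℤP.<-irrefl (cong c (sym e)) lt)
        (λ x (a , b , z) → ℤP.≤-trans (ℤP.<⇒≤ lt) a , ℤP.≤-trans b (ℤP.≮⇒≥ nq) , z))

  -- Along a strand the left ends increase or decrease throughout. With a before b and c a < c b
  -- they increase, and every position of e other than after b would break the monotonicity.
  zig₁ : ∀ {i a b e} → In i a → In i b → In i e → c a < c b → c b < c e → a N.< b → b N.< e
  zig₁ {i} {a} {b} {e} ma mb me l m a<b with NP.<-cmp b e
  ... | tri< q _ _ = q
  ... | tri≈ _ refl _ = ⊥-elim (ℤP.<-irrefl refl m)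
  ... | tri> _ _ e<b with NP.<-cmp e a
  ...   | tri≈ _ refl _ = ⊥-elim (ℤP.<-asym l m)
  ...   | tri< e<a _ _ with zigzag e<a a<b me ma mb
  ...     | inj₁ (x , _) = ⊥-elim (ℤP.<-asym x (ℤP.<-trans l m))
  ...     | inj₂ (_ , x) = ⊥-elim (ℤP.<-asym x l)
  zig₁ ma mb me l m a<b | tri> _ _ e<b | tri> _ _ a<e with zigzag a<e e<b ma me mb
  ...     | inj₁ (_ , x) = ⊥-elim (ℤP.<-asym x m)
  ...     | inj₂ (x , _) = ⊥-elim (ℤP.<-asym x (ℤP.<-trans l m))

  zig₂ : ∀ {i a b e} → In i a → In i b → In i e → c a < c b → c b < c e → b N.< e → a N.< b
  zig₂ {i} {a} {b} {e} ma mb me l m b<e with NP.<-cmp a b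
  ... | tri< q _ _ = q
  ... | tri≈ _ refl _ = ⊥-elim (ℤP.<-irrefl refl l)
  ... | tri> _ _ b<a with NP.<-cmp a e
  ...   | tri≈ _ refl _ = ⊥-elim (ℤP.<-asym l m)
  ...   | tri< a<e _ _ with zigzag b<a a<e mb ma me
  ...     | inj₁ (x , _) = ⊥-elim (ℤP.<-asym x l)
  ...     | inj₂ (_ , x) = ⊥-elim (ℤP.<-asym x (ℤP.<-trans l m))
  zig₂ ma mb me l m b<e | tri> _ _ b<a | tri> _ _ e<a with zigzag b<e e<a mb me ma
  ...     | inj₁ (_ , x) = ⊥-elim (ℤP.<-asym x (ℤP.<-trans l m))
  ...     | inj₂ (x , _) = ⊥-elim (ℤP.<-asym x m)

  zig₁′ : ∀ {i a b e} → In i a → In i b → In i e → c a < c b → c b < c e → a N.> b → b N.> e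
  zig₁′ {b = b} {e} ma mb me l m b<a with NP.<-cmp b e
  ... | tri< q _ _ = ⊥-elim (NP.<-asym b<a (zig₂ ma mb me l m q))
  ... | tri≈ _ refl _ = ⊥-elim (ℤP.<-irrefl refl m)
  ... | tri> _ _ q = q

  zig₂′ : ∀ {i a b e} → In i a → In i b → In i e → c a < c b → c b < c e → b N.> e → a N.> b
  zig₂′ {a = a} {b} ma mb me l m e<b with NP.<-cmp a b
  ... | tri< q _ _ = ⊥-elim (NP.<-asym e<b (zig₁ ma mb me l m q))
  ... | tri≈ _ refl _ = ⊥-elim (ℤP.<-irrefl refl l)
  ... | tri> _ _ q = q

  picked⇒In : ∀ {i k} → k N.< t → T (picked i (nth I k)) → In i k
  picked⇒In {i} {k} l h =
    let a , b = ∧-T {inIᵇ i (nth I k)} h ; a₁ , a₂ = ∧-T {⌊ c k ℤ.≤? i ⌋} a ; a₃ , a₄ = ∧-T {⌊ i ℤ.≤? d k ⌋} a₂ in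
    l , toWitness a₁ , toWitness a₃ , toWitness b , λ e → not-T a₄ (fromWitness e)

  In⇒picked : ∀ {i k} → In i k → T (picked i (nth I k))
  In⇒picked {i} {k} (_ , a , b , e , z) =
    T-∧ {inIᵇ i (nth I k)} {nontrivialᵇ (nth I k)}
      (T-∧ {⌊ c k ℤ.≤? i ⌋} {⌊ i ℤ.≤? d k ⌋ ∧ not (i ==ℤ + 0)} (fromWitness a)
        (T-∧ {⌊ i ℤ.≤? d k ⌋} {not (i ==ℤ + 0)} (fromWitness b) (T-not {i ==ℤ + 0} (λ h → z (toWitness h))))) (fromWitness e)

  edge⇒aedge : ∀ {x y} → Edge n I x y → AEdge N._<_ In x y
  edge⇒aedge (i , li , h) = strand-adj (sel id I i) (label≢0 li) (sel-sorted id I i id)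
    (λ m → let k , l , e , q = sel-∈⁻ id I i m in subst (In i) (sym e) (picked⇒In l q))
    (λ m → sel-∈⁺ id I i _ (proj₁ m) (In⇒picked m))
    (adj⁺ (subst (Adjacent _ _) (strand-sel I i) h))

  strand-edge : ∀ {i x y} → Label n i → Adj x y (src i ∷ map mid (sel id I i) ++ snk i ∷ []) → Edge n I x y
  strand-edge {i} li h = i , li , subst (Adjacent _ _) (sym (strand-sel I i)) (adj⁻ h)

  A : ℤ → ℤ → Set
  A i j = src i ⇝ snk j

  E : ℤ → ℤ → Set
  E i j = ∃ λ k → In i k × In j k

  A-refl : ∀ {i} → Label n i → A i i
  A-refl {i} li = walk (src i) (map mid (sel id I i)) (snk i) (strand-edge li)

  toMid : ∀ {i k} → Label n i → In i k → src i ⇝ mid k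
  toMid {i} {k} li m with ∈-∃++ (sel-∈⁺ id I i k (proj₁ m) (In⇒picked m))
  ... | as , bs , e = walk (src i) (map mid as) (mid k) (λ h → strand-edge li (subst (λ l → Adj _ _ (src i ∷ l))
        (eq as bs e) (adj-++ʳ (map mid bs ++ snk i ∷ []) h)))
    where
    eq : ∀ as bs → sel id I i ≡ as ++ k ∷ bs → (map mid as ++ mid k ∷ []) ++ (map mid bs ++ snk i ∷ []) ≡ map mid (sel id I i) ++ snk i ∷ []
    eq as bs e rewrite e | LP.map-++ mid as (k ∷ bs) = trans (LP.++-assoc (map mid as) (mid k ∷ []) _) (sym (LP.++-assoc (map mid as) (mid k ∷ map mid bs) (snk i ∷ [])))

  fromMid : ∀ {i k} → Label n i → In i k → mid k ⇝ snk i
  fromMid {i} {k} li m with ∈-∃++ (sel-∈⁺ id I i k (proj₁ m) (In⇒picked m))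
  ... | as , bs , e = walk (mid k) (map mid bs) (snk i) (λ h → strand-edge li (later (subst (Adj _ _) (eq as bs e) (adj-++ˡ (map mid as) h))))
    where
    eq : ∀ as bs → sel id I i ≡ as ++ k ∷ bs → map mid as ++ (mid k ∷ map mid bs ++ snk i ∷ []) ≡ map mid (sel id I i) ++ snk i ∷ []
    eq as bs e rewrite e | LP.map-++ mid as (k ∷ bs) = sym (LP.++-assoc (map mid as) (mid k ∷ map mid bs) (snk i ∷ []))

  In⇒A : ∀ {i j k} → Label n i → Label n j → In i k → In j k → A i j
  In⇒A li lj m m′ = ⇝-trans (toMid li m) (fromMid lj m′)

  E⇒A : ∀ {i j} → Label n i → Label n j → E i j → A i j
  E⇒A li lj (k , m , m′) = In⇒A li lj m m′

  record Consecutive (p s : ℕ) : Set where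
    field
      p<t    : p N.< t
      s<t    : s N.< t
      cp<cs  : c p < c s
      cs≤dp  : c s ≤ d p
      consec : ∀ {r} → r N.< t → c p < c r → ¬ (c r < c s)

  module _ {p s : ℕ} (C : Consecutive p s) where
    open Consecutive C

    module LR (p<s : p N.< s) where
      open Cut t c d N._<_ NP.<-trans NP.<-asym c-inj d-mono zig₁ zig₂ p<t s<t cp<cs cs≤dp consec p<s

      stayR : ∀ {i j} → A i j → d p < i → c s ≤ j
      stayR (_ , q) h = stay Right go q h
        where
        go : ∀ {x y} → Edge n I x y → Right x → Right y
        go e r with side (edge⇒aedge e)
        ... | inj₂ r′ = r′
        ... | inj₁ l = ⊥-elim (no-back (edge⇒aedge e) r l)

      crossLR : ∀ {i j l} → Path n I (src i) (snk j) l → i ≤ d p → c s ≤ j → Crosses (mid p) (mid s) (src i) (snk j) l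
      crossLR q h g = cross Left (mid p) (mid s) go q h (λ l → ℤP.<-irrefl refl (ℤP.<-≤-trans l g))
        where
        go : ∀ {x y} → Edge n I x y → Left x → Left y ⊎ (x ≡ mid p × y ≡ mid s)
        go e l with side (edge⇒aedge e)
        ... | inj₁ l′ = inj₁ l′
        ... | inj₂ r = inj₂ (crossing (edge⇒aedge e) l r)

    -- Reversing all edges reverses the order of the factors and exchanges sources with sinks, so
    -- this is the same cut for `N._>_`, with vertices read through `swapV`.
    module RL (s<p : s N.< p) where
      open Cut t c d N._>_ (λ a b → NP.<-trans b a) NP.<-asym c-inj d-mono zig₁′ zig₂′ p<t s<t cp<cs cs≤dp consec s<p

      stayL : ∀ {i j} → A i j → i < c s → j ≤ d p
      stayL (_ , q) h = stay (Left ∘ swapV) go q h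
        where
        go : ∀ {x y} → Edge n I x y → Left (swapV x) → Left (swapV y)
        go e l with side-src (aedge-flip (edge⇒aedge e))
        ... | inj₁ l′ = l′
        ... | inj₂ r = ⊥-elim (no-back (aedge-flip (edge⇒aedge e)) r l)

      crossRL : ∀ {i j l} → Path n I (src i) (snk j) l → c s ≤ i → j ≤ d p → Crosses (mid s) (mid p) (src i) (snk j) l
      crossRL q h g = cross (Right ∘ swapV) (mid s) (mid p) go q h (λ r → ℤP.<-irrefl refl (ℤP.<-≤-trans r g))
        where
        unswap : ∀ {x k} → swapV x ≡ mid k → x ≡ mid k
        unswap {mid k} refl = refl
        go : ∀ {x y} → Edge n I x y → Right (swapV x) → Right (swapV y) ⊎ (x ≡ mid s × y ≡ mid p)
        go e r with side-src (aedge-flip (edge⇒aedge e))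
        ... | inj₂ r′ = inj₁ r′
        ... | inj₁ l = let a , b = crossing (aedge-flip (edge⇒aedge e)) l r in inj₂ (unswap b , unswap a)

  -- No interval reaches across c₀, hence no edge does: below and above c₀ the network falls into
  -- two parts without connection.
  module _ {c₀ : ℤ} (gap : ∀ {r} → r N.< t → c r < c₀ → ¬ (c₀ ≤ d r)) where
    private
      Above : Vertex → Set
      Above (src i) = c₀ ≤ i
      Above (mid k) = c₀ ≤ c k
      Above (snk i) = c₀ ≤ i

      upA : ∀ {i k} → In i k → c₀ ≤ i → c₀ ≤ c k
      upA {i} {k} (k<t , _ , i≤ , _) h with c₀ ℤ.≤? c k
      ... | yes q = q
      ... | no nq = ⊥-elim (gap k<t (ℤP.≰⇒> nq) (ℤP.≤-trans h i≤))

      downA : ∀ {i k} → In i k → c₀ ≤ c k → c₀ ≤ i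
      downA (_ , h , _) q = ℤP.≤-trans q h

      fw : ∀ {x y} → AEdge N._<_ In x y → Above x → Above y
      fw (ss _ _) h = h
      fw (sm m _) h = upA m h
      fw (mm m m′ _ _) h = upA m′ (downA m h)
      fw (ms m _) h = downA m h

      bw : ∀ {x y} → AEdge N._<_ In x y → Above y → Above x
      bw (ss _ _) h = h
      bw (sm m _) h = downA m h
      bw (mm m m′ _ _) h = upA m (downA m′ h)
      bw (ms m _) h = upA m h

      back : ∀ {x y l} → Path n I x y l → Above y → Above x
      back here h = h
      back (step e p) h = bw (edge⇒aedge e) (back p h)

    gap-above : ∀ {i j} → A i j → c₀ ≤ i → c₀ ≤ j
    gap-above (_ , q) = stay Above (fw ∘ edge⇒aedge) q

    gap-below : ∀ {i j} → A i j → c₀ ≤ j → c₀ ≤ i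
    gap-below (_ , q) = back q

  -- On the labels up to m, the row of m is supported on the block from c₀ to m, and the other rows
  -- are constant on the columns of this block. When the block is m alone, the latter says nothing
  -- about the column of m; `isol` then makes this column vanish.
  record LastRowℤ (R : ℤ → ℤ → Set) (m c₀ : ℤ) : Set where
    field
      only : ∀ {b} → Label n b → b ≤ m → R m b → c₀ ≤ b
      full : ∀ {b} → Label n b → b ≤ m → c₀ ≤ b → R m b
      unif : ∀ {a k l} → Label n a → Label n k → Label n l → a < m → c₀ ≤ k → k ≤ m → c₀ ≤ l → l ≤ m → R a k → R a l
      isol : c₀ ≡ m → ∀ {a} → Label n a → a < m → ¬ R a m

  record Peeled (m : ℤ) : Set where
    field
      c₀      : ℤ
      c₀-label : Label n c₀
      c₀≤m    : c₀ ≤ m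
      E⇒≤     : ∀ {b} → b < m → E b m → c₀ ≤ b
      ≤⇒E     : ∀ {b} → Label n b → b < m → c₀ ≤ b → E b m
      lastRow : LastRowℤ A m c₀ ⊎ LastRowℤ (λ i j → A j i) m c₀

  -- Let s be the interval through m with least left end, so that the block starts at `c s`, and p
  -- the interval reaching over `c s` from the left with greatest left end. Every path between the
  -- two sides uses the edge between p and s. If p is the earlier factor, m cannot get to the left,
  -- and a path arriving in the block has passed `mid s`, from which all of the block is reached:
  -- this is the row case. If s is earlier, all directions are reversed. Without p the network is
  -- cut at `c s`, without s at m.
  peel : ∀ {m} → Label n m → Peeled m
  peel {m} lm with argmin c (In? m) t
  ... | inj₁ none = record { c₀ = m ; c₀-label = lm ; c₀≤m = ℤP.≤-refl
        ; E⇒≤ = λ _ (k , _ , q) → ⊥-elim (none (proj₁ q) q)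
        ; ≤⇒E = λ _ l h → ⊥-elim (ℤP.<-irrefl refl (ℤP.<-≤-trans l h))
        ; lastRow = inj₁ record
          { only = λ _ _ r → gap-above gap r ℤP.≤-refl
          ; full = λ {b} lb h g → subst (A m) (ℤP.≤-antisym g h) (A-refl lm)
          ; unif = λ {a} _ _ _ _ h g h′ g′ r → subst (A a) (trans (ℤP.≤-antisym g h) (ℤP.≤-antisym h′ g′)) r
          ; isol = λ _ _ l r → ℤP.<-irrefl refl (ℤP.<-≤-trans l (gap-below gap r ℤP.≤-refl)) } }
    where
    gap : ∀ {r} → r N.< t → c r < m → ¬ (m ≤ d r)
    gap r<t a b = none r<t (r<t , ℤP.<⇒≤ a , b , ℤP.<-≤-trans a b , label≢0 lm)
  ... | inj₂ (s , s<t , m∈s@(_ , cs≤m , m≤ds , cs<ds , _) , min) =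
    record { c₀ = c s ; c₀-label = proj₁ (interval-labels s<t) ; c₀≤m = cs≤m
           ; E⇒≤ = λ { _ (k , q , q′) → ℤP.≤-trans (min (proj₁ q′) q′) (proj₁ (proj₂ q)) }
           ; ≤⇒E = λ lb l h → s , inS lb h (ℤP.<⇒≤ l) , m∈s
           ; lastRow = rows (argmax c (λ r → (c r ℤ.<? c s) ×-dec (c s ℤ.≤? d r)) t) }
    where
    inS : ∀ {b} → Label n b → c s ≤ b → b ≤ m → In b s
    inS lb h g = s<t , h , ℤP.≤-trans g m≤ds , cs<ds , label≢0 lb
    module Neighbour {p : ℕ} (p<t : p N.< t) (cp<cs : c p < c s) (cs≤dp : c s ≤ d p)
      (max : ∀ {j} → j N.< t → (c j < c s × c s ≤ d j) → c j ≤ c p) where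
      C : Consecutive p s
      C = record { p<t = p<t ; s<t = s<t ; cp<cs = cp<cs ; cs≤dp = cs≤dp
        ; consec = λ r<t a b → ℤP.<-irrefl refl (ℤP.<-≤-trans a (max r<t (b , ℤP.≤-trans cs≤dp (ℤP.<⇒≤ (d-mono p<t r<t a))))) }
      -- Since s has the least left end among the intervals through m, p misses m; so m lies
      -- strictly to the right of the cut.
      dp<m : d p < m
      dp<m with d p ℤ.<? m
      ... | yes q = q
      ... | no nq = ⊥-elim (ℤP.<-irrefl refl (ℤP.<-≤-trans cp<cs (min p<t (p<t , ℤP.≤-trans (ℤP.<⇒≤ cp<cs) cs≤m , ℤP.≮⇒≥ nq , ℤP.<-≤-trans cp<cs cs≤dp , label≢0 lm))))
    rows : (∀ {k} → k N.< t → ¬ (c k < c s × c s ≤ d k)) ⊎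
           (∃ λ k → k N.< t × (c k < c s × c s ≤ d k) × (∀ {j} → j N.< t → (c j < c s × c s ≤ d j) → c j ≤ c k))
         → LastRowℤ A m (c s) ⊎ LastRowℤ (λ i j → A j i) m (c s)
    rows (inj₁ none) = inj₁ record
      { only = λ _ _ r → gap-above gap r cs≤m
      ; full = λ lb g h → In⇒A lm lb m∈s (inS lb h g)
      ; unif = λ la lk ll l h g h′ g′ r → In⇒A la ll (inS la (gap-below gap r h) (ℤP.<⇒≤ l)) (inS ll h′ g′)
      ; isol = λ e _ l r → ℤP.<-irrefl refl (ℤP.<-≤-trans l (ℤP.≤-trans (ℤP.≤-reflexive (sym e)) (gap-below gap r cs≤m))) }
      where
      gap : ∀ {r} → r N.< t → c r < c s → ¬ (c s ≤ d r)
      gap r<t a b = none r<t (a , b)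
    rows (inj₂ (p , p<t , (cp<cs , cs≤dp) , max)) with NP.<-cmp p s
    ... | tri≈ _ refl _ = ⊥-elim (ℤP.<-irrefl refl cp<cs)
    ... | tri< p<s _ _ = inj₁ record
      { only = λ _ _ r → stayR r dp<m
      ; full = λ lb g h → In⇒A lm lb m∈s (inS lb h g)
      ; unif = λ la lk ll l h g h′ g′ r → un la ll l h h′ g′ r
      ; isol = λ e _ l r → ℤP.<-irrefl refl (ℤP.<-≤-trans dp<m (ℤP.≤-trans (ℤP.≤-reflexive (sym e)) cs≤dp)) }
      where
      open Neighbour p<t cp<cs cs≤dp max
      open LR C p<s
      un : ∀ {a k l} → Label n a → Label n l → a < m → c s ≤ k → c s ≤ l → l ≤ m → A a k → A a l
      un {a} la ll l h h′ g′ r with c s ℤ.≤? a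
      ... | yes q = In⇒A la ll (inS la q (ℤP.<⇒≤ l)) (inS ll h′ g′)
      ... | no nq = let x = crossLR (proj₂ r) (ℤP.≤-trans (ℤP.<⇒≤ (ℤP.≰⇒> nq)) cs≤dp) h in
             ⇝-trans (Crosses.upto x) (⇝-trans (edge⇝ (Crosses.over x)) (fromMid ll (inS ll h′ g′)))
    ... | tri> _ _ s<p = inj₂ record
      { only = λ lb g r → on r
      ; full = λ lb g h → In⇒A lb lm (inS lb h g) m∈s
      ; unif = λ la lk ll l h g h′ g′ r → un la ll l h h′ g′ r
      ; isol = λ e _ l r → ℤP.<-irrefl refl (ℤP.<-≤-trans dp<m (ℤP.≤-trans (ℤP.≤-reflexive (sym e)) cs≤dp)) }
      where
      open Neighbour p<t cp<cs cs≤dp max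
      open RL C s<p
      on : ∀ {b} → A b m → c s ≤ b
      on {b} r with c s ℤ.≤? b
      ... | yes q = q
      ... | no nq = ⊥-elim (ℤP.<-irrefl refl (ℤP.<-≤-trans dp<m (stayL r (ℤP.≰⇒> nq))))
      un : ∀ {a k l} → Label n a → Label n l → a < m → c s ≤ k → c s ≤ l → l ≤ m → A k a → A l a
      un {a} la ll l h h′ g′ r with c s ℤ.≤? a
      ... | yes q = In⇒A ll la (inS ll h′ g′) (inS la q (ℤP.<⇒≤ l))
      ... | no nq = let x = crossRL (proj₂ r) h (ℤP.≤-trans (ℤP.<⇒≤ (ℤP.≰⇒> nq)) cs≤dp) in
             ⇝-trans (toMid ll (inS ll h′ g′)) (⇝-trans (edge⇝ (Crosses.over x)) (Crosses.after x))

  E-sym : ∀ {i j} → E i j → E j i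
  E-sym (k , a , b) = k , b , a

  E-convex : ∀ {i j x y} → Label n x → Label n y → i ≤ x → x ≤ j → i ≤ y → y ≤ j → E i j → E x y
  E-convex lx ly a b a′ b′ (k , (k<t , p , _ , q , _) , (_ , _ , r , _)) =
    k , (k<t , ℤP.≤-trans p a , ℤP.≤-trans b r , q , label≢0 lx) , (k<t , ℤP.≤-trans p a′ , ℤP.≤-trans b′ r , q , label≢0 ly)

  -- Peel the larger label j: one of the two directions is an entry of the sparse row or column of
  -- j, whose support is the neighbourhood.
  A∧Aᵗ⇒E< : ∀ {i j} → Label n i → Label n j → i < j → A i j → A j i → E i j
  A∧Aᵗ⇒E< li lj l r s with peel lj
  ... | P with Peeled.lastRow P
  ...   | inj₁ R = Peeled.≤⇒E P li l (LastRowℤ.only R li (ℤP.<⇒≤ l) s)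
  ...   | inj₂ R = Peeled.≤⇒E P li l (LastRowℤ.only R li (ℤP.<⇒≤ l) r)

  A∧Aᵗ⇒E : ∀ {i j} → Label n i → Label n j → i ≢ j → A i j → A j i → E i j
  A∧Aᵗ⇒E {i} {j} li lj ne r s with ℤP.<-cmp i j
  ... | tri< l _ _ = A∧Aᵗ⇒E< li lj l r s
  ... | tri≈ _ e _ = ⊥-elim (ne e)
  ... | tri> _ _ l = E-sym (A∧Aᵗ⇒E< lj li l s r)

  consecutive : ∀ {i p s} → In i p → In i s → c p < c s
    → (∀ {r} → r N.< t → In i r → c p < c r → ¬ (c r < c s)) → Consecutive p s
  consecutive {i} {p} {s} (p<t , _ , i≤dp , _ , z) (s<t , cs≤i , _) cp<cs h = record
    { p<t = p<t ; s<t = s<t ; cp<cs = cp<cs ; cs≤dp = ℤP.≤-trans cs≤i i≤dp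
    ; consec = λ r<t a b → let i≤dr = ℤP.≤-trans i≤dp (ℤP.<⇒≤ (d-mono p<t r<t a)) in
        h r<t (r<t , ℤP.≤-trans (ℤP.<⇒≤ b) cs≤i , i≤dr , ℤP.<-≤-trans b (ℤP.≤-trans cs≤i i≤dr) , z) a b }

  -- Take the interval through i next to k, on the left or on the right. A path from i to i starts
  -- and ends on suitable sides of the cut between the two, so it uses the crossing edge, one end of
  -- which is `mid k`. If k is the only interval through i, the first edge already leads there.
  path-meets : ∀ {i k l} → In i k → Path n I (src i) (snk i) l → mid k ∈ l
  path-meets {i} {k} {l} m@(k<t , ck≤i , i≤dk , ck<dk , z) q
    with argmax c (λ r → (In? i r) ×-dec (c r ℤ.<? c k)) t | argmin c (λ r → (In? i r) ×-dec (c k ℤ.<? c r)) t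
  ... | inj₂ (p , p<t , (m′@(_ , _ , i≤dp , _) , cp<ck) , max) | _ with NP.<-cmp p k
  ...   | tri≈ _ refl _ = ⊥-elim (ℤP.<-irrefl refl cp<ck)
  ...   | tri< p<k _ _ = proj₂ (adj-∈ (Crosses.adj (LR.crossLR (consecutive m′ m cp<ck (λ r<t m a b → ℤP.<-irrefl refl (ℤP.<-≤-trans a (max r<t (m , b))))) p<k q i≤dp ck≤i)))
  ...   | tri> _ _ k<p = proj₁ (adj-∈ (Crosses.adj (RL.crossRL (consecutive m′ m cp<ck (λ r<t m a b → ℤP.<-irrefl refl (ℤP.<-≤-trans a (max r<t (m , b))))) k<p q ck≤i i≤dp)))
  path-meets {i} {k} {l} m@(k<t , ck≤i , i≤dk , ck<dk , z) q | inj₁ _ | inj₂ (s , s<t , (m′@(_ , cs≤i , i≤ds , _) , ck<cs) , min) with NP.<-cmp k s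
  ...   | tri≈ _ refl _ = ⊥-elim (ℤP.<-irrefl refl ck<cs)
  ...   | tri< k<s _ _ = proj₁ (adj-∈ (Crosses.adj (LR.crossLR (consecutive m m′ ck<cs (λ r<t m a b → ℤP.<-irrefl refl (ℤP.<-≤-trans b (min r<t (m , a))))) k<s q i≤dk cs≤i)))
  ...   | tri> _ _ s<k = proj₂ (adj-∈ (Crosses.adj (RL.crossRL (consecutive m m′ ck<cs (λ r<t m a b → ℤP.<-irrefl refl (ℤP.<-≤-trans b (min r<t (m , a))))) s<k q cs≤i i≤dk)))
  path-meets {i} {k} {l} m (step e q) | inj₁ noL | inj₁ noR with path-head q | edge⇒aedge e
  ... | l′ , refl | ss _ h = ⊥-elim (h m)
  ... | l′ , refl | sm {k = k′} m′ _ with ℤP.<-cmp (c k) (c k′)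
  ...   | tri< a _ _ = ⊥-elim (noR (proj₁ m′) (m′ , a))
  ...   | tri≈ _ a _ = there (here (cong mid (c-inj (proj₁ m) (proj₁ m′) a)))
  ...   | tri> _ _ a = ⊥-elim (noL (proj₁ m′) (m′ , a))

-- Peelable relations

Relℕ : Set₁
Relℕ = ℕ → ℕ → Set

_ᵗ : Relℕ → Relℕ
(R ᵗ) i j = R j i

record LastRow (R : Relℕ) (m c : ℕ) : Set where
  field
    c≤m    : c N.≤ m
    only   : ∀ {b} → b N.≤ m → R m b → c N.≤ b
    full   : ∀ {b} → b N.≤ m → c N.≤ b → R m b
    unif   : ∀ {a k l} → a N.< m → c N.≤ k → k N.≤ m → c N.≤ l → l N.≤ m → R a k → R a l
    isol   : c ≡ m → ∀ {a} → a N.< m → ¬ R a m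

record PeelableRel (n : ℕ) (R : Relℕ) : Set where
  field
    diag : ∀ {i} → i N.< n → R i i
    peel : ∀ {m} → m N.< n → ∃ λ c → LastRow R m c ⊎ LastRow (R ᵗ) m c

peelable-pred : ∀ {n R} → PeelableRel (suc n) R → PeelableRel n R
peelable-pred g = record { diag = λ l → PeelableRel.diag g (NP.m<n⇒m<1+n l) ; peel = λ l → PeelableRel.peel g (NP.m<n⇒m<1+n l) }

record PermN (n : ℕ) : Set where
  field
    f g : ℕ → ℕ
    f<  : ∀ {i} → i N.< n → f i N.< n
    g<  : ∀ {i} → i N.< n → g i N.< n
    gf  : ∀ {i} → i N.< n → g (f i) ≡ i
    fg  : ∀ {i} → i N.< n → f (g i) ≡ i

invN : ∀ {n} → PermN n → PermN n
invN p = record { f = g ; g = f ; f< = g< ; g< = f< ; gf = fg ; fg = gf }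
  where open PermN p

record LocMax (R : Relℕ) {n : ℕ} (p : PermN n) : Set where
  open PermN p
  field
    within : ∀ {i} → i N.< n → R i (f i)
    noUp   : ∀ {i j} → i N.< j → j N.< n → f i N.< f j → R i (f j) → R j (f i) → ⊥

-- Exchanging two values of p is exchanging two positions of its inverse, and inversions correspond.
-- This reduces the column case of peeling to the row case.
locMax-inv : ∀ {R n} (p : PermN n) → LocMax R p → LocMax (R ᵗ) (invN p)
locMax-inv {R} p l = record
  { within = λ {i} h → subst (R (g i)) (fg h) (within (g< h))
  ; noUp = λ {i} {j} h k e r s → noUp {g i} {g j} e (g< k)
      (subst₂ N._<_ (sym (fg (NP.<-trans h k))) (sym (fg k)) h)
      (subst (R (g i)) (sym (fg k)) s)
      (subst (R (g j)) (sym (fg (NP.<-trans h k))) r) }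
  where open PermN p ; open LocMax l

-- `dn c` closes the gap left by a deleted value c and `up c` reopens it.
dn up : ℕ → ℕ → ℕ
dn c x with x N.<? c
... | yes _ = x
... | no _ = pred x
up c y with y N.<? c
... | yes _ = y
... | no _ = suc y

dn-lt : ∀ {c x} → x N.< c → dn c x ≡ x
dn-lt {c} {x} h with x N.<? c
... | yes _ = refl
... | no n = ⊥-elim (n h)

dn-gt : ∀ {c x} → c N.< x → suc (dn c x) ≡ x
dn-gt {c} {x} h with x N.<? c
... | yes k = ⊥-elim (NP.<-asym h k)
dn-gt {c} {suc x} h | no _ = refl

dn-≤ : ∀ c x → dn c x N.≤ x
dn-≤ c x with x N.<? c
... | yes _ = NP.≤-refl
... | no _ = NP.pred[n]≤n

cmp : ∀ {x c} → x ≢ c → x N.< c ⊎ c N.< x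
cmp {x} {c} n with NP.<-cmp x c
... | tri< a _ _ = inj₁ a

... | tri≈ _ e _ = ⊥-elim (n e)
... | tri> _ _ b = inj₂ b

up-dn : ∀ {c x} → x ≢ c → up c (dn c x) ≡ x
up-dn {c} {x} n with cmp n
... | inj₁ l rewrite dn-lt l with x N.<? c
...   | yes _ = refl
...   | no k = ⊥-elim (k l)
up-dn {c} {x} n | inj₂ l with dn c x N.<? c
...   | yes k = ⊥-elim (NP.<-irrefl refl (NP.<-≤-trans l (subst (N._≤ c) (dn-gt l) k)))
...   | no _ = dn-gt l

up-≢ : ∀ c y → up c y ≢ c
up-≢ c y e with y N.<? c
... | yes l = NP.<-irrefl e l
... | no n = n (NP.≤-reflexive e)

dn-up : ∀ c y → dn c (up c y) ≡ y
dn-up c y with y N.<? c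
... | yes l = dn-lt l
... | no n = NP.suc-injective (dn-gt (s≤s (NP.≮⇒≥ n)))

up-< : ∀ {c m y} → y N.< m → up c y N.< suc m
up-< {c} {m} {y} l with y N.<? c
... | yes _ = NP.m<n⇒m<1+n l
... | no _ = s≤s l

dn-< : ∀ {c m x} → c N.≤ m → x N.< suc m → x ≢ c → dn c x N.< m
dn-< {c} {m} {x} h l n with cmp n
... | inj₁ k = NP.≤-<-trans (dn-≤ c x) (NP.<-≤-trans k h)
... | inj₂ k = N.s≤s⁻¹ (subst (N._< suc m) (sym (dn-gt k)) l)

dn-mono⁻ : ∀ {c x y} → x ≢ c → y ≢ c → dn c x N.< dn c y → x N.< y
dn-mono⁻ {c} {x} {y} n k l with cmp n | cmp k
... | inj₁ a | inj₁ b = subst₂ N._<_ (dn-lt a) (dn-lt b) l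
... | inj₁ a | inj₂ b = NP.<-trans a b
... | inj₂ a | inj₁ b = ⊥-elim (NP.<-asym (NP.≤-<-trans (N.s≤s⁻¹ (subst (c N.<_) (sym (dn-gt a)) a)) (subst (dn c x N.<_) (dn-lt b) l)) b)
... | inj₂ a | inj₂ b = subst₂ N._<_ (dn-gt a) (dn-gt b) (s≤s l)

module Strip {R : Relℕ} {m c : ℕ} (row : LastRow R m c) (p : PermN (suc m)) (lm : LocMax R p) where
  open LastRow row
  open PermN p
  open LocMax lm

  -- Otherwise exchanging the images of m and of the preimage of c would go up.
  last-value : f m ≡ c
  last-value with NP.<-cmp c (f m)

  ... | tri≈ _ e _ = sym e
  ... | tri> _ _ l = ⊥-elim (NP.<-irrefl refl (NP.<-≤-trans l (only (N.s≤s⁻¹ (f< NP.≤-refl)) (within NP.≤-refl))))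
  ... | tri< l _ _ = ⊥-elim (noUp {g c} {m} gc<m NP.≤-refl (subst (N._< f m) (sym fgc) l)
          (unif gc<m NP.≤-refl c≤m (NP.<⇒≤ l) fm≤m (subst (R (g c)) fgc (within (g< (s≤s c≤m)))))
          (subst (R m) (sym fgc) (full c≤m NP.≤-refl)))
    where
    fm≤m : f m N.≤ m
    fm≤m = N.s≤s⁻¹ (f< NP.≤-refl)
    fgc : f (g c) ≡ c
    fgc = fg (s≤s c≤m)
    gc<m : g c N.< m
    gc<m = NP.≤∧≢⇒< (N.s≤s⁻¹ (g< (s≤s c≤m))) (λ e → NP.<-irrefl (trans (sym fgc) (cong f e)) l)

  f≢c : ∀ {i} → i N.< m → f i ≢ c
  f≢c {i} l e = NP.<-irrefl (trans (sym (gf (NP.m<n⇒m<1+n l))) (trans (cong g (trans e (sym last-value))) (gf NP.≤-refl))) l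

  strip : PermN m
  strip = record
    { f = λ i → dn c (f i) ; g = λ y → g (up c y)
    ; f< = λ l → dn-< c≤m (f< (NP.m<n⇒m<1+n l)) (f≢c l)
    ; g< = λ {y} l → NP.≤∧≢⇒< (N.s≤s⁻¹ (g< (up-< l))) (λ e → up-≢ c y (trans (sym (fg (up-< l))) (trans (cong f e) last-value)))
    ; gf = λ l → trans (cong g (up-dn (f≢c l))) (gf (NP.m<n⇒m<1+n l))
    ; fg = λ {y} l → trans (cong (dn c) (fg (up-< l))) (dn-up c y) }

  -- Only values above c are shifted, and they stay in the block from c to m, on which the rows
  -- before m are constant.
  dn-R : ∀ {a i} → a N.< m → i N.< m → R a (f i) → R a (dn c (f i))
  dn-R {a} {i} l k r with cmp (f≢c k)
  ... | inj₁ h = subst (R a) (sym (dn-lt h)) r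
  ... | inj₂ h = unif l (NP.<⇒≤ h) (N.s≤s⁻¹ (f< (NP.m<n⇒m<1+n k))) (N.s≤s⁻¹ (subst (c N.<_) (sym (dn-gt h)) h))
        (NP.≤-trans (dn-≤ c (f i)) (N.s≤s⁻¹ (f< (NP.m<n⇒m<1+n k)))) r

  R-dn : ∀ {a i} → a N.< m → i N.< m → R a (dn c (f i)) → R a (f i)
  R-dn {a} {i} l k r with cmp (f≢c k)
  ... | inj₁ h = subst (R a) (dn-lt h) r
  ... | inj₂ h = unif l (N.s≤s⁻¹ (subst (c N.<_) (sym (dn-gt h)) h))
        (NP.≤-trans (dn-≤ c (f i)) (N.s≤s⁻¹ (f< (NP.m<n⇒m<1+n k)))) (NP.<⇒≤ h) (N.s≤s⁻¹ (f< (NP.m<n⇒m<1+n k))) r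

  strip-max : LocMax R strip
  strip-max = record
    { within = λ l → dn-R l l (within (NP.m<n⇒m<1+n l))
    ; noUp = λ {i} {j} l k e r s → let i<m = NP.<-trans l k in
        noUp l (NP.m<n⇒m<1+n k) (dn-mono⁻ (f≢c i<m) (f≢c k) e) (R-dn i<m k r) (R-dn k i<m s) }

SameMax : Relℕ → ℕ → Set
SameMax R n = (p q : PermN n) → LocMax R p → LocMax R q → ∀ {i} → i N.< n → PermN.f p i ≡ PermN.f q i

sameMax-ᵗ : ∀ {R n} → SameMax R n → SameMax (R ᵗ) n
sameMax-ᵗ {R} h p q lp lq {i} l =
  trans (sym (PermN.fg q (PermN.f< p l))) (cong (PermN.f q) (trans
    (sym (h (invN p) (invN q) (locMax-inv p lp) (locMax-inv q lq) (PermN.f< p l))) (PermN.gf p l)))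

sameMax-step : ∀ {R m c} → LastRow R m c → SameMax R m → SameMax R (suc m)
sameMax-step {c = c} row h p q lp lq {i} l with NP.m<1+n⇒m<n∨m≡n l
... | inj₂ refl = trans (Strip.last-value row p lp) (sym (Strip.last-value row q lq))
... | inj₁ k = trans (sym (up-dn (Strip.f≢c row p lp k))) (trans
    (cong (up c) (h (Strip.strip row p lp) (Strip.strip row q lq) (Strip.strip-max row p lp) (Strip.strip-max row q lq) k))
    (up-dn (Strip.f≢c row q lq k)))

-- The last value of a local maximum is forced to be the left end of its block, and deleting it
-- leaves a local maximum on one label fewer. If the column is the sparse one, this is applied to
-- the inverse and to the transposed relation.
locMax-unique : ∀ n {R} → PeelableRel n R → SameMax R n
locMax-unique zero G p q lp lq ()
locMax-unique (suc n) G with PeelableRel.peel G NP.≤-refl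
... | c , inj₁ row = sameMax-step row (locMax-unique n (peelable-pred G))
... | c , inj₂ col = sameMax-ᵗ (sameMax-step col (sameMax-ᵗ (locMax-unique n (peelable-pred G))))

-- With rows numbered downwards, the support contains the rectangle spanned by any of its points and
-- another one to the lower left. So undoing an inversion of a permutation inside R does not leave
-- R.
Closed : Relℕ → ℕ → Set
Closed R n = ∀ {a i b x j y} → a N.≤ i → i N.≤ b → b N.< n → y N.≤ j → j N.≤ x → x N.< n → R a x → R b y → R i j

closed-ᵗ : ∀ {R n} → Closed R n → Closed (R ᵗ) n
closed-ᵗ h a i b y j x r s = h y j x a i b s r

-- A column of the block may be traded for column c, which belongs to the smaller square unless c is
-- m; in that case `isol` leaves no entry above the last row. If row m serves as the lower left
-- corner, `only` puts its column into the block.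
closed-step : ∀ {R m c} → LastRow R m c → (∀ {i} → i N.< suc m → R i i) → Closed R m → Closed R (suc m)
closed-step {R} {m} {c} row rf h {a} {i} {b} {x} {j} {y} a≤i i≤b b<n y≤j j≤x x<n r s
  with NP.m<1+n⇒m<n∨m≡n (NP.≤-<-trans i≤b b<n)
... | inj₂ refl = full (NP.≤-trans j≤x (N.s≤s⁻¹ x<n)) (NP.≤-trans (only (NP.≤-trans y≤j (NP.≤-trans j≤x (N.s≤s⁻¹ x<n)))
        (subst (λ z → R z y) (NP.≤-antisym (N.s≤s⁻¹ b<n) i≤b) s)) y≤j)
  where open LastRow row
... | inj₁ i<m = main (NP.≤-<-connex c j)
  where
  open LastRow row
  a<m = NP.≤-<-trans a≤i i<m
  x≤m = N.s≤s⁻¹ x<n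
  c<m⊎ : c N.≤ x → c N.< m
  c<m⊎ c≤x with NP.m≤n⇒m<n∨m≡n c≤m
  ... | inj₁ l = l
  ... | inj₂ e = ⊥-elim (isol e a<m (unif a<m c≤x x≤m c≤m NP.≤-refl r))
  main : c N.≤ j ⊎ j N.< c → R i j
  main (inj₁ c≤j) = unif i<m NP.≤-refl c≤m c≤j (NP.≤-trans j≤x x≤m) (Ric (NP.m<1+n⇒m<n∨m≡n b<n))
    where
    c≤x = NP.≤-trans c≤j j≤x
    c<m = c<m⊎ c≤x
    Rac : R a c
    Rac = unif a<m c≤x x≤m NP.≤-refl c≤m r
    Ric : b N.< m ⊎ b ≡ m → R i c
    Ric (inj₁ b<m) with NP.≤-<-connex c y
    ... | inj₁ c≤y = h a≤i i≤b b<m NP.≤-refl NP.≤-refl c<m Rac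
           (unif b<m c≤y (NP.≤-trans y≤j (NP.≤-trans j≤x x≤m)) NP.≤-refl c≤m s)
    ... | inj₂ y<c = h a≤i i≤b b<m (NP.<⇒≤ y<c) NP.≤-refl c<m Rac s
    Ric (inj₂ refl) with NP.≤-<-connex c i
    ... | inj₁ c≤i = unif i<m c≤i (NP.<⇒≤ i<m) NP.≤-refl c≤m (rf (NP.m<n⇒m<1+n i<m))
    ... | inj₂ i<c = h a≤i NP.≤-refl i<m (NP.<⇒≤ i<c) NP.≤-refl c<m Rac (rf (NP.m<n⇒m<1+n i<m))
  main (inj₂ j<c) with NP.m<1+n⇒m<n∨m≡n b<n
  ... | inj₂ refl = ⊥-elim (NP.<-irrefl refl (NP.<-≤-trans (NP.≤-<-trans y≤j j<c) (only (NP.≤-trans y≤j (NP.≤-trans j≤x x≤m)) s)))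
  ... | inj₁ b<m with NP.≤-<-connex c x
  ...   | inj₂ x<c = h a≤i i≤b b<m y≤j j≤x (NP.<-≤-trans x<c c≤m) r s
  ...   | inj₁ c≤x = h a≤i i≤b b<m y≤j (NP.<⇒≤ j<c) (c<m⊎ c≤x) (unif a<m c≤x x≤m NP.≤-refl c≤m r) s

peelable-closed : ∀ n {R} → PeelableRel n R → Closed R n
peelable-closed zero G _ _ ()
peelable-closed (suc n) G with PeelableRel.peel G NP.≤-refl
... | c , inj₁ row = closed-step row (PeelableRel.diag G) (peelable-closed n (peelable-pred G))
... | c , inj₂ col = closed-ᵗ (closed-step col (PeelableRel.diag G) (closed-ᵗ (peelable-closed n (peelable-pred G))))

-- The region spanned by the graph of p: one point of the graph lies weakly to the upper right of (i
-- , j), another one weakly to the lower left. For a local maximum p of R this region is R, which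
-- makes R decidable and lets it inherit symmetries of p.
Hull : ∀ {n} → PermN n → ℕ → ℕ → Set
Hull {n} p i j = (∃ λ a → a N.≤ i × j N.≤ PermN.f p a) × (∃ λ b → i N.≤ b × b N.< n × PermN.f p b N.≤ j)

hull-inv : ∀ {n} (p : PermN n) {i j} → j N.< n → Hull (invN p) j i → Hull p i j
hull-inv p j<n ((y , y≤j , i≤gy) , (x , j≤x , x<n , gx≤i)) =
  (PermN.g p x , gx≤i , subst (_ N.≤_) (sym (PermN.fg p x<n)) j≤x) ,
  (PermN.g p y , i≤gy , PermN.g< p y<n , subst (N._≤ _) (sym (PermN.fg p y<n)) y≤j)
  where y<n = NP.≤-<-trans y≤j j<n

InHull : Relℕ → ℕ → Set
InHull R n = (p : PermN n) → LocMax R p → ∀ {i j} → i N.< n → j N.< n → R i j → Hull p i j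

inHull-ᵗ : ∀ {R n} → InHull R n → InHull (R ᵗ) n
inHull-ᵗ h p lp i<n j<n r = hull-inv p j<n (h (invN p) (locMax-inv p lp) j<n i<n r)

inHull-step : ∀ {R m c} → LastRow R m c → InHull R m → InHull R (suc m)
inHull-step {R} {m} {c} row h p lp {i} {j} i<n j<n r with NP.m<1+n⇒m<n∨m≡n i<n
... | inj₂ refl = (g j , N.s≤s⁻¹ (g< j<n) , NP.≤-reflexive (sym (fg j<n))) ,
                  (m , NP.≤-refl , NP.≤-refl , subst (N._≤ j) (sym last-value) (only (N.s≤s⁻¹ j<n) r))
  where open LastRow row ; open PermN p ; open Strip row p lp
... | inj₁ i<m with NP.m<1+n⇒m<n∨m≡n j<n
...   | inj₁ j<m = (a , a≤i , NP.≤-trans j≤ (dn-≤ c (f a))) , low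
  where
  open LastRow row ; open PermN p ; open Strip row p lp
  H = h strip strip-max i<m j<m r
  a = proj₁ (proj₁ H)
  a≤i = proj₁ (proj₂ (proj₁ H))
  j≤ = proj₂ (proj₂ (proj₁ H))
  low : ∃ λ b → i N.≤ b × b N.< suc m × f b N.≤ j
  low with proj₂ H
  ... | b , i≤b , b<m , q with cmp (f≢c b<m)
  ...   | inj₁ l = b , i≤b , NP.m<n⇒m<1+n b<m , subst (N._≤ j) (dn-lt l) q
  -- Here `dn` lowered the value of b, so it exceeds c; the last row, whose value is c, serves as
  -- the lower left point instead.
  ...   | inj₂ l = m , NP.<⇒≤ i<m , NP.≤-refl , subst (N._≤ j) (sym last-value) (NP.≤-trans (N.s≤s⁻¹ (subst (c N.<_) (sym (dn-gt l)) l)) q)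
...   | inj₂ refl with NP.m≤n⇒m<n∨m≡n (LastRow.c≤m row)
...     | inj₂ e = ⊥-elim (LastRow.isol row e i<m r)
-- The last column lies in the block, so it may be traded for the one before it, inside the smaller
-- square. The point found there has a value above c before stripping, one more than after it, and
-- so it reaches the last column.
inHull-step {R} {suc m} {c} row h p lp {i} i<n j<n r | inj₁ i<m | inj₂ refl | inj₁ c<m =
  (a , a≤i , subst (suc m N.≤_) (dn-gt (c<fa (cmp (f≢c a<m)))) (s≤s j≤)) ,
  (suc m , NP.<⇒≤ i<m , NP.≤-refl , subst (N._≤ suc m) (sym last-value) c≤m)
  where
  open LastRow row ; open PermN p ; open Strip row p lp
  H = h strip strip-max i<m NP.≤-refl (unif i<m c≤m NP.≤-refl (N.s≤s⁻¹ c<m) (NP.n≤1+n m) r)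
  a = proj₁ (proj₁ H)
  a≤i = proj₁ (proj₂ (proj₁ H))
  j≤ = proj₂ (proj₂ (proj₁ H))
  a<m = NP.≤-<-trans a≤i i<m
  c<fa : f a N.< c ⊎ c N.< f a → c N.< f a
  c<fa (inj₂ l) = l
  c<fa (inj₁ l) = ⊥-elim (NP.<-irrefl refl (NP.<-≤-trans (NP.<-≤-trans l (N.s≤s⁻¹ c<m)) (subst (m N.≤_) (dn-lt l) j≤)))

peelable-inHull : ∀ n {R} → PeelableRel n R → InHull R n
peelable-inHull zero G p lp ()
peelable-inHull (suc n) G with PeelableRel.peel G NP.≤-refl
... | c , inj₁ row = inHull-step row (peelable-inHull n (peelable-pred G))
... | c , inj₂ col = inHull-ᵗ (inHull-step col (inHull-ᵗ (peelable-inHull n (peelable-pred G))))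

hull-inR : ∀ n {R} → PeelableRel n R → (p : PermN n) → (∀ {i} → i N.< n → R i (PermN.f p i))
  → ∀ {i j} → i N.< n → j N.< n → Hull p i j → R i j
hull-inR n G p w i<n j<n ((a , a≤i , q) , (b , i≤b , b<n , s)) =
  peelable-closed n G a≤i i≤b b<n s q (PermN.f< p (NP.≤-<-trans a≤i i<n)) (w (NP.≤-<-trans a≤i i<n)) (w b<n)

-- lab and idx identify {0,…,2n-1} with the labels -n,…,-1,1,…,n; idx n (+ 0) is a junk value.

label? : ∀ n i → Dec (Label n i)
label? n i = (1 N.≤? ∣ i ∣) ×-dec (∣ i ∣ N.≤? n)

lab : ℕ → ℕ → ℤ
lab n p with p N.<? n
... | yes _ = -[1+ n ∸ suc p ]
... | no _ = + suc (p ∸ n)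

idx : ℕ → ℤ → ℕ
idx n (+ zero) = n
idx n (+ suc k) = n N.+ k
idx n -[1+ k ] = n ∸ suc k

private
  ∸-suc-suc : ∀ {n k} → k N.< n → n ∸ suc (n ∸ suc k) ≡ k
  ∸-suc-suc {n} {k} h = trans (cong (n ∸_) (sym (NP.+-∸-assoc 1 h))) (NP.m∸[m∸n]≡n (NP.<⇒≤ h))

lab-idx : ∀ {n x} → Label n x → lab n (idx n x) ≡ x
lab-idx {n} {+ suc k} l with n N.+ k N.<? n
... | yes h = ⊥-elim (NP.<-irrefl refl (NP.≤-<-trans (NP.m≤m+n n k) h))
... | no _ = cong (λ z → + suc z) (NP.m+n∸m≡n n k)
lab-idx {n} { -[1+ k ] } (_ , l) with n ∸ suc k N.<? n
... | yes _ = cong -[1+_] (∸-suc-suc l)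
... | no h = ⊥-elim (h (NP.∸-monoʳ-< {n} (s≤s z≤n) l))

idx-lab : ∀ {n} p → idx n (lab n p) ≡ p
idx-lab {n} p with p N.<? n
... | yes h = ∸-suc-suc h
... | no h = NP.m+[n∸m]≡n (NP.≮⇒≥ h)

lab-label : ∀ {n p} → p N.< n N.+ n → Label n (lab n p)
lab-label {n} {p} l with p N.<? n
... | yes h = s≤s z≤n , NP.∸-monoʳ-< {n} (s≤s z≤n) h
... | no h = s≤s z≤n , NP.+-cancelˡ-< n (p ∸ n) n (subst (N._< n N.+ n) (sym (NP.m+[n∸m]≡n (NP.≮⇒≥ h))) l)

idx-< : ∀ {n x} → Label n x → idx n x N.< n N.+ n
idx-< {n} {+ suc k} (_ , l) = NP.+-monoʳ-< n l
idx-< {n} { -[1+ k ] } (_ , l) = NP.<-≤-trans (NP.∸-monoʳ-< {n} (s≤s z≤n) l) (NP.m≤m+n n n)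

idx-mono : ∀ {n x y} → Label n x → Label n y → x < y → idx n x N.< idx n y
idx-mono {n} lx (_ , ly) (ℤ.-<- h) = NP.∸-monoʳ-< {n} (s≤s h) (proj₂ lx)
idx-mono {n} {y = + suc k} (_ , lx) ly ℤ.-<+ = NP.<-≤-trans (NP.∸-monoʳ-< {n} (s≤s z≤n) lx) (NP.m≤m+n n k)
idx-mono {n} {+ suc j} {+ suc k} lx ly (ℤ.+<+ h) = NP.+-monoʳ-< n (N.s<s⁻¹ h)

idx-cancel : ∀ {n x y} → Label n x → Label n y → idx n x N.< idx n y → x < y
idx-cancel {n} {x} {y} lx ly h with ℤP.<-cmp x y
... | tri< l _ _ = l
... | tri≈ _ refl _ = ⊥-elim (NP.<-irrefl refl h)
... | tri> _ _ l = ⊥-elim (NP.<-asym h (idx-mono ly lx l))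

idx-mono≤ : ∀ {n x y} → Label n x → Label n y → x ≤ y → idx n x N.≤ idx n y
idx-mono≤ {n} {x} {y} lx ly h with idx n x N.≤? idx n y
... | yes q = q
... | no q = ⊥-elim (ℤP.<-irrefl refl (ℤP.<-≤-trans (idx-cancel ly lx (NP.≰⇒> q)) h))

idx-cancel≤ : ∀ {n x y} → Label n x → Label n y → idx n x N.≤ idx n y → x ≤ y
idx-cancel≤ {n} {x} {y} lx ly h with x ℤ.≤? y
... | yes q = q
... | no q = ⊥-elim (NP.<-irrefl refl (NP.<-≤-trans (idx-mono ly lx (ℤP.≰⇒> q)) h))

lab-mono : ∀ {n p q} → p N.< n N.+ n → q N.< n N.+ n → p N.< q → lab n p < lab n q
lab-mono {n} {p} {q} a b h = idx-cancel {n} {lab n p} {lab n q} (lab-label a) (lab-label b) (subst₂ N._<_ (sym (idx-lab {n} p)) (sym (idx-lab {n} q)) h)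

lab-mono≤ : ∀ {n p q} → p N.< n N.+ n → q N.< n N.+ n → p N.≤ q → lab n p ≤ lab n q
lab-mono≤ {n} {p} {q} a b h = idx-cancel≤ {n} {lab n p} {lab n q} (lab-label a) (lab-label b) (subst₂ N._≤_ (sym (idx-lab {n} p)) (sym (idx-lab {n} q)) h)

-- Permutations of the labels

record LabelPerm (n : ℕ) : Set where
  field
    u u⁻¹ : ℤ → ℤ
    u-lab   : ∀ {i} → Label n i → Label n (u i)
    u⁻¹-lab : ∀ {i} → Label n i → Label n (u⁻¹ i)
    u⁻¹u    : ∀ {i} → Label n i → u⁻¹ (u i) ≡ i
    uu⁻¹    : ∀ {i} → Label n i → u (u⁻¹ i) ≡ i

toPermN : ∀ {n} → LabelPerm n → PermN (n N.+ n)
toPermN {n} P = record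
  { f = λ p → idx n (u (lab n p)) ; g = λ p → idx n (u⁻¹ (lab n p))
  ; f< = λ {p} l → idx-< {n} {u (lab n p)} (u-lab {lab n p} (lab-label l)) ; g< = λ {p} l → idx-< {n} {u⁻¹ (lab n p)} (u⁻¹-lab {lab n p} (lab-label l))
  ; gf = λ {p} l → trans (cong (idx n ∘ u⁻¹) (lab-idx {n} {u (lab n p)} (u-lab {lab n p} (lab-label l)))) (trans (cong (idx n) (u⁻¹u {lab n p} (lab-label l))) (idx-lab {n} p))
  ; fg = λ {p} l → trans (cong (idx n ∘ u) (lab-idx {n} {u⁻¹ (lab n p)} (u⁻¹-lab {lab n p} (lab-label l)))) (trans (cong (idx n) (uu⁻¹ {lab n p} (lab-label l))) (idx-lab {n} p)) }
  where open LabelPerm P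

inverseLP : ∀ {n} → LabelPerm n → LabelPerm n
inverseLP P = record { u = u⁻¹ ; u⁻¹ = u ; u-lab = u⁻¹-lab ; u⁻¹-lab = u-lab ; u⁻¹u = uu⁻¹ ; uu⁻¹ = u⁻¹u }
  where open LabelPerm P

labelPerm-inj : ∀ {n} (P : LabelPerm n) {i j} → Label n i → Label n j → LabelPerm.u P i ≡ LabelPerm.u P j → i ≡ j
labelPerm-inj P li lj e = trans (sym (LabelPerm.u⁻¹u P li)) (trans (cong (LabelPerm.u⁻¹ P) e) (LabelPerm.u⁻¹u P lj))

swapL : ℤ → ℤ → ℤ → ℤ
swapL i j x with x ℤ.≟ i | x ℤ.≟ j
... | yes _ | _ = j
... | no _ | yes _ = i
... | no _ | no _ = x

swapL-left : ∀ i j → swapL i j i ≡ j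
swapL-left i j with i ℤ.≟ i
... | yes _ = refl
... | no h = ⊥-elim (h refl)

swapL-right : ∀ i j → swapL i j j ≡ i
swapL-right i j with j ℤ.≟ i | j ℤ.≟ j
... | yes e | _ = e
... | no _ | yes _ = refl
... | no _ | no h = ⊥-elim (h refl)

swapL-other : ∀ i j {x} → x ≢ i → x ≢ j → swapL i j x ≡ x
swapL-other i j {x} a b with x ℤ.≟ i | x ℤ.≟ j
... | yes e | _ = ⊥-elim (a e)
... | no _ | yes e = ⊥-elim (b e)
... | no _ | no _ = refl

swapL-elim : ∀ i j (P : ℤ → ℤ → Set) → P i j → P j i → (∀ {x} → x ≢ i → x ≢ j → P x x) → ∀ x → P x (swapL i j x)
swapL-elim i j P a b h x with x ℤ.≟ i | x ℤ.≟ j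
... | yes refl | _ = a
... | no _ | yes refl = b
... | no p | no q = h p q

swapL-invol : ∀ i j x → swapL i j (swapL i j x) ≡ x
swapL-invol i j = swapL-elim i j (λ x y → swapL i j y ≡ x) (swapL-right i j) (swapL-left i j) (swapL-other i j)

swapL-label : ∀ {n i j} → Label n i → Label n j → ∀ {x} → Label n x → Label n (swapL i j x)
swapL-label {n} {i} {j} li lj {x} = swapL-elim i j (λ x y → Label n x → Label n y) (λ _ → lj) (λ _ → li) (λ _ _ → id) x

swapLP : ∀ {n} → LabelPerm n → ∀ {i j} → Label n i → Label n j → LabelPerm n
swapLP P {i} {j} li lj = record
  { u = u ∘ swapL i j ; u⁻¹ = swapL i j ∘ u⁻¹ ; u-lab = λ {x} l → u-lab {swapL i j x} (swapL-label {_} {i} {j} li lj {x} l) ; u⁻¹-lab = λ {x} l → swapL-label {_} {i} {j} li lj {u⁻¹ x} (u⁻¹-lab {x} l)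
  ; u⁻¹u = λ {x} l → trans (cong (swapL i j) (u⁻¹u {swapL i j x} (swapL-label {_} {i} {j} li lj {x} l))) (swapL-invol i j x)
  ; uu⁻¹ = λ {x} l → trans (cong u (swapL-invol i j (u⁻¹ x))) (uu⁻¹ {x} l) }
  where open LabelPerm P

-- By the pigeonhole principle: the D + 1 positions up to D cannot all have values below C when C ≤
-- D.
permN-reaches : ∀ {m} (p : PermN m) {C D} → C N.≤ D → D N.< m → ∃ λ j → j N.≤ D × C N.≤ PermN.f p j
permN-reaches {m} p {C} {D} C≤D D<m with NP.anyUpTo? (λ j → C N.≤? PermN.f p j) (suc D)
... | yes (j , l , h) = j , N.s≤s⁻¹ l , h
... | no none = ⊥-elim (clash (FP.pigeonhole (s≤s C≤D) h))
  where
  open PermN p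
  small : ∀ (j : Fin (suc D)) → f (toℕ j) N.< C
  small j = NP.≰⇒> (λ q → none (toℕ j , FP.toℕ<n j , q))
  h : Fin (suc D) → Fin C
  h j = fromℕ< (small j)
  lt : ∀ (j : Fin (suc D)) → toℕ j N.< m
  lt j = NP.≤-<-trans (N.s≤s⁻¹ (FP.toℕ<n j)) D<m
  clash : (∃₂ λ i j → i Fin.< j × h i ≡ h j) → ⊥
  clash (i , j , i<j , e) = NP.<-irrefl (trans (sym (gf (lt i))) (trans (cong g eq) (gf (lt j)))) i<j
    where
    eq : f (toℕ i) ≡ f (toℕ j)
    eq = trans (sym (FP.toℕ-fromℕ< (small i))) (trans (cong toℕ e) (FP.toℕ-fromℕ< (small j)))

labelPerm-reaches : ∀ {n} (P : LabelPerm n) {C D} → Label n C → Label n D → C ≤ D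
  → ∃ λ j → Label n j × j ≤ D × C ≤ LabelPerm.u P j
labelPerm-reaches {n} P {C} {D} lC lD h with permN-reaches (toPermN P) (idx-mono≤ {n} {C} {D} lC lD h) (idx-< {n} {D} lD)
... | j , j≤ , C≤ = lab n j , lj , idx-cancel≤ {n} {lab n j} {D} lj lD (subst (N._≤ idx n D) (sym (idx-lab {n} j)) j≤) , idx-cancel≤ {n} {C} {LabelPerm.u P (lab n j)} lC (LabelPerm.u-lab P {lab n j} lj) C≤
  where
  lj : Label n (lab n j)
  lj = lab-label (NP.≤-<-trans j≤ (idx-< {n} {D} lD))

-- Covering families and shared vertices

module Net₂ (n : ℕ) (I : List Interval) (Z : ZigZag n I) where
  open Net n I Z public

  edge-src : ∀ {i y} → Edge n I (src i) y → Label n i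
  edge-src {i} (i₀ , l , h) with proj₁ (adj-∈ (adj⁺ (subst (Adjacent _ _) (strand-sel I i₀) h)))
  ... | here refl = l
  ... | there m with ∈-++⁻ (map mid (sel id I i₀)) m
  ...   | inj₂ (here ())
  ...   | inj₁ q with ∈-map⁻ mid q
  ...     | _ , _ , ()

  edge-snk : ∀ {i x} → Edge n I x (snk i) → Label n i
  edge-snk {i} (i₀ , l , h) with proj₂ (adj-∈ (adj⁺ (subst (Adjacent _ _) (strand-sel I i₀) h)))
  ... | here ()
  ... | there m with ∈-++⁻ (map mid (sel id I i₀)) m
  ...   | inj₂ (here refl) = l
  ...   | inj₁ q with ∈-map⁻ mid q
  ...     | _ , _ , ()

  out-unique : ∀ {i y z} → AEdge N._<_ In (src i) y → AEdge N._<_ In (src i) z → y ≡ z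
  out-unique (ss _ _) (ss _ _) = refl
  out-unique (ss _ h) (sm m _) = ⊥-elim (h m)
  out-unique (sm m _) (ss _ h) = ⊥-elim (h m)
  out-unique (sm {k = k} m h) (sm {k = l} m′ h′) with NP.<-cmp k l
  ... | tri< q _ _ = ⊥-elim (h′ m q)
  ... | tri≈ _ refl _ = refl
  ... | tri> _ _ q = ⊥-elim (h m′ q)

  in-unique : ∀ {i y z} → AEdge N._<_ In y (snk i) → AEdge N._<_ In z (snk i) → y ≡ z
  in-unique (ss _ _) (ss _ _) = refl
  in-unique (ss _ h) (ms m _) = ⊥-elim (h m)
  in-unique (ms m _) (ss _ h) = ⊥-elim (h m)
  in-unique (ms {k = k} m h) (ms {k = l} m′ h′) with NP.<-cmp k l
  ... | tri< q _ _ = ⊥-elim (h m′ q)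
  ... | tri≈ _ refl _ = refl
  ... | tri> _ _ q = ⊥-elim (h′ m q)

  path-out : ∀ {i j l y} → Path n I (src i) (snk j) l → Edge n I (src i) y → Adj (src i) y l
  path-out (step e p) e′ with path-head p | out-unique (edge⇒aedge e) (edge⇒aedge e′)
  ... | _ , refl | refl = now

  path-in : ∀ {x i l y} → Path n I x (snk i) l → x ≢ snk i → Edge n I y (snk i) → Adj y (snk i) l
  path-in here ne e′ = ⊥-elim (ne refl)
  path-in {x} {i} {y = y} (step {b = b} e p) ne e′ with b ≟V snk i
  ... | no q = later (path-in p q e′)
  ... | yes refl with path-head p | in-unique (edge⇒aedge e) (edge⇒aedge e′)
  ...   | _ , refl | refl = now

  -- Each interior edge is a cut that some path of the family must cross.
  covering : (P : LabelPerm n) → (∀ {i} → Label n i → A i (LabelPerm.u P i)) → IsCoveringType n I (LabelPerm.u P)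
  covering P paths = fam , (λ i l → pth i l) , λ a b e → cov e (edge⇒aedge e)
    where
    open LabelPerm P
    fam : ℤ → List Vertex
    fam i with label? n i
    ... | yes l = proj₁ (paths l)
    ... | no _ = []
    pth : ∀ i → Label n i → Path n I (src i) (snk (u i)) (fam i)
    pth i l with label? n i
    ... | yes l′ = proj₂ (paths l′)
    ... | no h = ⊥-elim (h l)
    to : ∀ {a b} j → Label n j → Adj a b (fam j) → ∃ λ i → Label n i × Adjacent a b (fam i)
    to j l h = j , l , adj⁻ h
    cov : ∀ {a b} → Edge n I a b → AEdge N._<_ In a b → ∃ λ i → Label n i × Adjacent a b (fam i)
    cov e (ss {i} _ _) = to i (edge-src e) (path-out (pth i (edge-src e)) e)
    cov e (sm {i} _ _) = to i (edge-src e) (path-out (pth i (edge-src e)) e)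
    cov e (ms {i} {k} _ _) = to (u⁻¹ i) (u⁻¹-lab {i} (edge-snk e)) (path-in (subst (λ z → Path n I (src (u⁻¹ i)) (snk z) (fam (u⁻¹ i))) (uu⁻¹ {i} (edge-snk e)) (pth (u⁻¹ i) (u⁻¹-lab {i} (edge-snk e)))) (λ ()) e)
    cov e (mm {i} {k} {l} m m′ k<l nb) with ℤP.<-cmp (c k) (c l)
    ... | tri≈ _ q _ = ⊥-elim (NP.<-irrefl (c-inj (proj₁ m) (proj₁ m′) q) k<l)
    ... | tri< q _ _ = let j , lj , a , b = labelPerm-reaches P {c l} {d k} (proj₁ (interval-labels (proj₁ m′))) (proj₁ (proj₂ (interval-labels (proj₁ m)))) (ℤP.≤-trans (proj₁ (proj₂ m′)) (proj₁ (proj₂ (proj₂ m)))) in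
            to j lj (Crosses.adj (LR.crossLR (consecutive m m′ q none) k<l (pth j lj) a b))
      where
      none : ∀ {r} → r N.< t → In i r → c k < c r → ¬ (c r < c l)
      none {r} _ mr x y with NP.<-cmp k r
      ... | tri< s _ _ = nb mr s (zig₁ m mr m′ x y s)
      ... | tri≈ _ refl _ = ℤP.<-irrefl refl x
      ... | tri> _ _ s = NP.<-asym k<l (NP.<-trans (zig₁′ m mr m′ x y s) s)
    -- This edge leads from right to left, so a path starting far right and ending far left is
    -- wanted; applied to the inverse permutation, `labelPerm-reaches` yields the end point j of
    -- such a path.
    ... | tri> _ _ q = let j , lj , a , b = labelPerm-reaches (inverseLP P) {c k} {d l} (proj₁ (interval-labels (proj₁ m))) (proj₁ (proj₂ (interval-labels (proj₁ m′)))) (ℤP.≤-trans (proj₁ (proj₂ m)) (proj₁ (proj₂ (proj₂ m′)))) in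
            to (u⁻¹ j) (u⁻¹-lab {j} lj) (Crosses.adj (RL.crossRL (consecutive m′ m q none) k<l (pth (u⁻¹ j) (u⁻¹-lab {j} lj)) b (subst (_≤ d l) (sym (uu⁻¹ {j} lj)) a)))
      where
      none : ∀ {r} → r N.< t → In i r → c l < c r → ¬ (c r < c k)
      none {r} _ mr x y with NP.<-cmp l r
      ... | tri< s _ _ = NP.<-asym k<l (NP.<-trans s (zig₁ m′ mr m x y s))
      ... | tri≈ _ refl _ = ℤP.<-irrefl refl x
      ... | tri> _ _ s = nb mr (zig₁′ m′ mr m x y s) s

  -- Changing paths at the common vertex leads from i to j and from j to i, and mutual reachability
  -- means a common interval.
  share⇒E : ∀ {p q i j} → Label n i → Label n j → i ≢ j → Path n I (src i) (snk i) p → Path n I (src j) (snk j) q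
    → T (shareVertex p q) → E i j
  share⇒E {p} {q} li lj ne P Q h with any-T (λ a → any (λ b → ⌊ a ≟V b ⌋) q) p h
  ... | a , a∈p , h′ with any-T (λ b → ⌊ a ≟V b ⌋) q h′
  ...   | b , b∈q , e with toWitness {a? = a ≟V b} e
  ...     | refl = A∧Aᵗ⇒E li lj ne (⇝-trans (proj₁ (path-∈ P a∈p)) (proj₂ (path-∈ Q b∈q)))
                                   (⇝-trans (proj₁ (path-∈ Q b∈q)) (proj₂ (path-∈ P a∈p)))

  E⇒share : ∀ {p q i j} → Path n I (src i) (snk i) p → Path n I (src j) (snk j) q → E i j → T (shareVertex p q)
  E⇒share {p} {q} P Q (k , m , m′) = T-any _ p (path-meets m P) (T-any _ q (path-meets m′ Q) (fromWitness {a? = mid k ≟V mid k} refl))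

  rel : Relℕ
  rel p q = A (lab n p) (lab n q)

  private
    toRow : ∀ {R : ℤ → ℤ → Set} {m c₀} → m N.< n N.+ n → Label n c₀ → c₀ ≤ lab n m → LastRowℤ R (lab n m) c₀
      → LastRow (λ p q → R (lab n p) (lab n q)) m (idx n c₀)
    toRow {R} {m} {c₀} m<N lc h row = record
      { c≤m = subst (idx n c₀ N.≤_) (idx-lab {n} m) (idx-mono≤ {n} {c₀} {lab n m} lc (lab-label m<N) h)
      ; only = λ {b} b≤m r → upN (NP.≤-<-trans b≤m m<N) (only (L b≤m) (le b≤m m<N) r)
      ; full = λ {b} b≤m q → full (L b≤m) (le b≤m m<N) (downN (NP.≤-<-trans b≤m m<N) q)
      ; unif = λ {a} {k} {l} a<m q k≤m q′ l≤m r → unif (L (NP.<⇒≤ a<m)) (L k≤m) (L l≤m) (lab-mono (NP.<-trans a<m m<N) m<N a<m)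
          (downN (NP.≤-<-trans k≤m m<N) q) (le k≤m m<N) (downN (NP.≤-<-trans l≤m m<N) q′) (le l≤m m<N) r
      ; isol = λ e {a} a<m r → isol (trans (sym (lab-idx {n} {c₀} lc)) (cong (lab n) e)) (L (NP.<⇒≤ a<m)) (lab-mono (NP.<-trans a<m m<N) m<N a<m) r }
      where
      open LastRowℤ row
      L : ∀ {b} → b N.≤ m → Label n (lab n b)
      L b≤m = lab-label (NP.≤-<-trans b≤m m<N)
      le : ∀ {a b} → a N.≤ b → b N.< n N.+ n → lab n a ≤ lab n b
      le h b< = lab-mono≤ (NP.≤-<-trans h b<) b< h
      upN : ∀ {b} → b N.< n N.+ n → c₀ ≤ lab n b → idx n c₀ N.≤ b
      upN {b} b< q = subst (idx n c₀ N.≤_) (idx-lab {n} b) (idx-mono≤ {n} {c₀} {lab n b} lc (lab-label b<) q)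
      downN : ∀ {b} → b N.< n N.+ n → idx n c₀ N.≤ b → c₀ ≤ lab n b
      downN {b} b< q = subst (_≤ lab n b) (lab-idx {n} {c₀} lc) (lab-mono≤ (idx-< {n} {c₀} lc) b< q)

  rel-peelable : PeelableRel (n N.+ n) rel
  rel-peelable = record
    { diag = λ l → A-refl (lab-label l)
    ; peel = λ {m} l → go l (peel (lab-label l)) }
    where
    go : ∀ {m} → m N.< n N.+ n → Peeled (lab n m) → ∃ λ c → LastRow rel m c ⊎ LastRow (rel ᵗ) m c
    go l P with Peeled.lastRow P
    ... | inj₁ R = _ , inj₁ (toRow l (Peeled.c₀-label P) (Peeled.c₀≤m P) R)
    ... | inj₂ R = _ , inj₂ (toRow l (Peeled.c₀-label P) (Peeled.c₀≤m P) R)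

-- Labels, words and one-line notation

range-∈⁺ : ∀ {n x} → 1 N.≤ x → x N.≤ n → x ∈ range n
range-∈⁺ {x = suc x} _ l = ∈-map⁺ suc (∈-upTo⁺ l)

range-∈⁻ : ∀ {n x} → x ∈ range n → 1 N.≤ x × x N.≤ n
range-∈⁻ {n} m with ∈-map⁻ suc m
... | y , i , refl = s≤s z≤n , ∈-upTo⁻ i

range-unique : ∀ n → Unique (range n)
range-unique n = unique-map suc (λ _ _ → NP.suc-injective) (upTo⁺ n)

range-length : ∀ n → length (range n) ≡ n
range-length n = trans (LP.length-map suc (upTo n)) (LP.length-upTo n)

neg-inj : ∀ {x y} → - x ≡ - y → x ≡ y
neg-inj {x} {y} e = trans (sym (ℤP.neg-involutive x)) (trans (cong -_ e) (ℤP.neg-involutive y))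

label-neg : ∀ {n x} → Label n x → Label n (- x)
label-neg {n} {x} (a , b) = subst (1 N.≤_) (sym (ℤP.∣-i∣≡∣i∣ x)) a , subst (N._≤ n) (sym (ℤP.∣-i∣≡∣i∣ x)) b

label≢neg : ∀ {n x} → Label n x → x ≢ - x
label≢neg {x = + suc _} _ ()
label≢neg {x = -[1+ _ ]} _ ()

negs : ℕ → List ℤ
negs n = map (λ i → - (+ i)) (range n)

labels-∈⁻ : ∀ {n x} → x ∈ labels n → Label n x
labels-∈⁻ {n} m with ∈-++⁻ (reverse (negs n)) m
... | inj₂ q with ∈-map⁻ +_ q
...   | y , i , refl = range-∈⁻ i
labels-∈⁻ {n} m | inj₁ q with ∈-map⁻ (λ i → - (+ i)) (∈-resp-↭ (↭-reverse (negs n)) q)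
...   | y , i , refl = label-neg {n} {+ y} (range-∈⁻ i)

labels-∈⁺ : ∀ {n} x → Label n x → x ∈ labels n
labels-∈⁺ {n} (+ x) (a , b) = ∈-++⁺ʳ (reverse (negs n)) (∈-map⁺ +_ (range-∈⁺ a b))
labels-∈⁺ {n} -[1+ x ] (a , b) = ∈-++⁺ˡ (∈-resp-↭ (↭-sym (↭-reverse (negs n))) (∈-map⁺ (λ i → - (+ i)) (range-∈⁺ a b)))

labels-unique : ∀ n → Unique (labels n)
labels-unique n = unique-++ (unique-↭ (↭-sym (↭-reverse (negs n))) (unique-map _ (λ _ _ e → ℤP.+-injective (neg-inj e)) (range-unique n)))
  (unique-map _ (λ _ _ → ℤP.+-injective) (range-unique n)) dis
  where
  dis : ∀ {x} → x ∈ reverse (negs n) → x ∈ map +_ (range n) → ⊥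
  dis p q with ∈-map⁻ (λ i → - (+ i)) (∈-resp-↭ (↭-reverse (negs n)) p) | ∈-map⁻ +_ q
  ... | suc y , i , refl | z , j , ()
  ... | zero , i , e | z , j , e′ with range-∈⁻ i
  ...   | () , _

∑-labels : ∀ n (f : ℤ → ℤ) → ∑ (labels n) f ≡ ∑ (range n) (λ i → f (+ i) ℤ.+ f (- + i))
∑-labels n f = trans (∑-++ (reverse (negs n)) (map +_ (range n)) f) (trans (cong₂ ℤ._+_ (trans (∑-↭ f (↭-reverse (negs n))) (∑-map (λ i → - (+ i)) (range n) f)) (∑-map +_ (range n) f))
  (trans (ℤP.+-comm (∑ (range n) (λ i → f (- + i))) (∑ (range n) (λ i → f (+ i)))) (sym (∑-+ (range n) (λ i → f (+ i)) (λ i → f (- + i))))))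

words-∈⁻ : ∀ k (S : List El) {s} → s ∈ words k S → length s ≡ k × (∀ {x} → x ∈ s → x ∈ S)
words-∈⁻ zero S (here refl) = refl , λ ()
words-∈⁻ (suc k) S m = go S m id
  where
  go : ∀ T′ {s} → s ∈ concatMap (λ x → map (x ∷_) (words k S)) T′ → (∀ {x} → x ∈ T′ → x ∈ S) → length s ≡ suc k × (∀ {x} → x ∈ s → x ∈ S)
  go (y ∷ T′) m h with ∈-++⁻ (map (y ∷_) (words k S)) m
  ... | inj₂ q = go T′ q (h ∘ there)
  ... | inj₁ q with ∈-map⁻ (y ∷_) q
  ...   | s′ , i , refl = let a , b = words-∈⁻ k S i in cong suc a , λ { (here refl) → h (here refl) ; (there j) → b j }

words-∈⁺ : ∀ k (S : List El) {s} → length s ≡ k → (∀ {x} → x ∈ s → x ∈ S) → s ∈ words k S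
words-∈⁺ zero S {[]} e h = here refl
words-∈⁺ (suc k) S {x ∷ s} e h = go S (h (here refl))
  where
  go : ∀ T′ → x ∈ T′ → (x ∷ s) ∈ concatMap (λ x → map (x ∷_) (words k S)) T′
  go (y ∷ T′) (here refl) = ∈-++⁺ˡ (∈-map⁺ (x ∷_) (words-∈⁺ k S (NP.suc-injective e) (h ∘ there)))
  go (y ∷ T′) (there i) = ∈-++⁺ʳ (map (y ∷_) (words k S)) (go T′ i)

words-unique : ∀ k {S : List El} → Unique S → Unique (words k S)
words-unique zero u = unique-∷ (λ ()) []
words-unique (suc k) {S} u = go u
  where
  head-∈ : ∀ T′ {x s} → (x ∷ s) ∈ concatMap (λ x → map (x ∷_) (words k S)) T′ → x ∈ T′
  head-∈ (y ∷ T′) m with ∈-++⁻ (map (y ∷_) (words k S)) m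
  ... | inj₂ q = there (head-∈ T′ q)
  ... | inj₁ q with ∈-map⁻ (y ∷_) q
  ...   | _ , _ , refl = here refl
  go : ∀ {T′} → Unique T′ → Unique (concatMap (λ x → map (x ∷_) (words k S)) T′)
  go {[]} v = []
  go {y ∷ T′} v = unique-++ (unique-map (y ∷_) (λ _ _ → LP.∷-injectiveʳ) (words-unique k u)) (go (unique-tail v)) dis
    where
    dis : ∀ {s} → s ∈ map (y ∷_) (words k S) → s ∈ concatMap (λ x → map (x ∷_) (words k S)) T′ → ⊥
    dis p q with ∈-map⁻ (y ∷_) p
    ... | _ , _ , refl = unique-head v (head-∈ T′ q)

at-∈ : (z : El) (w : List El) {i : ℕ} → 1 N.≤ i → i N.≤ length w → at z w i ∈ w
at-∈ z (x ∷ w) {suc zero} _ _ = here refl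
at-∈ z (x ∷ w) {suc (suc i)} _ (s≤s l) = there (at-∈ z w (s≤s z≤n) l)

at-surj : (z : El) (w : List El) {x : El} → x ∈ w → ∃ λ i → 1 N.≤ i × i N.≤ length w × at z w i ≡ x
at-surj z (y ∷ w) (here refl) = 1 , s≤s z≤n , s≤s z≤n , refl
at-surj z (y ∷ w) (there m) with at-surj z w m
... | suc i , a , b , e = suc (suc i) , s≤s z≤n , s≤s b , e

at-map : (z : El) (z′ : El′) (f : El → El′) (w : List El) {i : ℕ} → 1 N.≤ i → i N.≤ length w → at z′ (map f w) i ≡ f (at z w i)
at-map z z′ f (x ∷ w) {suc zero} _ _ = refl
at-map z z′ f (x ∷ w) {suc (suc i)} _ (s≤s l) = at-map z z′ f w (s≤s z≤n) l

at-inj : (z : El) {w : List El} {i j : ℕ} → Unique w → 1 N.≤ i → i N.≤ length w → 1 N.≤ j → j N.≤ length w → at z w i ≡ at z w j → i ≡ j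
at-inj z {x ∷ w} {suc zero} {suc zero} u _ _ _ _ e = refl
at-inj z {x ∷ w} {suc zero} {suc (suc j)} u _ _ _ (s≤s l) e = ⊥-elim (unique-head u (subst (_∈ w) (sym e) (at-∈ z w (s≤s z≤n) l)))
at-inj z {x ∷ w} {suc (suc i)} {suc zero} u _ (s≤s l) _ _ e = ⊥-elim (unique-head u (subst (_∈ w) e (at-∈ z w (s≤s z≤n) l)))
at-inj z {x ∷ w} {suc (suc i)} {suc (suc j)} u _ (s≤s l) _ (s≤s l′) e = cong suc (at-inj z (unique-tail u) (s≤s z≤n) l (s≤s z≤n) l′ e)

at-ext : (z : El) (v w : List El) → length v ≡ length w → (∀ {i} → 1 N.≤ i → i N.≤ length v → at z v i ≡ at z w i) → v ≡ w
at-ext z [] [] e h = refl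
at-ext z (x ∷ v) (y ∷ w) e h = cong₂ _∷_ (h (s≤s z≤n) (s≤s z≤n))
  (at-ext z v w (NP.suc-injective e) (λ { {suc i} a b → h {suc (suc i)} (s≤s z≤n) (s≤s b) }))

at-applyUpTo : (z : El) (f : ℕ → El) (n : ℕ) {i : ℕ} → i N.< n → at z (applyUpTo f n) (suc i) ≡ f i
at-applyUpTo z f (suc n) {zero} l = refl
at-applyUpTo z f (suc n) {suc i} (s≤s l) = at-applyUpTo z (f ∘ suc) n l

at-range : ∀ n {i} → 1 N.≤ i → i N.≤ n → at 0 (range n) i ≡ i
at-range n {suc i} _ l = trans (at-map 0 0 suc (upTo n) (s≤s z≤n) (subst (suc i N.≤_) (sym (LP.length-upTo n)) l)) (cong suc (at-applyUpTo 0 id n l))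

at-map-range : (z : El) (f : ℕ → El) (n : ℕ) {i : ℕ} → 1 N.≤ i → i N.≤ n → at z (map f (range n)) i ≡ f i
at-map-range z f n {i} a b = trans (at-map 0 z f (range n) a (subst (i N.≤_) (sym (range-length n)) b)) (cong f (at-range n a b))

map-at-range : (z : El) (w : List El) → map (at z w) (range (length w)) ≡ w
map-at-range z w = at-ext z _ w e (λ a b → at-map-range z (at z w) (length w) a (subst (_ N.≤_) e b))
  where
  e : length (map (at z w) (range (length w))) ≡ length w
  e = trans (LP.length-map (at z w) (range (length w))) (range-length (length w))

app-neg : ∀ w x → app w (- x) ≡ - app w x
app-neg w (+ zero) = refl
app-neg w (+ suc k) = refl
app-neg w -[1+ k ] = sym (ℤP.neg-involutive (at (+ 0) w (suc k)))

app-+ : ∀ w {i} → 1 N.≤ i → app w (+ i) ≡ at (+ 0) w i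
app-+ w {suc i} _ = refl

-- Elements of B_n

record Signed (n : ℕ) (w : List ℤ) : Set where
  field
    len   : length w ≡ n
    lbl   : ∀ {x} → x ∈ w → Label n x
    uniq  : Unique (map ∣_∣ w)

signed-surj : ∀ {n w} → Signed n w → ∀ {j} → 1 N.≤ j → j N.≤ n → j ∈ map ∣_∣ w
signed-surj {n} {w} S {j} a b = subset-full N._≟_ uniq sub le (range-∈⁺ a b)
  where
  open Signed S
  sub : ∀ {x} → x ∈ map ∣_∣ w → x ∈ range n
  sub m with ∈-map⁻ ∣_∣ m
  ... | x , i , refl = let p , q = lbl i in range-∈⁺ p q
  le : length (range n) N.≤ length (map ∣_∣ w)
  le = NP.≤-reflexive (trans (range-length n) (sym (trans (LP.length-map ∣_∣ w) len)))

IsBn⇒Signed : ∀ {n w} → IsBn n w → Signed n w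
IsBn⇒Signed {n} {w} h = record
  { len = e
  ; lbl = λ {x} m → let p , q = ∧-T {1 ≤ᵇ ∣ x ∣} (all-T _ w h₃ m) in NP.≤ᵇ⇒≤ 1 (∣ x ∣) p , NP.≤ᵇ⇒≤ (∣ x ∣) n q
  ; uniq = unique-of-surjective N._≟_ (range-unique n) sub (NP.≤-reflexive (trans (trans (LP.length-map ∣_∣ w) e) (sym (range-length n)))) }
  where
  h₁ = ∧-T {length w ≡ᵇ n} h
  h₂ = ∧-T {all (λ x → (1 ≤ᵇ ∣ x ∣) ∧ (∣ x ∣ ≤ᵇ n)) w} (proj₂ h₁)
  h₃ = proj₁ h₂
  e : length w ≡ n
  e = NP.≡ᵇ⇒≡ (length w) n (proj₁ h₁)
  sub : ∀ {j} → j ∈ range n → j ∈ map ∣_∣ w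
  sub {j} m with any-T (λ x → ∣ x ∣ ≡ᵇ j) w (all-T _ (range n) (proj₂ h₂) m)
  ... | x , i , q = subst (_∈ map ∣_∣ w) (NP.≡ᵇ⇒≡ (∣ x ∣) j q) (∈-map⁺ ∣_∣ i)

Signed⇒IsBn : ∀ {n w} → Signed n w → IsBn n w
Signed⇒IsBn {n} {w} S = T-∧ (NP.≡⇒≡ᵇ (length w) n len) (T-∧
  (T-all _ w (λ {x} m → let p , q = lbl m in T-∧ (NP.≤⇒≤ᵇ {1} {∣ x ∣} p) (NP.≤⇒≤ᵇ {∣ x ∣} {n} q)))
  (T-all _ (range n) (λ {j} m → let p , q = range-∈⁻ m ; x , i , e = ∈-map⁻ ∣_∣ (signed-surj S p q) in T-any _ w i (NP.≡⇒≡ᵇ (∣ x ∣) j (sym e)))))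
  where open Signed S

allBn-∈⁻ : ∀ {n w} → w ∈ allBn n → Signed n w
allBn-∈⁻ {n} m = IsBn⇒Signed (proj₂ (filt-∈⁻ (isBn n) (words n (labels n)) m))

allBn-∈⁺ : ∀ {n w} → Signed n w → w ∈ allBn n
allBn-∈⁺ {n} {w} S = filt-∈⁺ (isBn n) (words n (labels n)) (words-∈⁺ n (labels n) (Signed.len S) (λ {x} i → labels-∈⁺ x (Signed.lbl S i))) (Signed⇒IsBn S)

allBn-unique : ∀ n → Unique (allBn n)
allBn-unique n = unique-filt (isBn n) (words-unique n (labels-unique n))

abs-cases : ∀ x y → ∣ x ∣ ≡ ∣ y ∣ → x ≡ y ⊎ x ≡ - y
abs-cases (+ x) (+ y) e = inj₁ (cong +_ e)
abs-cases (+ suc x) -[1+ y ] e = inj₂ (cong +_ e)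
abs-cases -[1+ x ] (+ suc y) e = inj₂ (cong -[1+_] (NP.suc-injective e))
abs-cases -[1+ x ] -[1+ y ] e = inj₁ (cong -[1+_] (NP.suc-injective e))

module _ {n : ℕ} {w : List ℤ} (S : Signed n w) where
  open Signed S

  private
    le : ∀ {i} → i N.≤ n → i N.≤ length w
    le = subst (_ N.≤_) (sym len)

  at-label : ∀ {i} → 1 N.≤ i → i N.≤ n → Label n (at (+ 0) w i)
  at-label a b = lbl (at-∈ (+ 0) w a (le b))

  app-label : ∀ x → Label n x → Label n (app w x)
  app-label (+ suc k) (a , b) = at-label a b
  app-label -[1+ k ] (a , b) = label-neg {n} {at (+ 0) w (suc k)} (at-label a b)

  at-abs-inj : ∀ {i j} → 1 N.≤ i → i N.≤ n → 1 N.≤ j → j N.≤ n → ∣ at (+ 0) w i ∣ ≡ ∣ at (+ 0) w j ∣ → i ≡ j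
  at-abs-inj a b a′ b′ e = at-inj 0 uniq a (len′ b) a′ (len′ b′)
    (trans (at-map (+ 0) 0 ∣_∣ w a (le b)) (trans e (sym (at-map (+ 0) 0 ∣_∣ w a′ (le b′)))))
    where
    len′ : ∀ {i} → i N.≤ n → i N.≤ length (map ∣_∣ w)
    len′ = subst (_ N.≤_) (sym (trans (LP.length-map ∣_∣ w) len))

  app-abs : ∀ x → ∣ app w x ∣ ≡ ∣ app w (+ ∣ x ∣) ∣
  app-abs (+ k) = refl
  app-abs -[1+ k ] = ℤP.∣-i∣≡∣i∣ (at (+ 0) w (suc k))

  app-abs-inj : ∀ x y → Label n x → Label n y → ∣ app w x ∣ ≡ ∣ app w y ∣ → ∣ x ∣ ≡ ∣ y ∣
  app-abs-inj x y (a , b) (a′ , b′) e = at-abs-inj a b a′ b′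
    (trans (cong ∣_∣ (sym (app-+ w a))) (trans (trans (sym (app-abs x)) (trans e (app-abs y))) (cong ∣_∣ (app-+ w a′))))

  app-inj : ∀ x y → Label n x → Label n y → app w x ≡ app w y → x ≡ y
  app-inj x y lx ly e with abs-cases x y (app-abs-inj x y lx ly (cong ∣_∣ e))
  ... | inj₁ q = q
  ... | inj₂ refl = ⊥-elim (label≢neg {n} {app w y} (app-label y ly) (trans (sym e) (app-neg w y)))

  app-surj : ∀ y → Label n y → ∃ λ x → Label n x × app w x ≡ y
  app-surj y (a , b) with ∈-map⁻ ∣_∣ (signed-surj S a b)
  ... | z , m , e with at-surj (+ 0) w m
  ...   | suc i , p , q , e′ with abs-cases y z e
  ...     | inj₁ f = + suc i , (p , subst (suc i N.≤_) len q) , trans e′ (sym f)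
  ...     | inj₂ f = -[1+ i ] , (p , subst (suc i N.≤_) len q) , trans (cong -_ e′) (sym f)

  private
    at-spec : ∀ {j} (P : ℤ → Set) → 1 N.≤ j → j N.≤ n → (F : ℕ → ℤ) (v : List ℤ) → v ≡ map F (range n) → P (F j) → P (at (+ 0) v j)
    at-spec P a b F v refl = subst P (sym (at-map-range (+ 0) F n a b))

  at-inverse : ∀ {j} → 1 N.≤ j → j N.≤ n → Label n (at (+ 0) (inverse n w) j) × app w (at (+ 0) (inverse n w) j) ≡ + j
  at-inverse {j} a b with filt (λ x → app w x ==ℤ (+ j)) (labels n) in eq
                        | at-spec (λ z → Label n z × app w z ≡ + j) a b _ (inverse n w) refl
  ... | x ∷ _ | k = let p , q = filt-∈⁻ (λ x → app w x ==ℤ (+ j)) (labels n) (subst (x ∈_) (sym eq) (here refl)) in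
                    k (labels-∈⁻ p , toWitness {a? = app w x ℤ.≟ + j} q)
  ... | [] | _ with app-surj (+ j) (a , b)
  ...   | x , lx , e with subst (x ∈_) eq (filt-∈⁺ (λ x → app w x ==ℤ (+ j)) (labels n) (labels-∈⁺ x lx) (fromWitness e))
  ...     | ()

  inverse-length : length (inverse n w) ≡ n
  inverse-length = trans (LP.length-map _ (range n)) (range-length n)

  app-inverseʳ : ∀ y → Label n y → app w (app (inverse n w) y) ≡ y
  app-inverseʳ (+ suc k) (a , b) = proj₂ (at-inverse a b)
  app-inverseʳ -[1+ k ] (a , b) = trans (app-neg w (at (+ 0) (inverse n w) (suc k))) (cong -_ (proj₂ (at-inverse a b)))

  app-inverse-label : ∀ y → Label n y → Label n (app (inverse n w) y)
  app-inverse-label (+ suc k) (a , b) = proj₁ (at-inverse a b)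
  app-inverse-label -[1+ k ] (a , b) = label-neg {n} {at (+ 0) (inverse n w) (suc k)} (proj₁ (at-inverse a b))

  app-inverseˡ : ∀ x → Label n x → app (inverse n w) (app w x) ≡ x
  app-inverseˡ x lx = app-inj _ x (app-inverse-label (app w x) (app-label x lx)) lx (app-inverseʳ (app w x) (app-label x lx))

  signedPerm : LabelPerm n
  signedPerm = record { u = app w ; u⁻¹ = app (inverse n w) ; u-lab = λ {x} → app-label x ; u⁻¹-lab = λ {x} → app-inverse-label x
    ; u⁻¹u = λ {x} → app-inverseˡ x ; uu⁻¹ = λ {x} → app-inverseʳ x }

mkSigned : ∀ {n} (w : List ℤ) → length w ≡ n → (∀ {i} → 1 N.≤ i → i N.≤ n → Label n (at (+ 0) w i))
  → (∀ {i j} → 1 N.≤ i → i N.≤ n → 1 N.≤ j → j N.≤ n → ∣ at (+ 0) w i ∣ ≡ ∣ at (+ 0) w j ∣ → i ≡ j) → Signed n w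
mkSigned {n} w e l inj = record
  { len = e
  ; lbl = λ m → let i , a , b , q = at-surj (+ 0) w m in subst (Label n) q (l a (subst (i N.≤_) e b))
  ; uniq = subst Unique eq (unique-map (λ i → ∣ at (+ 0) w i ∣) (λ p q → let a , b = range-∈⁻ p ; a′ , b′ = range-∈⁻ q in inj a b a′ b′) (range-unique n)) }
  where
  eq : map (λ i → ∣ at (+ 0) w i ∣) (range n) ≡ map ∣_∣ w
  eq = trans (LP.map-∘ (range n)) (cong (map ∣_∣) (trans (cong (map (at (+ 0) w) ∘ range) (sym e)) (map-at-range (+ 0) w)))

app-mul : ∀ {n} u {v} → length v ≡ n → ∀ x → Label n x → app (mul u v) x ≡ app u (app v x)
app-mul u {v} refl (+ suc k) (a , b) = at-map (+ 0) (+ 0) (app u) v a b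
app-mul u {v} refl -[1+ k ] (a , b) = trans (cong -_ (at-map (+ 0) (+ 0) (app u) v a b)) (sym (app-neg u (at (+ 0) v (suc k))))

mul-signed : ∀ {n u v} → Signed n u → Signed n v → Signed n (mul u v)
mul-signed {n} {u} {v} U V = mkSigned (mul u v) (trans (LP.length-map (app u) v) len)
  (λ {i} a b → subst (Label n) (sym (at-mul a b)) (app-label U (at (+ 0) v i) (at-label V a b)))
  (λ {i} {j} a b a′ b′ e → at-abs-inj V a b a′ b′ (app-abs-inj U (at (+ 0) v i) (at (+ 0) v j) (at-label V a b) (at-label V a′ b′)
      (trans (cong ∣_∣ (sym (at-mul a b))) (trans e (cong ∣_∣ (at-mul a′ b′))))))
  where
  open Signed V
  at-mul : ∀ {i} → 1 N.≤ i → i N.≤ n → at (+ 0) (mul u v) i ≡ app u (at (+ 0) v i)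
  at-mul a b = at-map (+ 0) (+ 0) (app u) v a (subst (_ N.≤_) (sym len) b)

inverse-signed : ∀ {n w} → Signed n w → Signed n (inverse n w)
inverse-signed {n} {w} S = mkSigned (inverse n w) (inverse-length S) (λ a b → proj₁ (at-inverse S a b))
  (λ {i} {j} a b a′ b′ e → trans (sym (cong ∣_∣ (proj₂ (at-inverse S a b)))) (trans (trans (app-abs S (at (+ 0) (inverse n w) i)) (trans (cong (λ z → ∣ app w (+ z) ∣) e) (sym (app-abs S (at (+ 0) (inverse n w) j)))))
     (cong ∣_∣ (proj₂ (at-inverse S a′ b′)))))

signed-ext : ∀ {n v w} → Signed n v → Signed n w → (∀ x → Label n x → app v x ≡ app w x) → v ≡ w
signed-ext {n} {v} {w} V W h = at-ext (+ 0) v w (trans (Signed.len V) (sym (Signed.len W)))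
  (λ {i} a b → trans (sym (app-+ v a)) (trans (h (+ i) (a , subst (i N.≤_) (Signed.len V) b)) (app-+ w a)))

-- Cycle types

perm-split : ∀ {S s : List ℕ} → Unique S → Unique s → (∀ {x} → x ∈ s → x ∈ S) → S ↭ s ++ (S ∖ s)
perm-split {S} {s} u v sub = same-elements-↭ u (unique-++ v (∖-unique s u) (λ i j → proj₂ (∖-∈⁻ S s j) i)) to from
  where
  keep : ∀ S s {x} → x ∈ S → x ∉ s → x ∈ S ∖ s
  keep S [] i n = i
  keep S (y ∷ s) i n = keep (S − y) s (−-∈⁺ S i (λ e → n (here e))) (n ∘ there)
  to : ∀ {x} → x ∈ S → x ∈ s ++ (S ∖ s)
  to {x} i with Any.any? (x N.≟_) s
  ... | yes j = ∈-++⁺ˡ j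
  ... | no n = ∈-++⁺ʳ s (keep S s i n)
  from : ∀ {x} → x ∈ s ++ (S ∖ s) → x ∈ S
  from i with ∈-++⁻ s i
  ... | inj₁ j = sub j
  ... | inj₂ j = proj₁ (∖-∈⁻ S s j)

module Cycles (p : List ℕ) (inR : ∀ {x} → 1 N.≤ x → x N.≤ length p → 1 N.≤ at 0 p x × at 0 p x N.≤ length p)
  (inj : ∀ {x y} → 1 N.≤ x → x N.≤ length p → 1 N.≤ y → y N.≤ length p → at 0 p x ≡ at 0 p y → x ≡ y) where

  K : ℕ
  K = length p

  f : ℕ → ℕ
  f = at 0 p

  it : ℕ → ℕ → ℕ
  it = iterP p

  Dom : ℕ → Set
  Dom x = 1 N.≤ x × x N.≤ K

  it-dom : ∀ c {x} → Dom x → Dom (it c x)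
  it-dom zero d = d
  it-dom (suc c) d = let a , b = it-dom c d in inR a b

  it-+ : ∀ a b x → it (a N.+ b) x ≡ it a (it b x)
  it-+ zero b x = refl
  it-+ (suc a) b x = cong f (it-+ a b x)

  it-inj : ∀ c {x y} → Dom x → Dom y → it c x ≡ it c y → x ≡ y
  it-inj zero dx dy e = e
  it-inj (suc c) dx dy e = it-inj c dx dy (let a , b = it-dom c dx ; a′ , b′ = it-dom c dy in inj a b a′ b′ e)

  record HasLen (x r : ℕ) : Set where
    field
      pos    : 1 N.≤ r
      closes : it r x ≡ x
      first  : ∀ {c} → 1 N.≤ c → c N.< r → it c x ≢ x

  open HasLen

  len-unique : ∀ {x r q} → HasLen x r → HasLen x q → r ≡ q
  len-unique {x} {r} {q} h g with NP.<-cmp r q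
  ... | tri< l _ _ = ⊥-elim (first g (pos h) l (closes h))
  ... | tri≈ _ e _ = e
  ... | tri> _ _ l = ⊥-elim (first h (pos g) l (closes g))

  returns : ∀ {x} → Dom x → ∃ λ c → 1 N.≤ c × c N.≤ K × it c x ≡ x
  returns {x} d with FP.pigeonhole (NP.n<1+n K) (λ (c : Fin (suc K)) → fromℕ< (g c))
    where
    g : (c : Fin (suc K)) → it (toℕ c) x ∸ 1 N.< K
    g c with it (toℕ c) x | it-dom (toℕ c) d
    ... | suc y | _ , b = b
  ... | a , b , a<b , e = toℕ b ∸ toℕ a , NP.m<n⇒0<n∸m a<b , NP.≤-trans (NP.m∸n≤m (toℕ b) (toℕ a)) (N.s≤s⁻¹ (FP.toℕ<n b)) ,
      it-inj (toℕ a) (it-dom (toℕ b ∸ toℕ a) d) d (trans (sym (it-+ (toℕ a) _ x)) (trans (cong (λ z → it z x) (NP.m+[n∸m]≡n (NP.<⇒≤ a<b))) (sym eq)))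
    where
    eq′ : it (toℕ a) x ∸ 1 ≡ it (toℕ b) x ∸ 1
    eq′ = trans (sym (FP.toℕ-fromℕ< _)) (trans (cong toℕ e) (FP.toℕ-fromℕ< _))
    un1 : ∀ {y z} → 1 N.≤ y → 1 N.≤ z → y ∸ 1 ≡ z ∸ 1 → y ≡ z
    un1 {suc y} {suc z} _ _ e = cong suc e
    eq : it (toℕ a) x ≡ it (toℕ b) x
    eq = un1 (proj₁ (it-dom (toℕ a) d)) (proj₁ (it-dom (toℕ b) d)) eq′

  private
    upTo-ext : ∀ m {g h : ℕ → ℕ} → (∀ i → g i ≡ h i) → applyUpTo g m ≡ applyUpTo h m
    upTo-ext zero e = refl
    upTo-ext (suc m) e = cong₂ _∷_ (e 0) (upTo-ext m (e ∘ suc))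

    first-filt : ∀ (q : ℕ → Bool) c₀ m {x xs} → filt q (applyUpTo (λ i → c₀ N.+ i) m) ≡ x ∷ xs
      → T (q x) × c₀ N.≤ x × x N.< c₀ N.+ m × (∀ {c} → c₀ N.≤ c → c N.< x → ¬ T (q c))
    first-filt q c₀ (suc m) e with q (c₀ N.+ 0) in eq
    first-filt q c₀ (suc m) refl | true = ≡⇒T eq , NP.m≤m+n c₀ 0 , NP.+-monoʳ-< c₀ (s≤s z≤n) ,
       λ a b → ⊥-elim (NP.<-irrefl refl (NP.<-≤-trans b (NP.≤-trans (NP.≤-reflexive (NP.+-identityʳ c₀)) a)))
    first-filt q c₀ (suc m) {x} {xs} e | false with first-filt q (suc c₀) m (subst (λ l → filt q l ≡ x ∷ xs) (upTo-ext m (NP.+-suc c₀)) e)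
    ... | t , a , b , h = t , NP.<⇒≤ a , subst (x N.<_) (sym (NP.+-suc c₀ m)) b , λ {c} l l′ → case c l l′
      where
      case : ∀ c → c₀ N.≤ c → c N.< x → ¬ T (q c)
      case c l l′ with NP.m≤n⇒m<n∨m≡n l
      ... | inj₁ k = h k l′
      ... | inj₂ refl = λ t → subst T (trans (cong q (sym (NP.+-identityʳ c₀))) eq) t

    range-shift : ∀ m → range m ≡ applyUpTo (λ i → 1 N.+ i) m
    range-shift m = LP.map-applyUpTo id suc m

  cyc-len : ∀ {x} → Dom x → HasLen x (cycLen p x) × cycLen p x N.≤ K
  cyc-len {x} d with filt (λ c → iterP p c x ≡ᵇ x) (range (length p)) in eq
  ... | c ∷ cs with first-filt (λ c → iterP p c x ≡ᵇ x) 1 K (trans (cong (filt (λ c → iterP p c x ≡ᵇ x)) (sym (range-shift K))) eq)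
  ...   | t , a , b , h = record { pos = a ; closes = NP.≡ᵇ⇒≡ (it c x) x t ; first = λ l l′ e → h l l′ (NP.≡⇒≡ᵇ _ _ e) } , N.s≤s⁻¹ b
  cyc-len {x} d | [] with returns d
  ... | c , a , b , e with subst (c ∈_) eq (filt-∈⁺ (λ c → iterP p c x ≡ᵇ x) (range K) (range-∈⁺ a b) (NP.≡⇒≡ᵇ _ _ e))
  ...   | ()

  cl : ℕ → ℕ
  cl = cycLen p

  has-cl : ∀ {x} → Dom x → HasLen x (cl x)
  has-cl d = proj₁ (cyc-len d)

  hasLen-f : ∀ {x r} → Dom x → HasLen x r → HasLen (f x) r
  hasLen-f {x} {r} d h = record { pos = pos h ; closes = trans (comm r) (cong f (closes h))
    ; first = λ {c} a b e → first h a b (let (u , v) , (u′ , v′) = it-dom c d , d in inj u v u′ v′ (trans (sym (comm c)) e)) }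
    where
    comm : ∀ c → it c (f x) ≡ f (it c x)
    comm c = trans (sym (it-+ c 1 x)) (cong (λ z → it z x) (NP.+-comm c 1))

  hasLen-it : ∀ c {x r} → Dom x → HasLen x r → HasLen (it c x) r
  hasLen-it zero d h = h
  hasLen-it (suc c) d h = hasLen-f (it-dom c d) (hasLen-it c d h)

  orb : ℕ → ℕ → List ℕ
  orb r x = map (λ c → it c x) (upTo r)

  orb-∈⁻ : ∀ {r x y} → y ∈ orb r x → ∃ λ c → c N.< r × y ≡ it c x
  orb-∈⁻ m with ∈-map⁻ _ m
  ... | c , i , e = c , ∈-upTo⁻ i , e

  orb-∈⁺ : ∀ {r x} c → c N.< r → it c x ∈ orb r x
  orb-∈⁺ {r} {x} c l = ∈-map⁺ (λ c → it c x) (∈-upTo⁺ l)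

  distinct-its : ∀ {x r a b} → Dom x → HasLen x r → a N.< b → b N.< r → it a x ≢ it b x
  distinct-its {x} {r} {a} {b} d h a<b b<r e = first h (NP.m<n⇒0<n∸m a<b) (NP.≤-<-trans (NP.m∸n≤m b a) b<r)
    (sym (it-inj a d (it-dom (b ∸ a) d) (trans e (trans (cong (λ z → it z x) (sym (NP.m+[n∸m]≡n (NP.<⇒≤ a<b)))) (it-+ a (b ∸ a) x)))))

  orb-unique : ∀ {x r} → Dom x → HasLen x r → Unique (orb r x)
  orb-unique {x} {r} d h = unique-map _ (λ {a} {b} i j e → go a b (∈-upTo⁻ i) (∈-upTo⁻ j) e) (upTo⁺ r)
    where
    go : ∀ a b → a N.< r → b N.< r → it a x ≡ it b x → a ≡ b
    go a b l l′ e with NP.<-cmp a b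
    ... | tri< q _ _ = ⊥-elim (distinct-its d h q l′ e)
    ... | tri≈ _ q _ = q
    ... | tri> _ _ q = ⊥-elim (distinct-its d h q l (sym e))

  orb-length : ∀ r x → length (orb r x) ≡ r
  orb-length r x = trans (LP.length-map _ (upTo r)) (LP.length-upTo r)

  it-reduce : ∀ {x r} → HasLen x r → ∀ c → ∃ λ c′ → 1 N.≤ c′ × c′ N.≤ r × it c x ≡ it c′ x
  it-reduce {x} {r} h zero = r , pos h , NP.≤-refl , sym (closes h)
  it-reduce {x} {r} h (suc c) with it-reduce h c
  ... | c′ , a , b , e with NP.m≤n⇒m<n∨m≡n b
  ...   | inj₁ l = suc c′ , s≤s z≤n , l , cong f e
  ...   | inj₂ refl = 1 , s≤s z≤n , pos h , cong f (trans e (closes h))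

  orb-it : ∀ {x r} → HasLen x r → ∀ c → it c x ∈ orb r x
  orb-it {x} {r} h c with it-reduce h c
  ... | c′ , a , b , e with NP.m≤n⇒m<n∨m≡n b
  ...   | inj₁ l = subst (_∈ orb r x) (sym e) (orb-∈⁺ c′ l)
  ...   | inj₂ refl = subst (_∈ orb r x) (sym (trans e (closes h))) (orb-∈⁺ 0 (pos h))

  -- The elements on cycles of length r are the disjoint union of the orbits of the minima of these
  -- cycles, and `cycleType` lists each cycle through its minimum.
  cycle-count : ∀ r → 1 N.≤ r → ∑ (range K) (λ x → ⟦ cl x ≡ᵇ r ⟧) ≡ + r ℤ.* + multiplicity r (cycleType p)
  cycle-count r 1≤r = trans (sym (countP-∑ (λ x → cl x ≡ᵇ r) (range K))) (trans (cong +_ (trans (↭-length same)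
      (lenB′ M))) (trans (cong (λ z → + (r N.* z)) mult) (ℤP.pos-* r (multiplicity r (cycleType p)))))
    where
    M : List ℕ
    M = filt (λ i → isCycleMin p i ∧ (cl i ≡ᵇ r)) (range K)
    lenB′ : ∀ L → length (concatMap (orb r) L) ≡ r N.* length L
    lenB′ [] = sym (NP.*-zeroʳ r)
    lenB′ (x ∷ L) = trans (LP.length-++ (orb r x)) (trans (cong₂ N._+_ (orb-length r x) (lenB′ L)) (sym (NP.*-suc r (length L))))
    mult : length M ≡ multiplicity r (cycleType p)
    mult = sym (go (range K))
      where
      go : ∀ L → countP (_≡ᵇ r) (map cl (filt (isCycleMin p) L)) ≡ length (filt (λ i → isCycleMin p i ∧ (cl i ≡ᵇ r)) L)
      go [] = refl
      go (x ∷ L) with isCycleMin p x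
      ... | false = go L
      ... | true with cl x ≡ᵇ r
      ...   | true = cong suc (go L)
      ...   | false = go L
    domM : ∀ {i} → i ∈ M → Dom i × HasLen i r × T (isCycleMin p i)
    domM {i} m = let a , b = filt-∈⁻ _ (range K) m ; c , d = ∧-T {isCycleMin p i} b ; dm = range-∈⁻ a in
      dm , subst (HasLen i) (NP.≡ᵇ⇒≡ (cl i) r d) (has-cl dm) , c
    isMin≤ : ∀ {i} → i ∈ M → ∀ c → i N.≤ it c i
    isMin≤ {i} m c with domM m
    ... | d , h , t with it-reduce h c
    ...   | c′ , a , b , e = subst (i N.≤_) (sym e) (NP.≤ᵇ⇒≤ i (it c′ i) (all-T _ (range K) t (range-∈⁺ a (NP.≤-trans b r≤K))))
      where
      r≤K : r N.≤ K
      r≤K = subst (N._≤ K) (len-unique (has-cl d) h) (proj₂ (cyc-len d))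
    concat-∈⁻ : ∀ L {y} → y ∈ concatMap (orb r) L → ∃ λ i → i ∈ L × y ∈ orb r i
    concat-∈⁻ (x ∷ L) m with ∈-++⁻ (orb r x) m
    ... | inj₁ q = x , here refl , q
    ... | inj₂ q = let i , a , b = concat-∈⁻ L q in i , there a , b
    concat-∈⁺ : ∀ L {i y} → i ∈ L → y ∈ orb r i → y ∈ concatMap (orb r) L
    concat-∈⁺ (x ∷ L) (here refl) q = ∈-++⁺ˡ q
    concat-∈⁺ (x ∷ L) (there m) q = ∈-++⁺ʳ (orb r x) (concat-∈⁺ L m q)
    back : ∀ {i y} → HasLen i r → y ∈ orb r i → ∃ λ c → it c y ≡ i
    back {i} h m with orb-∈⁻ m
    ... | c , l , refl = r ∸ c , trans (sym (it-+ (r ∸ c) c i)) (trans (cong (λ z → it z i) (NP.m∸n+n≡m (NP.<⇒≤ l))) (closes h))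
    meet : ∀ {i j y} → i ∈ M → j ∈ M → y ∈ orb r i → y ∈ orb r j → i ≡ j
    meet {i} {j} mi mj p q with domM mi | domM mj
    ... | di , hi , _ | dj , hj , _ = NP.≤-antisym (le mi hj p q) (le mj hi q p)
      where
      le : ∀ {i j y} → i ∈ M → HasLen j r → y ∈ orb r i → y ∈ orb r j → i N.≤ j
      le {i} {j} {y} mi hj p q with orb-∈⁻ p | back hj q
      ... | a , _ , refl | b , e = subst (i N.≤_) (trans (it-+ b a i) e) (isMin≤ mi (b N.+ a))
    uni : ∀ L → Unique L → (∀ {i} → i ∈ L → i ∈ M) → Unique (concatMap (orb r) L)
    uni [] u sub = []
    uni (x ∷ L) u sub = unique-++ (let d , h , _ = domM (sub (here refl)) in orb-unique d h) (uni L (unique-tail u) (sub ∘ there))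
      (λ a b → let i , m , q = concat-∈⁻ L b in unique-head u (subst (_∈ L) (sym (meet (sub (here refl)) (sub (there m)) a q)) m))
    same : filt (λ x → cl x ≡ᵇ r) (range K) ↭ concatMap (orb r) M
    same = same-elements-↭ (unique-filt _ (range-unique K)) (uni M (unique-filt _ (range-unique K)) id) to from
      where
      from : ∀ {y} → y ∈ concatMap (orb r) M → y ∈ filt (λ x → cl x ≡ᵇ r) (range K)
      from m with concat-∈⁻ M m
      ... | i , a , b with domM a | orb-∈⁻ b
      ...   | d , h , _ | c , _ , refl = let u , v = it-dom c d in
              filt-∈⁺ _ (range K) (range-∈⁺ u v) (NP.≡⇒≡ᵇ _ _ (len-unique (has-cl (it-dom c d)) (hasLen-it c d h)))
      to : ∀ {y} → y ∈ filt (λ x → cl x ≡ᵇ r) (range K) → y ∈ concatMap (orb r) M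
      to {y} m with filt-∈⁻ (λ x → cl x ≡ᵇ r) (range K) m
      ... | a , t with range-∈⁻ a
      ...   | d with argmin (λ c → + it c y) {λ _ → T true} (λ _ → yes tt) r
      ...     | inj₁ none = ⊥-elim (none 1≤r tt)
      ...     | inj₂ (c , c<r , _ , min) = concat-∈⁺ M (filt-∈⁺ _ (range K) (range-∈⁺ (proj₁ di) (proj₂ di)) (T-∧ isMin (NP.≡⇒≡ᵇ _ _ (len-unique (has-cl di) hi))))
                 (subst (_∈ orb r i) ret (orb-it hi (r ∸ c)))
        where
        i = it c y
        hy : HasLen y r
        hy = subst (HasLen y) (NP.≡ᵇ⇒≡ (cl y) r t) (has-cl d)
        di = it-dom c d
        hi = hasLen-it c d hy
        ret : it (r ∸ c) i ≡ y
        ret = trans (sym (it-+ (r ∸ c) c y)) (trans (cong (λ z → it z y) (NP.m∸n+n≡m (NP.<⇒≤ c<r))) (closes hy))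
        isMin : T (isCycleMin p i)
        isMin = T-all _ (range K) (λ {e} _ → NP.≤⇒≤ᵇ (least (orb-∈⁻ (subst (_∈ orb r y) (it-+ e c y) (orb-it hy (e N.+ c))))))
          where
          least : ∀ {z} → (∃ λ e → e N.< r × z ≡ it e y) → i N.≤ z
          least (e , l , refl) = ℤP.drop‿+≤+ (min l tt)

  δ : Matrix
  δ a b = ⟦ f a ≡ᵇ b ⟧

  private
    _∈ᵇ_ : ℕ → List ℕ → Bool
    x ∈ᵇ S = any (x ≡ᵇ_) S

    -- With a permutation matrix, a single word can follow the letter a: the iterates of f. `ok`
    -- tests that its q letters can be drawn from S without repetition and that the next iterate is
    -- z.
    ok : ℕ → List ℕ → ℕ → ℕ → Bool
    ok zero S a z = f a ≡ᵇ z
    ok (suc q) S a z = (f a ∈ᵇ S) ∧ ok q (S − f a) (f a) z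

    path : ℕ → ℕ → List ℕ
    path zero a = []
    path (suc q) a = f a ∷ path q (f a)

    it-f : ∀ c a → it c (f a) ≡ f (it c a)
    it-f c a = trans (sym (it-+ c 1 a)) (cong (λ z → it z a) (NP.+-comm c 1))

    path-orb : ∀ q a → a ∷ path q a ≡ orb (suc q) a
    path-orb q a = trans (go q a) (sym (LP.map-applyUpTo id (λ c → it c a) (suc q)))
      where
      go : ∀ q a → a ∷ path q a ≡ applyUpTo (λ c → it c a) (suc q)
      go zero a = refl
      go (suc q) a = cong (a ∷_) (trans (go q (f a)) (upTo-ext (suc q) (λ c → it-f c a)))

    chain-sum : ∀ q S a z (g : List ℕ → ℤ) → Unique S → draw q S (λ t → chain δ a t z ℤ.* g t) ≡ ⟦ ok q S a z ⟧ ℤ.* g (path q a)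
    chain-sum zero S a z g u = refl
    chain-sum (suc q) S a z g u = trans (∑-cong S (λ b → trans (draw-cong′ q (S − b) (λ t → ℤP.*-assoc (δ a b) (chain δ b t z) (g (b ∷ t))))
        (trans (draw-*ˡ (δ a b) q (S − b) (λ t → chain δ b t z ℤ.* g (b ∷ t))) (cong (δ a b ℤ.*_) (chain-sum q (S − b) b z (g ∘ (b ∷_)) (unique-filt _ u))))))
      (pick′ (f a ∈ᵇ S) refl)
      where
      F : ℕ → ℤ
      F b = ⟦ ok q (S − b) b z ⟧ ℤ.* g (b ∷ path q b)
      pick′ : ∀ t → f a ∈ᵇ S ≡ t → ∑ S (λ b → δ a b ℤ.* F b) ≡ ⟦ t ∧ ok q (S − f a) (f a) z ⟧ ℤ.* g (f a ∷ path q (f a))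
      pick′ true e with any-T (f a ≡ᵇ_) S (≡⇒T e)
      ... | b , m , t = pick F u (subst (_∈ S) (sym (NP.≡ᵇ⇒≡ (f a) b t)) m)
      pick′ false e = trans (∑-zero∈ S (λ {b} m → trans (cong (λ t → ⟦ t ⟧ ℤ.* F b) (¬T⇒≡ (λ t → subst T e (T-any (f a ≡ᵇ_) S m t)))) (ℤP.*-zeroˡ (F b)))) (sym (ℤP.*-zeroˡ (g (f a ∷ path q (f a)))))

    ok⇒ : ∀ q S a z → T (ok q S a z) → it (suc q) a ≡ z × (∀ {c} → 1 N.≤ c → c N.≤ q → it c a ∈ S)
    ok⇒ zero S a z h = NP.≡ᵇ⇒≡ (f a) z h , λ 1≤c c≤0 → ⊥-elim (NP.<⇒≱ 1≤c c≤0)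
    ok⇒ (suc q) S a z h with ∧-T {f a ∈ᵇ S} h
    ... | h₁ , h₂ with any-T (f a ≡ᵇ_) S h₁ | ok⇒ q (S − f a) (f a) z h₂
    ...   | b , m , t | e , sub = trans (sym (it-f (suc q) a)) e , mem
      where
      mem : ∀ {c} → 1 N.≤ c → c N.≤ suc q → it c a ∈ S
      mem {suc zero} _ _ = subst (_∈ S) (sym (NP.≡ᵇ⇒≡ (f a) b t)) m
      mem {suc (suc c)} _ (s≤s l) = proj₁ (−-∈⁻ S (subst (_∈ S − f a) (it-f (suc c) a) (sub (s≤s z≤n) l)))

    ⇒ok : ∀ q S a z → it (suc q) a ≡ z → (∀ {c} → 1 N.≤ c → c N.≤ q → it c a ∈ S)
      → (∀ {c e} → 1 N.≤ c → c N.< e → e N.≤ q → it c a ≢ it e a) → T (ok q S a z)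
    ⇒ok zero S a z e sub dis = NP.≡⇒≡ᵇ (f a) z e
    ⇒ok (suc q) S a z e sub dis = T-∧ (T-any (f a ≡ᵇ_) S (sub (s≤s z≤n) (s≤s z≤n)) (≡ᵇ-refl (f a)))
      (⇒ok q (S − f a) (f a) z (trans (it-f (suc q) a) e)
        (λ {c} l l′ → subst (_∈ S − f a) (sym (it-f c a)) (−-∈⁺ S (sub {suc c} (s≤s z≤n) (s≤s l′)) (λ e → dis {1} {suc c} (s≤s z≤n) (s≤s l) (s≤s l′) (sym e))))
        (λ {c} {e′} l l′ l″ x → dis {suc c} {suc e′} (s≤s z≤n) (s≤s l′) (s≤s l″) (trans (sym (it-f c a)) (trans x (it-f e′ a)))))

  record Stable (S : List ℕ) : Set where
    field
      uniq   : Unique S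
      dom    : ∀ {x} → x ∈ S → Dom x
      closed : ∀ {x} → x ∈ S → f x ∈ S

  open Stable

  stable-it : ∀ {S} → Stable S → ∀ c {x} → x ∈ S → it c x ∈ S
  stable-it st zero m = m
  stable-it st (suc c) m = closed st (stable-it st c m)

  -- The only words with a nonzero cyclic product are the cycles of f, each written once from every
  -- one of its elements.
  draw-cycle : ∀ q {S} → Stable S → (h : List ℕ → ℤ)
    → draw (suc q) S (λ s → cyc δ s ℤ.* h s) ≡ ∑ S (λ x → ⟦ cl x ≡ᵇ suc q ⟧ ℤ.* h (orb (suc q) x))
  draw-cycle q {S} st h = ∑-cong∈ S (λ {x} m → trans (chain-sum q (S − x) x x (h ∘ (x ∷_)) (unique-filt _ (uniq st)))
      (cong₂ (λ b l → ⟦ b ⟧ ℤ.* h l) (bool-ext (to m) (from m)) (path-orb q x)))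
    where
    to : ∀ {x} → x ∈ S → T (ok q (S − x) x x) → T (cl x ≡ᵇ suc q)
    to {x} m t = let e , sub = ok⇒ q (S − x) x x t in NP.≡⇒≡ᵇ _ _ (len-unique (has-cl (dom st m))
      (record { pos = s≤s z≤n ; closes = e ; first = λ a b → proj₂ (−-∈⁻ S (sub a (N.s≤s⁻¹ b))) }))
    from : ∀ {x} → x ∈ S → T (cl x ≡ᵇ suc q) → T (ok q (S − x) x x)
    from {x} m t = ⇒ok q (S − x) x x (closes H) (λ {c} a b → −-∈⁺ S (stable-it st c m) (first H a (s≤s b)))
        (λ a b l → distinct-its (dom st m) H b (s≤s l))
      where
      H : HasLen x (suc q)
      H = subst (HasLen x) (NP.≡ᵇ⇒≡ (cl x) (suc q) t) (has-cl (dom st m))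

  Nc : List ℕ → ℕ → ℤ
  Nc S r = ∑ S (λ x → ⟦ cl x ≡ᵇ r ⟧)

  Match : List ℕ → List ℕ → Set
  Match S ρ = ∀ r → 1 N.≤ r → Nc S r ≡ + (r N.* multiplicity r ρ)

  module Remove {S} (st : Stable S) {x r} (x∈S : x ∈ S) (h : HasLen x r) where
    private d = dom st x∈S

    sub : ∀ {y} → y ∈ orb r x → y ∈ S
    sub m with orb-∈⁻ m
    ... | c , _ , refl = stable-it st c x∈S

    split : S ↭ orb r x ++ (S ∖ orb r x)
    split = perm-split (uniq st) (orb-unique d h) sub

    rest : Stable (S ∖ orb r x)
    rest = record { uniq = ∖-unique (orb r x) (uniq st) ; dom = λ m → dom st (proj₁ (∖-∈⁻ S (orb r x) m)) ; closed = cl′ }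
      where
      cl′ : ∀ {y} → y ∈ S ∖ orb r x → f y ∈ S ∖ orb r x
      cl′ {y} m with ∈-++⁻ (orb r x) (∈-resp-↭ split (closed st (proj₁ (∖-∈⁻ S (orb r x) m))))
      ... | inj₂ q = q
      ... | inj₁ q with orb-∈⁻ q
      ...   | c , l , e = ⊥-elim (proj₂ (∖-∈⁻ S (orb r x) m) (bad c e))
        where
        dy = dom st (proj₁ (∖-∈⁻ S (orb r x) m))
        pull : ∀ c → f y ≡ it (suc c) x → y ≡ it c x
        pull c e = let a , b = dy ; a′ , b′ = it-dom c d in inj a b a′ b′ e
        bad : ∀ c → f y ≡ it c x → y ∈ orb r x
        bad (suc c) e = subst (_∈ orb r x) (sym (pull c e)) (orb-it h c)
        bad zero e = last r (pos h) (closes h)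
          where
          last : ∀ r → 1 N.≤ r → it r x ≡ x → y ∈ orb r x
          last (suc r′) _ cr = subst (_∈ orb (suc r′) x) (sym (pull r′ (trans e (sym cr)))) (orb-∈⁺ r′ NP.≤-refl)

    rest-length : length S ≡ r N.+ length (S ∖ orb r x)
    rest-length = trans (↭-length split) (trans (LP.length-++ (orb r x)) (cong (N._+ length (S ∖ orb r x)) (orb-length r x)))

    Nc-split : ∀ q → Nc S q ≡ + r ℤ.* ⟦ r ≡ᵇ q ⟧ ℤ.+ Nc (S ∖ orb r x) q
    Nc-split q = trans (∑-↭ _ split) (trans (∑-++ (orb r x) (S ∖ orb r x) (λ y → ⟦ cl y ≡ᵇ q ⟧)) (cong (ℤ._+ Nc (S ∖ orb r x) q)
      (trans (∑-cong∈ (orb r x) (λ {y} m → cong (λ z → ⟦ z ≡ᵇ q ⟧) (eq m))) (trans (∑-const ⟦ r ≡ᵇ q ⟧ (orb r x)) (cong (λ z → + z ℤ.* ⟦ r ≡ᵇ q ⟧) (orb-length r x))))))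
      where
      eq : ∀ {y} → y ∈ orb r x → cl y ≡ r
      eq m with orb-∈⁻ m
      ... | c , _ , refl = len-unique (has-cl (it-dom c d)) (hasLen-it c d h)

    mult-split : ∀ ρ q → + (q N.* multiplicity q (r ∷ ρ)) ≡ + r ℤ.* ⟦ r ≡ᵇ q ⟧ ℤ.+ + (q N.* multiplicity q ρ)
    mult-split ρ q with r ≡ᵇ q in e
    ... | true = trans (cong +_ (NP.*-suc q (multiplicity q ρ))) (cong (ℤ._+ + (q N.* multiplicity q ρ)) (trans (cong +_ (sym (NP.≡ᵇ⇒≡ r q (≡⇒T e)))) (sym (ℤP.*-identityʳ (+ r)))))
    ... | false = sym (trans (cong (ℤ._+ + (q N.* multiplicity q ρ)) (ℤP.*-zeroʳ (+ r))) (ℤP.+-identityˡ _))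

    match⇒ : ∀ {ρ} → Match S (r ∷ ρ) → Match (S ∖ orb r x) ρ
    match⇒ {ρ} M q 1≤q = ∙-cancelˡ (+ r ℤ.* ⟦ r ≡ᵇ q ⟧) _ _ (trans (sym (Nc-split q)) (trans (M q 1≤q) (mult-split ρ q)))
      where
      ∙-cancelˡ : ∀ a b c → a ℤ.+ b ≡ a ℤ.+ c → b ≡ c
      ∙-cancelˡ a b c e = trans (sym (z a b)) (trans (cong (ℤ._+_ (- a)) e) (z a c))
        where
        z : ∀ a b → - a ℤ.+ (a ℤ.+ b) ≡ b
        z = solve-∀

    match⇐ : ∀ {ρ} → Match (S ∖ orb r x) ρ → Match S (r ∷ ρ)
    match⇐ {ρ} M q 1≤q = trans (Nc-split q) (trans (cong (ℤ._+_ (+ r ℤ.* ⟦ r ≡ᵇ q ⟧)) (M q 1≤q)) (sym (mult-split ρ q)))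

-- The constants z and fillings by cycles

∏-range-suc : ∀ m (F : ℕ → ℤ) → ∏ (range (suc m)) F ≡ ∏ (range m) F ℤ.* F (suc m)
∏-range-suc m F = trans (cong (λ l → ∏ (map suc l) F) (sym (LP.upTo-∷ʳ m))) (trans (cong (λ l → ∏ l F) (LP.map-++ suc (upTo m) (m ∷ [])))
  (trans (∏-++ (range m) (suc m ∷ []) F) (cong (∏ (range m) F ℤ.*_) (ℤP.*-identityʳ (F (suc m))))))

∏-range-extend : ∀ a b (F : ℕ → ℤ) → (∀ k → a N.< k → F k ≡ 1ℤ) → ∏ (range (b N.+ a)) F ≡ ∏ (range a) F
∏-range-extend a zero F h = refl
∏-range-extend a (suc b) F h = trans (∏-range-suc (b N.+ a) F) (trans (cong₂ ℤ._*_ (∏-range-extend a b F h) (h _ (s≤s (NP.m≤n+m a b)))) (ℤP.*-identityʳ _))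

∏-unit-except : ∀ {S : List ℕ} (c : ℤ) {r} → Unique S → r ∈ S → ∏ S (λ k → if r ≡ᵇ k then c else 1ℤ) ≡ c
∏-unit-except {x ∷ S} c {r} u (here refl) rewrite T⇒≡ (≡ᵇ-refl x) = trans (cong (c ℤ.*_) (trans (∏-cong∈ S (λ {y} m → cong (λ b → if b then c else 1ℤ) (¬T⇒≡ (λ t → unique-head u (subst (_∈ S) (sym (NP.≡ᵇ⇒≡ x y t)) m))))) (∏-1 S))) (ℤP.*-identityʳ c)
∏-unit-except {x ∷ S} c {r} u (there m) rewrite ¬T⇒≡ {r ≡ᵇ x} (λ t → unique-head u (subst (_∈ S) (NP.≡ᵇ⇒≡ r x t) m)) = trans (ℤP.*-identityˡ (∏ S (λ k → if r ≡ᵇ k then c else 1ℤ))) (∏-unit-except c (unique-tail u) m)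

zterm : List ℕ → ℕ → ℕ
zterm ρ k = (k ^ multiplicity k ρ) N.* (multiplicity k ρ) !

mult-big : ∀ ρ {k} → sum ρ N.< k → multiplicity k ρ ≡ 0
mult-big [] l = refl
mult-big (r ∷ ρ) {k} l with r ≡ᵇ k in e
... | true = ⊥-elim (NP.<-irrefl (NP.≡ᵇ⇒≡ r k (≡⇒T e)) (NP.≤-<-trans (NP.m≤m+n r (sum ρ)) l))
... | false = mult-big ρ (NP.≤-<-trans (NP.m≤n+m (sum ρ) r) l)

zee-∏ : ∀ b ρ → + zee ρ ≡ ∏ (range (b N.+ sum ρ)) (λ k → + zterm ρ k)
zee-∏ b ρ = trans (go (range (sum ρ))) (sym (∏-range-extend (sum ρ) b _ (λ k l → cong +_ (trans (cong (λ m → (k ^ m) N.* m !) (mult-big ρ l)) refl))))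
  where
  go : ∀ L → + foldr N._*_ 1 (map (zterm ρ) L) ≡ ∏ L (λ k → + zterm ρ k)
  go [] = refl
  go (x ∷ L) = trans (ℤP.pos-* (zterm ρ x) _) (cong (+ zterm ρ x ℤ.*_) (go L))

-- Only the factor at r changes, from r^a a! to r^(a+1) (a+1)!. The quotient r (a+1) is also the
-- number of elements on r-cycles in a permutation of cycle type r ∷ ρ, which is how it arises in
-- `count-rows`.
zee-∷ : ∀ r ρ → 1 N.≤ r → + zee (r ∷ ρ) ≡ + (r N.* multiplicity r (r ∷ ρ)) ℤ.* + zee ρ
zee-∷ r ρ 1≤r = trans (zee-∏ 0 (r ∷ ρ)) (trans (∏-cong (range (r N.+ sum ρ)) (λ k → pt k)) (trans (∏-* (range (r N.+ sum ρ)) (λ k → if r ≡ᵇ k then C else 1ℤ) _)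
   (cong₂ ℤ._*_ (∏-unit-except C (range-unique (r N.+ sum ρ)) (range-∈⁺ 1≤r (NP.m≤m+n r (sum ρ)))) (sym (zee-∏ r ρ)))))
  where
  C = + (r N.* multiplicity r (r ∷ ρ))
  alg : ∀ k m → + ((k N.* (k ^ m)) N.* ((suc m) N.* m !)) ≡ + (k N.* suc m) ℤ.* + ((k ^ m) N.* m !)
  alg k m = trans (cong +_ (trans (NP.*-assoc k (k ^ m) _) (trans (cong (k N.*_) (trans (sym (NP.*-assoc (k ^ m) (suc m) (m !))) (trans (cong (N._* m !) (NP.*-comm (k ^ m) (suc m))) (NP.*-assoc (suc m) (k ^ m) (m !))))) (sym (NP.*-assoc k (suc m) _))))) (ℤP.pos-* (k N.* suc m) _)
  pt : ∀ k → + zterm (r ∷ ρ) k ≡ (if r ≡ᵇ k then C else 1ℤ) ℤ.* + zterm ρ k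
  pt k with r ≡ᵇ k in e
  ... | false = sym (ℤP.*-identityˡ _)
  ... | true with NP.≡ᵇ⇒≡ r k (≡⇒T e)
  ...   | refl rewrite T⇒≡ (≡ᵇ-refl r) = alg r (multiplicity r ρ)

data Positive : List ℕ → Set where
  []  : Positive []
  _∷_ : ∀ {r ρ} → 1 N.≤ r → Positive ρ → Positive (r ∷ ρ)

module CycleRows (p : List ℕ) (inR : ∀ {x} → 1 N.≤ x → x N.≤ length p → 1 N.≤ at 0 p x × at 0 p x N.≤ length p)
  (inj : ∀ {x y} → 1 N.≤ x → x N.≤ length p → 1 N.≤ y → y N.≤ length p → at 0 p x ≡ at 0 p y → x ≡ y) where
  open Cycles p inR inj

  δrows : List ℕ → List (ℕ × Matrix)
  δrows = map (λ r → r , δ)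

  -- The first row takes a cycle of length r, started at any of its elements. Removing this cycle
  -- leaves a permutation that matches the remaining rows exactly when the whole one matched all
  -- rows; so the number of fillings obeys the recursion of z, or there are none.
  count-rows : ∀ ρ → Positive ρ → ∀ {S} → Stable S → length S ≡ sum ρ
    → (Match S ρ → draw (size (δrows ρ)) S (rowsProd (δrows ρ)) ≡ + zee ρ)
    × (¬ Match S ρ → draw (size (δrows ρ)) S (rowsProd (δrows ρ)) ≡ 0ℤ)
  count-rows [] P {[]} st e = (λ _ → refl) , λ n → ⊥-elim (n (λ r _ → cong +_ (sym (NP.*-zeroʳ r))))
  count-rows (suc q ∷ ρ) (_ ∷ P) {S} st e = matched , unmatched
    where
    r = suc q
    D : List ℕ → ℤ
    D s = draw (size (δrows ρ)) (S ∖ s) (rowsProd (δrows ρ))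
    expand : draw (size (δrows (r ∷ ρ))) S (rowsProd (δrows (r ∷ ρ))) ≡ ∑ S (λ x → ⟦ cl x ≡ᵇ r ⟧ ℤ.* D (orb r x))
    expand = trans (draw-rows r δ (δrows ρ) S) (draw-cycle q st D)
    H : ∀ {x} → x ∈ S → T (cl x ≡ᵇ r) → HasLen x r
    H {x} m t = subst (HasLen x) (NP.≡ᵇ⇒≡ (cl x) r t) (has-cl (Stable.dom st m))
    ih : ∀ {x} (m : x ∈ S) (t : T (cl x ≡ᵇ r)) → (Match (S ∖ orb r x) ρ → D (orb r x) ≡ + zee ρ) × (¬ Match (S ∖ orb r x) ρ → D (orb r x) ≡ 0ℤ)
    ih {x} m t = count-rows ρ P (Remove.rest st m (H m t)) (NP.+-cancelˡ-≡ r _ _ (trans (sym (Remove.rest-length st m (H m t))) e))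
    weigh : ∀ {x} c → (T (cl x ≡ᵇ r) → D (orb r x) ≡ c) → ⟦ cl x ≡ᵇ r ⟧ ℤ.* D (orb r x) ≡ ⟦ cl x ≡ᵇ r ⟧ ℤ.* c
    weigh {x} c h with cl x ≡ᵇ r
    ... | true = cong (1ℤ ℤ.*_) (h tt)
    ... | false = trans (ℤP.*-zeroˡ (D (orb r x))) (sym (ℤP.*-zeroˡ c))
    matched : Match S (r ∷ ρ) → draw (size (δrows (r ∷ ρ))) S (rowsProd (δrows (r ∷ ρ))) ≡ + zee (r ∷ ρ)
    matched M = trans expand (trans (∑-cong∈ S (λ {x} m → weigh (+ zee ρ) (λ t → proj₁ (ih m t) (Remove.match⇒ st m (H m t) {ρ} M))))
      (trans (∑-*ʳ (+ zee ρ) S (λ x → ⟦ cl x ≡ᵇ r ⟧)) (trans (cong (ℤ._* + zee ρ) (M r (s≤s z≤n))) (sym (zee-∷ r ρ (s≤s z≤n))))))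
    unmatched : ¬ Match S (r ∷ ρ) → draw (size (δrows (r ∷ ρ))) S (rowsProd (δrows (r ∷ ρ))) ≡ 0ℤ
    unmatched nM = trans expand (∑-zero∈ S (λ {x} m → trans (weigh 0ℤ (λ t → proj₂ (ih m t) (λ M′ → nM (Remove.match⇐ st m (H m t) {ρ} M′)))) (ℤP.*-zeroʳ ⟦ cl x ≡ᵇ r ⟧)))

  range-stable : Stable (range K)
  range-stable = record { uniq = range-unique K ; dom = range-∈⁻ ; closed = λ m → let a , b = range-∈⁻ m ; c , d = inR a b in range-∈⁺ c d }

  ψ-count : ∀ ρ → Positive ρ → sum ρ ≡ K → ψ ρ p ≡ draw (size (δrows ρ)) (range K) (rowsProd (δrows ρ))
  ψ-count ρ P e with hasCycleType p ρ in eq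
  ... | true = sym (proj₁ (count-rows ρ P range-stable (trans (range-length K) (sym e))) M)
    where
    M : Match (range K) ρ
    M r 1≤r with r N.≤? K N.+ sum ρ
    ... | yes l = trans (cycle-count r 1≤r) (trans (cong (λ z → + r ℤ.* + z) (NP.≡ᵇ⇒≡ _ _ (all-T _ (range (K N.+ sum ρ)) (≡⇒T eq) (range-∈⁺ 1≤r l)))) (sym (ℤP.pos-* r _)))
    -- Beyond the lengths tested by `hasCycleType` there are neither cycles nor parts, so both
    -- counts are 0.
    ... | no l = trans (∑-zero∈ (range K) (λ {x} m → cong ⟦_⟧ (¬T⇒≡ (λ t → l (NP.≤-trans (subst (N._≤ K) (NP.≡ᵇ⇒≡ (cl x) r t) (proj₂ (cyc-len (range-∈⁻ m)))) (NP.m≤m+n K (sum ρ)))))))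
        (sym (cong +_ (trans (cong (r N.*_) (mult-big ρ (NP.≤-<-trans (NP.m≤n+m (sum ρ) K) (NP.≰⇒> l)))) (NP.*-zeroʳ r))))
  ... | false = sym (proj₂ (count-rows ρ P range-stable (trans (range-length K) (sym e))) nM)
    where
    nM : ¬ Match (range K) ρ
    nM M = subst T eq (T-all _ (range (K N.+ sum ρ)) (λ {r} m → NP.≡⇒≡ᵇ _ _ (eq′ r (proj₁ (range-∈⁻ m)))))
      where
      eq′ : ∀ r → 1 N.≤ r → multiplicity r (cycleType p) ≡ multiplicity r ρ
      eq′ (suc r) 1≤r = NP.*-cancelˡ-≡ _ _ (suc r) (ℤP.+-injective (trans (ℤP.pos-* (suc r) _) (trans (sym (cycle-count (suc r) 1≤r)) (M (suc r) 1≤r))))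

-- Inversions

<ℤ-true : ∀ {a b} → a < b → (a <ℤ b) ≡ true
<ℤ-true h = T⇒≡ (fromWitness h)

<ℤ-false : ∀ {a b} → ¬ (a < b) → (a <ℤ b) ≡ false
<ℤ-false h = ¬T⇒≡ (λ t → h (toWitness t))

⟦⟧-mono : ∀ {a b} → (T a → T b) → ⟦ a ⟧ ≤ ⟦ b ⟧
⟦⟧-mono {true} {true} h = ℤP.≤-refl
⟦⟧-mono {true} {false} h = ⊥-elim (h tt)
⟦⟧-mono {false} {true} h = ℤ.+≤+ z≤n
⟦⟧-mono {false} {false} h = ℤP.≤-refl

∑-mono : ∀ {A : Set} (xs : List A) {f g : A → ℤ} → (∀ {x} → x ∈ xs → f x ≤ g x) → ∑ xs f ≤ ∑ xs g
∑-mono [] h = ℤP.≤-refl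
∑-mono (x ∷ xs) h = ℤP.+-mono-≤ (h (here refl)) (∑-mono xs (h ∘ there))

inverted : (ℤ → ℤ) → ℤ → ℤ → ℤ
inverted f a b = ⟦ a <ℤ b ⟧ ℤ.* ⟦ f b <ℤ f a ⟧

-- The list of positions is a parameter because inversions are counted both over the labels and over
-- the labels together with 0.
inv : List ℤ → (ℤ → ℤ) → ℤ
inv L f = ∑ L (λ a → ∑ L (λ b → inverted f a b))

inv-↭ : ∀ {L L′} f → L ↭ L′ → inv L f ≡ inv L′ f
inv-↭ {L} {L′} f p = trans (∑-cong L (λ a → ∑-↭ (inverted f a) p)) (∑-↭ _ p)

inv-cong : ∀ L {f g} → (∀ {x} → x ∈ L → f x ≡ g x) → inv L f ≡ inv L g
inv-cong L h = ∑-cong∈ L (λ {a} p → ∑-cong∈ L (λ {b} q → cong₂ (λ x y → ⟦ a <ℤ b ⟧ ℤ.* ⟦ y <ℤ x ⟧) (h p) (h q)))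

private
  cross : (ℤ → ℤ) → ℤ → ℤ → ℤ → ℤ
  cross f i j a = (inverted f i a ℤ.+ inverted f j a) ℤ.+ (inverted f a i ℤ.+ inverted f a j)

  inv-split : ∀ f i j L → inv (i ∷ j ∷ L) f ≡
    ((inverted f i i ℤ.+ inverted f i j) ℤ.+ (inverted f j i ℤ.+ inverted f j j)) ℤ.+ (∑ L (cross f i j) ℤ.+ inv L f)
  inv-split f i j L =
    trans (cong (λ z → (inverted f i i ℤ.+ (inverted f i j ℤ.+ P)) ℤ.+ ((inverted f j i ℤ.+ (inverted f j j ℤ.+ Q)) ℤ.+ z))
       (trans (∑-cong L (λ a → sym (ℤP.+-assoc (inverted f a i) (inverted f a j) (∑ L (inverted f a)))))
              (∑-+ L (λ a → inverted f a i ℤ.+ inverted f a j) (λ a → ∑ L (inverted f a)))))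
    (trans (z₁ (inverted f i i) (inverted f i j) P (inverted f j i) (inverted f j j) Q V (inv L f))
      (cong (λ z → ((inverted f i i ℤ.+ inverted f i j) ℤ.+ (inverted f j i ℤ.+ inverted f j j)) ℤ.+ (z ℤ.+ inv L f))
        (sym (trans (∑-+ L (λ a → inverted f i a ℤ.+ inverted f j a) (λ a → inverted f a i ℤ.+ inverted f a j))
                    (cong (ℤ._+ V) (∑-+ L (inverted f i) (inverted f j)))))))
    where
    P = ∑ L (inverted f i)
    Q = ∑ L (inverted f j)
    V = ∑ L (λ a → inverted f a i ℤ.+ inverted f a j)
    z₁ : ∀ a b p c d q r s → (a ℤ.+ (b ℤ.+ p)) ℤ.+ ((c ℤ.+ (d ℤ.+ q)) ℤ.+ (r ℤ.+ s)) ≡ ((a ℤ.+ b) ℤ.+ (c ℤ.+ d)) ℤ.+ ((p ℤ.+ q ℤ.+ r) ℤ.+ s)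
    z₁ = solve-∀

  inverted-no : ∀ f {a b} → ¬ (a < b) → inverted f a b ≡ 0ℤ
  inverted-no f {a} {b} h = trans (cong (λ z → ⟦ z ⟧ ℤ.* ⟦ f b <ℤ f a ⟧) (<ℤ-false h)) (ℤP.*-zeroˡ ⟦ f b <ℤ f a ⟧)

  inverted-yes : ∀ f {a b} → a < b → inverted f a b ≡ ⟦ f b <ℤ f a ⟧
  inverted-yes f {a} {b} h = trans (cong (λ z → ⟦ z ⟧ ℤ.* ⟦ f b <ℤ f a ⟧) (<ℤ-true h)) (ℤP.*-identityˡ ⟦ f b <ℤ f a ⟧)

  -- A position a outside the range from i to j sees the two values in exchanged places, with the
  -- same total. For a between them, each of its two comparisons can only become inverted.
  cross-mono : ∀ f g {i j} a → i < j → a ≢ i → a ≢ j → f i < f j → g i ≡ f j → g j ≡ f i → g a ≡ f a → cross f i j a ≤ cross g i j a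
  cross-mono f g {i} {j} a i<j a≢i a≢j h gi gj ga with ℤP.<-cmp a i | ℤP.<-cmp a j
  ... | tri≈ _ e _ | _ = ⊥-elim (a≢i e)
  ... | _ | tri≈ _ e _ = ⊥-elim (a≢j e)
  ... | tri< l _ _ | tri> _ _ m = ⊥-elim (ℤP.<-asym i<j (ℤP.<-trans m l))
  ... | tri< l n _ | tri< m n′ _ = ℤP.≤-reflexive (trans (val f) (trans (trans (ℤP.+-comm ⟦ f i <ℤ f a ⟧ ⟦ f j <ℤ f a ⟧)
          (cong₂ ℤ._+_ (cong₂ (λ x y → ⟦ x <ℤ y ⟧) (sym gi) (sym ga)) (cong₂ (λ x y → ⟦ x <ℤ y ⟧) (sym gj) (sym ga)))) (sym (val g))))
    where
    val : ∀ f → cross f i j a ≡ ⟦ f i <ℤ f a ⟧ ℤ.+ ⟦ f j <ℤ f a ⟧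
    val f = trans (cong₂ ℤ._+_ (cong₂ ℤ._+_ (inverted-no f (ℤP.<-asym l)) (inverted-no f (ℤP.<-asym m))) (cong₂ ℤ._+_ (inverted-yes f l) (inverted-yes f m)))
              (ℤP.+-identityˡ (⟦ f i <ℤ f a ⟧ ℤ.+ ⟦ f j <ℤ f a ⟧))
  ... | tri> _ _ l | tri> _ _ m = ℤP.≤-reflexive (trans (val f) (trans (trans (ℤP.+-comm ⟦ f a <ℤ f i ⟧ ⟦ f a <ℤ f j ⟧)
          (cong₂ ℤ._+_ (cong₂ (λ x y → ⟦ y <ℤ x ⟧) (sym gi) (sym ga)) (cong₂ (λ x y → ⟦ y <ℤ x ⟧) (sym gj) (sym ga)))) (sym (val g))))
    where
    val : ∀ f → cross f i j a ≡ ⟦ f a <ℤ f i ⟧ ℤ.+ ⟦ f a <ℤ f j ⟧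
    val f = trans (cong₂ ℤ._+_ (cong₂ ℤ._+_ (inverted-yes f l) (inverted-yes f m)) (cong₂ ℤ._+_ (inverted-no f (ℤP.<-asym l)) (inverted-no f (ℤP.<-asym m))))
              (ℤP.+-identityʳ (⟦ f a <ℤ f i ⟧ ℤ.+ ⟦ f a <ℤ f j ⟧))
  ... | tri> _ _ l | tri< m _ _ = subst₂ _≤_ (sym (val f)) (trans (cong₂ ℤ._+_ (cong₂ (λ x y → ⟦ y <ℤ x ⟧) (sym gi) (sym ga)) (cong₂ (λ x y → ⟦ x <ℤ y ⟧) (sym gj) (sym ga))) (sym (val g)))
         (ℤP.+-mono-≤ (⟦⟧-mono {f a <ℤ f i} {f a <ℤ f j} (λ t → fromWitness (ℤP.<-trans (toWitness t) h)))
                      (⟦⟧-mono {f j <ℤ f a} {f i <ℤ f a} (λ t → fromWitness (ℤP.<-trans h (toWitness t)))))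
    where
    z : ∀ x y → (x ℤ.+ 0ℤ) ℤ.+ (0ℤ ℤ.+ y) ≡ x ℤ.+ y
    z = solve-∀
    val : ∀ f → cross f i j a ≡ ⟦ f a <ℤ f i ⟧ ℤ.+ ⟦ f j <ℤ f a ⟧
    val f = trans (cong₂ ℤ._+_ (cong₂ ℤ._+_ (inverted-yes f l) (inverted-no f (ℤP.<-asym m))) (cong₂ ℤ._+_ (inverted-no f (ℤP.<-asym l)) (inverted-yes f m)))
              (z ⟦ f a <ℤ f i ⟧ ⟦ f j <ℤ f a ⟧)

-- The pair i, j itself becomes inverted, no third position loses inversions by `cross-mono`, and
-- pairs avoiding i and j are not affected.
inv-swap : ∀ {L} f {i j} → Unique L → i ∈ L → j ∈ L → i < j → f i < f j → inv L f < inv L (f ∘ swapL i j)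
inv-swap {L} f {i} {j} u pi pj i<j h with ∈-∃++ pi
... | as , bs , refl with ∈-resp-↭ (shift i as bs) pj
...   | here refl = ⊥-elim (ℤP.<-irrefl refl i<j)
...   | there pj′ with ∈-∃++ pj′
...     | as′ , bs′ , e = subst₂ _<_ (sym (inv-↭ f q)) (sym (inv-↭ g q)) (subst₂ _<_ (sym (inv-split f i j R)) (sym (inv-split g i j R))
           (ℤP.+-mono-<-≤ corner (ℤP.+-mono-≤ (∑-mono R (λ {a} m → cross-mono f g a i<j (a≢i m) (a≢j m) h gi gj (ga m))) (ℤP.≤-reflexive (inv-cong R (sym ∘ ga))))))
  where
  g = f ∘ swapL i j
  R = as′ ++ bs′
  q : as ++ i ∷ bs ↭ i ∷ j ∷ R
  q = ↭-trans (shift i as bs) (prep i (subst (_↭ j ∷ R) (sym e) (shift j as′ bs′)))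
  u′ : Unique (i ∷ j ∷ R)
  u′ = unique-↭ q u
  a≢i : ∀ {a} → a ∈ R → a ≢ i
  a≢i m refl = unique-head u′ (there m)
  a≢j : ∀ {a} → a ∈ R → a ≢ j
  a≢j m refl = unique-head (unique-tail u′) m
  gi : g i ≡ f j
  gi = cong f (swapL-left i j)
  gj : g j ≡ f i
  gj = cong f (swapL-right i j)
  ga : ∀ {a} → a ∈ R → g a ≡ f a
  ga m = cong f (swapL-other i j (a≢i m) (a≢j m))
  val : ∀ f → (inverted f i i ℤ.+ inverted f i j) ℤ.+ (inverted f j i ℤ.+ inverted f j j) ≡ ⟦ f j <ℤ f i ⟧
  val f = trans (cong₂ ℤ._+_ (cong₂ ℤ._+_ (inverted-no f {i} {i} (ℤP.<-irrefl refl)) (inverted-yes f i<j)) (cong₂ ℤ._+_ (inverted-no f (ℤP.<-asym i<j)) (inverted-no f {j} {j} (ℤP.<-irrefl refl))))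
     (z ⟦ f j <ℤ f i ⟧)
    where
    z : ∀ x → (0ℤ ℤ.+ x) ℤ.+ (0ℤ ℤ.+ 0ℤ) ≡ x
    z = solve-∀
  corner : (inverted f i i ℤ.+ inverted f i j) ℤ.+ (inverted f j i ℤ.+ inverted f j j) < (inverted g i i ℤ.+ inverted g i j) ℤ.+ (inverted g j i ℤ.+ inverted g j j)
  corner = subst₂ _<_ (sym (trans (val f) (cong ⟦_⟧ (<ℤ-false (ℤP.<-asym h))))) (sym (trans (val g) (cong ⟦_⟧ (trans (cong₂ _<ℤ_ gj gi) (<ℤ-true h))))) (ℤ.+<+ (s≤s z≤n))

pairsLt-∈⁻ : ∀ {n i j} → (i , j) ∈ pairsLt n → 1 N.≤ i × i N.< j × j N.≤ n
pairsLt-∈⁻ {n} {i} {j} m = go (range n) m id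
  where
  go : ∀ R → (i , j) ∈ concatMap (λ i → map (i ,_) (filt (i <ᵇ_) (range n))) R → (∀ {x} → x ∈ R → x ∈ range n) → 1 N.≤ i × i N.< j × j N.≤ n
  go (x ∷ R) m h with ∈-++⁻ (map (x ,_) (filt (x <ᵇ_) (range n))) m
  ... | inj₂ q = go R q (h ∘ there)
  ... | inj₁ q with ∈-map⁻ (x ,_) q
  ...   | y , k , refl = let a , b = filt-∈⁻ (x <ᵇ_) (range n) k in proj₁ (range-∈⁻ (h (here refl))) , NP.<ᵇ⇒< x y b , proj₂ (range-∈⁻ a)

pairsLt-∈⁺ : ∀ {n i j} → 1 N.≤ i → i N.< j → j N.≤ n → (i , j) ∈ pairsLt n
pairsLt-∈⁺ {n} {i} {j} a b c = go (range n) (range-∈⁺ a (NP.≤-trans (NP.<⇒≤ b) c))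
  where
  go : ∀ R → i ∈ R → (i , j) ∈ concatMap (λ i → map (i ,_) (filt (i <ᵇ_) (range n))) R
  go (x ∷ R) (here refl) = ∈-++⁺ˡ (∈-map⁺ (x ,_) (filt-∈⁺ (x <ᵇ_) (range n) (range-∈⁺ (NP.≤-trans a (NP.<⇒≤ b)) c) (NP.<⇒<ᵇ b)))
  go (x ∷ R) (there m) = ∈-++⁺ʳ (map (x ,_) (filt (x <ᵇ_) (range n))) (go R m)

∑-pairsLt : ∀ n (F : ℕ × ℕ → ℤ) → ∑ (pairsLt n) F ≡ ∑ (range n) (λ i → ∑ (range n) (λ j → ⟦ i <ᵇ j ⟧ ℤ.* F (i , j)))
∑-pairsLt n F = trans (∑-concatMap _ (range n) F) (∑-cong (range n) (λ i → trans (∑-map (i ,_) (filt (i <ᵇ_) (range n)) F) (∑-filt (i <ᵇ_) (range n) (λ j → F (i , j)))))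

at-mono : ∀ {A : Set} {R : A → A → Set} (z : A) {xs : List A} → AllPairs R xs → ∀ {i j} → 1 N.≤ i → i N.< j → j N.≤ length xs → R (at z xs i) (at z xs j)
at-mono z {x ∷ xs} (a ∷ _) {suc zero} {suc (suc j)} _ _ (s≤s l) = All.lookup a (at-∈ z xs (s≤s z≤n) l)
at-mono z {x ∷ xs} (_ ∷ s) {suc (suc i)} {suc (suc j)} _ (s≤s l) (s≤s l′) = at-mono z s (s≤s z≤n) l l′
at-mono z {x ∷ xs} _ {suc zero} {suc zero} _ (s≤s ()) _
at-mono z {x ∷ xs} _ {suc (suc i)} {suc zero} _ (s≤s ()) _
at-mono z {[]} _ {suc i} {suc j} _ _ ()

allPairs-reverse : ∀ {A : Set} {R : A → A → Set} {xs : List A} → AllPairs R xs → AllPairs (λ x y → R y x) (reverse xs)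
allPairs-reverse {xs = []} _ = []
allPairs-reverse {R = R} {xs = x ∷ xs} (a ∷ s) = subst (AllPairs (λ x y → R y x)) (sym (LP.unfold-reverse x xs))
  (APP.++⁺ (allPairs-reverse s) ([] ∷ []) (All.tabulate (λ m → All.lookup a (∈-resp-↭ (↭-reverse xs) m) ∷ [])))

labels-sorted : ∀ n → AllPairs _<_ (labels n)
labels-sorted n = APP.++⁺ (allPairs-reverse (APP.map⁺ (APP.map⁺ (APP.applyUpTo⁺₁ id n (λ l _ → ℤP.neg-mono-< (ℤ.+<+ (s≤s l)))))))
  (APP.map⁺ (APP.map⁺ (APP.applyUpTo⁺₁ id n (λ l _ → ℤ.+<+ (s≤s l)))))
  (All.tabulate (λ p → All.tabulate (λ q → lt (∈-resp-↭ (↭-reverse (negs n)) p) q)))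
  where
  lt : ∀ {x y} → x ∈ negs n → y ∈ map +_ (range n) → x < y
  lt p q with ∈-map⁻ (λ i → - (+ i)) p | ∈-map⁻ +_ q
  ... | suc a , _ , refl | b , _ , refl = ℤ.-<+
  ... | zero , m , _ | _ with range-∈⁻ m
  ...   | () , _

labels-length : ∀ n → length (labels n) ≡ 2 N.* n
labels-length n = trans (LP.length-++ (reverse (negs n))) (cong₂ N._+_ (trans (LP.length-reverse (negs n)) (trans (LP.length-map _ (range n)) (range-length n)))
  (trans (LP.length-map +_ (range n)) (trans (range-length n) (sym (NP.+-identityʳ n)))))

∑-at : ∀ (L : List ℤ) (G : ℤ → ℤ) → ∑ L G ≡ ∑ (range (length L)) (λ i → G (at (+ 0) L i))
∑-at L G = trans (cong (λ l → ∑ l G) (sym (map-at-range (+ 0) L))) (∑-map (at (+ 0) L) (range (length L)) G)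

invA-inv : ∀ n u → + invA n u ≡ inv (labels n) u
invA-inv n u = trans (countP-∑ _ (pairsLt (2 N.* n))) (trans (∑-pairsLt (2 N.* n) _)
  (sym (subst (λ N → inv L u ≡ ∑ (range N) (λ i → ∑ (range N) (λ j → ⟦ i <ᵇ j ⟧ ℤ.* ⟦ u (at (+ 0) L j) <ℤ u (at (+ 0) L i) ⟧))) (labels-length n)
    (trans (∑-at L _) (∑-cong∈ (range (length L)) (λ {i} p → trans (∑-at L _) (∑-cong∈ (range (length L)) (λ {j} q →
      cong (λ b → ⟦ b ⟧ ℤ.* ⟦ u (at (+ 0) L j) <ℤ u (at (+ 0) L i) ⟧) (ord i j (range-∈⁻ p) (range-∈⁻ q))))))))))
  where
  L = labels n
  ord : ∀ i j → 1 N.≤ i × i N.≤ length L → 1 N.≤ j × j N.≤ length L → (at (+ 0) L i <ℤ at (+ 0) L j) ≡ (i <ᵇ j)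
  ord i j (a , b) (a′ , b′) with NP.<-cmp i j
  ... | tri< l _ _ = trans (<ℤ-true (at-mono (+ 0) (labels-sorted n) a l b′)) (sym (T⇒≡ (NP.<⇒<ᵇ l)))
  ... | tri≈ h refl _ = trans (<ℤ-false (ℤP.<-irrefl refl)) (sym (¬T⇒≡ (λ t → h (NP.<ᵇ⇒< i i t))))
  ... | tri> h _ l = trans (<ℤ-false (ℤP.<-asym (at-mono (+ 0) (labels-sorted n) a′ l b))) (sym (¬T⇒≡ (λ t → h (NP.<ᵇ⇒< i j t))))

-- Inserting the fixed point 0 into the full word adds two inversions for each negative entry; this is
-- what makes four times the Coxeter length a sum of two inversion numbers (lenB-inv).

module _ {n : ℕ} (v : List ℤ) (len : length v ≡ n) where
  private
    R = range n
    v′ : ℕ → ℤ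
    v′ i = at (+ 0) v i
    f = app v
    Q G H : ℕ → ℕ → ℤ
    G i j = ⟦ i <ᵇ j ⟧ ℤ.* ⟦ v′ j <ℤ v′ i ⟧
    H i j = ⟦ (v′ i ℤ.+ v′ j) <ℤ + 0 ⟧
    Q i j = ⟦ i <ᵇ j ⟧ ℤ.* H i j
    ng : ℕ → ℤ
    ng i = ⟦ v′ i <ℤ + 0 ⟧
    ∑∑ : (ℕ → ℕ → ℤ) → ℤ
    ∑∑ F = ∑ R (λ i → ∑ R (F i))

    <ℤ-iff : ∀ {a b c d} → (a < b → c < d) → (c < d → a < b) → (a <ℤ b) ≡ (c <ℤ d)
    <ℤ-iff {a} {b} {c} {d} p q = bool-ext (λ t → fromWitness (p (toWitness t))) (λ t → fromWitness (q (toWitness t)))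

    neg< : ∀ a b → a < - b → b ℤ.+ a < + 0
    neg< a b h = subst (b ℤ.+ a <_) (ℤP.+-inverseʳ b) (ℤP.+-monoʳ-< b h)
    <neg : ∀ a b → b ℤ.+ a < + 0 → a < - b
    <neg a b h = subst₂ _<_ (e a b) (ℤP.+-identityʳ (- b)) (ℤP.+-monoʳ-< (- b) h)
      where
      e : ∀ a b → - b ℤ.+ (b ℤ.+ a) ≡ a
      e = solve-∀

    f+ : ∀ {i} → 1 N.≤ i → f (+ i) ≡ v′ i
    f+ = app-+ v
    f- : ∀ {i} → 1 N.≤ i → f (- + i) ≡ - v′ i
    f- {suc i} _ = refl

    -<- : ∀ {i j} → - + i < - + j → j N.< i
    -<- {i} {j} h with ℤP.neg-cancel-< h
    ... | ℤ.+<+ l = l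

    -- Among the four choices of signs, the pair -i, -j repeats the comparison of i and j in
    -- reverse, the positions i, -j are in the wrong order to count, and -i, j is inverted exactly
    -- when the two values have a negative sum: the origin of the second statistic in the Coxeter
    -- length, and for i = j of the third.
    block : ∀ {i j} → i ∈ R → j ∈ R →
      (inverted f (+ i) (+ j) ℤ.+ inverted f (+ i) (- + j)) ℤ.+ (inverted f (- + i) (+ j) ℤ.+ inverted f (- + i) (- + j))
      ≡ (G i j ℤ.+ G j i) ℤ.+ H i j
    block {i} {j} p q = trans (cong₂ ℤ._+_ (cong₂ ℤ._+_ e₁ (inverted-no f {+ i} { - + j} no′)) (cong₂ ℤ._+_ (trans (inverted-yes f { - + i} {+ j} yes′) e₃) e₄)) (z (G i j) (G j i) (H i j))
      where
      a = proj₁ (range-∈⁻ p)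
      b = proj₁ (range-∈⁻ q)
      z : ∀ x y w → (x ℤ.+ 0ℤ) ℤ.+ (w ℤ.+ y) ≡ (x ℤ.+ y) ℤ.+ w
      z = solve-∀
      no′ : ¬ (+ i < - + j)
      no′ h = ℤP.<-irrefl refl (ℤP.≤-<-trans (ℤ.+≤+ z≤n) (ℤP.<-≤-trans h (ℤP.neg-mono-≤ (ℤ.+≤+ z≤n))))
      yes′ : - + i < + j
      yes′ = ℤP.≤-<-trans (ℤP.neg-mono-≤ (ℤ.+≤+ {0} z≤n)) (ℤ.+<+ b)
      e₁ : inverted f (+ i) (+ j) ≡ G i j
      e₁ = cong₂ (λ x y → ⟦ x ⟧ ℤ.* ⟦ y ⟧) (bool-ext {+ i <ℤ + j} {i <ᵇ j} (λ t → NP.<⇒<ᵇ (ℤP.drop‿+<+ (toWitness {a? = + i ℤ.<? + j} t))) (λ t → fromWitness (ℤ.+<+ (NP.<ᵇ⇒< i j t))))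
             (cong₂ _<ℤ_ (f+ b) (f+ a))
      e₃ : ⟦ f (+ j) <ℤ f (- + i) ⟧ ≡ H i j
      e₃ = cong ⟦_⟧ (trans (cong₂ _<ℤ_ (f+ b) (f- a)) (<ℤ-iff (neg< (v′ j) (v′ i)) (<neg (v′ j) (v′ i))))
      e₄ : inverted f (- + i) (- + j) ≡ G j i
      e₄ = cong₂ (λ x y → ⟦ x ⟧ ℤ.* ⟦ y ⟧) (bool-ext { - + i <ℤ - + j} {j <ᵇ i} (λ t → NP.<⇒<ᵇ (-<- (toWitness {a? = - + i ℤ.<? - + j} t))) (λ t → fromWitness (ℤP.neg-mono-< (ℤ.+<+ (NP.<ᵇ⇒< j i t)))))
             (trans (cong₂ _<ℤ_ (f- b) (f- a)) (<ℤ-iff ℤP.neg-cancel-< ℤP.neg-mono-<))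

    diagonal : ∀ {i} → H i i ≡ ng i
    diagonal {i} = cong ⟦_⟧ (<ℤ-iff (λ h → ℤP.≰⇒> (λ q → ℤP.<-irrefl refl (ℤP.≤-<-trans (ℤP.+-mono-≤ q q) h))) (λ h → ℤP.+-mono-< h h))

    trich : ∀ i {j} → ⟦ i <ᵇ j ⟧ ℤ.+ ⟦ j <ᵇ i ⟧ ℤ.+ ⟦ i ≡ᵇ j ⟧ ≡ 1ℤ
    trich i {j} with NP.<-cmp i j
    ... | tri< l ne m rewrite T⇒≡ (NP.<⇒<ᵇ l) | ¬T⇒≡ (λ t → m (NP.<ᵇ⇒< j i t)) | ¬T⇒≡ (λ t → ne (NP.≡ᵇ⇒≡ i j t)) = refl
    ... | tri≈ l refl m rewrite ¬T⇒≡ (λ t → l (NP.<ᵇ⇒< i i t)) | T⇒≡ (NP.≡⇒≡ᵇ i i refl) = refl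
    ... | tri> l ne m rewrite ¬T⇒≡ (λ t → l (NP.<ᵇ⇒< i j t)) | T⇒≡ (NP.<⇒<ᵇ m) | ¬T⇒≡ (λ t → ne (NP.≡ᵇ⇒≡ i j t)) = refl

    ∑-+₃ : (S : List ℕ) (a b c : ℕ → ℤ) → ∑ S (λ i → (a i ℤ.+ b i) ℤ.+ c i) ≡ (∑ S a ℤ.+ ∑ S b) ℤ.+ ∑ S c
    ∑-+₃ S a b c = trans (∑-+ S (λ i → a i ℤ.+ b i) c) (cong (ℤ._+ ∑ S c) (∑-+ S a b))

    Q′ D : ℕ → ℕ → ℤ
    Q′ i j = ⟦ j <ᵇ i ⟧ ℤ.* H i j
    D i j = ⟦ i ≡ᵇ j ⟧ ℤ.* H i j

    H-split : ∑∑ H ≡ (∑∑ Q ℤ.+ ∑∑ Q) ℤ.+ ∑ R ng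
    H-split = trans (∑-cong R (λ i → trans (∑-cong R (λ j → trans (sym (ℤP.*-identityˡ (H i j)))
                    (trans (cong (ℤ._* H i j) (sym (trich i {j}))) (z ⟦ i <ᵇ j ⟧ ⟦ j <ᵇ i ⟧ ⟦ i ≡ᵇ j ⟧ (H i j)))))
                 (∑-+₃ R (Q i) (Q′ i) (D i))))
       (trans (∑-+₃ R (λ i → ∑ R (Q i)) (λ i → ∑ R (Q′ i)) (λ i → ∑ R (D i)))
         (cong₂ ℤ._+_ (cong (ℤ._+_ (∑∑ Q)) (trans (∑-swap R R Q′) (∑-cong R (λ j → ∑-cong R (λ i → cong (λ z → ⟦ j <ᵇ i ⟧ ℤ.* ⟦ z <ℤ + 0 ⟧) (ℤP.+-comm (v′ i) (v′ j)))))))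
           (∑-cong∈ R (λ {i} p → trans (pick (H i) (range-unique n) p) (diagonal {i})))))
      where
      z : ∀ a b c h → (a ℤ.+ b ℤ.+ c) ℤ.* h ≡ (a ℤ.* h ℤ.+ b ℤ.* h) ℤ.+ c ℤ.* h
      z = solve-∀

    -- In terms of the three statistics of the Coxeter length this is 2 inv + 2 nsp + neg. The last
    -- one has the wrong weight relative to the others; together with the version that includes 0,
    -- namely 2 inv + 2 nsp + 3 neg, it gives four times the length.
    inv-labels : inv (labels n) f ≡ (∑∑ G ℤ.+ ∑∑ G) ℤ.+ ((∑∑ Q ℤ.+ ∑∑ Q) ℤ.+ ∑ R ng)
    inv-labels = trans (∑-labels n (λ a → ∑ (labels n) (inverted f a))) (trans (∑-cong∈ R (λ {i} p →
        trans (cong₂ ℤ._+_ (∑-labels n (inverted f (+ i))) (∑-labels n (inverted f (- + i))))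
        (trans (sym (∑-+ R (λ j → inverted f (+ i) (+ j) ℤ.+ inverted f (+ i) (- + j)) (λ j → inverted f (- + i) (+ j) ℤ.+ inverted f (- + i) (- + j))))
          (∑-cong∈ R (λ {j} q → block {i} {j} p q)))))
      (trans (∑-cong R (λ i → ∑-+₃ R (G i) (λ j → G j i) (H i)))
      (trans (∑-+₃ R (λ i → ∑ R (G i)) (λ i → ∑ R (λ j → G j i)) (λ i → ∑ R (H i)))
        (cong₂ ℤ._+_ (cong (ℤ._+_ (∑∑ G)) (sym (∑-swap R R G))) H-split))))

    inv-zero : inv (+ 0 ∷ labels n) f ≡ (∑ R ng ℤ.+ ∑ R ng) ℤ.+ inv (labels n) f
    inv-zero = trans (cong₂ ℤ._+_ (trans (cong (ℤ._+ ∑ (labels n) (inverted f (+ 0))) (inverted-no f {+ 0} {+ 0} (ℤP.<-irrefl refl))) (trans (ℤP.+-identityˡ (∑ (labels n) (inverted f (+ 0)))) row)) (trans (∑-+ (labels n) (λ a → inverted f a (+ 0)) (λ a → ∑ (labels n) (inverted f a))) (cong (ℤ._+ inv (labels n) f) col)))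
       (sym (ℤP.+-assoc (∑ R ng) (∑ R ng) (inv (labels n) f)))
      where
      row : ∑ (labels n) (inverted f (+ 0)) ≡ ∑ R ng
      row = trans (∑-labels n (inverted f (+ 0))) (∑-cong∈ R (λ {i} p → let a = proj₁ (range-∈⁻ p) in
        trans (cong₂ ℤ._+_ (trans (inverted-yes f {+ 0} {+ i} (ℤ.+<+ a)) (cong (λ z → ⟦ z <ℤ + 0 ⟧) (f+ a)))
          (inverted-no f {+ 0} { - + i} (λ h → ℤP.<-irrefl refl (ℤP.<-≤-trans h (ℤP.neg-mono-≤ (ℤ.+≤+ {0} {i} z≤n)))))) (ℤP.+-identityʳ (ng i))))
      col : ∑ (labels n) (λ a → inverted f a (+ 0)) ≡ ∑ R ng
      col = trans (∑-labels n (λ a → inverted f a (+ 0))) (∑-cong∈ R (λ {i} p → let a = proj₁ (range-∈⁻ p) in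
        trans (cong₂ ℤ._+_ (inverted-no f {+ i} {+ 0} (λ { (ℤ.+<+ ()) })) (trans (inverted-yes f { - + i} {+ 0} (ℤP.neg-mono-< (ℤ.+<+ a)))
          (cong ⟦_⟧ (trans (cong (+ 0 <ℤ_) (f- a)) (<ℤ-iff (λ h → ℤP.neg-cancel-< h) ℤP.neg-mono-<))))) (ℤP.+-identityˡ (ng i))))

    lenB-∑ : + lenB v ≡ (∑∑ G ℤ.+ ∑∑ Q) ℤ.+ ∑ R ng
    lenB-∑ = cong₂ ℤ._+_ (cong₂ ℤ._+_
        (trans (countP-∑ _ (pairsLt (length v))) (trans (∑-pairsLt (length v) _) (cong (λ N → ∑ (range N) (λ i → ∑ (range N) (G i))) len)))
        (trans (countP-∑ _ (pairsLt (length v))) (trans (∑-pairsLt (length v) _) (cong (λ N → ∑ (range N) (λ i → ∑ (range N) (Q i))) len))))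
      (trans (countP-∑ _ v) (trans (∑-at v _) (cong (λ N → ∑ (range N) ng) len)))

  lenB-inv : + 4 ℤ.* + lenB v ≡ inv (labels n) (app v) ℤ.+ inv (+ 0 ∷ labels n) (app v)
  lenB-inv = trans (cong (+ 4 ℤ.*_) lenB-∑) (trans (z (∑∑ G) (∑∑ Q) (∑ R ng)) (sym (trans (cong (ℤ._+_ (inv (labels n) f)) inv-zero)
      (cong (λ x → x ℤ.+ ((∑ R ng ℤ.+ ∑ R ng) ℤ.+ x)) inv-labels))))
    where
    z : ∀ g q m → + 4 ℤ.* ((g ℤ.+ q) ℤ.+ m) ≡ ((g ℤ.+ g) ℤ.+ ((q ℤ.+ q) ℤ.+ m)) ℤ.+ ((m ℤ.+ m) ℤ.+ ((g ℤ.+ g) ℤ.+ ((q ℤ.+ q) ℤ.+ m)))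
    z = solve-∀

-- Reflections of B_n

-- For i = -j the transpositions of i, j and of -j, -i coincide and their product would be the
-- identity, so this case takes one of them only.
reflect : ℤ → ℤ → ℤ → ℤ
reflect i j x with i ℤ.≟ - j
... | yes _ = swapL i j x
... | no _ = swapL i j (swapL (- j) (- i) x)

swap-neg : ∀ {x y} → x ≡ - y → y ≡ - x
swap-neg {y = y} e = sym (trans (cong -_ e) (ℤP.neg-involutive y))

module _ {n : ℕ} {i j : ℤ} (li : Label n i) (lj : Label n j) where

  reflect-left : reflect i j i ≡ j
  reflect-left with i ℤ.≟ - j
  ... | yes _ = swapL-left i j
  ... | no ne = trans (cong (swapL i j) (swapL-other (- j) (- i) ne (label≢neg {n} {i} li))) (swapL-left i j)

  reflect-right : reflect i j j ≡ i
  reflect-right with i ℤ.≟ - j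
  ... | yes _ = swapL-right i j
  ... | no ne = trans (cong (swapL i j) (swapL-other (- j) (- i) (label≢neg {n} {j} lj) (ne ∘ swap-neg))) (swapL-right i j)

  reflect-negleft : reflect i j (- i) ≡ - j
  reflect-negleft with i ℤ.≟ - j
  ... | yes e = trans (cong (swapL i j) (sym (swap-neg e))) (trans (swapL-right i j) e)
  ... | no ne = trans (cong (swapL i j) (swapL-right (- j) (- i))) (swapL-other i j (ne ∘ sym) (label≢neg {n} {j} lj ∘ sym))

  reflect-negright : reflect i j (- j) ≡ - i
  reflect-negright with i ℤ.≟ - j
  ... | yes e = trans (cong (swapL i j) (sym e)) (trans (swapL-left i j) (swap-neg e))
  ... | no ne = trans (cong (swapL i j) (swapL-left (- j) (- i))) (swapL-other i j (label≢neg {n} {i} li ∘ sym) (λ e → ne (swap-neg (sym e))))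

reflect-other : ∀ i j {x} → x ≢ i → x ≢ j → x ≢ - i → x ≢ - j → reflect i j x ≡ x
reflect-other i j a b c d with i ℤ.≟ - j
... | yes _ = swapL-other i j a b
... | no _ = trans (cong (swapL i j) (swapL-other (- j) (- i) d c)) (swapL-other i j a b)

reflect-elim : ∀ {n i j} → Label n i → Label n j → (P : ℤ → ℤ → Set) → P i j → P j i → P (- i) (- j) → P (- j) (- i)
  → (∀ {x} → x ≢ i → x ≢ j → x ≢ - i → x ≢ - j → P x x) → ∀ x → P x (reflect i j x)
reflect-elim {n} {i} {j} li lj P a b c d h x with x ℤ.≟ i | x ℤ.≟ j | x ℤ.≟ - i | x ℤ.≟ - j
... | yes refl | _ | _ | _ = subst (P i) (sym (reflect-left {n} {i} {j} li lj)) a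
... | no _ | yes refl | _ | _ = subst (P j) (sym (reflect-right {n} {i} {j} li lj)) b
... | no _ | no _ | yes refl | _ = subst (P (- i)) (sym (reflect-negleft {n} {i} {j} li lj)) c
... | no _ | no _ | no _ | yes refl = subst (P (- j)) (sym (reflect-negright {n} {i} {j} li lj)) d
... | no p | no q | no r | no s = subst (P x) (sym (reflect-other i j p q r s)) (h p q r s)

reflect-invol : ∀ {n i j} → Label n i → Label n j → ∀ x → reflect i j (reflect i j x) ≡ x
reflect-invol {n} {i} {j} li lj = reflect-elim {n} {i} {j} li lj (λ x y → reflect i j y ≡ x)
  (reflect-right {n} {i} {j} li lj) (reflect-left {n} {i} {j} li lj) (reflect-negright {n} {i} {j} li lj) (reflect-negleft {n} {i} {j} li lj) (reflect-other i j)

reflect-odd : ∀ {n i j} → Label n i → Label n j → ∀ x → reflect i j (- x) ≡ - reflect i j x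
reflect-odd {n} {i} {j} li lj = reflect-elim {n} {i} {j} li lj (λ x y → reflect i j (- x) ≡ - y)
  (reflect-negleft {n} {i} {j} li lj) (reflect-negright {n} {i} {j} li lj)
  (trans (cong (reflect i j) (ℤP.neg-involutive i)) (trans (reflect-left {n} {i} {j} li lj) (sym (ℤP.neg-involutive j))))
  (trans (cong (reflect i j) (ℤP.neg-involutive j)) (trans (reflect-right {n} {i} {j} li lj) (sym (ℤP.neg-involutive i))))
  (λ p q r s → reflect-other i j (λ e → r (swap-neg (sym e))) (λ e → s (swap-neg (sym e))) (p ∘ neg-inj) (q ∘ neg-inj))

reflect-label : ∀ {n i j} → Label n i → Label n j → ∀ x → Label n x → Label n (reflect i j x)
reflect-label {n} {i} {j} li lj = reflect-elim {n} {i} {j} li lj (λ x y → Label n x → Label n y)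
  (λ _ → lj) (λ _ → li) (λ _ → label-neg {n} {j} lj) (λ _ → label-neg {n} {i} li) (λ _ _ _ _ → id)

record IsReflection (n : ℕ) (t : List ℤ) : Set where
  field
    i j   : ℤ
    li    : Label n i
    lj    : Label n j
    i<j   : i < j
    len   : length t ≡ n
    acts  : ∀ x → Label n x → app t x ≡ reflect i j x

reflection-signed : ∀ {n t} → IsReflection n t → Signed n t
reflection-signed {n} {t} r = mkSigned t len lbl inj
  where
  open IsReflection r
  lbl : ∀ {k} → 1 N.≤ k → k N.≤ n → Label n (at (+ 0) t k)
  lbl {k} a b = subst (Label n) (trans (sym (acts (+ k) (a , b))) (app-+ t a)) (reflect-label {n} {i} {j} li lj (+ k) (a , b))
  inj : ∀ {k l} → 1 N.≤ k → k N.≤ n → 1 N.≤ l → l N.≤ n → ∣ at (+ 0) t k ∣ ≡ ∣ at (+ 0) t l ∣ → k ≡ l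
  inj {k} {l} a b a′ b′ e with abs-cases (reflect i j (+ k)) (reflect i j (+ l))
     (trans (cong ∣_∣ (trans (sym (acts (+ k) (a , b))) (app-+ t a))) (trans e (cong ∣_∣ (trans (sym (app-+ t a′)) (acts (+ l) (a′ , b′))))))
  ... | inj₁ q = ℤP.+-injective (trans (sym (reflect-invol {n} {i} {j} li lj (+ k))) (trans (cong (reflect i j) q) (reflect-invol {n} {i} {j} li lj (+ l))))
  ... | inj₂ q = cong ∣_∣ {+ k} { - + l} (trans (sym (reflect-invol {n} {i} {j} li lj (+ k))) (trans (cong (reflect i j) q)
        (trans (cong (reflect i j) (sym (reflect-odd {n} {i} {j} li lj (+ l)))) (reflect-invol {n} {i} {j} li lj (- + l))))) ⟨≡⟩ ℤP.∣-i∣≡∣i∣ (+ l)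
    where
    _⟨≡⟩_ : ∀ {x y z : ℕ} → x ≡ y → y ≡ z → x ≡ z
    _⟨≡⟩_ = trans

list-reflects : ∀ {n i j} → Label n i → Label n j → (h : ℕ → ℤ) → (∀ {k} → 1 N.≤ k → k N.≤ n → h k ≡ reflect i j (+ k))
  → ∀ x → Label n x → app (map h (range n)) x ≡ reflect i j x
list-reflects {n} li lj h e (+ suc k) (a , b) = trans (at-map-range (+ 0) h n a b) (e a b)
list-reflects {n} {i} {j} li lj h e -[1+ k ] (a , b) = trans (cong -_ (trans (at-map-range (+ 0) h n a b) (e a b))) (sym (reflect-odd {n} {i} {j} li lj (+ suc k)))

two-values : ∀ a b x y k (z : ℤ) → (k ≡ a → x ≡ z) → (k ≡ b → y ≡ z) → (k ≢ a → k ≢ b → + k ≡ z)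
  → (if k ≡ᵇ a then x else if k ≡ᵇ b then y else + k) ≡ z
two-values a b x y k z p q r with k ≡ᵇ a in e
... | true = p (NP.≡ᵇ⇒≡ k a (≡⇒T e))
... | false with k ≡ᵇ b in e′
...   | true = q (NP.≡ᵇ⇒≡ k b (≡⇒T e′))
...   | false = r (λ h → subst T e (NP.≡⇒≡ᵇ k a h)) (λ h → subst T e′ (NP.≡⇒≡ᵇ k b h))

+≢- : ∀ {k l} → 1 N.≤ k → + k ≢ - + l
+≢- {suc k} {zero} _ ()
+≢- {suc k} {suc l} _ ()

module _ {n a b : ℕ} (1≤a : 1 N.≤ a) (a<b : a N.< b) (b≤n : b N.≤ n) where
  private
    la : Label n (+ a)
    la = 1≤a , NP.≤-trans (NP.<⇒≤ a<b) b≤n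
    lb : Label n (+ b)
    lb = NP.≤-trans 1≤a (NP.<⇒≤ a<b) , b≤n

  sameSign oppSign : ℕ → ℤ
  sameSign k = if k ≡ᵇ a then + b else if k ≡ᵇ b then + a else + k
  oppSign k = if k ≡ᵇ a then - + b else if k ≡ᵇ b then - + a else + k

  same-acts : ∀ {k} → 1 N.≤ k → k N.≤ n → sameSign k ≡ reflect (+ a) (+ b) (+ k)
  same-acts {k} 1≤k _ = two-values a b (+ b) (+ a) k _ (λ { refl → sym (reflect-left {n} {+ a} {+ b} la lb) }) (λ { refl → sym (reflect-right {n} {+ a} {+ b} la lb) })
    (λ p q → sym (reflect-other (+ a) (+ b) (p ∘ ℤP.+-injective) (q ∘ ℤP.+-injective) (+≢- 1≤k) (+≢- 1≤k)))

  -- The pairs i < j and -j < -i give the same reflection; `reflections` lists it once, and this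
  -- version serves two negative labels. `opp-acts` and `opp-acts′` are such a couple for labels of
  -- opposite sign.
  same-acts-neg : ∀ {k} → 1 N.≤ k → k N.≤ n → sameSign k ≡ reflect (- + b) (- + a) (+ k)
  same-acts-neg {k} 1≤k _ = two-values a b (+ b) (+ a) k _
    (λ { refl → sym (trans (cong (reflect (- + b) (- + k)) (sym (ℤP.neg-involutive (+ k)))) (trans (reflect-negright {n} { - + b} { - + k} (label-neg {n} {+ b} lb) (label-neg {n} {+ k} la)) (ℤP.neg-involutive (+ b)))) })
    (λ { refl → sym (trans (cong (reflect (- + k) (- + a)) (sym (ℤP.neg-involutive (+ k)))) (trans (reflect-negleft {n} { - + k} { - + a} (label-neg {n} {+ k} lb) (label-neg {n} {+ a} la)) (ℤP.neg-involutive (+ a)))) })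
    (λ p q → sym (reflect-other (- + b) (- + a) (+≢- 1≤k) (+≢- 1≤k)
        (λ e → q (ℤP.+-injective (trans e (ℤP.neg-involutive (+ b))))) (λ e → p (ℤP.+-injective (trans e (ℤP.neg-involutive (+ a)))))))

  opp-acts : ∀ {k} → 1 N.≤ k → k N.≤ n → oppSign k ≡ reflect (- + b) (+ a) (+ k)
  opp-acts {k} 1≤k _ = two-values a b (- + b) (- + a) k _
    (λ { refl → sym (reflect-right {n} { - + b} {+ k} (label-neg {n} {+ b} lb) la) })
    (λ { refl → sym (trans (cong (reflect (- + k) (+ a)) (sym (ℤP.neg-involutive (+ k)))) (reflect-negleft {n} { - + k} {+ a} (label-neg {n} {+ k} lb) la)) })
    (λ p q → sym (reflect-other (- + b) (+ a) (+≢- 1≤k) (p ∘ ℤP.+-injective) (λ e → q (ℤP.+-injective (trans e (ℤP.neg-involutive (+ b))))) (+≢- 1≤k)))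

  opp-acts′ : ∀ {k} → 1 N.≤ k → k N.≤ n → oppSign k ≡ reflect (- + a) (+ b) (+ k)
  opp-acts′ {k} 1≤k _ = two-values a b (- + b) (- + a) k _
    (λ { refl → sym (trans (cong (reflect (- + k) (+ b)) (sym (ℤP.neg-involutive (+ k)))) (reflect-negleft {n} { - + k} {+ b} (label-neg {n} {+ k} la) lb)) })
    (λ { refl → sym (reflect-right {n} { - + a} {+ k} (label-neg {n} {+ a} la) lb) })
    (λ p q → sym (reflect-other (- + a) (+ b) (+≢- 1≤k) (q ∘ ℤP.+-injective) (λ e → p (ℤP.+-injective (trans e (ℤP.neg-involutive (+ a))))) (+≢- 1≤k)))

single-acts : ∀ {n a k} → 1 N.≤ a → a N.≤ n → 1 N.≤ k → (if k ≡ᵇ a then - + a else + k) ≡ reflect (- + a) (+ a) (+ k)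
single-acts {n} {a} {k} 1≤a a≤n 1≤k with k ≡ᵇ a in e
... | true rewrite NP.≡ᵇ⇒≡ k a (≡⇒T e) = sym (reflect-right {n} { - + a} {+ a} (label-neg {n} {+ a} (1≤a , a≤n)) (1≤a , a≤n))
... | false = sym (reflect-other (- + a) (+ a) n₁ n₂ (λ q → n₂ (trans q (ℤP.neg-involutive (+ a)))) n₁)
  where
  n₂ : + k ≢ + a
  n₂ q = subst T e (NP.≡⇒≡ᵇ k a (ℤP.+-injective q))
  n₁ : + k ≢ - + a
  n₁ = +≢- 1≤k

neg<pos : ∀ {a b} → 1 N.≤ a → - + a < + b
neg<pos {suc a} _ = ℤ.-<+

range-map-length : ∀ n (h : ℕ → ℤ) → length (map h (range n)) ≡ n
range-map-length n h = trans (LP.length-map h (range n)) (range-length n)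

reflections-sound : ∀ {n t} → t ∈ reflections n → IsReflection n t
reflections-sound {n} {t} m with ∈-++⁻ (map _ (pairsLt n)) m
... | inj₁ q with ∈-map⁻ _ q
...   | (a , b) , p , refl with pairsLt-∈⁻ p
...     | 1≤a , a<b , b≤n = record { i = + a ; j = + b ; li = 1≤a , NP.≤-trans (NP.<⇒≤ a<b) b≤n ; lj = NP.≤-trans 1≤a (NP.<⇒≤ a<b) , b≤n ; i<j = ℤ.+<+ a<b
            ; len = range-map-length n _
            ; acts = list-reflects {n} {+ a} {+ b} (1≤a , NP.≤-trans (NP.<⇒≤ a<b) b≤n) (NP.≤-trans 1≤a (NP.<⇒≤ a<b) , b≤n) _ (same-acts 1≤a a<b b≤n) }
reflections-sound {n} {t} m | inj₂ q with ∈-++⁻ (map _ (pairsLt n)) q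
... | inj₁ q′ with ∈-map⁻ _ q′
...   | (a , b) , p , refl with pairsLt-∈⁻ p
...     | 1≤a , a<b , b≤n = record { i = - + b ; j = + a ; li = lb ; lj = la ; i<j = neg<pos (NP.≤-trans 1≤a (NP.<⇒≤ a<b)) ; len = range-map-length n _
            ; acts = list-reflects {n} { - + b} {+ a} lb la _ (opp-acts 1≤a a<b b≤n) }
  where
  la : Label n (+ a)
  la = 1≤a , NP.≤-trans (NP.<⇒≤ a<b) b≤n
  lb : Label n (- + b)
  lb = label-neg {n} {+ b} (NP.≤-trans 1≤a (NP.<⇒≤ a<b) , b≤n)
reflections-sound {n} {t} m | inj₂ q | inj₂ q′ with ∈-map⁻ _ q′
...   | a , p , refl with range-∈⁻ p
...     | 1≤a , a≤n = record { i = - + a ; j = + a ; li = label-neg {n} {+ a} (1≤a , a≤n) ; lj = 1≤a , a≤n ; i<j = neg<pos 1≤a ; len = range-map-length n _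
            ; acts = list-reflects {n} { - + a} {+ a} (label-neg {n} {+ a} (1≤a , a≤n)) (1≤a , a≤n) _ (λ a₁ _ → single-acts {n} 1≤a a≤n a₁) }

reflections-complete : ∀ {n} i j → Label n i → Label n j → i < j
  → ∃ λ t → t ∈ reflections n × (∀ x → Label n x → app t x ≡ reflect i j x)
reflections-complete {n} (+ a) (+ b) li lj (ℤ.+<+ a<b) =
  _ , ∈-++⁺ˡ (∈-map⁺ _ (pairsLt-∈⁺ (proj₁ li) a<b (proj₂ lj))) , list-reflects {n} {+ a} {+ b} li lj _ (same-acts (proj₁ li) a<b (proj₂ lj))
reflections-complete {n} -[1+ a ] -[1+ b ] li lj (ℤ.-<- b<a) =
  _ , ∈-++⁺ˡ (∈-map⁺ _ (pairsLt-∈⁺ (proj₁ lj) (s≤s b<a) (proj₂ li))) , list-reflects {n} { -[1+ a ]} { -[1+ b ]} li lj _ (same-acts-neg (proj₁ lj) (s≤s b<a) (proj₂ li))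
reflections-complete {n} -[1+ a ] (+ b) li lj ℤ.-<+ with NP.<-cmp (suc a) b
... | tri< l _ _ = _ , ∈-++⁺ʳ (map _ (pairsLt n)) (∈-++⁺ˡ (∈-map⁺ _ (pairsLt-∈⁺ (proj₁ li) l (proj₂ lj)))) , list-reflects {n} { -[1+ a ]} {+ b} li lj _ (opp-acts′ (proj₁ li) l (proj₂ lj))
... | tri> _ _ l = _ , ∈-++⁺ʳ (map _ (pairsLt n)) (∈-++⁺ˡ (∈-map⁺ _ (pairsLt-∈⁺ (proj₁ lj) l (proj₂ li)))) , list-reflects {n} { -[1+ a ]} {+ b} li lj _ (opp-acts (proj₁ lj) l (proj₂ li))
... | tri≈ _ refl _ = _ , ∈-++⁺ʳ (map _ (pairsLt n)) (∈-++⁺ʳ (map _ (pairsLt n)) (∈-map⁺ _ (range-∈⁺ (proj₁ lj) (proj₂ lj)))) , list-reflects {n} { -[1+ a ]} {+ suc a} li lj _ (λ 1≤k _ → single-acts {n} (proj₁ lj) (proj₂ lj) 1≤k)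

-- A reflection is one exchange or two. In the second case the exchange at i, j leaves the values at
-- -j < -i as they were; by oddness these are in increasing order too, so both exchanges add
-- inversions.
inv-reflect : ∀ {n L i j} (f : ℤ → ℤ) → (∀ x → f (- x) ≡ - f x) → Unique L → (∀ {x} → Label n x → x ∈ L) → Label n i → Label n j → i < j → f i < f j
  → inv L f < inv L (f ∘ reflect i j)
inv-reflect {n} {L} {i} {j} f odd u full li lj i<j h with i ℤ.≟ - j
... | yes e = inv-swap f u (full {i} li) (full {j} lj) i<j h
... | no ne = ℤP.<-trans (inv-swap f u (full {i} li) (full {j} lj) i<j h)
      (inv-swap (f ∘ swapL i j) u (full { - j} (label-neg {n} {j} lj)) (full { - i} (label-neg {n} {i} li)) (ℤP.neg-mono-< i<j)
         (subst₂ _<_ (sym (trans (cong f (swapL-other i j (ne ∘ sym) (label≢neg {n} {j} lj ∘ sym))) (odd j)))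
                     (sym (trans (cong f (swapL-other i j (label≢neg {n} {i} li ∘ sym) (λ e → ne (swap-neg (sym e))))) (odd i))) (ℤP.neg-mono-< h)))

-- By `lenB-inv` four times the length is a sum of two inversion numbers, and the reflection, which
-- fixes 0, increases both.
lenB-up : ∀ {n v t} → Signed n v → length t ≡ n → ∀ i j → Label n i → Label n j → i < j → (∀ x → Label n x → app t x ≡ reflect i j x)
  → app v i < app v j → lenB v N.< lenB (mul v t)
lenB-up {n} {v} {t} V lt i j li lj i<j acts h = ℤP.drop‿+<+ (ℤP.*-cancelˡ-<-nonNeg {+ lenB v} {+ lenB (mul v t)} (+ 4)
  (subst₂ _<_ (sym (lenB-inv v (Signed.len V))) (sym (lenB-inv (mul v t) (trans (LP.length-map (app v) t) lt)))
    (ℤP.+-mono-< (grow (labels n) (labels-unique n) (λ {x} → labels-∈⁺ x) (λ m → inj₂ (labels-∈⁻ m)))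
                 (grow (+ 0 ∷ labels n) (unique-∷ (λ m → label≢0 {n} {+ 0} (labels-∈⁻ m) refl) (labels-unique n)) (λ {x} l → there (labels-∈⁺ x l)) z))))
  where
  z : ∀ {x} → x ∈ + 0 ∷ labels n → x ≡ + 0 ⊎ Label n x
  z (here e) = inj₁ e
  z (there m) = inj₂ (labels-∈⁻ m)
  grow : ∀ L → Unique L → (∀ {x} → Label n x → x ∈ L) → (∀ {x} → x ∈ L → x ≡ + 0 ⊎ Label n x)
    → inv L (app v) < inv L (app (mul v t))
  grow L u full back = subst (inv L (app v) <_) (inv-cong L (λ {x} m → eq x (back m))) (inv-reflect {n} {L} {i} {j} (app v) (app-neg v) u (λ {x} → full {x}) li lj i<j h)
    where
    eq : ∀ x → x ≡ + 0 ⊎ Label n x → app v (reflect i j x) ≡ app (mul v t) x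
    eq x (inj₂ lx) = sym (trans (app-mul v {t} lt x lx) (cong (app v) (acts x lx)))
    eq .(+ 0) (inj₁ refl) = cong (app v) (reflect-other i j (label≢0 {n} {i} li ∘ sym) (label≢0 {n} {j} lj ∘ sym)
       (label≢0 {n} { - i} (label-neg {n} {i} li) ∘ sym) (label≢0 {n} { - j} (label-neg {n} {j} lj) ∘ sym))

lenB-bound : ∀ v → lenB v N.≤ (length (pairsLt (length v)) N.+ length (pairsLt (length v))) N.+ length v
lenB-bound v = NP.+-mono-≤ (NP.+-mono-≤ (count≤ _ (pairsLt (length v))) (count≤ _ (pairsLt (length v)))) (count≤ _ v)
  where
  count≤ : ∀ {A : Set} (p : A → Bool) xs → countP p xs N.≤ length xs
  count≤ p [] = z≤n
  count≤ p (x ∷ xs) with p x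
  ... | true = s≤s (count≤ p xs)
  ... | false = NP.m≤n⇒m≤1+n (count≤ p xs)

-- Bruhat order

data Below (n : ℕ) (v : List ℤ) : List ℤ → Set where
  done : Below n v v
  down : ∀ {w t} → t ∈ reflections n → lenB (mul w t) N.< lenB w → Below n v (mul w t) → Below n v w

-- Chains are built from the top, as in the definition of the Bruhat order, whereas the argument
-- climbs from below; this extends a chain at its lower end.
below-snoc : ∀ {n v w t} → Below n v w → t ∈ reflections n → lenB (mul v t) N.< lenB v → Below n (mul v t) w
below-snoc done m l = down m l done
below-snoc (down m l b) m′ l′ = down m l (below-snoc b m′ l′)

below⇒leqFuel : ∀ {n v w} k → lenB w N.≤ k → Below n v w → T (leqFuel n k v w)
below⇒leqFuel zero h done = fromWitness refl
below⇒leqFuel {v = v} (suc k) h done = T-∨ˡ {v ==L v} (fromWitness refl)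
below⇒leqFuel zero h (down m l b) = ⊥-elim (NP.<⇒≱ (NP.<-≤-trans l h) z≤n)
below⇒leqFuel {n} {v} {w} (suc k) h (down {t = t} m l b) = T-∨ʳ {v ==L w} (T-any _ (reflections n) m
  (T-∧ (NP.<⇒<ᵇ l) (below⇒leqFuel k (N.s≤s⁻¹ (NP.<-≤-trans l h)) b)))

leqFuel⇒below : ∀ {n v w} k → T (leqFuel n k v w) → Below n v w
leqFuel⇒below zero h = subst (Below _ _) (toWitness h) done
leqFuel⇒below {n} {v} {w} (suc k) h with ∨-T {v ==L w} h
... | inj₁ e = subst (Below n v) (toWitness e) done
... | inj₂ q with any-T _ (reflections n) q
...   | t , m , r = let a , b = ∧-T {lenB (mul w t) <ᵇ lenB w} r in down m (NP.<ᵇ⇒< _ _ a) (leqFuel⇒below k b)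

module Bruhat (n : ℕ) (I : List Interval) (Z : ZigZag n I) (w : List ℤ) (W : Signed n w) (max : IsMaxCoveringType n I (app w)) where
  open Net₂ n I Z public

  InS : List ℤ → Set
  InS v = ∀ x → Label n x → A x (app v x)

  within : InS w
  within x lx = let fam , p , _ = proj₁ max in fam x , p x lx

  -- After the exchange every source still reaches its sink, so by `covering` the result is a
  -- covering type, and it has more inversions than w, against maximality.
  noUp : ∀ i j → Label n i → Label n j → i < j → app w i < app w j → A i (app w j) → A j (app w i) → ⊥
  noUp i j li lj i<j h r s = ℤP.<-irrefl refl (ℤP.<-≤-trans
      (subst₂ _<_ (sym (invA-inv n (app w))) (sym (invA-inv n u)) (inv-swap (app w) (labels-unique n) (labels-∈⁺ i li) (labels-∈⁺ j lj) i<j h))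
      (ℤ.+≤+ (proj₂ max u ((λ x → LabelPerm.u-lab P {x}) , (λ x y → labelPerm-inj P {x} {y})) (covering P (λ {x} → paths x)))))
    where
    P = swapLP (signedPerm W) {i} {j} li lj
    u = LabelPerm.u P
    paths : ∀ x → Label n x → A x (u x)
    paths = swapL-elim i j (λ x y → Label n x → A x (app w y)) (λ _ → r) (λ _ → s) (λ _ _ → within _)

  permOf : ∀ {v} → Signed n v → PermN (n N.+ n)
  permOf V = toPermN (signedPerm V)

  private
    fix : ∀ {v} (V : Signed n v) {p q} → q N.< n N.+ n → rel p (PermN.f (permOf V) q) → A (lab n p) (app v (lab n q))
    fix {v} V {p} {q} l = subst (A (lab n p)) (lab-idx {n} {app v (lab n q)} (app-label V (lab n q) (lab-label l)))
    unfix : ∀ {v} (V : Signed n v) {p q} → q N.< n N.+ n → A (lab n p) (app v (lab n q)) → rel p (PermN.f (permOf V) q)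
    unfix {v} V {p} {q} l = subst (A (lab n p)) (sym (lab-idx {n} {app v (lab n q)} (app-label V (lab n q) (lab-label l))))

  toLocMax : ∀ {v} (V : Signed n v) → InS v
    → (∀ i j → Label n i → Label n j → i < j → app v i < app v j → A i (app v j) → A j (app v i) → ⊥) → LocMax rel (permOf V)
  toLocMax {v} V s nu = record
    { within = λ {p} l → unfix V {p} {p} l (s (lab n p) (lab-label l))
    ; noUp = λ {p} {q} p<q q<N h r r′ → let p<N = NP.<-trans p<q q<N in
        nu (lab n p) (lab n q) (lab-label p<N) (lab-label q<N) (lab-mono p<N q<N p<q)
          (idx-cancel {n} {app v (lab n p)} {app v (lab n q)} (app-label V (lab n p) (lab-label p<N)) (app-label V (lab n q) (lab-label q<N)) h)
          (fix V {p} {q} q<N r) (fix V {q} {p} p<N r′) }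

  wMax : LocMax rel (permOf W)
  wMax = toLocMax W within noUp

  toRel : ∀ i j → Label n i → Label n j → A i j → rel (idx n i) (idx n j)
  toRel i j li lj = subst₂ A (sym (lab-idx {n} {i} li)) (sym (lab-idx {n} {j} lj))

  fromRel : ∀ i j → Label n i → Label n j → rel (idx n i) (idx n j) → A i j
  fromRel i j li lj = subst₂ A (lab-idx {n} {i} li) (lab-idx {n} {j} lj)

  closedA : ∀ {a i b x j y} → Label n a → Label n i → Label n b → Label n x → Label n j → Label n y
    → a ≤ i → i ≤ b → y ≤ j → j ≤ x → A a x → A b y → A i j
  closedA {a} {i} {b} {x} {j} {y} la li lb lx lj ly h₁ h₂ h₃ h₄ r s = fromRel i j li lj
    (peelable-closed (n N.+ n) rel-peelable (idx-mono≤ {n} {a} {i} la li h₁) (idx-mono≤ {n} {i} {b} li lb h₂) (idx-< {n} {b} lb)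
      (idx-mono≤ {n} {y} {j} ly lj h₃) (idx-mono≤ {n} {j} {x} lj lx h₄) (idx-< {n} {x} lx) (toRel a x la lx r) (toRel b y lb ly s))

  hull? : ∀ p i j → Dec (Hull {n N.+ n} p i j)
  hull? p i j = map′ (λ (a , l , h) → a , N.s≤s⁻¹ l , h) (λ (a , l , h) → a , s≤s l , h) (NP.anyUpTo? (λ a → j N.≤? PermN.f p a) (suc i))
    ×-dec map′ (λ (b , l , h , q) → b , h , l , q) (λ (b , h , l , q) → b , l , h , q) (NP.anyUpTo? (λ b → (i N.≤? b) ×-dec (PermN.f p b N.≤? j)) (n N.+ n))

  -- Reachability coincides with the hull of the graph of w, a finite condition.
  A? : ∀ i j → Label n i → Label n j → Dec (A i j)
  A? i j li lj = map′ (λ h → fromRel i j li lj (hull-inR (n N.+ n) rel-peelable (permOf W) (LocMax.within wMax) (idx-< {n} {i} li) (idx-< {n} {j} lj) h))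
    (λ r → peelable-inHull (n N.+ n) rel-peelable (permOf W) wMax (idx-< {n} {i} li) (idx-< {n} {j} lj) (toRel i j li lj r))
    (hull? (permOf W) (idx n i) (idx n j))

  -- Negation maps the graph of w to itself and exchanges the roles of the two points that enclose
  -- (i , j): the upper right one becomes the lower left one.
  A-neg : ∀ i j → Label n i → Label n j → A i j → A (- i) (- j)
  A-neg i j li lj r with peelable-inHull (n N.+ n) rel-peelable (permOf W) wMax (idx-< {n} {i} li) (idx-< {n} {j} lj) (toRel i j li lj r)
  ... | (a , a≤i , j≤wa) , (b , i≤b , b<N , wb≤j) =
    closedA {a′} { - i} {b′} {app w a′} { - j} {app w b′} la′ (nl i li) lb′ (app-label W a′ la′) (nl j lj) (app-label W b′ lb′)
      (ℤP.neg-mono-≤ (idx-cancel≤ {n} {i} {lab n b} li (lab-label b<N) (subst (idx n i N.≤_) (sym (idx-lab {n} b)) i≤b)))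
      (ℤP.neg-mono-≤ (idx-cancel≤ {n} {lab n a} {i} (lab-label a<N) li (subst (N._≤ idx n i) (sym (idx-lab {n} a)) a≤i)))
      (subst (_≤ - j) (sym (app-neg w (lab n a))) (ℤP.neg-mono-≤ (idx-cancel≤ {n} {j} {app w (lab n a)} lj (app-label W (lab n a) (lab-label a<N)) j≤wa)))
      (subst (- j ≤_) (sym (app-neg w (lab n b))) (ℤP.neg-mono-≤ (idx-cancel≤ {n} {app w (lab n b)} {j} (app-label W (lab n b) (lab-label b<N)) lj wb≤j)))
      (within a′ la′) (within b′ lb′)
    where
    a<N = NP.≤-<-trans a≤i (idx-< {n} {i} li)
    nl : ∀ x → Label n x → Label n (- x)
    nl x = label-neg {n} {x}
    a′ = - lab n b
    b′ = - lab n a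
    la′ : Label n a′
    la′ = nl (lab n b) (lab-label b<N)
    lb′ : Label n b′
    lb′ = nl (lab n a) (lab-label a<N)

  -- A reflection that lowers the length undoes an inversion at i < j and its mirror image at -j <
  -- -i; both stay inside A by the rectangle property.
  InS-down : ∀ {v t} → Signed n v → InS v → t ∈ reflections n → lenB (mul v t) N.< lenB v → InS (mul v t)
  InS-down {v} {t} V s m lt x lx = subst (A x) (sym (trans (app-mul v {t} len x lx) (cong (app v) (acts x lx))))
     (reflect-elim {n} {i} {j} li lj (λ x y → Label n x → A x (app v y)) (λ _ → proj₁ (sw i j li lj i<j inverted′)) (λ _ → proj₂ (sw i j li lj i<j inverted′))
       (λ _ → proj₂ (sw (- j) (- i) (nl j lj) (nl i li) (ℤP.neg-mono-< i<j) inverted″)) (λ _ → proj₁ (sw (- j) (- i) (nl j lj) (nl i li) (ℤP.neg-mono-< i<j) inverted″))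
       (λ _ _ _ _ → s _) x lx)
    where
    open IsReflection (reflections-sound {n} m)
    nl : ∀ x → Label n x → Label n (- x)
    nl x = label-neg {n} {x}
    inverted′ : app v j < app v i
    inverted′ with ℤP.<-cmp (app v i) (app v j)
    ... | tri< h _ _ = ⊥-elim (NP.<-asym lt (lenB-up V len i j li lj i<j acts h))
    ... | tri≈ _ e _ = ⊥-elim (ℤP.<-irrefl (app-inj V i j li lj e) i<j)
    ... | tri> _ _ h = h
    inverted″ : app v (- i) < app v (- j)
    inverted″ = subst₂ _<_ (sym (app-neg v i)) (sym (app-neg v j)) (ℤP.neg-mono-< inverted′)
    sw : ∀ i j → Label n i → Label n j → i < j → app v j < app v i → A i (app v j) × A j (app v i)
    sw i j li lj l h =
      closedA {i} {i} {j} {app v i} {app v j} {app v j} li li lj (app-label V i li) (app-label V j lj) (app-label V j lj) ℤP.≤-refl (ℤP.<⇒≤ l) ℤP.≤-refl (ℤP.<⇒≤ h) (s i li) (s j lj) ,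
      closedA {i} {j} {j} {app v i} {app v i} {app v j} li lj lj (app-label V i li) (app-label V i li) (app-label V j lj) (ℤP.<⇒≤ l) ℤP.≤-refl (ℤP.<⇒≤ h) ℤP.≤-refl (s i li) (s j lj)

  below⇒InS : ∀ {v u} → Signed n u → InS u → Below n v u → InS v
  below⇒InS U s done = s
  below⇒InS U s (down m l b) = below⇒InS (mul-signed U (reflection-signed (reflections-sound {n} m))) (InS-down U s m l) b

  Up : List ℤ → ℤ → ℤ → Set
  Up v i j = Label n i × Label n j × i < j × app v i < app v j × A i (app v j) × A j (app v i)

  up? : ∀ {v} → Signed n v → Dec (∃₂ λ i j → Up v i j)
  up? {v} V = map′
    (λ h → let i , _ , q = find h ; j , _ , u = find q in i , j , u)
    (λ (i , j , u) → lose (labels-∈⁺ i (proj₁ u)) (lose (labels-∈⁺ j (proj₁ (proj₂ u))) u))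
    (Any.any? (λ i → Any.any? (λ j → dec i j) (labels n)) (labels n))
    where
    dec : ∀ i j → Dec (Up v i j)
    dec i j with label? n i | label? n j
    ... | no h | _ = no (h ∘ proj₁)
    ... | yes _ | no h = no (h ∘ proj₁ ∘ proj₂)
    ... | yes li | yes lj = map′ (λ u → li , lj , u) (λ u → proj₂ (proj₂ u))
          ((i ℤ.<? j) ×-dec (app v i ℤ.<? app v j) ×-dec A? i (app v j) li (app-label V j lj) ×-dec A? j (app v i) lj (app-label V i li))

  stuck⇒w : ∀ {v} → Signed n v → InS v → ¬ (∃₂ λ i j → Up v i j) → v ≡ w
  stuck⇒w {v} V s h = signed-ext V W λ x lx → let l = idx-< {n} {x} lx ; y = lab n (idx n x) ; e = lab-idx {n} {x} lx in
    trans (cong (app v) (sym e)) (trans (trans (sym (lab-idx {n} {app v y} (app-label V y (lab-label l)))) (trans (cong (lab n)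
      (locMax-unique (n N.+ n) rel-peelable (permOf V) (permOf W) (toLocMax V s (λ i j li lj a b c d → h (i , j , li , lj , a , b , c , d))) wMax l))
      (lab-idx {n} {app w y} (app-label W y (lab-label l))))) (cong (app w) e))

  -- As long as some exchange inside A adds an inversion, the corresponding reflection leads to a
  -- longer element that is again inside A; when none is left, the element is w. The number k bounds
  -- the steps still possible, since the length cannot exceed the bound of `lenB-bound`.
  InS⇒below : ∀ k {v} → Signed n v → InS v → (length (pairsLt n) N.+ length (pairsLt n)) N.+ n N.≤ k N.+ lenB v → Below n v w
  InS⇒below k {v} V s h with up? V
  ... | no q = subst (Below n v) (stuck⇒w V s q) done
  -- The length of v has reached its bound, so a further ascent is impossible.
  InS⇒below zero {v} V s h | yes (i , j , li , lj , i<j , vi<vj , _) = ⊥-elim (NP.<-irrefl refl (NP.<-≤-trans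
      (NP.≤-<-trans h (lenB-up V (Signed.len T′) i j li lj i<j acts vi<vj)) (subst (λ l → lenB (mul v τ) N.≤ (length (pairsLt l) N.+ length (pairsLt l)) N.+ l) (Signed.len (mul-signed V T′)) (lenB-bound (mul v τ)))))
    where
    R = reflections-complete i j li lj i<j
    τ = proj₁ R
    acts = proj₂ (proj₂ R)
    T′ = reflection-signed (reflections-sound {n} (proj₁ (proj₂ R)))
  InS⇒below (suc k) {v} V s h | yes (i , j , li , lj , i<j , vi<vj , r , r′) =
    subst (λ z → Below n z w) back (below-snoc (InS⇒below k V′ s′ (NP.≤-trans h (subst (N._≤ k N.+ lenB (mul v τ)) (NP.+-suc k (lenB v)) (NP.+-monoʳ-≤ k len<)))) (proj₁ (proj₂ R))
      (subst (λ z → lenB z N.< lenB (mul v τ)) (sym back) len<))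
    where
    R = reflections-complete i j li lj i<j
    τ = proj₁ R
    acts = proj₂ (proj₂ R)
    T′ = reflection-signed (reflections-sound {n} (proj₁ (proj₂ R)))
    V′ = mul-signed V T′
    len< = lenB-up V (Signed.len T′) i j li lj i<j acts vi<vj
    act : ∀ x → Label n x → app (mul v τ) x ≡ app v (reflect i j x)
    act x lx = trans (app-mul v (Signed.len T′) x lx) (cong (app v) (acts x lx))
    back : mul (mul v τ) τ ≡ v
    back = signed-ext (mul-signed V′ T′) V (λ x lx → trans (app-mul (mul v τ) (Signed.len T′) x lx) (trans (cong (app (mul v τ)) (acts x lx))
       (trans (act (reflect i j x) (reflect-label {n} {i} {j} li lj x lx)) (cong (app v) (reflect-invol {n} {i} {j} li lj x)))))
    s′ : InS (mul v τ)
    -- The exchange at i, j stays inside A by the choice of i and j, its mirror image by `A-neg`.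
    s′ x lx = subst (A x) (sym (act x lx)) (reflect-elim {n} {i} {j} li lj (λ x y → Label n x → A x (app v y)) (λ _ → r) (λ _ → r′)
      (λ _ → subst (A (- i)) (sym (app-neg v j)) (A-neg i (app v j) li (app-label V j lj) r))
      (λ _ → subst (A (- j)) (sym (app-neg v i)) (A-neg j (app v i) lj (app-label V i li) r′)) (λ _ _ _ _ → s _) x lx)

  bruhat⇒InS : ∀ {v} → T (bruhatLeq n v w) → InS v
  bruhat⇒InS h = below⇒InS W within (leqFuel⇒below (lenB w) h)

  InS⇒bruhat : ∀ {v} → Signed n v → InS v → T (bruhatLeq n v w)
  InS⇒bruhat {v} V s = below⇒leqFuel (lenB w) NP.≤-refl (InS⇒below ((length (pairsLt n) N.+ length (pairsLt n)) N.+ n) V s (NP.m≤m+n _ (lenB v)))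

-- Fillings

chainPairs : El → List El → El → List (El × El)
chainPairs a [] z = (a , z) ∷ []
chainPairs a (b ∷ s) z = (a , b) ∷ chainPairs b s z

cycPairs : List El → List (El × El)
cycPairs [] = []
cycPairs (x ∷ s) = chainPairs x s x

rowPairs : List ℕ → List El → List (El × El)
rowPairs [] s = []
rowPairs (r ∷ ρ) s = cycPairs (take r s) ++ rowPairs ρ (drop r s)

both : (El → El′) → El × El → El′ × El′
both f (a , b) = f a , f b

rowPairs-map : (f : El → El′) (ρ : List ℕ) (s : List El) → rowPairs ρ (map f s) ≡ map (both f) (rowPairs ρ s)
rowPairs-map f [] s = refl
rowPairs-map f (r ∷ ρ) s = trans (cong₂ _++_ (trans (cong cycPairs (LP.take-map r s)) (cyc′ (take r s)))
    (trans (cong (rowPairs ρ) (LP.drop-map r s)) (rowPairs-map f ρ (drop r s)))) (sym (LP.map-++ (both f) (cycPairs (take r s)) (rowPairs ρ (drop r s))))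
  where
  chain′ : ∀ a s z → chainPairs (f a) (map f s) (f z) ≡ map (both f) (chainPairs a s z)
  chain′ a [] z = refl
  chain′ a (b ∷ s) z = cong ((f a , f b) ∷_) (chain′ b s z)
  cyc′ : ∀ s → cycPairs (map f s) ≡ map (both f) (cycPairs s)
  cyc′ [] = refl
  cyc′ (x ∷ s) = chain′ x s x

cycPairs-fst : (s : List El) → map proj₁ (cycPairs s) ≡ s
cycPairs-fst [] = refl
cycPairs-fst (x ∷ s) = go x s x
  where
  go : (a : El) (s : List El) (z : El) → map proj₁ (chainPairs a s z) ≡ a ∷ s
  go a [] z = refl
  go a (b ∷ s) z = cong (a ∷_) (go b s z)

cycPairs-snd : (s : List El) → map proj₂ (cycPairs s) ↭ s
cycPairs-snd [] = ↭-refl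
cycPairs-snd (x ∷ s) = ↭-trans (↭-reflexive (go x s x)) (↭-sym (∷↭∷ʳ x s))
  where
  go : (a : El) (s : List El) (z : El) → map proj₂ (chainPairs a s z) ≡ s ++ z ∷ []
  go a [] z = refl
  go a (b ∷ s) z = cong (b ∷_) (go b s z)

private
  len-drop : (r : ℕ) (s : List El) (m : ℕ) → length s ≡ r N.+ m → length (drop r s) ≡ m
  len-drop r s m e = trans (LP.length-drop r s) (trans (cong (_∸ r) e) (NP.m+n∸m≡n r m))

-- Each letter is the first component of one pair and, by `rowPairs-snd`, the second of one. So a
-- filling defines a permutation, products over letters become products over pairs, and signs
-- attached to both components cancel.
rowPairs-fst : (ρ : List ℕ) (s : List El) → length s ≡ sum ρ → map proj₁ (rowPairs ρ s) ≡ s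
rowPairs-fst [] [] e = refl
rowPairs-fst (r ∷ ρ) s e = trans (LP.map-++ proj₁ (cycPairs (take r s)) _) (trans (cong₂ _++_ (cycPairs-fst (take r s)) (rowPairs-fst ρ (drop r s) (len-drop r s (sum ρ) e))) (LP.take++drop≡id r s))

rowPairs-snd : (ρ : List ℕ) (s : List El) → length s ≡ sum ρ → map proj₂ (rowPairs ρ s) ↭ s
rowPairs-snd [] [] e = ↭-refl
rowPairs-snd (r ∷ ρ) s e = ↭-trans (↭-reflexive (LP.map-++ proj₂ (cycPairs (take r s)) _))
  (↭-trans (++⁺ (cycPairs-snd (take r s)) (rowPairs-snd ρ (drop r s) (len-drop r s (sum ρ) e))) (↭-reflexive (LP.take++drop≡id r s)))

sameRows : Matrix → List ℕ → List (ℕ × Matrix)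
sameRows M = map (λ r → r , M)

rowsProd-∏ : ∀ M ρ s → rowsProd (sameRows M ρ) s ≡ ∏ (rowPairs ρ s) (λ q → M (proj₁ q) (proj₂ q))
rowsProd-∏ M [] s = refl
rowsProd-∏ M (r ∷ ρ) s = trans (cong₂ ℤ._*_ (cyc-∏ (take r s)) (rowsProd-∏ M ρ (drop r s))) (sym (∏-++ (cycPairs (take r s)) (rowPairs ρ (drop r s)) _))
  where
  chain-∏ : ∀ a s z → chain M a s z ≡ ∏ (chainPairs a s z) (λ q → M (proj₁ q) (proj₂ q))
  chain-∏ a [] z = sym (ℤP.*-identityʳ (M a z))
  chain-∏ a (b ∷ s) z = cong (M a b ℤ.*_) (chain-∏ b s z)
  cyc-∏ : ∀ s → cyc M s ≡ ∏ (cycPairs s) (λ q → M (proj₁ q) (proj₂ q))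
  cyc-∏ [] = refl
  cyc-∏ (x ∷ s) = chain-∏ x s x

size-sameRows : ∀ M ρ → size (sameRows M ρ) ≡ sum ρ
size-sameRows M [] = refl
size-sameRows M (r ∷ ρ) = cong (r N.+_) (size-sameRows M ρ)

Full : List ℕ → List ℕ → (El → El → ℤ) → (El → El → ℤ) → List El → ℤ
Full ρ τ F G s = ∏ (rowPairs ρ (take (sum ρ) s)) (λ q → F (proj₁ q) (proj₂ q)) ℤ.* ∏ (rowPairs τ (drop (sum ρ) s)) (λ q → G (proj₁ q) (proj₂ q))

rowPairs-take : (ρ : List ℕ) (s : List El) → rowPairs ρ (take (sum ρ) s) ≡ rowPairs ρ s
rowPairs-take [] s = refl
rowPairs-take (r ∷ ρ) s = cong₂ _++_ (cong cycPairs (tk r (sum ρ) s)) (trans (cong (rowPairs ρ) (dt r (sum ρ) s)) (rowPairs-take ρ (drop r s)))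
  where
  tk : ∀ r m (s : List El) → take r (take (r N.+ m) s) ≡ take r s
  tk zero m s = refl
  tk (suc r) m [] = refl
  tk (suc r) m (x ∷ s) = cong (x ∷_) (tk r m s)
  dt : ∀ r m (s : List El) → drop r (take (r N.+ m) s) ≡ take m (drop r s)
  dt zero m s = refl
  dt (suc r) zero [] = refl
  dt (suc r) (suc m) [] = refl
  dt (suc r) m (x ∷ s) = dt r m s

rowsProd-Full : ∀ M M′ ρ τ s → rowsProd (sameRows M ρ ++ sameRows M′ τ) s ≡ Full ρ τ M M′ s
rowsProd-Full M M′ ρ τ s = trans (go ρ s) (cong (λ l → ∏ l (λ q → M (proj₁ q) (proj₂ q)) ℤ.* ∏ (rowPairs τ (drop (sum ρ) s)) (λ q → M′ (proj₁ q) (proj₂ q))) (sym (rowPairs-take ρ s)))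
  where
  dd : ∀ r m (s : List ℕ) → drop m (drop r s) ≡ drop (r N.+ m) s
  dd r m s = LP.drop-drop r m s
  go : ∀ ρ s → rowsProd (sameRows M ρ ++ sameRows M′ τ) s ≡ ∏ (rowPairs ρ s) (λ q → M (proj₁ q) (proj₂ q)) ℤ.* ∏ (rowPairs τ (drop (sum ρ) s)) (λ q → M′ (proj₁ q) (proj₂ q))
  go [] s = trans (rowsProd-∏ M′ τ s) (sym (ℤP.*-identityˡ _))
  go (r ∷ ρ) s = trans (cong (cyc M (take r s) ℤ.*_) (trans (go ρ (drop r s)) (cong (λ l → P ℤ.* ∏ (rowPairs τ l) (λ q → M′ (proj₁ q) (proj₂ q))) (dd r (sum ρ) s))))
      (trans (sym (ℤP.*-assoc (cyc M (take r s)) P _)) (cong (ℤ._* ∏ (rowPairs τ (drop (r N.+ sum ρ) s)) (λ q → M′ (proj₁ q) (proj₂ q)))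
        (trans (cong (cyc M (take r s) ℤ.*_) (sym (rowsProd-∏ M ρ (drop r s)))) (rowsProd-∏ M (r ∷ ρ) s))))
    where P = ∏ (rowPairs ρ (drop r s)) (λ q → M (proj₁ q) (proj₂ q))

rowPairs-∈ : (ρ : List ℕ) (s : List El) → length s ≡ sum ρ → ∀ {a b} → (a , b) ∈ rowPairs ρ s → a ∈ s × b ∈ s
rowPairs-∈ ρ s e m = subst (_ ∈_) (rowPairs-fst ρ s e) (∈-map⁺ proj₁ m) , ∈-resp-↭ (rowPairs-snd ρ s e) (∈-map⁺ proj₂ m)

private
  len-− : ∀ {S x} → Unique S → x ∈ S → suc (length (S − x)) ≡ length S
  len-− {y ∷ S} {x} u (here refl) rewrite T⇒≡ (≡ᵇ-refl y) = cong suc (go S (unique-head u))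
    where
    go : ∀ S → y ∉ S → length (S − y) ≡ length S
    go [] n = refl
    go (z ∷ S) n rewrite ¬T⇒≡ {z ≡ᵇ y} (λ t → n (here (sym (NP.≡ᵇ⇒≡ z y t)))) = cong suc (go S (n ∘ there))
  len-− {y ∷ S} {x} u (there m) rewrite ¬T⇒≡ {y ≡ᵇ x} (λ t → unique-head u (subst (_∈ S) (sym (NP.≡ᵇ⇒≡ y x t)) m)) = cong suc (len-− (unique-tail u) m)

draw-count : ∀ r S → Unique S → length S ≡ r → draw r S (λ _ → 1ℤ) ≡ + (r !)
draw-count zero S u e = refl
draw-count (suc r) S u e = trans (∑-cong∈ S (λ {x} m → draw-count r (S − x) (unique-filt _ u) (NP.suc-injective (trans (len-− u m) e))))
  (trans (∑-const (+ (r !)) S) (trans (cong (λ z → + z ℤ.* + (r !)) e) (sym (ℤP.pos-* (suc r) (r !)))))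

draw-const : ∀ r S c → Unique S → length S ≡ r → draw r S (λ _ → c) ≡ + (r !) ℤ.* c
draw-const r S c u e = trans (draw-cong′ r S (λ _ → sym (ℤP.*-identityʳ c))) (trans (draw-*ˡ c r S (λ _ → 1ℤ)) (trans (cong (c ℤ.*_) (draw-count r S u e)) (ℤP.*-comm c (+ (r !)))))

draw-∑ : ∀ r S (xs : List El) (F : El → List ℕ → ℤ) → draw r S (λ s → ∑ xs (λ x → F x s)) ≡ ∑ xs (λ x → draw r S (F x))
draw-∑ r S [] F = draw-0 r S
draw-∑ r S (x ∷ xs) F = trans (draw-+ r S (F x) (λ s → ∑ xs (λ x → F x s))) (cong (ℤ._+_ (draw r S (F x))) (draw-∑ r S xs F))

range-suc : ∀ m → range (suc m) ≡ 1 ∷ map suc (range m)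
range-suc m = cong (λ l → 1 ∷ map suc l) (sym (LP.map-applyUpTo id suc m))

-- Distributivity: the letters of a word are chosen independently, position by position.
∑-words-∏ : ∀ n (L : List El) (z : El) (h : ℕ → El → ℤ) → ∑ (words n L) (λ v → ∏ (range n) (λ a → h a (at z v a))) ≡ ∏ (range n) (λ a → ∑ L (h a))
∑-words-∏ zero L z h = refl
∑-words-∏ (suc n) L z h = trans (∑-concatMap _ L _) (trans (∑-cong L (λ x → trans (∑-map (x ∷_) (words n L) _)
   (trans (∑-cong (words n L) (λ v → trans (cong (λ l → ∏ l (λ a → h a (at z (x ∷ v) a))) (range-suc n)) (cong (h 1 x ℤ.*_) (trans (∏-map suc (range n) _) (∏-cong∈ (range n) (λ {a} m → cong (h (suc a)) (sh x v a (proj₁ (range-∈⁻ m)))))))))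
     (trans (∑-*ˡ (h 1 x) (words n L) (λ v → ∏ (range n) (λ a → h (suc a) (at z v a)))) (cong (h 1 x ℤ.*_) (∑-words-∏ n L z (h ∘ suc)))))))
   (trans (∑-*ʳ (∏ (range n) (λ a → ∑ L (h (suc a)))) L (h 1)) (trans (cong (∑ L (h 1) ℤ.*_) (sym (∏-map suc (range n) (λ a → ∑ L (h a))))) (cong (λ l → ∏ l (λ a → ∑ L (h a))) (sym (range-suc n))))))
  where
  sh : ∀ x v a → 1 N.≤ a → at z (x ∷ v) (suc a) ≡ at z v a
  sh x v (suc a) _ = refl

∑-words-abs : ∀ k n (F : List ℕ → ℤ) → ∑ (words k (labels n)) (F ∘ map ∣_∣) ≡ + (2 ^ k) ℤ.* ∑ (words k (range n)) F
∑-words-abs zero n F = sym (ℤP.*-identityˡ (F [] ℤ.+ 0ℤ))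
∑-words-abs (suc k) n F = trans (∑-concatMap _ (labels n) _) (trans (∑-cong (labels n) (λ x → trans (∑-map (x ∷_) (words k (labels n)) _) (∑-words-abs k n (F ∘ (∣ x ∣ ∷_)))))
   (trans (∑-labels n (λ x → + (2 ^ k) ℤ.* ∑ (words k (range n)) (F ∘ (∣ x ∣ ∷_)))) (trans (∑-cong (range n) (λ i → dbl i)) (trans (∑-*ˡ (+ (2 ^ suc k)) (range n) (λ i → ∑ (words k (range n)) (F ∘ (i ∷_))))
     (cong (+ (2 ^ suc k) ℤ.*_) (sym (trans (∑-concatMap _ (range n) F) (∑-cong (range n) (λ i → ∑-map (i ∷_) (words k (range n)) F)))))))))
  where
  X : ℕ → ℤ
  X i = ∑ (words k (range n)) (F ∘ (i ∷_))
  z : ∀ a x → a ℤ.* x ℤ.+ a ℤ.* x ≡ + 2 ℤ.* a ℤ.* x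
  z = solve-∀
  dbl : ∀ i → + (2 ^ k) ℤ.* X i ℤ.+ + (2 ^ k) ℤ.* X (∣ - + i ∣) ≡ + (2 ^ suc k) ℤ.* X i
  dbl i = trans (cong (λ j → + (2 ^ k) ℤ.* X i ℤ.+ + (2 ^ k) ℤ.* X j) (ℤP.∣-i∣≡∣i∣ (+ i))) (trans (z (+ (2 ^ k)) (X i)) (cong (ℤ._* X i) (sym (ℤP.pos-* 2 (2 ^ k)))))

distinct⇒unique : ∀ s → T (distinct s) → Unique s
distinct⇒unique [] t = []
distinct⇒unique (x ∷ s) t = let a , b = ∧-T {not (any (_≡ᵇ x) s)} t in
  unique-∷ (λ m → not-T a (T-any (_≡ᵇ x) s m (≡ᵇ-refl x))) (distinct⇒unique s b)

unique⇒distinct : ∀ {s} → Unique s → T (distinct s)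
unique⇒distinct {[]} u = tt
unique⇒distinct {x ∷ s} u = T-∧ (T-not (λ t → let y , m , e = any-T (_≡ᵇ x) s t in unique-head u (subst (_∈ s) (NP.≡ᵇ⇒≡ y x e) m))) (unique⇒distinct (unique-tail u))

∑-allBn-abs : ∀ n (F : List ℕ → ℤ) → ∑ (allBn n) (F ∘ map ∣_∣) ≡ + (2 ^ n) ℤ.* draw n (range n) F
∑-allBn-abs n F = trans (∑-filt (isBn n) (words n (labels n)) (F ∘ map ∣_∣)) (trans (∑-cong∈ (words n (labels n)) (λ {z} m → cong (λ b → ⟦ b ⟧ ℤ.* F (map ∣_∣ z)) (eq z m)))
  (trans (∑-words-abs n n (λ s → ⟦ distinct s ⟧ ℤ.* F s)) (cong (+ (2 ^ n) ℤ.*_) (trans (sym (∑-filt distinct (words n (range n)) F)) (∑-distinct-words n (range n) F)))))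
  where
  eq : ∀ z → z ∈ words n (labels n) → isBn n z ≡ distinct (map ∣_∣ z)
  eq z m = bool-ext (λ t → unique⇒distinct (Signed.uniq (IsBn⇒Signed {n} {z} t)))
    (λ t → Signed⇒IsBn record { len = proj₁ (words-∈⁻ n (labels n) m) ; lbl = λ i → labels-∈⁻ (proj₂ (words-∈⁻ n (labels n) m) i) ; uniq = distinct⇒unique _ t })

-- The trace

-- For u in the hyperoctahedral group and b ≥ 1, `χ⁺ b (u a)` is the matrix of the permutation of
-- absolute values, and `χ⁻ b (u a)` is the matrix of the signed permutation, whose entries supply
-- the sign of the second tensor factor.
χ⁺ χ⁻ : ℤ → ℤ → ℤ
χ⁺ b l = ⟦ l ==ℤ b ⟧ ℤ.+ ⟦ l ==ℤ - b ⟧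
χ⁻ b l = ⟦ l ==ℤ b ⟧ ℤ.- ⟦ l ==ℤ - b ⟧

==ℤ-iff : ∀ {a b c d} → (a ≡ b → c ≡ d) → (c ≡ d → a ≡ b) → (a ==ℤ b) ≡ (c ==ℤ d)
==ℤ-iff {a} {b} {c} {d} f g = bool-ext (λ t → fromWitness {a? = c ℤ.≟ d} (f (toWitness {a? = a ℤ.≟ b} t))) (λ t → fromWitness {a? = a ℤ.≟ b} (g (toWitness {a? = c ℤ.≟ d} t)))

==ℤ-no : ∀ {a b} → a ≢ b → (a ==ℤ b) ≡ false
==ℤ-no {a} {b} h = ¬T⇒≡ (λ t → h (toWitness {a? = a ℤ.≟ b} t))

neg-swap : ∀ l b → (- l ==ℤ b) ≡ (l ==ℤ - b)
neg-swap l b = ==ℤ-iff (λ e → trans (sym (ℤP.neg-involutive l)) (cong -_ e)) (λ e → trans (cong -_ e) (ℤP.neg-involutive b))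

neg-neg : ∀ l b → (- l ==ℤ - b) ≡ (l ==ℤ b)
neg-neg l b = ==ℤ-iff neg-inj (cong -_)

χ⁺-neg : ∀ b l → χ⁺ b (- l) ≡ χ⁺ b l
χ⁺-neg b l = trans (cong₂ (λ x y → ⟦ x ⟧ ℤ.+ ⟦ y ⟧) (neg-swap l b) (neg-neg l b)) (ℤP.+-comm ⟦ l ==ℤ - b ⟧ ⟦ l ==ℤ b ⟧)

χ⁺-neg′ : ∀ b l → χ⁺ (- b) l ≡ χ⁺ b l
χ⁺-neg′ b l = trans (cong (λ z → ⟦ l ==ℤ - b ⟧ ℤ.+ ⟦ l ==ℤ z ⟧) (ℤP.neg-involutive b)) (ℤP.+-comm ⟦ l ==ℤ - b ⟧ ⟦ l ==ℤ b ⟧)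

private
  flip- : ∀ a b → a ℤ.- b ≡ - (b ℤ.- a)
  flip- = solve-∀

χ⁻-neg : ∀ b l → χ⁻ b (- l) ≡ - χ⁻ b l
χ⁻-neg b l = trans (cong₂ (λ x y → ⟦ x ⟧ ℤ.- ⟦ y ⟧) (neg-swap l b) (neg-neg l b)) (flip- ⟦ l ==ℤ - b ⟧ ⟦ l ==ℤ b ⟧)

χ⁻-neg′ : ∀ b l → χ⁻ (- b) l ≡ - χ⁻ b l
χ⁻-neg′ b l = trans (cong (λ z → ⟦ l ==ℤ - b ⟧ ℤ.- ⟦ l ==ℤ z ⟧) (ℤP.neg-involutive b)) (flip- ⟦ l ==ℤ - b ⟧ ⟦ l ==ℤ b ⟧)

sg : ℤ → ℤ
sg x = if x <ℤ + 0 then -1ℤ else 1ℤ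

sg-sg : ∀ x → sg x ℤ.* sg x ≡ 1ℤ
sg-sg x with x <ℤ + 0
... | true = refl
... | false = refl

χ⁺-sign : ∀ v b a → χ⁺ b (app v a) ≡ χ⁺ (+ ∣ b ∣) (app v (+ ∣ a ∣))
χ⁺-sign v (+ b) (+ a) = refl
χ⁺-sign v -[1+ b ] (+ a) = χ⁺-neg′ (+ suc b) (app v (+ a))
χ⁺-sign v (+ b) -[1+ a ] = χ⁺-neg (+ b) (app v (+ suc a))
χ⁺-sign v -[1+ b ] -[1+ a ] = trans (χ⁺-neg -[1+ b ] (app v (+ suc a))) (χ⁺-neg′ (+ suc b) (app v (+ suc a)))

χ⁻-sign : ∀ v b a → χ⁻ b (app v a) ≡ (sg a ℤ.* sg b) ℤ.* χ⁻ (+ ∣ b ∣) (app v (+ ∣ a ∣))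
χ⁻-sign v (+ b) (+ a) = sym (ℤP.*-identityˡ (χ⁻ (+ b) (app v (+ a))))
χ⁻-sign v -[1+ b ] (+ a) = trans (χ⁻-neg′ (+ suc b) (app v (+ a))) (sym (ℤP.-1*i≡-i (χ⁻ (+ suc b) (app v (+ a)))))
χ⁻-sign v (+ b) -[1+ a ] = trans (χ⁻-neg (+ b) (app v (+ suc a))) (sym (ℤP.-1*i≡-i (χ⁻ (+ b) (app v (+ suc a)))))
χ⁻-sign v -[1+ b ] -[1+ a ] = trans (χ⁻-neg -[1+ b ] (app v (+ suc a))) (trans (cong -_ (χ⁻-neg′ (+ suc b) (app v (+ suc a)))) (trans (ℤP.neg-involutive (χ⁻ (+ suc b) (app v (+ suc a)))) (sym (ℤP.*-identityˡ (χ⁻ (+ suc b) (app v (+ suc a)))))))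

==ℤ-pos : ∀ l b → (+ l ==ℤ + b) ≡ (l ≡ᵇ b)
==ℤ-pos l b = bool-ext (λ t → NP.≡⇒≡ᵇ l b (ℤP.+-injective (toWitness {a? = + l ℤ.≟ + b} t))) (λ t → fromWitness {a? = + l ℤ.≟ + b} (cong +_ (NP.≡ᵇ⇒≡ l b t)))

==ℤ-posneg : ∀ l {b} → 1 N.≤ b → (+ l ==ℤ - + b) ≡ false
==ℤ-posneg l {suc b} _ = ==ℤ-no {+ l} { - + suc b} (λ ())

χ⁺-abs : ∀ b l → 1 N.≤ b → χ⁺ (+ b) l ≡ ⟦ ∣ l ∣ ≡ᵇ b ⟧
χ⁺-abs b (+ l) 1≤b = trans (cong₂ (λ x y → ⟦ x ⟧ ℤ.+ ⟦ y ⟧) (==ℤ-pos l b) (==ℤ-posneg l 1≤b)) (ℤP.+-identityʳ ⟦ l ≡ᵇ b ⟧)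
χ⁺-abs b -[1+ l ] 1≤b = trans (χ⁺-neg (+ b) (+ suc l)) (χ⁺-abs b (+ suc l) 1≤b)

χ⁻-abs : ∀ b l → 1 N.≤ b → χ⁻ (+ b) l ≡ sg l ℤ.* ⟦ ∣ l ∣ ≡ᵇ b ⟧
χ⁻-abs b (+ l) 1≤b = trans (cong₂ (λ x y → ⟦ x ⟧ ℤ.- ⟦ y ⟧) (==ℤ-pos l b) (==ℤ-posneg l 1≤b)) (trans (ℤP.+-identityʳ ⟦ l ≡ᵇ b ⟧) (sym (ℤP.*-identityˡ ⟦ l ≡ᵇ b ⟧)))
χ⁻-abs b -[1+ l ] 1≤b = trans (χ⁻-neg (+ b) (+ suc l)) (trans (cong -_ (trans (χ⁻-abs b (+ suc l) 1≤b) (ℤP.*-identityˡ ⟦ suc l ≡ᵇ b ⟧))) (sym (ℤP.-1*i≡-i ⟦ suc l ≡ᵇ b ⟧)))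

Full-map : ∀ {A B : Set} ρ τ (F G : B → B → ℤ) (g : A → B) s → Full ρ τ F G (map g s) ≡ Full ρ τ (λ a b → F (g a) (g b)) (λ a b → G (g a) (g b)) s
Full-map ρ τ F G g s = cong₂ ℤ._*_
  (trans (cong (λ l → ∏ l (λ q → F (proj₁ q) (proj₂ q))) (trans (cong (rowPairs ρ) (LP.take-map (sum ρ) s)) (rowPairs-map g ρ (take (sum ρ) s)))) (∏-map (both g) (rowPairs ρ (take (sum ρ) s)) _))
  (trans (cong (λ l → ∏ l (λ q → G (proj₁ q) (proj₂ q))) (trans (cong (rowPairs τ) (LP.drop-map (sum ρ) s)) (rowPairs-map g τ (drop (sum ρ) s)))) (∏-map (both g) (rowPairs τ (drop (sum ρ) s)) _))

app-range : ∀ {n x} → Signed n x → ∀ {a} → a ∈ range n → Label n (app x (+ a))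
app-range X {a} m = app-label X (+ a) (range-∈⁻ m)

module Trace (n : ℕ) (ρ τ : List ℕ) (Pρ : Positive ρ) (Pτ : Positive τ) (n-eq : sum ρ N.+ sum τ ≡ n) where

  k m : ℕ
  k = sum ρ
  m = sum τ

  Ψ : List ℤ → List ℤ → ℤ
  Ψ v = Full ρ τ (λ a b → χ⁺ b (app v a)) (λ a b → χ⁻ b (app v a))

  k≤n : k N.≤ n
  k≤n = subst (k N.≤_) n-eq (NP.m≤m+n k m)

  hi : ∀ {a} → a ∈ range m → (k N.+ a) ∈ range n
  hi p = let a , b = range-∈⁻ p in range-∈⁺ (NP.≤-trans a (NP.m≤n+m _ k)) (subst (_ N.≤_) n-eq (NP.+-monoʳ-≤ k b))

  lo : ∀ {a} → a ∈ range k → a ∈ range n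
  lo p = let a , b = range-∈⁻ p in range-∈⁺ a (NP.≤-trans b k≤n)

  low-factor high-factor : List ℤ → List ℕ → ℤ
  low-factor c y = ∏ (rowPairs ρ y) (λ q → χ⁺ (+ proj₂ q) (app c (+ proj₁ q)))
  high-factor c y′ = ∏ (rowPairs τ y′) (λ q → χ⁻ (+ (k N.+ proj₂ q)) (app c (+ (k N.+ proj₁ q))))

  drawn-full : ∀ {r y} → Drawn r (range r) y → y ↭ range r
  drawn-full {r} {y} (l , u , s) = same-elements-↭ u (range-unique r) s (subset-full N._≟_ u s (NP.≤-reflexive (trans (range-length r) (sym l))))

  module _ {c : List ℤ} (C : Signed n c) where
    open Signed C

    private
      le : ∀ {a} → a N.≤ n → a N.≤ length c
      le = subst (_ N.≤_) (sym len)

      app-at : ∀ {a} → a ∈ range n → app c (+ a) ≡ at (+ 0) c a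
      app-at p = app-+ c (proj₁ (range-∈⁻ p))

      take-len : length (take k c) ≡ k
      take-len = trans (LP.length-take k c) (trans (cong (k N.⊓_) len) (NP.m≤n⇒m⊓n≡m k≤n))

      at-take : ∀ r (w : List ℤ) {a} → 1 N.≤ a → a N.≤ r → a N.≤ length w → at (+ 0) (take r w) a ≡ at (+ 0) w a
      at-take (suc r) (x ∷ w) {suc zero} _ _ _ = refl
      at-take (suc r) (x ∷ w) {suc (suc a)} _ (s≤s l) (s≤s l′) = at-take r w (s≤s z≤n) l l′
      at-take (suc r) [] {suc a} _ _ ()

      at-drop : ∀ r (w : List ℤ) {a} → 1 N.≤ a → at (+ 0) (drop r w) a ≡ at (+ 0) w (r N.+ a)
      at-drop zero w _ = refl
      at-drop (suc r) [] {suc a} _ = refl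
      at-drop (suc r) (x ∷ w) {suc a} h = trans (at-drop r w h) (sh (r N.+ suc a) (NP.≤-trans h (NP.m≤n+m (suc a) r)))
        where
        sh : ∀ j → 1 N.≤ j → at (+ 0) w j ≡ at (+ 0) (x ∷ w) (suc j)
        sh (suc j) _ = refl

      φ-low : ∀ {a} → a ∈ range k → at 0 (φ (take k c)) a ≡ ∣ app c (+ a) ∣
      φ-low p = let a , b = range-∈⁻ p in trans (at-map (+ 0) 0 ∣_∣ (take k c) a (subst (_ N.≤_) (sym take-len) b))
        (cong ∣_∣ (trans (at-take k c a b (le (NP.≤-trans b k≤n))) (sym (app-at (lo p)))))

    low-indicator : ∀ {y} → Drawn k (range k) y → low-factor c y ≡ ⟦ all (λ q → ∣ app c (+ proj₁ q) ∣ ≡ᵇ proj₂ q) (rowPairs ρ y) ⟧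
    low-indicator {y} (l , u , s) = trans (∏-cong∈ (rowPairs ρ y) (λ {q} i → χ⁺-abs (proj₂ q) (app c (+ proj₁ q)) (proj₁ (range-∈⁻ (s (proj₂ (rowPairs-∈ ρ y l i)))))))
      (sym (⟦all⟧ _ (rowPairs ρ y)))

    -- A nonzero product would make c permute the absolute values 1, ..., k, that is, put it into
    -- the subgroup. Hence the case distinction in the induction formula is automatic.
    not-inH : ¬ T (inH k c) → ∀ {y} → Drawn k (range k) y → low-factor c y ≡ 0ℤ
    not-inH h {y} d@(l , u , s) = trans (low-indicator d) (cong ⟦_⟧ (¬T⇒≡ (λ t → h (T-all _ (range k) (λ {j} i → hit t i)))))
      where
      hit : T (all (λ q → ∣ app c (+ proj₁ q) ∣ ≡ᵇ proj₂ q) (rowPairs ρ y)) → ∀ {j} → j ∈ range k → T (any (λ x → ∣ x ∣ ≡ᵇ j) (take k c))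
      hit t {j} i with ∈-map⁻ proj₂ (∈-resp-↭ (↭-sym (↭-trans (rowPairs-snd ρ y l) (drawn-full d))) i)
      ... | (a , .j) , p , refl = let a∈ = s (proj₁ (rowPairs-∈ ρ y l p)) ; b , b′ = range-∈⁻ a∈ in
             T-any (λ x → ∣ x ∣ ≡ᵇ j) (take k c) (at-∈ (+ 0) (take k c) b (subst (a N.≤_) (sym take-len) b′))
               (NP.≡⇒≡ᵇ (∣ at (+ 0) (take k c) a ∣) j (trans (cong ∣_∣ (trans (at-take k c b b′ (le (NP.≤-trans b′ k≤n))) (sym (app-at (lo a∈))))) (NP.≡ᵇ⇒≡ (∣ app c (+ a) ∣) j (all-T _ (rowPairs ρ y) t p))))

    module InH (h : T (inH k c)) where
      private
        u₁ = take k c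
        u₂ = map (shiftDown k) (drop k c)
        p₁ = φ u₁
        p₂ = φ u₂

        p₁-len : length p₁ ≡ k
        p₁-len = trans (LP.length-map ∣_∣ u₁) take-len

        covers : ∀ {j} → j ∈ range k → j ∈ p₁
        covers {j} i with any-T (λ x → ∣ x ∣ ≡ᵇ j) u₁ (all-T _ (range k) h i)
        ... | x , q , e = subst (_∈ p₁) (NP.≡ᵇ⇒≡ (∣ x ∣) j e) (∈-map⁺ ∣_∣ q)

        p₁-range : ∀ {j} → j ∈ p₁ → j ∈ range k
        p₁-range = subset-full N._≟_ (range-unique k) covers (NP.≤-reflexive (trans p₁-len (sym (range-length k))))

        p₁-unique : Unique p₁
        p₁-unique = unique-of-surjective N._≟_ (range-unique k) covers (NP.≤-reflexive (trans p₁-len (sym (range-length k))))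

        inR₁ : ∀ {x} → 1 N.≤ x → x N.≤ length p₁ → 1 N.≤ at 0 p₁ x × at 0 p₁ x N.≤ length p₁
        inR₁ {x} a b = let q , r = range-∈⁻ (p₁-range (at-∈ 0 p₁ a b)) in q , subst (at 0 p₁ x N.≤_) (sym p₁-len) r

        inj₁′ : ∀ {x y} → 1 N.≤ x → x N.≤ length p₁ → 1 N.≤ y → y N.≤ length p₁ → at 0 p₁ x ≡ at 0 p₁ y → x ≡ y
        inj₁′ = at-inj 0 p₁-unique

        above : ∀ {a} → a ∈ range m → k N.< ∣ app c (+ (k N.+ a)) ∣
        above {a} i with k N.<? ∣ app c (+ (k N.+ a)) ∣
        ... | yes q = q
        ... | no q with range-∈⁻ (hi i)
        ...   | l₁ , l₂ with at-surj 0 p₁ (covers (range-∈⁺ {x = ∣ app c (+ (k N.+ a)) ∣} (proj₁ (app-range C {k N.+ a} (hi i))) (NP.≮⇒≥ q)))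
        ...     | j , j₁ , j₂ , e = ⊥-elim (NP.<-irrefl (at-abs-inj C j₁ j≤n l₁ l₂ eq) (NP.≤-<-trans j≤k (NP.m<m+n k (proj₁ (range-∈⁻ i)))))
          where
          j≤k : j N.≤ k
          j≤k = subst (j N.≤_) p₁-len j₂
          j≤n = NP.≤-trans j≤k k≤n
          eq : ∣ at (+ 0) c j ∣ ≡ ∣ at (+ 0) c (k N.+ a) ∣
          eq = trans (cong ∣_∣ (sym (app-at (range-∈⁺ j₁ j≤n)))) (trans (sym (φ-low (range-∈⁺ j₁ j≤k))) (trans e (cong ∣_∣ (app-at (hi i)))))

        shift-abs : ∀ z → ∣ shiftDown k z ∣ ≡ ∣ z ∣ ∸ k
        shift-abs (+ z) = refl
        shift-abs -[1+ z ] = ℤP.∣-i∣≡∣i∣ (+ (suc z ∸ k))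

        drop-len : length (drop k c) ≡ m
        drop-len = trans (LP.length-drop k c) (trans (cong (_∸ k) (trans len (sym n-eq))) (NP.m+n∸m≡n k m))

        p₂-len : length p₂ ≡ m
        p₂-len = trans (LP.length-map ∣_∣ u₂) (trans (LP.length-map (shiftDown k) (drop k c)) drop-len)

        at-u₂ : ∀ {a} → a ∈ range m → at (+ 0) u₂ a ≡ shiftDown k (app c (+ (k N.+ a)))
        at-u₂ i = let a , b = range-∈⁻ i in trans (at-map (+ 0) (+ 0) (shiftDown k) (drop k c) a (subst (_ N.≤_) (sym drop-len) b))
          (cong (shiftDown k) (trans (at-drop k c a) (sym (app-at (hi i)))))

        φ-high : ∀ {a} → a ∈ range m → at 0 p₂ a ≡ ∣ app c (+ (k N.+ a)) ∣ ∸ k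
        φ-high {a₀} i = let a , b = range-∈⁻ i in trans (at-map (+ 0) 0 ∣_∣ u₂ a (subst (_ N.≤_) (sym (trans (LP.length-map (shiftDown k) (drop k c)) drop-len)) b))
          (trans (cong ∣_∣ (at-u₂ i)) (shift-abs (app c (+ (k N.+ a₀)))))

        rng : ∀ {a} → 1 N.≤ a → a N.≤ length p₂ → a ∈ range m
        rng a b = range-∈⁺ a (subst (_ N.≤_) p₂-len b)

        inR₂ : ∀ {x} → 1 N.≤ x → x N.≤ length p₂ → 1 N.≤ at 0 p₂ x × at 0 p₂ x N.≤ length p₂
        inR₂ {x} a b = let i = rng a b in subst (λ z → 1 N.≤ z × z N.≤ length p₂) (sym (φ-high i))
          (NP.m<n⇒0<n∸m (above i) , subst (∣ app c (+ (k N.+ x)) ∣ ∸ k N.≤_) (sym p₂-len)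
             (NP.≤-trans (NP.∸-monoˡ-≤ k (proj₂ (app-range C (hi i)))) (NP.≤-reflexive (trans (cong (_∸ k) (sym n-eq)) (NP.m+n∸m≡n k m)))))

        inj₂′ : ∀ {x y} → 1 N.≤ x → x N.≤ length p₂ → 1 N.≤ y → y N.≤ length p₂ → at 0 p₂ x ≡ at 0 p₂ y → x ≡ y
        inj₂′ {x} {y} a b a′ b′ e = NP.+-cancelˡ-≡ k x y (at-abs-inj C (proj₁ (range-∈⁻ (hi i))) (proj₂ (range-∈⁻ (hi i))) (proj₁ (range-∈⁻ (hi j))) (proj₂ (range-∈⁻ (hi j)))
            (trans (cong ∣_∣ (sym (app-at (hi i)))) (trans (NP.∸-cancelʳ-≡ (NP.<⇒≤ (above i)) (NP.<⇒≤ (above j)) (trans (sym (φ-high i)) (trans e (φ-high j)))) (cong ∣_∣ (app-at (hi j))))))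
          where
          i = rng a b
          j = rng a′ b′

        δ₁ = Cycles.δ p₁ inR₁ inj₁′
        δ₂ = Cycles.δ p₂ inR₂ inj₂′

      low-sum : ψ ρ p₁ ≡ draw k (range k) (low-factor c)
      low-sum = trans (CycleRows.ψ-count p₁ inR₁ inj₁′ ρ Pρ (sym p₁-len)) (trans (cong₂ (λ r K → draw r (range K) (rowsProd (sameRows δ₁ ρ))) (size-sameRows δ₁ ρ) p₁-len)
         (draw-cong k (range k) (λ {y} d@(l , u , s) → trans (rowsProd-∏ δ₁ ρ y) (∏-cong∈ (rowPairs ρ y) (λ {q} i →
            let a∈ , b∈ = rowPairs-∈ ρ y l i in trans (cong (λ z → ⟦ z ≡ᵇ proj₂ q ⟧) (φ-low (s a∈))) (sym (χ⁺-abs (proj₂ q) (app c (+ proj₁ q)) (proj₁ (range-∈⁻ (s b∈))))))))))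

      private
        sign-∏ : ∀ xs → signPow (ℓt xs) ≡ ∏ xs sg
        sign-∏ [] = refl
        sign-∏ (x ∷ xs) with x <ℤ + 0
        ... | true = trans (cong -_ (sign-∏ xs)) (sym (ℤP.-1*i≡-i _))
        ... | false = trans (sign-∏ xs) (sym (ℤP.*-identityˡ _))

        sg-shift : ∀ z → k N.< ∣ z ∣ → sg (shiftDown k z) ≡ sg z
        sg-shift (+ z) l = refl
        sg-shift -[1+ z ] l with suc z ∸ k | NP.m<n⇒0<n∸m l
        ... | suc _ | _ = refl

        ∏-at : ∀ (L : List ℤ) {j} → length L ≡ j → (G : ℤ → ℤ) → ∏ L G ≡ ∏ (range j) (λ i → G (at (+ 0) L i))
        ∏-at L refl G = trans (cong (λ l → ∏ l G) (sym (map-at-range (+ 0) L))) (∏-map (at (+ 0) L) (range (length L)) G)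

        sign-high : signPow (ℓt u₂) ≡ ∏ (range m) (λ a → sg (app c (+ (k N.+ a))))
        sign-high = trans (sign-∏ u₂) (trans (∏-at u₂ (trans (LP.length-map (shiftDown k) (drop k c)) drop-len) sg)
          (∏-cong∈ (range m) (λ i → trans (cong sg (at-u₂ i)) (sg-shift _ (above i)))))

      -- The sign is the product of the signs of the entries; as every letter is the first component
      -- of exactly one pair, each sign can be attached to a pair, which turns the 0/1 entries into
      -- values of `χ⁻`.
      high-sum : signPow (ℓt u₂) ℤ.* ψ τ p₂ ≡ draw m (range m) (high-factor c)
      high-sum = trans (cong (signPow (ℓt u₂) ℤ.*_) (trans (CycleRows.ψ-count p₂ inR₂ inj₂′ τ Pτ (sym p₂-len)) (cong₂ (λ r K → draw r (range K) (rowsProd (sameRows δ₂ τ))) (size-sameRows δ₂ τ) p₂-len)))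
        (trans (sym (draw-*ˡ (signPow (ℓt u₂)) m (range m) (rowsProd (sameRows δ₂ τ)))) (draw-cong m (range m) (λ {y} d@(l , u , s) →
          trans (cong₂ ℤ._*_ (trans sign-high (trans (∏-↭ _ (↭-sym (drawn-full d))) (trans (cong (λ L → ∏ L (λ a → sg (app c (+ (k N.+ a))))) (sym (rowPairs-fst τ y l))) (∏-map proj₁ (rowPairs τ y) _)))) (rowsProd-∏ δ₂ τ y))
          (trans (sym (∏-* (rowPairs τ y) (λ q → sg (app c (+ (k N.+ proj₁ q)))) (λ q → δ₂ (proj₁ q) (proj₂ q)))) (∏-cong∈ (rowPairs τ y) (λ {q} i →
            let a∈ , b∈ = rowPairs-∈ τ y l i in trans (cong (λ z → sg (app c (+ (k N.+ proj₁ q))) ℤ.* ⟦ z ⟧) (eq (proj₁ q) (proj₂ q) (s a∈)))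
              (sym (χ⁻-abs (k N.+ proj₂ q) (app c (+ (k N.+ proj₁ q))) (NP.≤-trans (proj₁ (range-∈⁻ (s b∈))) (NP.m≤n+m (proj₂ q) k))))))))))
        where
        eq : ∀ a b → a ∈ range m → (at 0 p₂ a ≡ᵇ b) ≡ (∣ app c (+ (k N.+ a)) ∣ ≡ᵇ k N.+ b)
        eq a b i = bool-ext
          (λ t → NP.≡⇒≡ᵇ _ _ (trans (sym (NP.m+[n∸m]≡n (NP.<⇒≤ (above i)))) (cong (k N.+_) (trans (sym (φ-high i)) (NP.≡ᵇ⇒≡ (at 0 p₂ a) b t)))))
          (λ t → NP.≡⇒≡ᵇ (at 0 p₂ a) b (trans (φ-high i) (trans (cong (_∸ k) (NP.≡ᵇ⇒≡ (∣ app c (+ (k N.+ a)) ∣) (k N.+ b) t)) (NP.m+n∸m≡n k b))))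

    fH-draw : (if inH k c then fH ρ τ c else + 0) ≡ draw k (range k) (λ y → draw m (range m) (λ y′ → low-factor c y ℤ.* high-factor c y′))
    fH-draw with inH k c in e
    ... | true = trans (cong₂ ℤ._*_ (InH.low-sum (≡⇒T e)) (InH.high-sum (≡⇒T e)))
         (trans (ℤP.*-comm L H) (trans (sym (draw-*ˡ H k (range k) (low-factor c)))
           (draw-cong′ k (range k) (λ y → trans (ℤP.*-comm H (low-factor c y)) (sym (draw-*ˡ (low-factor c y) m (range m) (high-factor c)))))))
      where
      L = draw k (range k) (low-factor c)
      H = draw m (range m) (high-factor c)
    ... | false = sym (trans (draw-cong k (range k) (λ {y} d → trans (draw-cong′ m (range m) (λ y′ → trans (cong (ℤ._* high-factor c y′) (not-inH (λ t → subst T e t) d)) (ℤP.*-zeroˡ (high-factor c y′)))) (draw-0 m (range m)))) (draw-0 k (range k)))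

  Y : List ℕ → List ℕ → List ℤ
  Y y y′ = map +_ (y ++ map (k N.+_) y′)

  Y-signed : ∀ {y y′} → Drawn k (range k) y → Drawn m (range m) y′ → Signed n (Y y y′)
  Y-signed {y} {y′} (l , u , s) (l′ , u′ , s′) = record
    { len = trans (LP.length-map +_ (y ++ map (k N.+_) y′)) (trans (LP.length-++ y) (trans (cong₂ N._+_ l (trans (LP.length-map (k N.+_) y′) l′)) n-eq))
    ; lbl = λ i → lbl′ (∈-map⁻ +_ i)
    ; uniq = subst Unique (trans (sym (LP.map-id _)) (LP.map-∘ (y ++ map (k N.+_) y′))) (unique-++ u (unique-map (k N.+_) (λ _ _ → NP.+-cancelˡ-≡ k _ _) u′) dis) }
    where
    lbl′ : ∀ {x} → (∃ λ a → a ∈ y ++ map (k N.+_) y′ × x ≡ + a) → Label n x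
    lbl′ (a , i , refl) with ∈-++⁻ y i
    ... | inj₁ q = range-∈⁻ (lo (s q))
    ... | inj₂ q with ∈-map⁻ (k N.+_) q
    ...   | b , j , refl = range-∈⁻ (hi (s′ j))
    dis : ∀ {a} → a ∈ y → a ∈ map (k N.+_) y′ → ⊥
    dis p q with ∈-map⁻ (k N.+_) q
    ... | b , j , refl = NP.<-irrefl refl (NP.<-≤-trans (NP.m<m+n k (proj₁ (range-∈⁻ (s′ j)))) (proj₂ (range-∈⁻ (s p))))

  conj : List ℤ → List ℤ → List ℤ
  conj v x = mul (inverse n x) (mul v x)

  module _ {v x : List ℤ} (V : Signed n v) (X : Signed n x) where
    private
      eq-inv : ∀ b l → Label n b → Label n l → (app (inverse n x) l ==ℤ b) ≡ (l ==ℤ app x b)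
      eq-inv b l lb ll = ==ℤ-iff (λ e → trans (sym (app-inverseʳ X l ll)) (cong (app x) e)) (λ e → trans (cong (app (inverse n x)) e) (app-inverseˡ X b lb))

      eq-inv- : ∀ b l → Label n b → Label n l → (app (inverse n x) l ==ℤ - b) ≡ (l ==ℤ - app x b)
      eq-inv- b l lb ll = trans (eq-inv (- b) l (label-neg {n} {b} lb) ll) (cong (l ==ℤ_) (app-neg x b))

      conj-app : ∀ {a} → a ∈ range n → app (conj v x) (+ a) ≡ app (inverse n x) (app v (app x (+ a)))
      conj-app {a} i = trans (app-mul (inverse n x) (trans (LP.length-map (app v) x) (Signed.len X)) (+ a) (range-∈⁻ i))
        (cong (app (inverse n x)) (app-mul v (Signed.len X) (+ a) (range-∈⁻ i)))

      lv : ∀ {a} → a ∈ range n → Label n (app v (app x (+ a)))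
      lv {a} i = app-label V (app x (+ a)) (app-range X i)

    -- The conjugate of v by x relates a to b exactly when v relates x(a) to x(b). So its product
    -- over a filling is the product of v over the filling with x applied to all entries.
    factor-conj : ∀ {y y′} → Drawn k (range k) y → Drawn m (range m) y′ → low-factor (conj v x) y ℤ.* high-factor (conj v x) y′ ≡ Ψ v (mul x (Y y y′))
    factor-conj {y} {y′} (l , u , s) (l′ , u′ , s′) = sym (trans (Full-map ρ τ _ _ (app x) (Y y y′)) (trans (Full-map ρ τ _ _ +_ (y ++ map (k N.+_) y′))
      (cong₂ ℤ._*_
        (trans (cong (λ L → ∏ (rowPairs ρ L) F₁) (take-++-len y (map (k N.+_) y′) l))
           (∏-cong∈ (rowPairs ρ y) (λ {q} i → let a∈ , b∈ = rowPairs-∈ ρ y l i in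
              trans (cong₂ (λ p r → ⟦ p ⟧ ℤ.+ ⟦ r ⟧) (sym (eq-inv (+ proj₂ q) (app v (app x (+ proj₁ q))) (range-∈⁻ (lo (s b∈))) (lv (lo (s a∈))))) (sym (eq-inv- (+ proj₂ q) (app v (app x (+ proj₁ q))) (range-∈⁻ (lo (s b∈))) (lv (lo (s a∈))))))
                (cong (χ⁺ (+ proj₂ q)) (sym (conj-app (lo (s a∈))))))))
        (trans (cong (λ L → ∏ (rowPairs τ L) F₂) (drop-++-len y (map (k N.+_) y′) l)) (trans (cong (λ L → ∏ L F₂) (rowPairs-map (k N.+_) τ y′)) (trans (∏-map (both (k N.+_)) (rowPairs τ y′) F₂)
           (∏-cong∈ (rowPairs τ y′) (λ {q} i → let a∈ , b∈ = rowPairs-∈ τ y′ l′ i in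
              trans (cong₂ (λ p r → ⟦ p ⟧ ℤ.- ⟦ r ⟧) (sym (eq-inv (+ (k N.+ proj₂ q)) (app v (app x (+ (k N.+ proj₁ q)))) (range-∈⁻ (hi (s′ b∈))) (lv (hi (s′ a∈))))) (sym (eq-inv- (+ (k N.+ proj₂ q)) (app v (app x (+ (k N.+ proj₁ q)))) (range-∈⁻ (hi (s′ b∈))) (lv (hi (s′ a∈))))))
                (cong (χ⁻ (+ (k N.+ proj₂ q))) (sym (conj-app (hi (s′ a∈))))))))))))) 
      where
      F₁ F₂ : ℕ × ℕ → ℤ
      F₁ q = χ⁺ (app x (+ proj₂ q)) (app v (app x (+ proj₁ q)))
      F₂ q = χ⁻ (app x (+ proj₂ q)) (app v (app x (+ proj₁ q)))

    term-draw : (if inH k (conj v x) then fH ρ τ (conj v x) else + 0) ≡ draw k (range k) (λ y → draw m (range m) (λ y′ → Ψ v (mul x (Y y y′))))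
    term-draw = trans (fH-draw (mul-signed (inverse-signed X) (mul-signed V X))) (draw-cong k (range k) (λ d → draw-cong m (range m) (λ d′ → factor-conj d d′)))

  ∑-mulʳ : ∀ {y} → Signed n y → (F : List ℤ → ℤ) → ∑ (allBn n) (λ x → F (mul x y)) ≡ ∑ (allBn n) F
  ∑-mulʳ {y} S F = ∑-bij (allBn n) (allBn n) (λ x → mul x y) (λ x → F (mul x y)) F (allBn-unique n) (allBn-unique n)
    (λ i → allBn-∈⁺ (mul-signed (allBn-∈⁻ i) S))
    (λ {x} {x′} i j e → signed-ext (allBn-∈⁻ i) (allBn-∈⁻ j) (λ l ll → trans (via x l ll) (trans (cong (λ z → app z (app (inverse n y) l)) e) (sym (via x′ l ll)))))
    (λ {z} i → mul z (inverse n y) , allBn-∈⁺ (mul-signed (allBn-∈⁻ i) (inverse-signed S)) ,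
       signed-ext (mul-signed (mul-signed (allBn-∈⁻ i) (inverse-signed S)) S) (allBn-∈⁻ i) (λ l ll → trans (app-mul (mul z (inverse n y)) (Signed.len S) l ll)
         (trans (app-mul z (inverse-length S) (app y l) (app-label S l ll)) (cong (app z) (app-inverseˡ S l ll)))))
    (λ _ → refl)
    where
    via : ∀ x l → Label n l → app x l ≡ app (mul x y) (app (inverse n y) l)
    via x l ll = trans (cong (app x) (sym (app-inverseʳ S l ll))) (sym (app-mul x (Signed.len S) (app (inverse n y) l) (app-inverse-label S l ll)))

  -- The arrangements y, y′ of cycles into rows are absorbed into the conjugating element x.
  ∑-conj : ∀ {v} → Signed n v → ∑ (allBn n) (λ x → if inH k (conj v x) then fH ρ τ (conj v x) else + 0) ≡ + (k !) ℤ.* (+ (m !) ℤ.* ∑ (allBn n) (Ψ v))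
  ∑-conj {v} V = trans (∑-cong∈ (allBn n) (λ i → term-draw V (allBn-∈⁻ i)))
    (trans (sym (draw-∑ k (range k) (allBn n) (λ x y → draw m (range m) (λ y′ → Ψ v (mul x (Y y y′))))))
    (trans (draw-cong k (range k) (λ {y} d → trans (sym (draw-∑ m (range m) (allBn n) (λ x y′ → Ψ v (mul x (Y y y′)))))
        (trans (draw-cong m (range m) (λ {y′} d′ → ∑-mulʳ (Y-signed d d′) (Ψ v))) (draw-const m (range m) _ (range-unique m) (range-length m)))))
      (draw-const k (range k) _ (range-unique k) (range-length k))))

-- Summation over the elements below w

Tagged : Set
Tagged = ℕ × ℕ × Bool

nx : List Tagged → ℕ → ℕ × Bool
nx [] a = 0 , true
nx ((a′ , bs) ∷ L) a = if a′ ≡ᵇ a then bs else nx L a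

nx-spec : ∀ {L a bs} → Unique (map proj₁ L) → (a , bs) ∈ L → nx L a ≡ bs
nx-spec {(a , bs) ∷ L} u (here refl) rewrite T⇒≡ (≡ᵇ-refl a) = refl
nx-spec {(a′ , bs′) ∷ L} {a} u (there i) rewrite ¬T⇒≡ {a′ ≡ᵇ a} (λ t → unique-head u (subst (_∈ map proj₁ L) (sym (NP.≡ᵇ⇒≡ a′ a t)) (∈-map⁺ proj₁ i))) = nx-spec (unique-tail u) i

ε : Bool → ℤ
ε true = 1ℤ
ε false = -1ℤ

χ : Bool → ℤ → ℤ → ℤ
χ true = χ⁺
χ false = χ⁻

χ-pos : ∀ s b i → 1 N.≤ b → χ s (+ b) (+ i) ≡ ⟦ i ≡ᵇ b ⟧
χ-pos true b i h = χ⁺-abs b (+ i) h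
χ-pos false b i h = trans (χ⁻-abs b (+ i) h) (ℤP.*-identityˡ ⟦ i ≡ᵇ b ⟧)

χ-neg : ∀ s b i → 1 N.≤ b → χ s (+ b) (- + i) ≡ ε s ℤ.* ⟦ i ≡ᵇ b ⟧
χ-neg true b i h = trans (χ⁺-neg (+ b) (+ i)) (trans (χ⁺-abs b (+ i) h) (sym (ℤP.*-identityˡ ⟦ i ≡ᵇ b ⟧)))
χ-neg false b i h = trans (χ⁻-neg (+ b) (+ i)) (trans (cong -_ (trans (χ⁻-abs b (+ i) h) (ℤP.*-identityˡ ⟦ i ≡ᵇ b ⟧))) (sym (ℤP.-1*i≡-i ⟦ i ≡ᵇ b ⟧)))

χ-zero : ∀ s b l → 1 N.≤ b → ¬ T (∣ l ∣ ≡ᵇ b) → χ s (+ b) l ≡ 0ℤ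
χ-zero true b l h n = trans (χ⁺-abs b l h) (cong ⟦_⟧ (¬T⇒≡ n))
χ-zero false b l h n = trans (χ⁻-abs b l h) (trans (cong (λ t → sg l ℤ.* ⟦ t ⟧) (¬T⇒≡ n)) (ℤP.*-zeroʳ (sg l)))

module TraceSum (n : ℕ) (ρ τ : List ℕ) (Pρ : Positive ρ) (Pτ : Positive τ) (n-eq : sum ρ N.+ sum τ ≡ n)
  (α : ℤ → ℤ → Bool) (sb : List ℤ → Bool)
  (sb-∏ : ∀ {v} → Signed n v → ⟦ sb v ⟧ ≡ ∏ (range n) (λ a → ⟦ α (+ a) (app v (+ a)) ⟧)) where
  open Trace n ρ τ Pρ Pτ n-eq

  M : Bool → ℕ → ℕ → ℤ
  M s a b = ⟦ α (+ a) (+ b) ⟧ ℤ.+ ε s ℤ.* ⟦ α (+ a) (- + b) ⟧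

  -- In the second shape each letter contributes its sign twice, once as an entry and once as the
  -- successor of an entry, so only absolute values matter.
  Ψ-abs : ∀ {z} v → Signed n z → Ψ v z ≡ Full ρ τ (λ a b → χ⁺ (+ b) (app v (+ a))) (λ a b → χ⁻ (+ b) (app v (+ a))) (map ∣_∣ z)
  Ψ-abs {z} v Z = trans (cong₂ ℤ._*_ (∏-cong (rowPairs ρ (take k z)) (λ q → χ⁺-sign v (proj₂ q) (proj₁ q))) high)
      (sym (Full-map ρ τ (λ a b → χ⁺ (+ b) (app v (+ a))) (λ a b → χ⁻ (+ b) (app v (+ a))) ∣_∣ z))
    where
    s = drop k z
    len-s : length s ≡ sum τ
    len-s = trans (LP.length-drop k z) (trans (cong (_∸ k) (trans (Signed.len Z) (sym n-eq))) (NP.m+n∸m≡n k m))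
    Q = rowPairs τ s
    X : ℤ × ℤ → ℤ
    X q = χ⁻ (+ ∣ proj₂ q ∣) (app v (+ ∣ proj₁ q ∣))
    ones : ∏ Q (λ q → sg (proj₁ q) ℤ.* sg (proj₂ q)) ≡ 1ℤ
    ones = trans (∏-* Q (sg ∘ proj₁) (sg ∘ proj₂)) (trans (cong₂ ℤ._*_
       (trans (sym (∏-map proj₁ Q sg)) (cong (λ l → ∏ l sg) (rowPairs-fst τ s len-s)))
       (trans (sym (∏-map proj₂ Q sg)) (∏-↭ sg (rowPairs-snd τ s len-s))))
       (trans (sym (∏-* s sg sg)) (trans (∏-cong s sg-sg) (∏-1 s))))
    high : ∏ Q (λ q → χ⁻ (proj₂ q) (app v (proj₁ q))) ≡ ∏ Q X
    high = trans (∏-cong Q (λ q → χ⁻-sign v (proj₂ q) (proj₁ q))) (trans (∏-* Q (λ q → sg (proj₁ q) ℤ.* sg (proj₂ q)) X)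
      (trans (cong (ℤ._* ∏ Q X) ones) (ℤP.*-identityˡ (∏ Q X))))

  module _ {σ : List ℕ} (σ-len : length σ ≡ n) (σ-uniq : Unique σ) (σ-sub : ∀ {x} → x ∈ σ → x ∈ range n) where
    private
      low = rowPairs ρ (take k σ)
      high = rowPairs τ (drop k σ)
      tag : Bool → ℕ × ℕ → Tagged
      tag s q = proj₁ q , proj₂ q , s
      pr : List Tagged
      pr = map (tag true) low ++ map (tag false) high

      ∏-pr : (H : Tagged → ℤ) → ∏ pr H ≡ ∏ low (H ∘ tag true) ℤ.* ∏ high (H ∘ tag false)
      ∏-pr H = trans (∏-++ (map (tag true) low) (map (tag false) high) H) (cong₂ ℤ._*_ (∏-map (tag true) low H) (∏-map (tag false) high H))

      len-low : length (take k σ) ≡ k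
      len-low = trans (LP.length-take k σ) (trans (cong (k N.⊓_) σ-len) (NP.m≤n⇒m⊓n≡m k≤n))

      len-high : length (drop k σ) ≡ sum τ
      len-high = trans (LP.length-drop k σ) (trans (cong (_∸ k) (trans σ-len (sym n-eq))) (NP.m+n∸m≡n k m))

      snd₃ : Tagged → ℕ
      snd₃ t = proj₁ (proj₂ t)

      firsts : map proj₁ pr ≡ σ
      firsts = trans (LP.map-++ proj₁ (map (tag true) low) (map (tag false) high)) (trans (cong₂ _++_
         (trans (sym (LP.map-∘ low)) (rowPairs-fst ρ (take k σ) len-low)) (trans (sym (LP.map-∘ high)) (rowPairs-fst τ (drop k σ) len-high))) (LP.take++drop≡id k σ))

      seconds : map snd₃ pr ↭ σ
      seconds = ↭-trans (↭-reflexive (trans (LP.map-++ snd₃ (map (tag true) low) (map (tag false) high)) (cong₂ _++_ (sym (LP.map-∘ low)) (sym (LP.map-∘ high)))))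
        (↭-trans (++⁺ (rowPairs-snd ρ (take k σ) len-low) (rowPairs-snd τ (drop k σ) len-high)) (↭-reflexive (LP.take++drop≡id k σ)))

      full : σ ↭ range n
      full = same-elements-↭ σ-uniq (range-unique n) σ-sub (subset-full N._≟_ σ-uniq σ-sub (NP.≤-reflexive (trans (range-length n) (sym σ-len))))

      fst-uniq : Unique (map proj₁ pr)
      fst-uniq = subst Unique (sym firsts) σ-uniq

      next : ℕ → ℕ
      next a = proj₁ (nx pr a)
      sgn : ℕ → Bool
      sgn a = proj₂ (nx pr a)

      ∏-next : (H : ℕ → ℕ → Bool → ℤ) → ∏ pr (λ t → H (proj₁ t) (snd₃ t) (proj₂ (proj₂ t))) ≡ ∏ (range n) (λ a → H a (next a) (sgn a))
      ∏-next H = trans (∏-cong∈ pr (λ { {a , b , s} i → cong (λ q → H a (proj₁ q) (proj₂ q)) (sym (nx-spec fst-uniq i)) }))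
        (trans (sym (∏-map proj₁ pr (λ a → H a (next a) (sgn a)))) (trans (cong (λ l → ∏ l (λ a → H a (next a) (sgn a))) firsts) (∏-↭ _ full)))

      next-range : ∀ {a} → a ∈ range n → next a ∈ range n
      next-range {a} i with ∈-map⁻ proj₁ (subst (a ∈_) (sym firsts) (∈-resp-↭ (↭-sym full) i))
      ... | (.a , b , s) , p , refl = subst (_∈ range n) (sym (cong proj₁ (nx-spec fst-uniq p))) (σ-sub (∈-resp-↭ seconds (∈-map⁺ snd₃ p)))

      G : ℕ → ℤ → ℤ
      G a l = ⟦ α (+ a) l ⟧ ℤ.* χ (sgn a) (+ next a) l

      P : List ℤ → ℤ
      P v = ∏ (range n) (λ a → G a (at (+ 0) v a))

      P-eq : ∀ {v} → Signed n v → ⟦ sb v ⟧ ℤ.* Full ρ τ (λ a b → χ⁺ (+ b) (app v (+ a))) (λ a b → χ⁻ (+ b) (app v (+ a))) σ ≡ P v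
      P-eq {v} V = trans (cong₂ ℤ._*_ (sb-∏ V) (trans (sym (∏-pr (λ t → χ (proj₂ (proj₂ t)) (+ snd₃ t) (app v (+ proj₁ t))))) (∏-next (λ a b s → χ s (+ b) (app v (+ a))))))
        (trans (sym (∏-* (range n) (λ a → ⟦ α (+ a) (app v (+ a)) ⟧) (λ a → χ (sgn a) (+ next a) (app v (+ a)))))
          (∏-cong∈ (range n) (λ {a} i → cong (G a) (app-+ v (proj₁ (range-∈⁻ i))))))

      -- A nonzero product forces the absolute value at position a to be the successor of a in the
      -- filling, which makes v a signed permutation. So the sum over the group extends to all
      -- words, where positions are independent.
      P-signed : ∀ {v} → v ∈ words n (labels n) → ⟦ isBn n v ⟧ ℤ.* P v ≡ P v
      P-signed {v} i with all (λ a → ∣ at (+ 0) v a ∣ ≡ᵇ next a) (range n) in e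
      ... | true = trans (cong (λ b → ⟦ b ⟧ ℤ.* P v) (T⇒≡ (Signed⇒IsBn S))) (ℤP.*-identityˡ (P v))
        where
        vl = proj₁ (words-∈⁻ n (labels n) i)
        abs-v : map ∣_∣ v ≡ map next (range n)
        abs-v = at-ext 0 _ _ (trans (LP.length-map ∣_∣ v) (trans vl (sym (trans (LP.length-map next (range n)) (range-length n)))))
          (λ {j} a b → let b′ = subst (j N.≤_) (LP.length-map ∣_∣ v) b ; b″ = subst (j N.≤_) vl b′ in
             trans (at-map (+ 0) 0 ∣_∣ v a b′) (trans (NP.≡ᵇ⇒≡ (∣ at (+ 0) v j ∣) (next j) (all-T _ (range n) (≡⇒T e) (range-∈⁺ a b″))) (sym (at-map-range 0 next n a b″))))
        next-σ : map next σ ≡ map snd₃ pr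
        next-σ = trans (cong (map next) (sym firsts)) (trans (sym (LP.map-∘ pr)) (LP.map-cong-local (All.tabulate (λ { {a , b , s} p → cong proj₁ (nx-spec fst-uniq p) }))))
        S : Signed n v
        S = record { len = vl ; lbl = λ p → labels-∈⁻ (proj₂ (words-∈⁻ n (labels n) i) p)
          ; uniq = subst Unique (sym abs-v) (unique-↭ (↭-trans (↭-sym (↭-trans (↭-reflexive next-σ) seconds)) (map⁺ next full)) σ-uniq) }
      ... | false = trans (cong (⟦ isBn n v ⟧ ℤ.*_) zero′) (trans (ℤP.*-zeroʳ ⟦ isBn n v ⟧) (sym zero′))
        where
        fails : ∀ L → all (λ a → ∣ at (+ 0) v a ∣ ≡ᵇ next a) L ≡ false → ∃ λ a → a ∈ L × ¬ T (∣ at (+ 0) v a ∣ ≡ᵇ next a)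
        fails (a ∷ L) e with ∣ at (+ 0) v a ∣ ≡ᵇ next a in e′
        ... | false = a , here refl , λ t → subst T e′ t
        ... | true = let b , p , q = fails L e in b , there p , q
        zero′ : P v ≡ 0ℤ
        zero′ with fails (range n) e
        ... | a , p , q = ∏-zero (range n) _ p (trans (cong (⟦ α (+ a) (at (+ 0) v a) ⟧ ℤ.*_) (χ-zero (sgn a) (next a) (at (+ 0) v a) (proj₁ (range-∈⁻ (next-range p))) q)) (ℤP.*-zeroʳ ⟦ α (+ a) (at (+ 0) v a) ⟧))

      ∑-G : ∀ {a} → a ∈ range n → ∑ (labels n) (G a) ≡ M (sgn a) a (next a)
      ∑-G {a} i = trans (∑-labels n (G a)) (trans (∑-cong (range n) (λ j → trans (cong₂ (λ x y → ⟦ α (+ a) (+ j) ⟧ ℤ.* x ℤ.+ ⟦ α (+ a) (- + j) ⟧ ℤ.* y)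
            (trans (χ-pos (sgn a) (next a) j b₁) (cong ⟦_⟧ (≡ᵇ-sym j (next a)))) (trans (χ-neg (sgn a) (next a) j b₁) (cong (λ t → ε (sgn a) ℤ.* ⟦ t ⟧) (≡ᵇ-sym j (next a)))))
          (z ⟦ α (+ a) (+ j) ⟧ ⟦ α (+ a) (- + j) ⟧ ⟦ next a ≡ᵇ j ⟧ (ε (sgn a))))) (pick (M (sgn a) a) (range-unique n) (next-range i)))
        where
        b₁ = proj₁ (range-∈⁻ (next-range i))
        z : ∀ p q d e → p ℤ.* d ℤ.+ q ℤ.* (e ℤ.* d) ≡ d ℤ.* (p ℤ.+ e ℤ.* q)
        z = solve-∀

    -- The filling prescribes the absolute values of v and leaves the signs free. Since lying below
    -- w is a condition on each position separately, the sum over signs factors into one sum of two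
    -- terms per position, an entry of `M`.
    ∑-below : ∑ (allBn n) (λ v → ⟦ sb v ⟧ ℤ.* Full ρ τ (λ a b → χ⁺ (+ b) (app v (+ a))) (λ a b → χ⁻ (+ b) (app v (+ a))) σ) ≡ Full ρ τ (M true) (M false) σ
    ∑-below = trans (∑-cong∈ (allBn n) (λ i → P-eq (allBn-∈⁻ i))) (trans (∑-filt (isBn n) (words n (labels n)) P) (trans (∑-cong∈ (words n (labels n)) P-signed)
      (trans (∑-words-∏ n (labels n) (+ 0) G) (trans (∏-cong∈ (range n) ∑-G) (trans (sym (∏-next (λ a b s → M s a b))) (∏-pr (λ t → M (proj₂ (proj₂ t)) (proj₁ t) (snd₃ t))))))))

  total : List ℤ → ℤ
  total v = ∑ (allBn n) (λ x → if inH k (conj v x) then fH ρ τ (conj v x) else + 0)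

  -- The order of the subgroup appears as k! and (n - k)! for the arrangements absorbed in `∑-conj`,
  -- times 2^n for the signs of the conjugating element, on which nothing depends.
  total-sum : ∑ (filt sb (allBn n)) total ≡ + orderH n k ℤ.* draw n (range n) (Full ρ τ (M true) (M false))
  total-sum = trans (∑-filt sb (allBn n) total) (trans (∑-cong∈ (allBn n) (λ {v} i → trans (cong (⟦ sb v ⟧ ℤ.*_) (∑-conj (allBn-∈⁻ i)))
       (trans (z ⟦ sb v ⟧ (+ (k !)) (+ (m !)) (∑ (allBn n) (Ψ v))) (cong (K ℤ.*_) (trans (sym (∑-*ˡ ⟦ sb v ⟧ (allBn n) (Ψ v))) (∑-cong∈ (allBn n) (λ {x} j → cong (⟦ sb v ⟧ ℤ.*_) (Ψ-abs v (allBn-∈⁻ j)))))))))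
    (trans (∑-*ˡ K (allBn n) _) (trans (cong (K ℤ.*_) (trans (∑-swap (allBn n) (allBn n) _)
       (trans (∑-cong∈ (allBn n) (λ {x} j → let Z = allBn-∈⁻ j in ∑-below {map ∣_∣ x} (trans (LP.length-map ∣_∣ x) (Signed.len Z)) (Signed.uniq Z) (sub Z)))
         (∑-allBn-abs n (Full ρ τ (M true) (M false))))))
      (trans (z₂ (+ (k !)) (+ (m !)) (+ (2 ^ n)) _) (cong (ℤ._* draw n (range n) (Full ρ τ (M true) (M false))) ord)))))
    where
    K = + (k !) ℤ.* + (m !)
    z : ∀ s a b c → s ℤ.* (a ℤ.* (b ℤ.* c)) ≡ (a ℤ.* b) ℤ.* (s ℤ.* c)
    z = solve-∀
    z₂ : ∀ a b c d → (a ℤ.* b) ℤ.* (c ℤ.* d) ≡ (c ℤ.* (a ℤ.* b)) ℤ.* d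
    z₂ = solve-∀
    sub : ∀ {x} → Signed n x → ∀ {a} → a ∈ map ∣_∣ x → a ∈ range n
    sub Z i with ∈-map⁻ ∣_∣ i
    ... | l , j , refl = let p , q = Signed.lbl Z j in range-∈⁺ p q
    ord : + (2 ^ n) ℤ.* (+ (k !) ℤ.* + (m !)) ≡ + orderH n k
    ord = trans (cong (+ (2 ^ n) ℤ.*_) (trans (sym (ℤP.pos-* (k !) (m !))) (cong (λ j → + (k ! N.* j !)) (sym (trans (cong (_∸ k) (sym n-eq)) (NP.m+n∸m≡n k m))))))
      (sym (ℤP.pos-* (2 ^ n) (k ! N.* (n ∸ k) !)))

-- Counting bitableaux

all-cong : {p q : El → Bool} (xs : List El) → (∀ x → p x ≡ q x) → all p xs ≡ all q xs
all-cong [] h = refl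
all-cong (x ∷ xs) h = cong₂ _∧_ (h x) (all-cong xs h)

map-zip-fst : (σ : List El) (s : List El′) → length σ ≡ length s → map proj₁ (zip σ s) ≡ σ
map-zip-fst [] [] e = refl
map-zip-fst (x ∷ σ) (y ∷ s) e = cong (x ∷_) (map-zip-fst σ s (NP.suc-injective e))

module Tableaux (n : ℕ) (π : ℤ → List Vertex) (ρ τ : List ℕ) (n-eq : sum ρ N.+ sum τ ≡ n) where

  k : ℕ
  k = sum ρ

  g : ℕ → Bool
  g = grounded π

  weak : ℕ → ℕ → Bool
  weak a b = not (gtQ π a b)

  N₂ N₀ : Matrix
  N₂ a b = (1ℤ ℤ.+ ⟦ g a ⟧) ℤ.* ⟦ weak a b ⟧
  N₀ a b = (1ℤ ℤ.- ⟦ g a ⟧) ℤ.* ⟦ weak a b ⟧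

  private
    W : ℕ × ℕ → ℤ
    W q = ⟦ weak (proj₁ q) (proj₂ q) ⟧

  row-∏ : ∀ (r : List (ℕ × Bool)) → ⟦ cycRow π r ⟧ ≡ ∏ (cycPairs (map proj₁ r)) W
  row-∏ [] = refl
  row-∏ (x ∷ r) = trans (⟦∧⟧ (rowSemistrict π (x ∷ r)) _) (go x r (proj₁ x))
    where
    go : ∀ y r z → ⟦ rowSemistrict π (y ∷ r) ⟧ ℤ.* ⟦ weak (proj₁ (lastOr y r)) z ⟧ ≡ ∏ (chainPairs (proj₁ y) (map proj₁ r) z) W
    go y [] z = trans (ℤP.*-identityˡ ⟦ weak (proj₁ y) z ⟧) (sym (ℤP.*-identityʳ ⟦ weak (proj₁ y) z ⟧))
    go y (y′ ∷ r) z = trans (cong (ℤ._* ⟦ weak (proj₁ (lastOr y′ r)) z ⟧) (⟦∧⟧ (weak (proj₁ y) (proj₁ y′)) (rowSemistrict π (y′ ∷ r))))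
      (trans (ℤP.*-assoc ⟦ weak (proj₁ y) (proj₁ y′) ⟧ ⟦ rowSemistrict π (y′ ∷ r) ⟧ ⟦ weak (proj₁ (lastOr y′ r)) z ⟧) (cong (⟦ weak (proj₁ y) (proj₁ y′) ⟧ ℤ.*_) (go y′ r z)))

  rows-∏ : ∀ ρ e → ⟦ cyclicallyRowSemistrict π (chop ρ e) ⟧ ≡ ∏ (rowPairs ρ (map proj₁ e)) W
  rows-∏ [] e = refl
  rows-∏ (r ∷ ρ) e = trans (⟦∧⟧ (cycRow π (take r e)) _) (trans (cong₂ ℤ._*_ (trans (row-∏ (take r e)) (cong (λ l → ∏ (cycPairs l) W) (sym (LP.take-map r e))))
      (trans (rows-∏ ρ (drop r e)) (cong (λ l → ∏ (rowPairs ρ l) W) (sym (LP.drop-map r e))))) (sym (∏-++ (cycPairs (take r (map proj₁ e))) (rowPairs ρ (drop r (map proj₁ e))) W)))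

  okStars okPlaces : List (ℕ × Bool) → Bool
  okStars e = all (λ q → not (proj₂ q) ∨ g (proj₁ q)) e
  okPlaces e = all (λ q → not (g (proj₁ q)) ∨ any (λ y → proj₁ y ≡ᵇ proj₁ q) (take k e)) e

  -- The two flags of a letter are chosen independently of the others: a grounded letter allows
  -- both, any other letter only the absence of a star.
  stars-sum : ∀ σ → ∑ (words (length σ) (true ∷ false ∷ [])) (λ s → ⟦ okStars (zip σ s) ⟧) ≡ ∏ σ (λ x → 1ℤ ℤ.+ ⟦ g x ⟧)
  stars-sum [] = refl
  stars-sum (x ∷ σ) = trans (∑-concatMap (λ t → map (t ∷_) Ws) (true ∷ false ∷ []) (λ s → ⟦ okStars (zip (x ∷ σ) s) ⟧)) (trans (cong₂ (λ a b → a ℤ.+ (b ℤ.+ 0ℤ)) (part true) (part false))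
      (trans (z ⟦ g x ⟧ (∑ Ws S)) (cong ((1ℤ ℤ.+ ⟦ g x ⟧) ℤ.*_) (stars-sum σ))))
    where
    Ws = words (length σ) (true ∷ false ∷ [])
    S : List Bool → ℤ
    S s = ⟦ okStars (zip σ s) ⟧
    z : ∀ a b → a ℤ.* b ℤ.+ (1ℤ ℤ.* b ℤ.+ 0ℤ) ≡ (1ℤ ℤ.+ a) ℤ.* b
    z = solve-∀
    part : ∀ t → ∑ (map (t ∷_) Ws) (λ s → ⟦ okStars (zip (x ∷ σ) s) ⟧) ≡ ⟦ not t ∨ g x ⟧ ℤ.* ∑ Ws S
    part t = trans (∑-map (t ∷_) Ws _) (trans (∑-cong Ws (λ s → ⟦∧⟧ (not t ∨ g x) (okStars (zip σ s)))) (∑-*ˡ ⟦ not t ∨ g x ⟧ Ws S))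

  module _ {σ : List ℕ} (len : length σ ≡ n) (u : Unique σ) where
    private
      lo = take k σ
      hi = drop k σ
      len-lo : length lo ≡ k
      len-lo = trans (LP.length-take k σ) (trans (cong (k N.⊓_) len) (NP.m≤n⇒m⊓n≡m (subst (k N.≤_) n-eq (NP.m≤m+n k (sum τ)))))
      len-hi : length hi ≡ sum τ
      len-hi = trans (LP.length-drop k σ) (trans (cong (_∸ k) (trans len (sym n-eq))) (NP.m+n∸m≡n k (sum τ)))
      split : lo ++ hi ≡ σ
      split = LP.take++drop≡id k σ
      disjoint : ∀ {x} → x ∈ lo → x ∈ hi → ⊥
      disjoint = go lo hi (subst Unique (sym split) u)
        where
        go : ∀ xs ys → Unique (xs ++ ys) → ∀ {x} → x ∈ xs → x ∈ ys → ⊥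
        go (x ∷ xs) ys v (here refl) j = unique-head v (∈-++⁺ʳ xs j)
        go (x ∷ xs) ys v (there i) j = go xs ys (unique-tail v) i j

    -- A letter of the first shape meets the condition in any case, a letter of the second shape
    -- only if it is not grounded, because it does not recur in the first.
    places : ∀ {s} → length s ≡ n → ⟦ okPlaces (zip σ s) ⟧ ≡ ∏ hi (λ x → 1ℤ ℤ.- ⟦ g x ⟧)
    places {s} ls = trans (cong ⟦_⟧ (trans (all-fst (zip σ s) P₀)
        (trans (cong (all P₀) fstσ) (trans (all-cong σ (λ x → cong (not (g x) ∨_) (any-fst x)))
          (cong (all P) (sym split))))))
      (trans (⟦all⟧ P (lo ++ hi)) (trans (∏-++ lo hi (λ x → ⟦ P x ⟧)) (trans (cong₂ ℤ._*_ (trans (∏-cong∈ lo (λ {x} i → cong ⟦_⟧ (T⇒≡ (T-∨ʳ {not (g x)} (T-any (_≡ᵇ x) lo i (≡ᵇ-refl x)))))) (∏-1 lo))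
          (∏-cong∈ hi (λ {x} i → trans (cong (λ b → ⟦ not (g x) ∨ b ⟧) (¬T⇒≡ (λ t → let y , j , e = any-T (_≡ᵇ x) lo t in disjoint j (subst (_∈ hi) (sym (NP.≡ᵇ⇒≡ y x e)) i)))) (flip (g x)))))
        (ℤP.*-identityˡ (∏ hi (λ x → 1ℤ ℤ.- ⟦ g x ⟧))))))
      where
      P₀ P : ℕ → Bool
      P₀ x = not (g x) ∨ any (λ y → proj₁ y ≡ᵇ x) (take k (zip σ s))
      P x = not (g x) ∨ any (_≡ᵇ x) lo
      fstσ : map proj₁ (zip σ s) ≡ σ
      fstσ = map-zip-fst σ s (trans len (sym ls))
      all-fst : ∀ (e : List (ℕ × Bool)) (p : ℕ → Bool) → all (λ q → p (proj₁ q)) e ≡ all p (map proj₁ e)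
      all-fst [] p = refl
      all-fst (x ∷ e) p = cong (p (proj₁ x) ∧_) (all-fst e p)
      any-fst′ : ∀ (e : List (ℕ × Bool)) (p : ℕ → Bool) → any (λ q → p (proj₁ q)) e ≡ any p (map proj₁ e)
      any-fst′ [] p = refl
      any-fst′ (x ∷ e) p = cong (p (proj₁ x) ∨_) (any-fst′ e p)
      any-fst : ∀ x → any (λ y → proj₁ y ≡ᵇ x) (take k (zip σ s)) ≡ any (_≡ᵇ x) lo
      any-fst x = trans (any-fst′ (take k (zip σ s)) (_≡ᵇ x)) (cong (any (_≡ᵇ x)) (trans (sym (LP.take-map k (zip σ s))) (cong (take k) fstσ)))
      flip : ∀ b → ⟦ not b ∨ false ⟧ ≡ 1ℤ ℤ.- ⟦ b ⟧
      flip true = refl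
      flip false = refl

    fillings : ∀ {s} → length s ≡ n → ⟦ cyclicallyRowSemistrict π (chop ρ (take k (zip σ s))) ∧ cyclicallyRowSemistrict π (chop τ (drop k (zip σ s))) ⟧
      ≡ ∏ (rowPairs ρ lo) W ℤ.* ∏ (rowPairs τ hi) W
    fillings {s} ls = trans (⟦∧⟧ (cyclicallyRowSemistrict π (chop ρ (take k (zip σ s)))) _) (cong₂ ℤ._*_
        (trans (rows-∏ ρ (take k (zip σ s))) (cong (λ l → ∏ (rowPairs ρ l) W) (trans (sym (LP.take-map k (zip σ s))) (cong (take k) fstσ))))
        (trans (rows-∏ τ (drop k (zip σ s))) (cong (λ l → ∏ (rowPairs τ l) W) (trans (sym (LP.drop-map k (zip σ s))) (cong (drop k) fstσ)))))
      where
      fstσ : map proj₁ (zip σ s) ≡ σ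
      fstσ = map-zip-fst σ s (trans len (sym ls))

    private
      X = ∏ (rowPairs ρ lo) W
      Y = ∏ (rowPairs τ hi) W
      G₀ = ∏ hi (λ x → 1ℤ ℤ.- ⟦ g x ⟧)

    flags-sum : ∑ (words n (true ∷ false ∷ [])) (λ s → ⟦ okStars (zip σ s) ∧ okPlaces (zip σ s) ⟧
        ℤ.* ⟦ cyclicallyRowSemistrict π (chop ρ (take k (zip σ s))) ∧ cyclicallyRowSemistrict π (chop τ (drop k (zip σ s))) ⟧) ≡ Full ρ τ N₂ N₀ σ
    flags-sum = trans (∑-cong∈ (words n _) (λ {s} i → let ls = proj₁ (words-∈⁻ n _ i) in
         cong₂ ℤ._*_ (trans (⟦∧⟧ (okStars (zip σ s)) (okPlaces (zip σ s))) (cong (⟦ okStars (zip σ s) ⟧ ℤ.*_) (places ls))) (fillings ls)))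
      (trans (∑-*ʳ (X ℤ.* Y) (words n _) (λ s → ⟦ okStars (zip σ s) ⟧ ℤ.* G₀)) (trans (cong (ℤ._* (X ℤ.* Y)) (trans (∑-*ʳ G₀ (words n _) (λ s → ⟦ okStars (zip σ s) ⟧))
          (cong (ℤ._* G₀) (trans (cong (λ j → ∑ (words j (true ∷ false ∷ [])) (λ s → ⟦ okStars (zip σ s) ⟧)) (sym len)) (trans (stars-sum σ) (trans (cong (λ l → ∏ l (λ x → 1ℤ ℤ.+ ⟦ g x ⟧)) (sym split)) (∏-++ lo hi _)))))))
        (trans (z₁ A₁ B₁ G₀ X Y) (cong₂ ℤ._*_ lowpart highpart))))
      where
      A₁ = ∏ lo (λ x → 1ℤ ℤ.+ ⟦ g x ⟧)
      B₁ = ∏ hi (λ x → 1ℤ ℤ.+ ⟦ g x ⟧)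
      z₁ : ∀ a b c x y → ((a ℤ.* b) ℤ.* c) ℤ.* (x ℤ.* y) ≡ (a ℤ.* x) ℤ.* ((b ℤ.* c) ℤ.* y)
      z₁ = solve-∀
      pull : ∀ κ l → length l ≡ sum κ → (h : ℕ → ℤ) → ∏ l h ℤ.* ∏ (rowPairs κ l) W ≡ ∏ (rowPairs κ l) (λ q → h (proj₁ q) ℤ.* ⟦ weak (proj₁ q) (proj₂ q) ⟧)
      pull κ l e h = trans (cong (ℤ._* ∏ (rowPairs κ l) W) (trans (cong (λ L → ∏ L h) (sym (rowPairs-fst κ l e))) (∏-map proj₁ (rowPairs κ l) h))) (sym (∏-* (rowPairs κ l) (h ∘ proj₁) W))
      lowpart : A₁ ℤ.* X ≡ ∏ (rowPairs ρ lo) (λ q → N₂ (proj₁ q) (proj₂ q))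
      lowpart = pull ρ lo len-lo (λ x → 1ℤ ℤ.+ ⟦ g x ⟧)
      -- The flags were summed over the letters of both shapes; in the second shape their factor is
      -- swallowed by the exclusion of grounded letters.
      merge : ∀ b → (1ℤ ℤ.+ ⟦ b ⟧) ℤ.* (1ℤ ℤ.- ⟦ b ⟧) ≡ 1ℤ ℤ.- ⟦ b ⟧
      merge true = refl
      merge false = refl
      highpart : (B₁ ℤ.* G₀) ℤ.* Y ≡ ∏ (rowPairs τ hi) (λ q → N₀ (proj₁ q) (proj₂ q))
      highpart = trans (cong (ℤ._* Y) (trans (sym (∏-* hi (λ x → 1ℤ ℤ.+ ⟦ g x ⟧) (λ x → 1ℤ ℤ.- ⟦ g x ⟧))) (∏-cong hi (λ x → merge (g x))))) (pull τ hi len-hi (λ x → 1ℤ ℤ.- ⟦ g x ⟧))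

  countCyc-draw : + countCyc n π ρ τ ≡ draw n (range n) (Full ρ τ N₂ N₀)
  countCyc-draw = trans (countP-∑ _ (Tab n π ρ τ)) (trans (∑-map _ (filt _ L) _) (trans (∑-filt _ L _)
    (trans (∑-concatMap _ (filt distinct (words n (range n))) _) (trans (∑-distinct-words n (range n) _) (draw-cong n (range n) (λ {σ} d@(l , u , _) →
      trans (∑-map (zip σ) (words n (true ∷ false ∷ [])) _) (trans (∑-cong (words n (true ∷ false ∷ [])) (λ s → cong₂ ℤ._*_
          (cong ⟦_⟧ (cong₂ _∧_ (all-cong (zip σ s) (λ { (x , b) → refl })) (all-cong (zip σ s) (λ { (x , b) → refl })))) refl))
        (flags-sum l u))))))))
    where
    L = concatMap (λ σ → map (zip σ) (words n (true ∷ false ∷ []))) (filt distinct (words n (range n)))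

-- Division by the order of the subgroup

+-/ : ∀ i j d .{{_ : NonZero d}} → (i / d) ℚ.+ (j / d) ≡ (i ℤ.+ j) / d
+-/ i j (suc d) = ℚP.toℚᵘ-injective (ℚᵘP.≃-trans (ℚP.toℚᵘ-homo-+ (i / suc d) (j / suc d))
  (ℚᵘP.≃-trans (ℚᵘP.+-cong (ℚP.toℚᵘ-fromℚᵘ (mkℚᵘ i d)) (ℚP.toℚᵘ-fromℚᵘ (mkℚᵘ j d)))
  (ℚᵘP.≃-trans (*≡* (trans (z i j (+ suc d)) (cong ((i ℤ.+ j) ℤ.*_) (sym (ℤP.pos-* (suc d) (suc d)))))) (ℚᵘP.≃-sym (ℚP.toℚᵘ-fromℚᵘ (mkℚᵘ (i ℤ.+ j) d))))))
  where
  z : ∀ i j D → (i ℤ.* D ℤ.+ j ℤ.* D) ℤ.* D ≡ (i ℤ.+ j) ℤ.* (D ℤ.* D)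
  z = solve-∀

cancel-/ : ∀ c d .{{_ : NonZero d}} → (+ d ℤ.* c) / d ≡ c / 1
cancel-/ c (suc d) = ℚP.fromℚᵘ-cong {mkℚᵘ (+ suc d ℤ.* c) d} {mkℚᵘ c 0} (*≡* (trans (ℤP.*-identityʳ (+ suc d ℤ.* c)) (ℤP.*-comm (+ suc d) c)))

zero-/ : ∀ d .{{_ : NonZero d}} → 0ℤ / d ≡ ℚ.0ℚ
zero-/ (suc d) = ℚP.fromℚᵘ-cong {mkℚᵘ 0ℤ d} {mkℚᵘ 0ℤ 0} (*≡* refl)

sumℚ-/ : ∀ {A : Set} (L : List A) (t : A → ℤ) d .{{_ : NonZero d}} → sumℚ (map (λ v → t v / d) L) ≡ ∑ L t / d
sumℚ-/ [] t d = sym (zero-/ d)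
sumℚ-/ (x ∷ L) t d = trans (cong ((t x / d) ℚ.+_) (sumℚ-/ L t d)) (+-/ (t x) (∑ L t) d)

sumℤ-∑ : ∀ {A : Set} (f : A → ℤ) L → sumℤ (map f L) ≡ ∑ L f
sumℤ-∑ f [] = refl
sumℤ-∑ f (x ∷ L) = cong (ℤ._+_ (f x)) (sumℤ-∑ f L)

partition-positive : ∀ ρ → IsPartition ρ → Positive ρ
partition-positive [] _ = []
partition-positive (x ∷ []) h = h ∷ []
partition-positive (x ∷ y ∷ ρ) (h , d) with partition-positive (y ∷ ρ) d
... | 1≤y ∷ P = NP.≤-trans 1≤y h ∷ (1≤y ∷ P)

-- Networks symmetric under negation, and conclusion

module Main (n : ℕ) (w : List ℤ) (W : Signed n w) (I : List Interval) (Z : ZigZag n I) (max : IsMaxCoveringType n I (app w))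
  (π : ℤ → List Vertex) (fam : PathFamily n I (λ i → i) π) where
  open Bruhat n I Z w W max

  Dom : ℕ → Set
  Dom x = 1 N.≤ x × x N.≤ n

  α : ℤ → ℤ → Bool
  α i j with label? n i | label? n j
  ... | yes li | yes lj = ⌊ A? i j li lj ⌋
  ... | _ | _ = false

  α-complete : ∀ i j → Label n i → Label n j → A i j → T (α i j)
  α-complete i j li lj r with label? n i | label? n j
  ... | yes li′ | yes lj′ = fromWitness r
  ... | no h | _ = h li
  ... | yes _ | no h = h lj

  α-sound : ∀ i j → T (α i j) → A i j
  α-sound i j t with label? n i | label? n j
  ... | yes li | yes lj = toWitness t

  α-iff : ∀ {i j i′ j′} → Label n i → Label n j → Label n i′ → Label n j′ → (A i j → A i′ j′) → (A i′ j′ → A i j) → α i j ≡ α i′ j′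
  α-iff {i} {j} {i′} {j′} li lj li′ lj′ f h = bool-ext (λ t → α-complete i′ j′ li′ lj′ (f (α-sound i j t))) (λ t → α-complete i j li lj (h (α-sound i′ j′ t)))

  nl : ∀ x → Label n x → Label n (- x)
  nl x = label-neg {n} {x}

  -- By `InS⇒bruhat` and `bruhat⇒InS` the Bruhat condition is tested position by position, and
  -- `A-neg` reduces the negative positions to the positive ones.
  sb-∏ : ∀ {v} → Signed n v → ⟦ bruhatLeq n v w ⟧ ≡ ∏ (range n) (λ a → ⟦ α (+ a) (app v (+ a)) ⟧)
  sb-∏ {v} V = trans (cong ⟦_⟧ (bool-ext to from)) (⟦all⟧ (λ a → α (+ a) (app v (+ a))) (range n))
    where
    to : T (bruhatLeq n v w) → T (all (λ a → α (+ a) (app v (+ a))) (range n))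
    to t = T-all _ (range n) (λ {a} i → let la = range-∈⁻ i in α-complete (+ a) (app v (+ a)) la (app-label V (+ a) la) (bruhat⇒InS t (+ a) la))
    from : T (all (λ a → α (+ a) (app v (+ a))) (range n)) → T (bruhatLeq n v w)
    from t = InS⇒bruhat V inS
      where
      pos : ∀ {a} → 1 N.≤ a → a N.≤ n → A (+ a) (app v (+ a))
      pos {a} p q = α-sound (+ a) (app v (+ a)) (all-T _ (range n) t (range-∈⁺ p q))
      inS : InS v
      inS (+ a) (p , q) = pos p q
      inS -[1+ a ] (p , q) = A-neg (+ suc a) (app v (+ suc a)) (p , q) (app-label V (+ suc a) (p , q)) (pos p q)

  share⇒ : ∀ i j → Label n i → Label n j → i ≢ j → T (shareVertex (π i) (π j)) → E i j
  share⇒ i j li lj ne = share⇒E li lj ne (fam i li) (fam j lj)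

  ⇒share : ∀ i j → Label n i → Label n j → E i j → T (shareVertex (π i) (π j))
  ⇒share i j li lj = E⇒share (fam i li) (fam j lj)

  E-neg : ∀ i j → Label n i → Label n j → i ≢ j → E i j → E (- i) (- j)
  E-neg i j li lj ne e = A∧Aᵗ⇒E (nl i li) (nl j lj) (ne ∘ neg-inj) (A-neg i j li lj (E⇒A li lj e)) (A-neg j i lj li (E⇒A lj li (E-sym e)))

  K : ℕ → ℕ → Bool
  K m b = shareVertex (π (+ b)) (π (+ m))

  g : ℕ → Bool
  g = grounded π

  ω : Bool → ℕ → ℤ
  ω true m = 1ℤ ℤ.+ ⟦ g m ⟧
  ω false m = 1ℤ ℤ.- ⟦ g m ⟧

  M : Bool → Matrix
  M s a b = ⟦ α (+ a) (+ b) ⟧ ℤ.+ ε s ℤ.* ⟦ α (+ a) (- + b) ⟧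

  ω-eq : ∀ s m → ω s m ≡ 1ℤ ℤ.+ ε s ℤ.* ⟦ g m ⟧
  ω-eq true m = cong (ℤ._+_ 1ℤ) (sym (ℤP.*-identityˡ ⟦ g m ⟧))
  ω-eq false m = cong (ℤ._+_ 1ℤ) (sym (ℤP.-1*i≡-i ⟦ g m ⟧))

  ln : ∀ {a} → Dom a → Label n (- + a)
  ln {a} d = nl (+ a) d

  α-refl : ∀ {m} → Dom m → α (+ m) (+ m) ≡ true
  α-refl {m} d = T⇒≡ (α-complete (+ m) (+ m) d d (A-refl d))

  -- A path from m to -m yields one from -m to m by negation, and mutual reachability means a common
  -- interval, hence a common vertex of the two paths of type e.
  α-ground : ∀ {m} → Dom m → α (+ m) (- + m) ≡ g m
  α-ground {m} d = bool-ext
    (λ t → let r = α-sound (+ m) (- + m) t in ⇒share (+ m) (- + m) d (ln d) (A∧Aᵗ⇒E {+ m} { - + m} d (ln d) (label≢neg {n} {+ m} d) r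
        (subst (A (- + m)) (ℤP.neg-involutive (+ m)) (A-neg (+ m) (- + m) d (ln d) r))))
    (λ t → α-complete (+ m) (- + m) d (ln d) (E⇒A d (ln d) (share⇒ (+ m) (- + m) d (ln d) (label≢neg {n} {+ m} d) t)))

  -m≤ : ∀ {a m} → a N.≤ m → - + m ≤ + a
  -m≤ {a} {m} _ = ℤP.≤-trans (ℤP.neg-mono-≤ (ℤ.+≤+ {0} {m} z≤n)) (ℤ.+≤+ z≤n)

  -a≤ : ∀ {a m} → - + a ≤ + m
  -a≤ {a} {m} = ℤP.≤-trans (ℤP.neg-mono-≤ (ℤ.+≤+ {0} {a} z≤n)) (ℤ.+≤+ z≤n)

  -a<m : ∀ {a m} → 1 N.≤ m → - + a < + m
  -a<m {a} {m} h = ℤP.≤-<-trans (ℤP.neg-mono-≤ (ℤ.+≤+ {0} {a} z≤n)) (ℤ.+<+ h)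

  -- The symmetry of A under negation rules out two different overlapping intervals [c,d] and [-d,-c].
  grounded-of-neg : ∀ {b m} → Dom b → Dom m → b N.≤ m → E (- + b) (+ m) → E (+ m) (- + m)
  grounded-of-neg {b} {m} db dm b≤m e = A∧Aᵗ⇒E {+ m} { - + m} dm (ln dm) (label≢neg {n} {+ m} dm) (proj₁ both′) (proj₂ both′)
    where
    P = peel {+ m} dm
    e′ : E (- + m) (+ b)
    e′ = E-sym (subst (λ z → E z (- + m)) (ℤP.neg-involutive (+ b)) (E-neg (- + b) (+ m) (ln db) dm (λ q → ℤP.<-irrefl q (-a<m (proj₁ dm))) e))
    -- The interval common to -m and b contains -b as well, because b ≤ m.
    e″ : E (- + m) (- + b)
    e″ = E-convex {x = - + m} {y = - + b} (ln dm) (ln db) ℤP.≤-refl (-m≤ {b} {m} b≤m) (ℤP.neg-mono-≤ (ℤ.+≤+ b≤m)) -a≤ e′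
    c≤ : Peeled.c₀ P ≤ - + b
    c≤ = Peeled.E⇒≤ P (-a<m (proj₁ dm)) e
    flipA : A (- + m) (+ m) → A (+ m) (- + m)
    flipA r = subst (λ z → A z (- + m)) (ℤP.neg-involutive (+ m)) (A-neg (- + m) (+ m) (ln dm) dm r)
    flipA′ : A (+ m) (- + m) → A (- + m) (+ m)
    flipA′ r = subst (A (- + m)) (ℤP.neg-involutive (+ m)) (A-neg (+ m) (- + m) dm (ln dm) r)
    both′ : A (+ m) (- + m) × A (- + m) (+ m)
    both′ with Peeled.lastRow P
    ... | inj₁ R = flipA r , r
      where
      r : A (- + m) (+ m)
      -- Row -m reaches -b, which lies in the block from c₀ to m; as the columns of the block agree,
      -- it reaches m.
      r = LastRowℤ.unif R { - + m} { - + b} {+ m} (ln dm) (ln db) dm (-a<m (proj₁ dm)) c≤ -a≤ (Peeled.c₀≤m P) ℤP.≤-refl (E⇒A (ln dm) (ln db) e″)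
    ... | inj₂ R = r , flipA′ r
      where
      r : A (+ m) (- + m)
      r = LastRowℤ.unif R { - + m} { - + b} {+ m} (ln dm) (ln db) dm (-a<m (proj₁ dm)) c≤ -a≤ (Peeled.c₀≤m P) ℤP.≤-refl (E⇒A (ln db) (ln dm) (E-sym e″))

  module Grounded {m} (dm : Dom m) (gm : T (g m)) where
    e : E (- + m) (+ m)
    e = E-sym (share⇒ (+ m) (- + m) dm (ln dm) (label≢neg {n} {+ m} dm) gm)

    αpp : ∀ {a b} → Dom a → Dom b → a N.≤ m → b N.≤ m → α (+ a) (+ b) ≡ true
    αpp {a} {b} da db a≤ b≤ = T⇒≡ (α-complete (+ a) (+ b) da db (E⇒A da db (E-convex {x = + a} {y = + b} da db (-m≤ a≤) (ℤ.+≤+ a≤) (-m≤ b≤) (ℤ.+≤+ b≤) e)))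

    αpn : ∀ {a b} → Dom a → Dom b → a N.≤ m → b N.≤ m → α (+ a) (- + b) ≡ true
    αpn {a} {b} da db a≤ b≤ = T⇒≡ (α-complete (+ a) (- + b) da (ln db) (E⇒A da (ln db) (E-convex {x = + a} {y = - + b} da (ln db) (-m≤ a≤) (ℤ.+≤+ a≤) (ℤP.neg-mono-≤ (ℤ.+≤+ b≤)) -a≤ e)))

    -- One interval contains all labels from -m to m, so a reaches both b and -b, and the entry is 1
    -- plus or minus 1.
    Mval : ∀ s {a b} → Dom a → Dom b → a N.≤ m → b N.≤ m → M s a b ≡ ω s m
    Mval s da db a≤ b≤ = trans (cong₂ (λ x y → ⟦ x ⟧ ℤ.+ ε s ℤ.* ⟦ y ⟧) (αpp da db a≤ b≤) (αpn da db a≤ b≤)) (sym (trans (ω-eq s m) (cong (λ t → 1ℤ ℤ.+ ε s ℤ.* ⟦ t ⟧) (T⇒≡ gm))))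

    Kval : ∀ {b} → Dom b → b N.≤ m → K m b ≡ true
    Kval {b} db b≤ = T⇒≡ (⇒share (+ b) (+ m) db dm (E-convex {x = + b} {y = + m} db dm (-m≤ b≤) (ℤ.+≤+ b≤) (-m≤ NP.≤-refl) ℤP.≤-refl e))

  module _ (s : Bool) where
    open RowSums Dom (ω s) K

    private
      ⟦⟧-unit : ∀ {m} → ¬ T (g m) → ω s m ≡ 1ℤ
      ⟦⟧-unit {m} h = trans (ω-eq s m) (trans (cong (λ t → 1ℤ ℤ.+ ε s ℤ.* ⟦ t ⟧) (¬T⇒≡ h)) (cong (ℤ._+_ 1ℤ) (ℤP.*-zeroʳ (ε s))))

      drop-neg : ∀ x {y} → y ≡ false → ⟦ x ⟧ ℤ.+ ε s ℤ.* ⟦ y ⟧ ≡ ⟦ x ⟧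
      drop-neg x refl = trans (cong (ℤ._+_ ⟦ x ⟧) (ℤP.*-zeroʳ (ε s))) (ℤP.+-identityʳ ⟦ x ⟧)

      times-unit : ∀ {m} x → ¬ T (g m) → ⟦ x ⟧ ≡ ω s m ℤ.* ⟦ x ⟧
      times-unit x h = sym (trans (cong (ℤ._* ⟦ x ⟧) (⟦⟧-unit h)) (ℤP.*-identityˡ ⟦ x ⟧))

      module Ungrounded {m} (dm : Dom m) (ng : ¬ T (g m)) (P : Peeled (+ m)) where
        open Peeled P

        -- Otherwise -b would be a neighbour of m, and `grounded-of-neg` would make m grounded. Thus
        -- the sparse row or column of the combination has no contribution from negative labels.
        no-neg : ∀ {b} → Dom b → b N.< m → ¬ (c₀ ≤ - + b)
        no-neg {b} db b<m h = ng (⇒share (+ m) (- + m) dm (ln dm) (grounded-of-neg db dm (NP.<⇒≤ b<m) (≤⇒E { - + b} (ln db) (-a<m (proj₁ dm)) h)))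

        K⇒≤ : ∀ {k} → Dom k → k N.< m → T (K m k) → c₀ ≤ + k
        K⇒≤ {k} dk k<m t = E⇒≤ (ℤ.+<+ k<m) (share⇒ (+ k) (+ m) dk dm (λ q → NP.<-irrefl (ℤP.+-injective q) k<m) t)

        ≤⇒K : ∀ {b} → Dom b → b N.< m → c₀ ≤ + b → T (K m b)
        ≤⇒K {b} db b<m h = ⇒share (+ b) (+ m) db dm (≤⇒E {+ b} db (ℤ.+<+ b<m) h)

        forward : LastRowℤ A (+ m) c₀ → Peel (M s) m
        forward R = fwd
          (λ {b} db b<m → trans (drop-neg (α (+ m) (+ b)) (¬T⇒≡ (λ t → no-neg db b<m (only { - + b} (ln db) -a≤ (α-sound (+ m) (- + b) t)))))
             (trans (cong ⟦_⟧ (bool-ext (λ t → ≤⇒K db b<m (only {+ b} db (ℤ.+≤+ (NP.<⇒≤ b<m)) (α-sound (+ m) (+ b) t)))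
                (λ t → α-complete (+ m) (+ b) dm db (full {+ b} db (ℤ.+≤+ (NP.<⇒≤ b<m)) (K⇒≤ db b<m t))))) (times-unit (K m b) ng)))
          (λ {a} {k} da dk a<m k<m t → let c≤k = K⇒≤ dk k<m t ; k≤m = ℤ.+≤+ (NP.<⇒≤ k<m) in cong₂ (λ x y → ⟦ x ⟧ ℤ.+ ε s ℤ.* ⟦ y ⟧)
             (α-iff {+ a} {+ m} {+ a} {+ k} da dm da dk
                (unif {+ a} {+ m} {+ k} da dm dk (ℤ.+<+ a<m) c₀≤m ℤP.≤-refl c≤k k≤m) (unif {+ a} {+ k} {+ m} da dk dm (ℤ.+<+ a<m) c≤k k≤m c₀≤m ℤP.≤-refl))
             -- The columns -m and -k are compared in row a by negating: they become the columns m
             -- and k in row -a, where the rule for the block applies.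
             (α-iff {+ a} { - + m} {+ a} { - + k} da (ln dm) da (ln dk)
                (via da dm dk (unif { - + a} {+ m} {+ k} (ln da) dm dk (-a<m (proj₁ dm)) c₀≤m ℤP.≤-refl c≤k k≤m))
                (via da dk dm (unif { - + a} {+ k} {+ m} (ln da) dk dm (-a<m (proj₁ dm)) c≤k k≤m c₀≤m ℤP.≤-refl))))
          where
          open LastRowℤ R
          via : ∀ {a k l} → Dom a → Dom k → Dom l → (A (- + a) (+ k) → A (- + a) (+ l)) → A (+ a) (- + k) → A (+ a) (- + l)
          via {a} {k} {l} da dk dl h r = subst (λ z → A z (- + l)) (ℤP.neg-involutive (+ a)) (A-neg (- + a) (+ l) (ln da) dl (h (subst (A (- + a)) (ℤP.neg-involutive (+ k)) (A-neg (+ a) (- + k) da (ln dk) r))))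

        backward : LastRowℤ (λ i j → A j i) (+ m) c₀ → Peel (M s) m
        backward R = bwd
          (λ {b} db b<m → trans (drop-neg (α (+ b) (+ m)) (¬T⇒≡ (λ t → no-neg db b<m (only { - + b} (ln db) -a≤
                (subst (A (- + b)) (ℤP.neg-involutive (+ m)) (A-neg (+ b) (- + m) db (ln dm) (α-sound (+ b) (- + m) t)))))))
             (trans (cong ⟦_⟧ (bool-ext (λ t → ≤⇒K db b<m (only {+ b} db (ℤ.+≤+ (NP.<⇒≤ b<m)) (α-sound (+ b) (+ m) t)))
                (λ t → α-complete (+ b) (+ m) db dm (full {+ b} db (ℤ.+≤+ (NP.<⇒≤ b<m)) (K⇒≤ db b<m t))))) (times-unit (K m b) ng)))
          (λ {a} {k} da dk a<m k<m t → let c≤k = K⇒≤ dk k<m t ; k≤m = ℤ.+≤+ (NP.<⇒≤ k<m) in cong₂ (λ x y → ⟦ x ⟧ ℤ.+ ε s ℤ.* ⟦ y ⟧)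
             (α-iff {+ m} {+ a} {+ k} {+ a} dm da dk da
                (unif {+ a} {+ m} {+ k} da dm dk (ℤ.+<+ a<m) c₀≤m ℤP.≤-refl c≤k k≤m) (unif {+ a} {+ k} {+ m} da dk dm (ℤ.+<+ a<m) c≤k k≤m c₀≤m ℤP.≤-refl))
             (α-iff {+ m} { - + a} {+ k} { - + a} dm (ln da) dk (ln da)
                (unif { - + a} {+ m} {+ k} (ln da) dm dk (-a<m (proj₁ dm)) c₀≤m ℤP.≤-refl c≤k k≤m) (unif { - + a} {+ k} {+ m} (ln da) dk dm (-a<m (proj₁ dm)) c≤k k≤m c₀≤m ℤP.≤-refl)))
          where open LastRowℤ R

      peelM : ∀ {m} → Dom m → Peel (M s) m
      peelM {m} dm with g m in eq
      ... | true = fwd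
          (λ {b} db b<m → trans (Gr.Mval s dm db NP.≤-refl (NP.<⇒≤ b<m)) (sym (trans (cong (λ t → ω s m ℤ.* ⟦ t ⟧) (Gr.Kval db (NP.<⇒≤ b<m))) (ℤP.*-identityʳ (ω s m)))))
          (λ da dk a<m k<m _ → trans (Gr.Mval s da dm (NP.<⇒≤ a<m) NP.≤-refl) (sym (Gr.Mval s da dk (NP.<⇒≤ a<m) (NP.<⇒≤ k<m))))
        where module Gr = Grounded dm (≡⇒T eq)
      ... | false with Peeled.lastRow (peel {+ m} dm)
      ...   | inj₁ R = Ungrounded.forward dm (λ t → subst T eq t) (peel {+ m} dm) R
      ...   | inj₂ R = Ungrounded.backward dm (λ t → subst T eq t) (peel {+ m} dm) R

    M-peelable : Peelable (M s)
    M-peelable = record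
      { diag = λ {m} dm → trans (cong₂ (λ x y → ⟦ x ⟧ ℤ.+ ε s ℤ.* ⟦ y ⟧) (α-refl dm) (α-ground dm)) (sym (ω-eq s m))
      ; peel = peelM }

    N : Matrix
    N a b = ω s a ℤ.* ⟦ not (gtQ π a b) ⟧

    private
      weak-lt : ∀ {m b} → b N.< m → not (gtQ π m b) ≡ K m b
      weak-lt {m} {b} h rewrite T⇒≡ (NP.<⇒<ᵇ h) = BP.not-involutive (K m b)

      weak-ge : ∀ {a b} → a N.≤ b → not (gtQ π a b) ≡ true
      weak-ge {a} {b} h rewrite ¬T⇒≡ {b <ᵇ a} (λ t → NP.<⇒≱ (NP.<ᵇ⇒< b a t) h) = refl

      weak-K : ∀ {m a k} → Dom m → Dom a → Dom k → a N.< m → k N.< m → T (K m k) → not (gtQ π a k) ≡ true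
      weak-K {m} {a} {k} dm da dk a<m k<m t with NP.<-cmp k a
      ... | tri≈ _ refl _ = weak-ge {a} NP.≤-refl
      ... | tri> _ _ l = weak-ge (NP.<⇒≤ l)
      ... | tri< l _ _ = trans (weak-lt l) (T⇒≡ (⇒share (+ k) (+ a) dk da (E-convex {x = + k} {y = + a} dk da ℤP.≤-refl (ℤ.+≤+ (NP.<⇒≤ k<m)) (ℤ.+≤+ (NP.<⇒≤ l)) (ℤ.+≤+ (NP.<⇒≤ a<m))
             (share⇒ (+ k) (+ m) dk dm (λ q → NP.<-irrefl (ℤP.+-injective q) k<m) t))))

    -- No a < m lies above m, nor above a neighbour k of m: if k < a, convexity makes k and a
    -- neighbours as well. And m lies above exactly those b < m that are not its neighbours. So the
    -- row is always the sparse one.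
    N-peelable : Peelable N
    N-peelable = record
      { diag = λ {m} dm → trans (cong (λ t → ω s m ℤ.* ⟦ t ⟧) (weak-ge {m} NP.≤-refl)) (ℤP.*-identityʳ (ω s m))
      ; peel = λ {m} dm → fwd (λ {b} db b<m → cong (λ t → ω s m ℤ.* ⟦ t ⟧) (weak-lt b<m))
          (λ {a} {k} da dk a<m k<m t → cong (λ t → ω s a ℤ.* ⟦ t ⟧) (trans (weak-ge (NP.<⇒≤ a<m)) (sym (weak-K dm da dk a<m k<m t)))) }

  module _ (ρ τ : List ℕ) (Pρ : Positive ρ) (Pτ : Positive τ) (n-eq : sum ρ N.+ sum τ ≡ n) where
    open TraceSum n ρ τ Pρ Pτ n-eq α (λ v → bruhatLeq n v w) sb-∏ using (total; total-sum)
    open Tableaux n π ρ τ n-eq using (countCyc-draw)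

    private
      rowsOf : Matrix → Matrix → List (ℕ × Matrix)
      rowsOf F G = sameRows F ρ ++ sameRows G τ

      size-rows : ∀ F G → size (rowsOf F G) ≡ n
      size-rows F G = trans (cong sum (LP.map-++ proj₁ (sameRows F ρ) (sameRows G τ))) (trans (SumP.sum-++ (map proj₁ (sameRows F ρ)) (map proj₁ (sameRows G τ)))
        (trans (cong₂ N._+_ (size-sameRows F ρ) (size-sameRows G τ)) n-eq))

      draw-Full : ∀ F G → draw n (range n) (Full ρ τ F G) ≡ draw (size (rowsOf F G)) (range n) (rowsProd (rowsOf F G))
      draw-Full F G = trans (draw-cong′ n (range n) (λ y → sym (rowsProd-Full F G ρ τ y))) (cong (λ r → draw r (range n) (rowsProd (rowsOf F G))) (sym (size-rows F G)))

      pointwise : ∀ s κ → Pointwise (SameRow Dom) (sameRows (M s) κ) (sameRows (N s) κ)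
      pointwise s [] = []
      pointwise s (r ∷ κ) = (refl , ω s , K , M-peelable s , N-peelable s) ∷ pointwise s κ

      draws-agree : draw n (range n) (Full ρ τ (M true) (M false)) ≡ draw n (range n) (Full ρ τ (N true) (N false))
      draws-agree = trans (draw-Full (M true) (M false)) (trans (rows-sum-unique Dom (Pw.++⁺ (pointwise true ρ) (pointwise false τ)) (range n) range-∈⁻) (sym (draw-Full (N true) (N false))))

    trace-count : traceC n ρ τ w ≡ + countCyc n π ρ τ / 1
    trace-count = trans (cong sumℚ (LP.map-cong (λ v → cong (λ z → _/_ z (orderH n (sum ρ)) {{orderH-nonZero {n} {sum ρ}}}) (sumℤ-∑ _ (allBn n))) below))
      (trans (sumℚ-/ below total (orderH n (sum ρ)) {{orderH-nonZero {n} {sum ρ}}})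
      (trans (cong (λ z → _/_ z (orderH n (sum ρ)) {{orderH-nonZero {n} {sum ρ}}}) (trans total-sum (cong (+ orderH n (sum ρ) ℤ.*_) (trans draws-agree (sym countCyc-draw)))))
        (cancel-/ (+ countCyc n π ρ τ) (orderH n (sum ρ)) {{orderH-nonZero {n} {sum ρ}}})))
      where
      below : List (List ℤ)
      below = filt (λ v → bruhatLeq n v w) (allBn n)

theorem9p9 : (n : ℕ) (w : List ℤ) → IsBn n w → Avoids3412-4231 w
    → (λ′ μ : List ℕ) → IsBipartition n λ′ μ
    → (I : List Interval) → ZigZag n I → IsMaxCoveringType n I (app w)
    → (π : ℤ → List Vertex) → CoveringFamily n I (λ i → i) π
    → traceC n λ′ μ w ≡ (+ countCyc n π λ′ μ) / 1
theorem9p9 n w isBn _ λ′ μ (pλ , pμ , e) I Z max π (fam , _) =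
  Main.trace-count n w (IsBn⇒Signed isBn) I Z max π fam λ′ μ (partition-positive λ′ pλ) (partition-positive μ pμ) e
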